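{- Let $n>7000$ be an integer, and define polynomials $A_n(q)$, $B_n(q)$, $C_n(q)$ by \[ \frac{(q;q)_{3n}}{(q^3;q^3)_n}=A_n(q^3)-qB_n(q^3)-q^2C_n(q^3). \] Then $A_n(q)$, $B_n(q)$ and $C_n(q)$ all have non-negative coefficients.
   Context: For $n\ge1$, $(a;q)_n=(1-a)(1-aq)\cdots(1-aq^{n-1})$, and $(a;q)_0=1$. The polynomials $A_n,B_n,C_n$ are uniquely determined by the displayed identity: they collect the monomials of $(q;q)_{3n}/(q^3;q^3)_n$ whose exponents are $\equiv0,1,2\pmod 3$ respectively, with the indicated signs. -}

module Defs where

open import Data.Nat using (ℕ; zero; suc)
open import Data.Integer using (ℤ; +_; _+_; _*_; -_)
open import Data.List using (List; []; _∷_; replicate)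

-- Polynomials over ℤ in one variable q, as coefficient lists
-- (head = constant term). Trailing zeros are allowed; equality of
-- polynomials is coefficientwise equality via `coeff`.
Poly : Set
Poly = List ℤ

coeff : Poly → ℕ → ℤ
coeff []       _       = + 0
coeff (a ∷ p)  zero    = a
coeff (a ∷ p)  (suc k) = coeff p k

_⊕_ : Poly → Poly → Poly
[]      ⊕ q       = q
(a ∷ p) ⊕ []      = a ∷ p
(a ∷ p) ⊕ (b ∷ q) = (a + b) ∷ (p ⊕ q)

scale : ℤ → Poly → Poly
scale c []      = []
scale c (a ∷ p) = (c * a) ∷ scale c p

neg : Poly → Poly
neg = scale (- (+ 1))

shift : Poly → Poly
shift p = + 0 ∷ p

_⊗_ : Poly → Poly → Poly
[]      ⊗ q = []
(a ∷ p) ⊗ q = scale a q ⊕ shift (p ⊗ q)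

monomial : ℕ → Poly
monomial k = replicate k (+ 0) Data.List.++ (+ 1 ∷ [])
  where import Data.List

oneMinusQPow : ℕ → Poly
oneMinusQPow k = (+ 1 ∷ []) ⊕ neg (monomial k)

subst3 : Poly → Poly
subst3 []      = []
subst3 (a ∷ p) = a ∷ + 0 ∷ + 0 ∷ subst3 p

qPoch : ℕ → Poly
qPoch zero    = + 1 ∷ []
qPoch (suc m) = qPoch m ⊗ oneMinusQPow (suc m)

q3Poch : ℕ → Poly
q3Poch m = subst3 (qPoch m)

combine : Poly → Poly → Poly → Poly
combine A B C = subst3 A ⊕ (neg (shift (subst3 B)) ⊕ neg (shift (shift (subst3 C))))

NonNegCoeffs : Poly → Set
NonNegCoeffs p = ∀ k → + 0 Data.Integer.≤ coeff p k
  where import Data.Integer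

-- (q;q)_{3n} / (q³;q³)_n is ∏ (1 - q^(3i+1)) (1 - q^(3i+2)). Its coefficient at m is an average of
-- values on a circle of radius r over roots of unity. The saddle point r is chosen so that m is the
-- mean of the weights at ω and ω̄, whose peaks carry the sign pattern +, -, -; a Gaussian lower bound
-- there beats everything else once n > 7000. For m ≤ 3n the coefficients agree with those of the
-- infinite product, whose dissections are positive products, and the palindrome gives m > 3n²/2.
module Submission where

import Algebra.Structures.Biased as Biased
import Data.Integer as ℤ
import Data.Integer.Properties as ℤP
import Data.Nat as ℕ
import Data.Nat.Coprimality as Cop
import Data.Nat.Properties as ℕP
import Data.Nat.Solver as ℕS
import Data.Rational as ℚ
import Data.Rational.Properties as ℚP
open import Data.Nat using (ℕ; zero; suc)
open import Data.Product using (_×_; _,_; proj₁; proj₂; Σ; ∃)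
open import Data.Sum using (_⊎_; inj₁; inj₂)
open import Data.Empty using (⊥; ⊥-elim)
open import Relation.Binary.PropositionalEquality using (_≡_; _≢_; refl; sym; trans; cong; cong₂; subst; subst₂; _≗_)
open import Relation.Binary.PropositionalEquality using () renaming (trans to infixr 2 _·_)

-- Rational arithmetic: opaque operations, ring solver, finite sums and products

module Q1 where
 open import Data.Integer using (ℤ)
 open import Data.Rational using (ℚ; _≤_; _<_) renaming (0ℚ to 0#; 1ℚ to 1#) public
 open import Data.Rational using (_≤ᵇ_)
 open import Data.Rational.Properties using (≤-refl; ≤-trans; <⇒≤; ≤-total) renaming (≤-reflexive to of≡) public
 open import Data.Rational.Properties using () renaming (≤-trans to infixr 1 _»_) public
 infixr 1 _≡»_ _»≡_
 _≡»_ : ∀ {p q r} -> p ≡ q -> q ≤ r -> p ≤ r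
 refl ≡» h = h
 _»≡_ : ∀ {p q r} -> p ≤ q -> q ≡ r -> p ≤ r
 h »≡ refl = h
 open import Data.Rational.Properties using (<-≤-trans; <-irrefl; <-cmp)
 open import Data.Vec using (Vec)
 open import Data.Bool using (T)
 open import Data.Maybe using (is-just; nothing)
 open import Relation.Nullary using (yes)
 open import Relation.Nullary.Decidable using (dec⇒maybe)
 open import Relation.Binary using (tri<; tri≈; tri>)
 open import Tactic.RingSolver.Core.AlmostCommutativeRing using (AlmostCommutativeRing; IsAlmostCommutativeRing; fromCommutativeRing)
 open import Tactic.RingSolver.Core.Polynomial.Parameters using (RawCoeff; Homomorphism)
 open import Tactic.RingSolver.Core.Expression public using (Expr; Κ; Ι) renaming (_⊕_ to infixl 6 _:+_; _⊗_ to infixl 7 _:*_; ⊝_ to infix 8 :-_)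
 open import Tactic.RingSolver.Core.Expression using (module Eval; _⊛_)
 open import Algebra.Bundles using (CommutativeRing)
 open import Level using (0ℓ)
 infixl 6 _:-_
 _:-_ : ∀ {A : Set} {n} -> Expr A n -> Expr A n -> Expr A n
 x :- y = x :+ (:- y)
 infix 4 _:=_
 _:=_ : ∀ {A : Set} -> A -> A -> A × A
 _:=_ = _,_
 -- Coefficients and carrier are separate rings: constants compute with the library rationals, while
 -- the carrier operations are opaque, so goals never unfold into normalised fractions.
 module RingSolve (h : Homomorphism 0ℓ 0ℓ 0ℓ 0ℓ) where
  open Homomorphism h using (⟦_⟧ᵣ; to; from)
  open AlmostCommutativeRing to using (Carrier; _≈_; setoid; rawRing; +-cong; *-cong; -‿cong; semiring)
  open import Algebra.Properties.Semiring.Exp.TCOptimised semiring using (^-congˡ)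
  open RawCoeff from using () renaming (Carrier to Coeff)
  open import Tactic.RingSolver.Core.Polynomial.Base from using (Poly; κ; ι; _⊞_; _⊠_; ⊟_; _⊡_)
  open import Tactic.RingSolver.Core.Polynomial.Semantics h renaming (⟦_⟧ to ⟦_⟧ₚ)
  open import Tactic.RingSolver.Core.Polynomial.Homomorphism h
  open Eval rawRing ⟦_⟧ᵣ public
  norm : ∀ {n} -> Expr Coeff n -> Poly n
  norm (Κ x) = κ x
  norm (Ι x) = ι x
  norm (x :+ y) = norm x ⊞ norm y
  norm (x :* y) = norm x ⊠ norm y
  norm (:- x) = ⊟ norm x
  norm (x ⊛ i) = norm x ⊡ i
  ⟦_⇓⟧ : ∀ {n} -> Expr Coeff n -> Vec Carrier n -> Carrier
  ⟦ e ⇓⟧ = ⟦ norm e ⟧ₚ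
  correct : ∀ {n} (e : Expr Coeff n) ρ -> ⟦ e ⇓⟧ ρ ≈ ⟦ e ⟧ ρ
  correct (Κ x) ρ = κ-hom x ρ
  correct (Ι x) ρ = ι-hom x ρ
  correct (x :+ y) ρ = AlmostCommutativeRing.trans to (⊞-hom (norm x) (norm y) ρ) (+-cong (correct x ρ) (correct y ρ))
  correct (x :* y) ρ = AlmostCommutativeRing.trans to (⊠-hom (norm x) (norm y) ρ) (*-cong (correct x ρ) (correct y ρ))
  correct (:- x) ρ = AlmostCommutativeRing.trans to (⊟-hom (norm x) ρ) (-‿cong (correct x ρ))
  correct (x ⊛ i) ρ = AlmostCommutativeRing.trans to (⊡-hom (norm x) i ρ) (^-congˡ i (correct x ρ))
  open import Relation.Binary.Reflection setoid Ι ⟦_⟧ ⟦_⇓⟧ correct public using (solve)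
 infix 8 -_
 infixl 7 _*_
 infixl 6 _+_ _-_
 opaque
  _+_ _*_ : ℚ -> ℚ -> ℚ
  _+_ = ℚ._+_
  _*_ = ℚ._*_
  -_ : ℚ -> ℚ
  -_ = ℚ.-_
 _-_ : ℚ -> ℚ -> ℚ
 p - q = p + (- q)
 opaque
  unfolding _+_ _*_ -_
  ℚ-isRing : IsAlmostCommutativeRing _≡_ _+_ _*_ -_ 0# 1#
  ℚ-isRing = AlmostCommutativeRing.isAlmostCommutativeRing
   (fromCommutativeRing ℚP.+-*-commutativeRing (λ x -> dec⇒maybe (0# ℚP.≟ x)))
  +≡ : ∀ x y -> x ℚ.+ y ≡ x + y
  +≡ _ _ = refl
  *≡ : ∀ x y -> x ℚ.* y ≡ x * y
  *≡ _ _ = refl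
  -≡ : ∀ x -> ℚ.- x ≡ - x
  -≡ _ = refl
  +≤ : ∀ {p q u v} -> p ≤ q -> u ≤ v -> p + u ≤ q + v
  +≤ = ℚP.+-mono-≤
  +-mono-<-≤ : ∀ {p q u v} -> p < q -> u ≤ v -> p + u < q + v
  +-mono-<-≤ = ℚP.+-mono-<-≤
  *≤ʳ : ∀ {p u v} -> 0# ≤ p -> u ≤ v -> p * u ≤ p * v
  *≤ʳ {p} p₀ h = ℚP.*-monoˡ-≤-nonNeg p {{ℚ.nonNegative p₀}} h
  *≤ˡ : ∀ {p u v} -> 0# ≤ p -> u ≤ v -> u * p ≤ v * p
  *≤ˡ {p} p₀ h = ℚP.*-monoʳ-≤-nonNeg p {{ℚ.nonNegative p₀}} h
  *-mono-< : ∀ {u v} p -> 0# < p -> u < v -> p * u < p * v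
  *-mono-< p p₀ h = ℚP.*-monoʳ-<-pos p {{ℚ.positive p₀}} h
  cancel≤ : ∀ {p u v} -> 0# < p -> p * u ≤ p * v -> u ≤ v
  cancel≤ {p} p₀ h = ℚP.*-cancelˡ-≤-pos p {{ℚ.positive p₀}} h
  inv : (p : ℚ) -> 0# < p -> ℚ
  inv p h = ℚ.1/_ p {{ℚ.>-nonZero h}}
  *-inv : ∀ p h -> p * inv p h ≡ 1#
  *-inv p h = ℚP.*-inverseʳ p {{ℚ.>-nonZero h}}
 ℚ-homo : Homomorphism 0ℓ 0ℓ 0ℓ 0ℓ
 ℚ-homo = record
  { from = record { rawRing = CommutativeRing.rawRing ℚP.+-*-commutativeRing
          ; isZero = λ x -> is-just (dec⇒maybe (0# ℚP.≟ x)) }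
  ; to = record { Carrier = ℚ ; _≈_ = _≡_ ; _+_ = _+_ ; _*_ = _*_ ; -_ = -_ ; 0# = 0# ; 1# = 1#
         ; 0≟_ = λ _ -> nothing ; isAlmostCommutativeRing = ℚ-isRing }
  ; morphism = record { ⟦_⟧ = λ x -> x ; +-homo = +≡ ; *-homo = *≡ ; -‿homo = -≡ ; 0-homo = refl ; 1-homo = refl }
  ; Zero-C⟶Zero-R = zero-homo }
  where
  zero-homo : ∀ x -> T (is-just (dec⇒maybe (0# ℚP.≟ x))) -> 0# ≡ x
  zero-homo x h with 0# ℚP.≟ x
  ... | yes p = p
 module QS = RingSolve ℚ-homo
 open QS public using (solve)
 c : ℕ -> (d : ℕ) -> .{{_ : ℕ.NonZero d}} -> ℚ
 c a d = ℤ.+ a ℚ./ d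
 κ : ∀ {n} -> ℕ -> (d : ℕ) -> .{{_ : ℕ.NonZero d}} -> Expr ℚ n
 κ a d = Κ (c a d)
 lit : ∀ {p q} {_ : T (p ≤ᵇ q)} -> p ≤ q
 lit {p} {q} {h} = ℚP.≤ᵇ⇒≤ {p} {q} h
 0<1 : 0# < 1#
 0<1 = ℚP.positive⁻¹ 1#
 infixl 7 _*₀_ _*₊_
 infixl 6 _+₀_
 _+₀_ : ∀ {p q} -> 0# ≤ p -> 0# ≤ q -> 0# ≤ p + q
 _+₀_ {p} {q} a b = subst (_≤ p + q) (solve 0 (Κ 0# :+ Κ 0# := Κ 0#) refl) (+≤ a b)
 _*₀_ : ∀ {p q} -> 0# ≤ p -> 0# ≤ q -> 0# ≤ p * q
 _*₀_ {p} {q} a b = subst (_≤ p * q) (solve 1 (λ p -> p :* Κ 0# := Κ 0#) refl p) (*≤ʳ a b)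
 _*₊_ : ∀ {p q} -> 0# < p -> 0# < q -> 0# < p * q
 _*₊_ {p} {q} a b = subst (_< p * q) (solve 1 (λ p -> p :* Κ 0# := Κ 0#) refl p) (*-mono-< p a b)
 _+₊_ : ∀ {p q} -> 0# < p -> 0# ≤ q -> 0# < p + q
 _+₊_ {p} {q} a b = subst (_< p + q) (solve 0 (Κ 0# :+ Κ 0# := Κ 0#) refl) (+-mono-<-≤ a b)
 gap≤ : ∀ {p q e} -> 0# ≤ e -> q ≡ p + e -> p ≤ q
 gap≤ {p} {_} {e} h refl = subst (_≤ p + e) (solve 1 (λ p -> p :+ Κ 0# := p) refl p) (+≤ (≤-refl {p}) h)
 by-gap< : ∀ {p q} e -> 0# < e -> q ≡ p + e -> p < q
 by-gap< {p} e h refl = subst₂ _<_ (solve 1 (λ p -> Κ 0# :+ p := p) refl p) (solve 2 (λ p e -> e :+ p := p :+ e) refl p e) (+-mono-<-≤ h (≤-refl {p}))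
 gap : ∀ {p q} -> p ≤ q -> 0# ≤ q - p
 gap {p} {q} h = subst (_≤ q - p) (solve 1 (λ p -> p :- p := Κ 0#) refl p) (+≤ h (≤-refl { - p}))
 gap< : ∀ {p q} -> p < q -> 0# < q - p
 gap< {p} {q} h = subst (_< q - p) (solve 1 (λ p -> p :- p := Κ 0#) refl p) (+-mono-<-≤ h (≤-refl { - p}))
 ungap : ∀ {p q} -> 0# ≤ q - p -> p ≤ q
 ungap {p} {q} h = gap≤ h (solve 2 (λ p q -> q := p :+ (q :- p)) refl p q)
 *≤ : ∀ {p q u v} -> 0# ≤ p -> 0# ≤ v -> p ≤ q -> u ≤ v -> p * u ≤ q * v
 *≤ {p} {q} {u} {v} p₀ v₀ pq uv = *≤ʳ p₀ uv » *≤ˡ v₀ pq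
 sq₀ : ∀ p -> 0# ≤ p * p
 sq₀ p with ≤-total 0# p
 ... | inj₁ h = h *₀ h
 ... | inj₂ h = subst (0# ≤_) (solve 1 (λ p -> (Κ 0# :- p) :* (Κ 0# :- p) := p :* p) refl p) (gap h *₀ gap h)
 -- The substitute for extracting square roots, since moduli are known only through their squares.
 sq-cancel : ∀ {a b} -> 0# ≤ b -> a * a ≤ b * b -> a ≤ b
 sq-cancel {a} {b} b₀ h with ≤-total a b
 ... | inj₁ le = le
 ... | inj₂ ge with <-cmp 0# (a + b)
 ...   | tri< p _ _ = ungap (cancel≤ p (subst₂ _≤_ (solve 2 (λ a b -> Κ 0# := (a :+ b) :* Κ 0#) refl a b) (solve 2 (λ a b -> b :* b :- a :* a := (a :+ b) :* (b :- a)) refl a b) (gap h)))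
 ...   | tri≈ _ p _ = gap≤ (b₀ +₀ b₀) (solve 2 (λ a b -> b := a :+ (b :+ b) :- (a :+ b)) refl a b · cong (λ z -> a + (b + b) - z) (sym p) · solve 2 (λ a b -> a :+ b :- Κ 0# := a :+ b) refl a (b + b))
 ...   | tri> _ _ p = ⊥-elim (<-irrefl refl (<-≤-trans p (≤-trans b₀ ge +₀ b₀)))
 *-0ˡ : ∀ p -> 0# * p ≡ 0#
 *-0ˡ = solve 1 (λ p -> Κ 0# :* p := Κ 0#) refl
 *-0ʳ : ∀ p -> p * 0# ≡ 0#
 *-0ʳ = solve 1 (λ p -> p :* Κ 0# := Κ 0#) refl
 *-1ˡ : ∀ p -> 1# * p ≡ p
 *-1ˡ = solve 1 (λ p -> Κ 1# :* p := p) refl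
 *-1ʳ : ∀ p -> p * 1# ≡ p
 *-1ʳ = solve 1 (λ p -> p :* Κ 1# := p) refl
 +-0ˡ : ∀ p -> 0# + p ≡ p
 +-0ˡ = solve 1 (λ p -> Κ 0# :+ p := p) refl
 +-0ʳ : ∀ p -> p + 0# ≡ p
 +-0ʳ = solve 1 (λ p -> p :+ Κ 0# := p) refl
 *-assoc : ∀ a b c -> a * b * c ≡ a * (b * c)
 *-assoc = solve 3 (λ a b c -> a :* b :* c := a :* (b :* c)) refl
 *-comm : ∀ a b -> a * b ≡ b * a
 *-comm = solve 2 (λ a b -> a :* b := b :* a) refl
 +-comm : ∀ a b -> a + b ≡ b + a
 +-comm = solve 2 (λ a b -> a :+ b := b :+ a) refl
 ι : ℕ -> ℚ
 ι zero = 0#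
 ι (suc n) = 1# + ι n
 ι₀ : ∀ n -> 0# ≤ ι n
 ι₀ zero = ≤-refl
 ι₀ (suc n) = lit +₀ ι₀ n
 ι₊ : ∀ n -> 0# < ι (suc n)
 ι₊ n = 0<1 +₊ ι₀ n
 ι-+ : ∀ m n -> ι (m ℕ.+ n) ≡ ι m + ι n
 ι-+ zero n = sym (+-0ˡ _)
 ι-+ (suc m) n = cong (1# +_) (ι-+ m n) · solve 2 (λ a b -> Κ 1# :+ (a :+ b) := Κ 1# :+ a :+ b) refl (ι m) (ι n)
 ι-* : ∀ m n -> ι (m ℕ.* n) ≡ ι m * ι n
 ι-* zero n = sym (*-0ˡ _)
 ι-* (suc m) n = ι-+ n (m ℕ.* n) · cong (ι n +_) (ι-* m n) · solve 2 (λ a b -> b :+ a :* b := (Κ 1# :+ a) :* b) refl (ι m) (ι n)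
 ι-mono : ∀ {m n} -> m ℕ.≤ n -> ι m ≤ ι n
 ι-mono {n = n} ℕ.z≤n = ι₀ n
 ι-mono (ℕ.s≤s h) = +≤ (≤-refl {1#}) (ι-mono h)
 infixr 8 _^_
 _^_ : ℚ -> ℕ -> ℚ
 p ^ zero = 1#
 p ^ suc n = p * p ^ n
 ^-+ : ∀ p m n -> p ^ (m ℕ.+ n) ≡ p ^ m * p ^ n
 ^-+ p zero n = sym (*-1ˡ _)
 ^-+ p (suc m) n = cong (p *_) (^-+ p m n) · sym (*-assoc p _ _)
 ^-* : ∀ p m n -> p ^ (m ℕ.* n) ≡ (p ^ n) ^ m
 ^-* p zero n = refl
 ^-* p (suc m) n = ^-+ p n (m ℕ.* n) · cong (p ^ n *_) (^-* p m n)
 *-^ : ∀ p q n -> (p * q) ^ n ≡ p ^ n * q ^ n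
 *-^ p q zero = sym (*-1ˡ _)
 *-^ p q (suc n) = cong (p * q *_) (*-^ p q n) · solve 4 (λ p q a b -> p :* q :* (a :* b) := p :* a :* (q :* b)) refl p q (p ^ n) (q ^ n)
 1^ : ∀ n -> 1# ^ n ≡ 1#
 1^ zero = refl
 1^ (suc n) = *-1ˡ _ · 1^ n
 ^₀ : ∀ {p} n -> 0# ≤ p -> 0# ≤ p ^ n
 ^₀ zero h = lit
 ^₀ (suc n) h = h *₀ ^₀ n h
 ^₊ : ∀ {p} n -> 0# < p -> 0# < p ^ n
 ^₊ zero h = 0<1
 ^₊ (suc n) h = h *₊ ^₊ n h
 ^-mono : ∀ {p q} n -> 0# ≤ p -> p ≤ q -> p ^ n ≤ q ^ n
 ^-mono zero _ _ = ≤-refl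
 ^-mono (suc n) p₀ h = *≤ p₀ (^₀ n (p₀ » h)) h (^-mono n p₀ h)
 ^≤1 : ∀ {p} n -> 0# ≤ p -> p ≤ 1# -> p ^ n ≤ 1#
 ^≤1 {p} n p₀ h = subst (p ^ n ≤_) (1^ n) (^-mono n p₀ h)
 ^-anti : ∀ {p m n} -> 0# ≤ p -> p ≤ 1# -> m ℕ.≤ n -> p ^ n ≤ p ^ m
 ^-anti {n = n} p₀ p₁ ℕ.z≤n = ^≤1 n p₀ p₁
 ^-anti {p} p₀ p₁ (ℕ.s≤s h) = *≤ʳ p₀ (^-anti p₀ p₁ h)
 bernoulli : ∀ {p} n -> 0# ≤ 1# + p -> 1# + ι n * p ≤ (1# + p) ^ n
 bernoulli {p} zero h = of≡ (solve 1 (λ p -> Κ 1# :+ Κ 0# :* p := Κ 1#) refl p)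
 bernoulli {p} (suc n) h = gap≤ (ι₀ n *₀ sq₀ p) (solve 2 (λ p n -> (Κ 1# :+ p) :* (Κ 1# :+ n :* p) := Κ 1# :+ (Κ 1# :+ n) :* p :+ n :* (p :* p)) refl p (ι n)) » *≤ʳ h (bernoulli n h)
 sum prod : (ℕ -> ℚ) -> ℕ -> ℚ
 sum f zero = 0#
 sum f (suc n) = sum f n + f n
 prod f zero = 1#
 prod f (suc n) = prod f n * f n
 sum-mono : ∀ {f g} n -> (∀ i -> i ℕ.< n -> f i ≤ g i) -> sum f n ≤ sum g n
 sum-mono zero h = ≤-refl
 sum-mono (suc n) h = +≤ (sum-mono n (λ i l -> h i (ℕP.m<n⇒m<1+n l))) (h n (ℕP.n<1+n n))
 sum-cong : ∀ {f g} n -> (∀ i -> f i ≡ g i) -> sum f n ≡ sum g n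
 sum-cong zero h = refl
 sum-cong (suc n) h = cong₂ _+_ (sum-cong n h) (h n)
 prod-cong : ∀ {f g} n -> (∀ i -> f i ≡ g i) -> prod f n ≡ prod g n
 prod-cong zero h = refl
 prod-cong (suc n) h = cong₂ _*_ (prod-cong n h) (h n)
 +-swap : ∀ a b c d -> a + b + (c + d) ≡ a + c + (b + d)
 +-swap = solve 4 (λ a b c d -> a :+ b :+ (c :+ d) := a :+ c :+ (b :+ d)) refl
 *-swap : ∀ a b c d -> a * b * (c * d) ≡ a * c * (b * d)
 *-swap = solve 4 (λ a b c d -> a :* b :* (c :* d) := a :* c :* (b :* d)) refl
 sum-+ : ∀ f g n -> sum (λ i -> f i + g i) n ≡ sum f n + sum g n
 sum-+ f g zero = sym (+-0ˡ _)
 sum-+ f g (suc n) = cong (_+ (f n + g n)) (sum-+ f g n) · +-swap (sum f n) (sum g n) (f n) (g n)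
 sum-*ˡ : ∀ k f n -> sum (λ i -> k * f i) n ≡ k * sum f n
 sum-*ˡ k f zero = sym (*-0ʳ k)
 sum-*ˡ k f (suc n) = cong (_+ k * f n) (sum-*ˡ k f n) · solve 3 (λ k a b -> k :* a :+ k :* b := k :* (a :+ b)) refl k (sum f n) (f n)
 sum₀ : ∀ {f} n -> (∀ i -> 0# ≤ f i) -> 0# ≤ sum f n
 sum₀ zero h = ≤-refl
 sum₀ (suc n) h = sum₀ n h +₀ h n
 sum-const : ∀ k n -> sum (λ _ -> k) n ≡ ι n * k
 sum-const k zero = sym (*-0ˡ k)
 sum-const k (suc n) = cong (_+ k) (sum-const k n) · solve 2 (λ k n -> n :* k :+ k := (Κ 1# :+ n) :* k) refl k (ι n)
 prod₀ : ∀ {f} n -> (∀ i -> 0# ≤ f i) -> 0# ≤ prod f n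
 prod₀ zero h = lit
 prod₀ (suc n) h = prod₀ n h *₀ h n
 prod₊ : ∀ {f} n -> (∀ i -> 0# < f i) -> 0# < prod f n
 prod₊ zero h = 0<1
 prod₊ (suc n) h = prod₊ n h *₊ h n
 prod-mono : ∀ {f g} n -> (∀ i -> 0# ≤ f i) -> (∀ i -> f i ≤ g i) -> prod f n ≤ prod g n
 prod-mono zero f₀ h = ≤-refl
 prod-mono (suc n) f₀ h = *≤ (prod₀ n f₀) (f₀ n » h n) (prod-mono n f₀ h) (h n)
 prod-* : ∀ f g n -> prod (λ i -> f i * g i) n ≡ prod f n * prod g n
 prod-* f g zero = sym (*-1ˡ _)
 prod-* f g (suc n) = cong (_* (f n * g n)) (prod-* f g n) · *-swap (prod f n) (prod g n) (f n) (g n)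
 prod-^ : ∀ f k n -> prod (λ i -> f i ^ k) n ≡ prod f n ^ k
 prod-^ f k zero = sym (1^ k)
 prod-^ f k (suc n) = cong (_* f n ^ k) (prod-^ f k n) · sym (*-^ (prod f n) (f n) k)
 1+sum≤prod : ∀ f n -> (∀ i -> 0# ≤ f i) -> 1# + sum f n ≤ prod (λ i -> 1# + f i) n
 1+sum≤prod f zero h = of≡ (+-0ʳ _)
 1+sum≤prod f (suc n) h = gap≤ (sum₀ n h *₀ h n) (solve 2 (λ s f -> (Κ 1# :+ s) :* (Κ 1# :+ f) := Κ 1# :+ (s :+ f) :+ s :* f) refl (sum f n) (f n)) » *≤ˡ (lit +₀ h n) (1+sum≤prod f n h)

-- Eisenstein rationals: norm, trace and comparison of moduli

module E1 where
 open Q1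
 open import Data.Bool using (Bool; T; _∧_)
 open import Data.Maybe using (is-just; nothing)
 open import Relation.Nullary using (yes)
 open import Relation.Nullary.Decidable using (dec⇒maybe)
 open import Relation.Binary.PropositionalEquality using (isEquivalence)
 open import Tactic.RingSolver.Core.AlmostCommutativeRing using (IsAlmostCommutativeRing)
 open import Tactic.RingSolver.Core.Polynomial.Parameters using (Homomorphism)
 open import Tactic.RingSolver.Core.Expression using (Κ)
 open import Level using (0ℓ)
 -- Coordinates in the basis 1, `ω`, where ω² = -1 - ω. Norm and trace are rational polynomials in
 -- them, so √3 never has to be represented.
 record 𝔼 : Set where
  no-eta-equality
  pattern
  constructor _+ω_
  field re im : ℚ
 open 𝔼 public
 infix 8 -°_
 infixl 7 _*°_
 infixl 6 _+°_ _-°_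
 opaque
  _+°_ _*°_ : 𝔼 -> 𝔼 -> 𝔼
  (a +ω b) +° (u +ω v) = (a + u) +ω (b + v)
  (a +ω b) *° (u +ω v) = (a * u - b * v) +ω (a * v + b * u - b * v)
  -°_ conj : 𝔼 -> 𝔼
  -° (a +ω b) = (- a) +ω (- b)
  conj (a +ω b) = (a - b) +ω (- b)
  N Tr : 𝔼 -> ℚ
  N (a +ω b) = a * a - a * b + b * b
  Tr (a +ω b) = a + a - b
 _-°_ : 𝔼 -> 𝔼 -> 𝔼
 x -° y = x +° (-° y)
 ofℚ : ℚ -> 𝔼
 ofℚ a = a +ω 0#
 0° 1° ω ω̄ : 𝔼
 0° = 0# +ω 0#
 1° = 1# +ω 0#
 ω = 0# +ω 1#
 ω̄ = (ℚ.- 1#) +ω (ℚ.- 1#)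
 opaque
  unfolding _+°_
  𝔼-isRing : IsAlmostCommutativeRing _≡_ _+°_ _*°_ -°_ 0° 1°
  𝔼-isRing = record
   { isCommutativeSemiring = Biased.isCommutativeSemiringˡ record
    { +-isCommutativeMonoid = record { isMonoid = record { isSemigroup = record { isMagma = record { isEquivalence = isEquivalence ; ∙-cong = cong₂ _+°_ }
      ; assoc = λ { (a +ω b) (u +ω v) (x +ω y) -> cong₂ _+ω_ (as a u x) (as b v y) } }
      ; identity = (λ { (a +ω b) -> cong₂ _+ω_ (+-0ˡ a) (+-0ˡ b) }) , (λ { (a +ω b) -> cong₂ _+ω_ (+-0ʳ a) (+-0ʳ b) }) }
      ; comm = λ { (a +ω b) (u +ω v) -> cong₂ _+ω_ (+-comm a u) (+-comm b v) } }
    ; *-isCommutativeMonoid = record { isMonoid = record { isSemigroup = record { isMagma = record { isEquivalence = isEquivalence ; ∙-cong = cong₂ _*°_ }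
      ; assoc = λ { (a +ω b) (u +ω v) (x +ω y) -> cong₂ _+ω_ (solve 6 (λ a b u v x y -> (a :* u :- b :* v) :* x :- (a :* v :+ b :* u :- b :* v) :* y := a :* (u :* x :- v :* y) :- b :* (u :* y :+ v :* x :- v :* y)) refl a b u v x y) (solve 6 (λ a b u v x y -> (a :* u :- b :* v) :* y :+ (a :* v :+ b :* u :- b :* v) :* x :- (a :* v :+ b :* u :- b :* v) :* y := a :* (u :* y :+ v :* x :- v :* y) :+ b :* (u :* x :- v :* y) :- b :* (u :* y :+ v :* x :- v :* y)) refl a b u v x y) } }
      ; identity = (λ { (a +ω b) -> cong₂ _+ω_ (solve 2 (λ a b -> Κ 1# :* a :- Κ 0# :* b := a) refl a b) (solve 2 (λ a b -> Κ 1# :* b :+ Κ 0# :* a :- Κ 0# :* b := b) refl a b) })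
            , (λ { (a +ω b) -> cong₂ _+ω_ (solve 2 (λ a b -> a :* Κ 1# :- b :* Κ 0# := a) refl a b) (solve 2 (λ a b -> a :* Κ 0# :+ b :* Κ 1# :- b :* Κ 0# := b) refl a b) }) }
      ; comm = λ { (a +ω b) (u +ω v) -> cong₂ _+ω_ (solve 4 (λ a b u v -> a :* u :- b :* v := u :* a :- v :* b) refl a b u v) (solve 4 (λ a b u v -> a :* v :+ b :* u :- b :* v := u :* b :+ v :* a :- v :* b) refl a b u v) } }
    ; distribʳ = λ { (a +ω b) (u +ω v) (x +ω y) -> cong₂ _+ω_ (solve 6 (λ a b u v x y -> (u :+ x) :* a :- (v :+ y) :* b := (u :* a :- v :* b) :+ (x :* a :- y :* b)) refl a b u v x y) (solve 6 (λ a b u v x y -> (u :+ x) :* b :+ (v :+ y) :* a :- (v :+ y) :* b := (u :* b :+ v :* a :- v :* b) :+ (x :* b :+ y :* a :- y :* b)) refl a b u v x y) }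
    ; zeroˡ = λ { (a +ω b) -> cong₂ _+ω_ (solve 2 (λ a b -> Κ 0# :* a :- Κ 0# :* b := Κ 0#) refl a b) (solve 2 (λ a b -> Κ 0# :* b :+ Κ 0# :* a :- Κ 0# :* b := Κ 0#) refl a b) } }
   ; -‿cong = cong (λ x -> -° x)
   ; -‿*-distribˡ = λ { (a +ω b) (u +ω v) -> cong₂ _+ω_ (solve 4 (λ a b u v -> (:- a) :* u :- (:- b) :* v := :- (a :* u :- b :* v)) refl a b u v) (solve 4 (λ a b u v -> (:- a) :* v :+ (:- b) :* u :- (:- b) :* v := :- (a :* v :+ b :* u :- b :* v)) refl a b u v) }
   ; -‿+-comm = λ { (a +ω b) (u +ω v) -> cong₂ _+ω_ (ng a u) (ng b v) } }
   where
   as : ∀ a b x -> a + b + x ≡ a + (b + x)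
   as = solve 3 (λ a b x -> a :+ b :+ x := a :+ (b :+ x)) refl
   ng : ∀ a u -> (- a) + (- u) ≡ - (a + u)
   ng = solve 2 (λ a u -> (:- a) :+ (:- u) := :- (a :+ u)) refl
 module _ where
  addᶜ mulᶜ : 𝔼 -> 𝔼 -> 𝔼
  addᶜ (a +ω b) (u +ω v) = (a ℚ.+ u) +ω (b ℚ.+ v)
  mulᶜ (a +ω b) (u +ω v) = (a ℚ.* u ℚ.+ ℚ.- (b ℚ.* v)) +ω (a ℚ.* v ℚ.+ b ℚ.* u ℚ.+ ℚ.- (b ℚ.* v))
  negᶜ : 𝔼 -> 𝔼
  negᶜ (a +ω b) = (ℚ.- a) +ω (ℚ.- b)
  isZeroᶜ : 𝔼 -> Bool
  isZeroᶜ (a +ω b) = is-just (dec⇒maybe (0# ℚP.≟ a)) ∧ is-just (dec⇒maybe (0# ℚP.≟ b))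
  zeroᶜ : ∀ x -> T (isZeroᶜ x) -> 0° ≡ x
  zeroᶜ (a +ω b) h with 0# ℚP.≟ a | 0# ℚP.≟ b
  ... | yes p | yes q = cong₂ _+ω_ p q
 opaque
  unfolding _+°_ _+_
  addᶜ≡ : ∀ x y -> addᶜ x y ≡ x +° y
  addᶜ≡ (_ +ω _) (_ +ω _) = refl
  mulᶜ≡ : ∀ x y -> mulᶜ x y ≡ x *° y
  mulᶜ≡ (_ +ω _) (_ +ω _) = refl
  negᶜ≡ : ∀ x -> negᶜ x ≡ -° x
  negᶜ≡ (_ +ω _) = refl
 𝔼-homo : Homomorphism 0ℓ 0ℓ 0ℓ 0ℓ
 𝔼-homo = record
  { from = record { rawRing = record { Carrier = 𝔼 ; _≈_ = _≡_ ; _+_ = addᶜ ; _*_ = mulᶜ ; -_ = negᶜ ; 0# = 0° ; 1# = 1° }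
          ; isZero = isZeroᶜ }
  ; to = record { Carrier = 𝔼 ; _≈_ = _≡_ ; _+_ = _+°_ ; _*_ = _*°_ ; -_ = -°_ ; 0# = 0° ; 1# = 1°
         ; 0≟_ = λ _ -> nothing ; isAlmostCommutativeRing = 𝔼-isRing }
  ; morphism = record { ⟦_⟧ = λ x -> x ; +-homo = addᶜ≡ ; *-homo = mulᶜ≡ ; -‿homo = negᶜ≡ ; 0-homo = refl ; 1-homo = refl }
  ; Zero-C⟶Zero-R = zeroᶜ }
 open RingSolve 𝔼-homo public using () renaming (solve to solve°)
 opaque
  unfolding _+°_
  N-* : ∀ x y -> N (x *° y) ≡ N x * N y
  N-* (a +ω b) (u +ω v) = solve 4 (λ a b u v ->
   let p = a :* u :- b :* v ; q = a :* v :+ b :* u :- b :* v in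
   p :* p :- p :* q :+ q :* q := (a :* a :- a :* b :+ b :* b) :* (u :* u :- u :* v :+ v :* v)) refl a b u v
  N-conj : ∀ x -> N (conj x) ≡ N x
  N-conj (a +ω b) = solve 2 (λ a b -> (a :- b) :* (a :- b) :- (a :- b) :* (:- b) :+ (:- b) :* (:- b) := a :* a :- a :* b :+ b :* b) refl a b
  N-neg : ∀ x -> N (-° x) ≡ N x
  N-neg (a +ω b) = solve 2 (λ a b -> (:- a) :* (:- a) :- (:- a) :* (:- b) :+ (:- b) :* (:- b) := a :* a :- a :* b :+ b :* b) refl a b
  N-+ : ∀ x y -> N (x +° y) ≡ N x + N y + Tr (x *° conj y)
  N-+ (a +ω b) (u +ω v) = solve 4 (λ a b u v ->
   let p = a :+ u ; q = b :+ v ; s = a :* (u :- v) :- b :* (:- v) ; t = a :* (:- v) :+ b :* (u :- v) :- b :* (:- v) in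
   p :* p :- p :* q :+ q :* q := (a :* a :- a :* b :+ b :* b) :+ (u :* u :- u :* v :+ v :* v) :+ (s :+ s :- t)) refl a b u v
  N-ofℚ : ∀ a -> N (ofℚ a) ≡ a * a
  N-ofℚ = solve 1 (λ a -> a :* a :- a :* Κ 0# :+ Κ 0# :* Κ 0# := a :* a) refl
  Tr-ofℚ : ∀ a -> Tr (ofℚ a) ≡ a + a
  Tr-ofℚ = solve 1 (λ a -> a :+ a :- Κ 0# := a :+ a) refl
  Tr-+ : ∀ x y -> Tr (x +° y) ≡ Tr x + Tr y
  Tr-+ (a +ω b) (u +ω v) = solve 4 (λ a b u v -> a :+ u :+ (a :+ u) :- (b :+ v) := a :+ a :- b :+ (u :+ u :- v)) refl a b u v
  Tr-neg : ∀ x -> Tr (-° x) ≡ - Tr x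
  Tr-neg (a +ω b) = solve 2 (λ a b -> (:- a) :+ (:- a) :- (:- b) := :- (a :+ a :- b)) refl a b
  Tr-conj : ∀ x -> Tr (conj x) ≡ Tr x
  Tr-conj (a +ω b) = solve 2 (λ a b -> (a :- b) :+ (a :- b) :- (:- b) := a :+ a :- b) refl a b
  Tr-ofℚ* : ∀ a x -> Tr (ofℚ a *° x) ≡ a * Tr x
  Tr-ofℚ* a (u +ω v) = solve 3 (λ a u v -> let p = a :* u :- Κ 0# :* v in
   p :+ p :- (a :* v :+ Κ 0# :* u :- Κ 0# :* v) := a :* (u :+ u :- v)) refl a u v
  x+conj : ∀ x -> x +° conj x ≡ ofℚ (Tr x)
  x+conj (a +ω b) = cong₂ _+ω_ (solve 2 (λ a b -> a :+ (a :- b) := a :+ a :- b) refl a b) (solve 1 (λ b -> b :+ (:- b) := Κ 0#) refl b)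
  x*conj : ∀ x -> x *° conj x ≡ ofℚ (N x)
  x*conj (a +ω b) = cong₂ _+ω_ (solve 2 (λ a b -> a :* (a :- b) :- b :* (:- b) := a :* a :- a :* b :+ b :* b) refl a b) (solve 2 (λ a b -> a :* (:- b) :+ b :* (a :- b) :- b :* (:- b) := Κ 0#) refl a b)
  conj-* : ∀ x y -> conj (x *° y) ≡ conj x *° conj y
  conj-* (a +ω b) (u +ω v) = cong₂ _+ω_ (solve 4 (λ a b u v -> a :* u :- b :* v :- (a :* v :+ b :* u :- b :* v) := (a :- b) :* (u :- v) :- (:- b) :* (:- v)) refl a b u v) (solve 4 (λ a b u v -> :- (a :* v :+ b :* u :- b :* v) := (a :- b) :* (:- v) :+ (:- b) :* (u :- v) :- (:- b) :* (:- v)) refl a b u v)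
  conj-+ : ∀ x y -> conj (x +° y) ≡ conj x +° conj y
  conj-+ (a +ω b) (u +ω v) = cong₂ _+ω_ (solve 4 (λ a b u v -> a :+ u :- (b :+ v) := a :- b :+ (u :- v)) refl a b u v) (solve 2 (λ b v -> :- (b :+ v) := (:- b) :+ (:- v)) refl b v)
  conj-conj : ∀ x -> conj (conj x) ≡ x
  conj-conj (a +ω b) = cong₂ _+ω_ (solve 2 (λ a b -> a :- b :- (:- b) := a) refl a b) (solve 1 (λ b -> :- (:- b) := b) refl b)
  conj-ofℚ : ∀ a -> conj (ofℚ a) ≡ ofℚ a
  conj-ofℚ a = cong₂ _+ω_ (solve 1 (λ a -> a :- Κ 0# := a) refl a) (solve 0 (:- Κ 0# := Κ 0#) refl)
  conj-ω : conj ω ≡ ω̄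
  conj-ω = cong₂ _+ω_ (solve 0 (Κ 0# :- Κ 1# := Κ (ℚ.- 1#)) refl) (solve 0 (:- Κ 1# := Κ (ℚ.- 1#)) refl)
  ofℚ-+ : ∀ a b -> ofℚ (a + b) ≡ ofℚ a +° ofℚ b
  ofℚ-+ a b = cong₂ _+ω_ refl (solve 0 (Κ 0# := Κ 0# :+ Κ 0#) refl)
  ofℚ-* : ∀ a b -> ofℚ (a * b) ≡ ofℚ a *° ofℚ b
  ofℚ-* a b = cong₂ _+ω_ (solve 2 (λ a b -> a :* b := a :* b :- Κ 0# :* Κ 0#) refl a b) (solve 2 (λ a b -> Κ 0# := a :* Κ 0# :+ Κ 0# :* b :- Κ 0# :* Κ 0#) refl a b)
  ofℚ-neg : ∀ a -> ofℚ (- a) ≡ -° ofℚ a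
  ofℚ-neg a = cong₂ _+ω_ refl (solve 0 (Κ 0# := :- Κ 0#) refl)
  N₀ : ∀ x -> 0# ≤ N x
  N₀ (a +ω b) = subst (0# ≤_) (solve 2 (λ a b -> (a :- κ 1 2 :* b) :* (a :- κ 1 2 :* b) :+ κ 3 4 :* (b :* b) := a :* a :- a :* b :+ b :* b) refl a b)
   (sq₀ (a - c 1 2 * b) +₀ (lit {q = c 3 4} *₀ sq₀ b))
  Tr²≤4N : ∀ x -> Tr x * Tr x ≤ c 4 1 * N x
  Tr²≤4N (a +ω b) = gap≤ (lit *₀ sq₀ b) (solve 2 (λ a b -> κ 4 1 :* (a :* a :- a :* b :+ b :* b) := (a :+ a :- b) :* (a :+ a :- b) :+ κ 3 1 :* (b :* b)) refl a b)
  im²≤ : ∀ x -> c 3 4 * (im x * im x) ≤ N x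
  im²≤ (a +ω b) = gap≤ (sq₀ (a - c 1 2 * b)) (solve 2 (λ a b -> a :* a :- a :* b :+ b :* b := κ 3 4 :* (b :* b) :+ (a :- κ 1 2 :* b) :* (a :- κ 1 2 :* b)) refl a b)
 infix 4 _⊑[_]_
 -- The squared form of |x| ≤ k |w|. Keeping an element `w` as the reference makes relative errors
 -- multiply along products.
 _⊑[_]_ : 𝔼 -> ℚ -> 𝔼 -> Set
 x ⊑[ k ] w = N x ≤ k * k * N w
 -- The triangle inequality: the cross term `Tr (x *° conj y)` is controlled by `Tr²≤4N`, which
 -- plays the role of Cauchy-Schwarz.
 ⊑-+ : ∀ {x y w k l} -> 0# ≤ k -> 0# ≤ l -> x ⊑[ k ] w -> y ⊑[ l ] w -> x +° y ⊑[ k + l ] w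
 ⊑-+ {x} {y} {w} {k} {l} k₀ l₀ p q = (N-+ x y ≡» +≤ (+≤ p q) tr) »≡ solve 3 (λ k l n -> k :* k :* n :+ l :* l :* n :+ κ 2 1 :* (k :* l :* n) := (k :+ l) :* (k :+ l) :* n) refl k l (N w)
  where
  tr : Tr (x *° conj y) ≤ c 2 1 * (k * l * N w)
  tr = sq-cancel (lit *₀ (k₀ *₀ l₀ *₀ N₀ w)) (Tr²≤4N (x *° conj y) » *≤ʳ lit (N-* x (conj y) · cong (N x *_) (N-conj y) ≡» *≤ (N₀ x) (sq₀ l *₀ N₀ w) p q) »≡ solve 3 (λ k l n -> κ 4 1 :* (k :* k :* n :* (l :* l :* n)) :=
    κ 2 1 :* (k :* l :* n) :* (κ 2 1 :* (k :* l :* n))) refl k l (N w))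
 ⊑-* : ∀ {x y v w k l} -> x ⊑[ k ] v -> y ⊑[ l ] w -> x *° y ⊑[ k * l ] v *° w
 ⊑-* {x} {y} {v} {w} {k} {l} p q = subst₂ _≤_ (sym (N-* x y)) (solve 4 (λ k l n m -> k :* k :* n :* (l :* l :* m) := k :* l :* (k :* l) :* (n :* m)) refl k l (N v) (N w) · cong (k * l * (k * l) *_) (sym (N-* v w)))
  (*≤ (N₀ x) (sq₀ l *₀ N₀ w) p q)
 ⊑-mono : ∀ {x w k l} -> 0# ≤ k -> k ≤ l -> x ⊑[ k ] w -> x ⊑[ l ] w
 ⊑-mono {w = w} k₀ h p = p » *≤ˡ (N₀ w) (*≤ k₀ (k₀ » h) h h)
 ⊑-refl : ∀ x -> x ⊑[ 1# ] x
 ⊑-refl x = of≡ (solve 1 (λ n -> n := Κ 1# :* Κ 1# :* n) refl (N x))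
 Tr-⊑ : ∀ {x k} -> 0# ≤ k -> N x ≤ k * k -> Tr x ≤ c 2 1 * k
 Tr-⊑ {x} {k} k₀ h = sq-cancel (lit *₀ k₀) (Tr²≤4N x » *≤ʳ lit h »≡ solve 1 (λ k -> κ 4 1 :* (k :* k) := κ 2 1 :* k :* (κ 2 1 :* k)) refl k)
 infixr 8 _^°_
 _^°_ : 𝔼 -> ℕ -> 𝔼
 x ^° zero = 1°
 x ^° suc n = x *° x ^° n
 ^°-+ : ∀ x m n -> x ^° (m ℕ.+ n) ≡ x ^° m *° x ^° n
 ^°-+ x zero n = solve° 1 (λ y -> y := Κ 1° :* y) refl (x ^° n)
 ^°-+ x (suc m) n = cong (x *°_) (^°-+ x m n) · solve° 3 (λ x y z -> x :* (y :* z) := x :* y :* z) refl x (x ^° m) (x ^° n)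
 *-^° : ∀ x y n -> (x *° y) ^° n ≡ x ^° n *° y ^° n
 *-^° x y zero = solve° 0 (Κ 1° := Κ 1° :* Κ 1°) refl
 *-^° x y (suc n) = cong (x *° y *°_) (*-^° x y n) · solve° 4 (λ x y a b -> x :* y :* (a :* b) := x :* a :* (y :* b)) refl x y (x ^° n) (y ^° n)
 ^°-* : ∀ x m n -> x ^° (m ℕ.* n) ≡ (x ^° n) ^° m
 ^°-* x zero n = refl
 ^°-* x (suc m) n = ^°-+ x n (m ℕ.* n) · cong (x ^° n *°_) (^°-* x m n)
 ofℚ-^ : ∀ p n -> ofℚ (p ^ n) ≡ ofℚ p ^° n
 ofℚ-^ p zero = refl
 ofℚ-^ p (suc n) = ofℚ-* p (p ^ n) · cong (ofℚ p *°_) (ofℚ-^ p n)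
 conj-^ : ∀ x n -> conj (x ^° n) ≡ conj x ^° n
 conj-^ x zero = conj-ofℚ 1#
 conj-^ x (suc n) = conj-* x (x ^° n) · cong (conj x *°_) (conj-^ x n)
 N-^ : ∀ x n -> N (x ^° n) ≡ N x ^ n
 N-^ x zero = N-ofℚ 1# · *-1ˡ 1#
 N-^ x (suc n) = N-* x (x ^° n) · cong (N x *_) (N-^ x n)
 prod° : (ℕ -> 𝔼) -> ℕ -> 𝔼
 prod° f zero = 1°
 prod° f (suc n) = prod° f n *° f n
 N-prod : ∀ f n -> N (prod° f n) ≡ prod (λ i -> N (f i)) n
 N-prod f zero = N-ofℚ 1# · *-1ˡ 1#
 N-prod f (suc n) = N-* (prod° f n) (f n) · cong (_* N (f n)) (N-prod f n)
 sum° : (ℕ -> 𝔼) -> ℕ -> 𝔼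
 sum° f zero = 0°
 sum° f (suc n) = sum° f n +° f n

-- Decay without exponentials, Abel summation, powers of a point on the unit circle

module U1 where
 open Q1
 open E1
 -- Bernoulli's inequality for B / A with denominators cleared: the power lies above its tangent at
 -- B = A.
 bernoulli-homogeneous : ∀ {A B} n -> 0# ≤ A -> 0# ≤ B -> ι (suc n) * A ^ n * B - ι n * (A * A ^ n) ≤ B ^ suc n
 bernoulli-homogeneous {A} {B} zero a b = of≡ (solve 2 (λ A B -> (Κ 1# :+ Κ 0#) :* Κ 1# :* B :- Κ 0# :* (A :* Κ 1#) := B :* Κ 1#) refl A B)
 bernoulli-homogeneous {A} {B} (suc n) a b = gap≤ (ι₀ (suc n) *₀ ^₀ n a *₀ sq₀ (B - A)) (solve 4 (λ A B m x -> B :* ((Κ 1# :+ m) :* x :* B :- m :* (A :* x)) :=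
  (Κ 1# :+ (Κ 1# :+ m)) :* (A :* x) :* B :- (Κ 1# :+ m) :* (A :* (A :* x)) :+ (Κ 1# :+ m) :* x :* ((B :- A) :* (B :- A)))
     refl A B _ _) » *≤ʳ b (bernoulli-homogeneous n a b)
 -- Induction on the number of factors: if A is the mean of the first n, the last factor equals (n +
 -- 1) B - n A, and the homogeneous Bernoulli inequality absorbs it.
 am-gm : ∀ f n B -> (∀ i -> 0# ≤ f i) -> 0# ≤ B -> sum f n ≡ ι n * B -> prod f n ≤ B ^ n
 am-gm f zero B f₀ b e = ≤-refl
 am-gm f (suc zero) B f₀ b e = of≡ (solve 1 (λ x -> Κ 1# :* x := Κ 0# :+ x) refl _ · e · solve 1 (λ B -> (Κ 1# :+ Κ 0#) :* B := B :* Κ 1#) refl B)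
 am-gm f (suc n@(suc k)) B f₀ b e = *≤ˡ (f₀ n) (am-gm f n A f₀ A₀ eA) » eq ≡» bernoulli-homogeneous n A₀ b
  where
  v : ℚ
  v = inv (ι n) (ι₊ k)
  v₀ : 0# ≤ v
  v₀ = cancel≤ (ι₊ k) (subst₂ _≤_ (sym (*-0ʳ _)) (sym (*-inv _ _)) lit)
  A : ℚ
  A = v * sum f n
  A₀ : 0# ≤ A
  A₀ = v₀ *₀ sum₀ n f₀
  eA : sum f n ≡ ι n * A
  eA = sym (*-1ˡ _) · cong (_* sum f n) (sym (*-inv (ι n) (ι₊ k))) · *-assoc (ι n) v (sum f n)
  eq : A ^ n * f n ≡ ι (suc n) * A ^ n * B - ι n * (A * A ^ n)
  eq = solve 3 (λ x y s -> x :* y := x :* (s :+ y :- s)) refl _ _ _ · cong₂ (λ p q -> A ^ n * (p - q)) e eA · solve 4 (λ A x m B -> x :* ((Κ 1# :+ m) :* B :- m :* A) := (Κ 1# :+ m) :* x :* B :- m :* (A :* x)) refl A _ _ B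
 inv₀ : ∀ p h -> 0# ≤ inv p h
 inv₀ p h = cancel≤ h (subst₂ _≤_ (sym (*-0ʳ p)) (sym (*-inv p h)) lit)
 -- Stands for ∏ f ≤ exp (-Y). With Z the total deficit, L = `suc l` and η = Z / (L n), the product
 -- is at most (1 - L η)^n ≤ (1 - η)^(L n), while 1 + Z / L = 1 + n η ≤ (1 + η)^n; multiplying
 -- leaves a power of 1 - η².
 prod-decay : ∀ f n l Y -> (∀ i -> 0# ≤ f i) -> 0# ≤ Y -> Y ≤ sum (λ i -> 1# - f i) n ->
  prod f n * (1# + Y * inv (ι (suc l)) (ι₊ l)) ^ suc l ≤ 1#
 prod-decay f zero l Y f₀ Y₀ h = *-1ˡ _ ≡» subst ((1# + Y * inv (ι (suc l)) (ι₊ l)) ^ suc l ≤_) (1^ (suc l))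
  (^-mono (suc l) (lit +₀ (Y₀ *₀ inv₀ _ _))
   (+≤ ≤-refl (*≤ˡ (inv₀ (ι (suc l)) (ι₊ l)) h) »≡ solve 1 (λ v -> Κ 1# :+ Κ 0# :* v := Κ 1#) refl _))
 prod-decay f (suc k) l Y f₀ Y₀ h = *≤ (prod₀ n f₀) (^₀ L (lit +₀ (Z₀ *₀ v₀)))
  (am-gm f n B f₀ B₀ eB » ^-mono n B₀ B≤)
  (^-mono L (lit +₀ (Y₀ *₀ v₀)) (+≤ ≤-refl (*≤ˡ v₀ h))) » cong (_* (1# + Z * v) ^ L) (sym (^-* (1# - η) n L) · cong ((1# - η) ^_) (ℕP.*-comm n L) · ^-* (1# - η) L n) · sym (*-^ ((1# - η) ^ n) (1# + Z * v) L) ≡» ^≤1 L ((^₀ n 1-η₀) *₀ (lit +₀ (Z₀ *₀ v₀))) (*≤ʳ (^₀ n 1-η₀) bern » sym (*-^ (1# - η) (1# + η) n) ≡» ^≤1 n (1-η₀ *₀ (lit +₀ η₀)) (gap≤ (sq₀ η) (solve 1 (λ η -> Κ 1# := (Κ 1# :- η) :* (Κ 1# :+ η) :+ η :* η) refl η)))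
  where
  n L : ℕ
  n = suc k
  L = suc l
  Z v w B η : ℚ
  Z = sum (λ i -> 1# - f i) n
  v = inv (ι L) (ι₊ l)
  w = inv (ι n) (ι₊ k)
  B = w * sum f n
  η = Z * v * w
  v₀ : 0# ≤ v
  v₀ = inv₀ (ι L) (ι₊ l)
  w₀ : 0# ≤ w
  w₀ = inv₀ (ι n) (ι₊ k)
  Z₀ : 0# ≤ Z
  Z₀ = Y₀ » h
  η₀ : 0# ≤ η
  η₀ = Z₀ *₀ v₀ *₀ w₀
  B₀ : 0# ≤ B
  B₀ = w₀ *₀ sum₀ n f₀
  nw : ι n * w ≡ 1#
  nw = *-inv (ι n) (ι₊ k)
  Lv : ι L * v ≡ 1#
  Lv = *-inv (ι L) (ι₊ l)
  eB : sum f n ≡ ι n * B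
  eB = sym (*-1ˡ _) · cong (_* sum f n) (sym nw) · *-assoc (ι n) w (sum f n)
  Zf : Z ≡ ι n - sum f n
  Zf = sum-+ (λ _ -> 1#) (λ i -> - f i) n · (cong₂ _+_ (sum-const 1# n · *-1ʳ _) (neg n))
   where
   neg : ∀ m -> sum (λ i -> - f i) m ≡ - sum f m
   neg zero = solve 0 (Κ 0# := :- Κ 0#) refl
   neg (suc m) = cong (_+ (- f m)) (neg m) · solve 2 (λ a b -> (:- a) :+ (:- b) := :- (a :+ b)) refl _ _
  B≡ : B ≡ 1# + ι L * (- η)
  B≡ = sym (solve 4 (λ L Z v w -> Κ 1# :+ L :* (:- (Z :* v :* w)) := Κ 1# :- (L :* v) :* Z :* w) refl _ Z v w · cong₂ (λ p q -> 1# - p * q * w) Lv Zf · solve 3 (λ n w s -> Κ 1# :- Κ 1# :* (n :- s) :* w := Κ 1# :- n :* w :+ w :* s) refl _ w _ · cong (λ p -> 1# - p + w * sum f n) nw · solve 1 (λ b -> Κ 1# :- Κ 1# :+ b := b) refl _)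
  Lη≤1 : ι L * η ≤ 1#
  Lη≤1 = ungap (subst (0# ≤_) (B≡ · solve 2 (λ L η -> Κ 1# :+ L :* (:- η) := Κ 1# :- L :* η) refl _ η) B₀)
  η≤1 : η ≤ 1#
  η≤1 = gap≤ (ι₀ l *₀ η₀) (solve 2 (λ l η -> (Κ 1# :+ l) :* η := η :+ l :* η) refl _ η) » Lη≤1
  1-η₀ : 0# ≤ 1# - η
  1-η₀ = gap η≤1
  B≤ : B ≤ (1# - η) ^ L
  B≤ = B≡ ≡» bernoulli L 1-η₀
  bern : 1# + Z * v ≤ (1# + η) ^ n
  bern = cong (1# +_) (sym (*-1ˡ _) · cong (_* (Z * v)) (sym nw) · solve 3 (λ n w p -> n :* w :* p := n :* (p :* w)) refl _ w _) ≡» bernoulli n (lit +₀ η₀)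
 -- Summation by parts against decreasing weights. While the partial sums of `h` are non-negative
 -- nothing is lost, so the bound `B` is paid only at the weight `g J` reached when that stops.
 abel : ∀ (g h : ℕ -> ℚ) n J B -> (∀ i -> 0# ≤ g i) -> (∀ i -> g (suc i) ≤ g i) -> 0# ≤ B ->
  (∀ j -> j ℕ.≤ n -> - B ≤ sum h j) -> (∀ j -> j ℕ.≤ J -> 0# ≤ sum h j) -> - (B * g J) ≤ sum (λ i -> g i * h i) n
 abel g h n J B g₀ g↓ B₀ low pos = fin (ℕP.≤-total n J) »≡ solve 2 (λ s t -> s :- t :+ t := s) refl _ _
  where
  S H Q : ℕ -> ℚ
  S m = sum (λ i -> g i * h i) m
  H m = sum h m
  Q m = S m - g m * H m
  step : ∀ m -> Q (suc m) ≡ Q m + (g m - g (suc m)) * H (suc m)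
  step m = solve 5 (λ s g g' t c -> s :+ g :* c :- g' :* (t :+ c) := s :- g :* t :+ (g :- g') :* (t :+ c)) refl _ _ _ _ _
  Q₀ : ∀ m -> m ℕ.≤ J -> 0# ≤ Q m
  Q₀ zero _ = of≡ (solve 1 (λ g -> Κ 0# := Κ 0# :- g :* Κ 0#) refl _)
  Q₀ (suc m) l = subst (0# ≤_) (sym (step m)) (Q₀ m (ℕP.<⇒≤ l) +₀ (gap (g↓ m) *₀ pos (suc m) l))
  Q₁ : ∀ m -> m ℕ.+ J ℕ.≤ n -> - (B * (g J - g (m ℕ.+ J))) ≤ Q (m ℕ.+ J)
  Q₁ zero _ = solve 2 (λ B g -> :- (B :* (g :- g)) := Κ 0#) refl B _ ≡» Q₀ J ℕP.≤-refl
  Q₁ (suc m) l = solve 4 (λ B g a b -> :- (B :* (g :- b)) := :- (B :* (g :- a)) :+ (a :- b) :* (:- B)) refl B _ _ _ ≡» +≤ (Q₁ m (ℕP.<⇒≤ l)) (*≤ʳ (gap (g↓ (m ℕ.+ J))) (low (suc m ℕ.+ J) l)) »≡ sym (step (m ℕ.+ J))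
  fin : (n ℕ.≤ J) ⊎ (J ℕ.≤ n) -> - (B * g J) ≤ Q n + g n * H n
  fin (inj₁ l) = gap≤ (B₀ *₀ g₀ J) (solve 2 (λ B g -> Κ 0# := :- (B :* g) :+ B :* g) refl B _) » (Q₀ n l +₀ (g₀ n *₀ pos n l))
  fin (inj₂ l) = subst (λ m -> - (B * g J) ≤ Q m + g m * H m) (ℕP.m∸n+n≡m l) (solve 3 (λ B g a -> :- (B :* g) := :- (B :* (g :- a)) :+ a :* (:- B)) refl B _ _ ≡» +≤ (Q₁ (n ℕ.∸ J) m'≤n) (*≤ʳ (g₀ m') (low m' m'≤n)))
   where
   m' : ℕ
   m' = n ℕ.∸ J ℕ.+ J
   m'≤n : m' ℕ.≤ n
   m'≤n = ℕP.≤-reflexive (ℕP.m∸n+n≡m l)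
 module Unit (z : 𝔼) (Nz : N z ≡ 1#) where
  -- For z of argument θ this is the squared chord 2 - 2 cos kθ. The value `D` at k = 1 replaces θ²
  -- throughout.
  d : ℕ -> ℚ
  d k = N (1° -° z ^° k)
  N-unit : ∀ k -> N (z ^° k) ≡ 1#
  N-unit k = N-^ z k · cong (_^ k) Nz · 1^ k
  N-1- : ∀ x -> N (1° -° x) ≡ 1# + N x - Tr x
  N-1- x = N-+ 1° (-° x) · (cong₂ _+_ (cong₂ _+_ (N-ofℚ 1# · *-1ˡ 1#) (N-neg x)) (cong Tr (*°-1ˡ (conj (-° x))) · Tr-conj (-° x) · Tr-neg x))
   where
   *°-1ˡ : ∀ y -> 1° *° y ≡ y
   *°-1ˡ = solve° 1 (λ y -> Κ 1° :* y := y) refl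
  d-Tr : ∀ k -> d k ≡ c 2 1 - Tr (z ^° k)
  d-Tr k = N-1- (z ^° k) · cong (λ p -> 1# + p - Tr (z ^° k)) (N-unit k) · solve 1 (λ t -> Κ 1# :+ Κ 1# :- t := κ 2 1 :- t) refl _
  z² : ∀ x -> z *° (z *° x) ≡ ofℚ (Tr z) *° (z *° x) -° x
  z² x = solve° 3 (λ z y x -> z :* (z :* x) := (z :+ y) :* (z :* x) :- z :* y :* x) refl z _ x · cong₂ (λ p q -> p *° (z *° x) -° q *° x) (x+conj z) (x*conj z · cong ofℚ Nz) · solve° 2 (λ y x -> y :- Κ 1° :* x := y :- x) refl _ x
  Tr-rec : ∀ k -> Tr (z ^° suc (suc k)) ≡ Tr z * Tr (z ^° suc k) - Tr (z ^° k)
  Tr-rec k = cong Tr (z² (z ^° k)) · Tr-+ _ _ · (cong₂ _+_ (Tr-ofℚ* _ _) (Tr-neg _))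
  D : ℚ
  D = d 1
  z^1 : z ^° 1 ≡ z
  z^1 = solve° 1 (λ z -> z :* Κ 1° := z) refl z
  Tr-z : Tr z ≡ c 2 1 - D
  Tr-z = solve 1 (λ t -> t := κ 2 1 :- (κ 2 1 :- t)) refl _ · cong (λ p -> c 2 1 - p) (sym (d-Tr 1 · cong (λ p -> c 2 1 - Tr p) z^1))
  D₀ : 0# ≤ D
  D₀ = N₀ _
  d₀ : ∀ k -> 0# ≤ d k
  d₀ k = N₀ _
  d-zero : d 0 ≡ 0#
  d-zero = d-Tr 0 · cong (λ p -> c 2 1 - p) (Tr-ofℚ 1#) · solve 0 (κ 2 1 :- (Κ 1# :+ Κ 1#) := Κ 0#) refl
  -- The cosine recurrence written as a second difference, so that Taylor bounds follow by summing
  -- twice.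
  d-rec : ∀ k -> d (suc (suc k)) - d (suc k) ≡ d (suc k) - d k + D * (c 2 1 - d (suc k))
  d-rec k = (cong₂ _-_ (d-Tr (suc (suc k)) · cong (λ p -> c 2 1 - p) (Tr-rec k · cong (λ p -> p * Tr (z ^° suc k) - Tr (z ^° k)) Tr-z)) (d-Tr (suc k))) · solve 3 (λ D s t -> κ 2 1 :- ((κ 2 1 :- D) :* s :- t) :- (κ 2 1 :- s) := (κ 2 1 :- s) :- (κ 2 1 :- t) :+ D :* (κ 2 1 :- (κ 2 1 :- s))) refl D _ _ · sym (cong₂ (λ p q -> p - q + D * (c 2 1 - p)) (d-Tr (suc k)) (d-Tr k))
  d-upper : ∀ k -> (d k ≤ ι k * ι k * D) × (d (suc k) - d k ≤ (ι k + ι k + 1#) * D)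
  d-upper zero = of≡ (d-zero · solve 1 (λ D -> Κ 0# := Κ 0# :* Κ 0# :* D) refl D) ,
   of≡ (cong (λ p -> D - p) d-zero · solve 1 (λ D -> D :- Κ 0# := (Κ 0# :+ Κ 0# :+ Κ 1#) :* D) refl D)
  d-upper (suc k) = let (p , q) = d-upper k in
   ≤-trans (of≡ (solve 2 (λ a b -> b := a :+ (b :- a)) refl _ _))
    (+≤ p q »≡ solve 2 (λ k D -> k :* k :* D :+ (k :+ k :+ Κ 1#) :* D := (Κ 1# :+ k) :* (Κ 1# :+ k) :* D) refl _ D) ,
   ≤-trans (of≡ (d-rec k)) (+≤ q (*≤ʳ {u = c 2 1 - d (suc k)} {v = c 2 1} D₀ (gap≤ (d₀ (suc k)) (solve 1 (λ x -> κ 2 1 := κ 2 1 :- x :+ x) refl _))) »≡ solve 2 (λ k D -> (k :+ k :+ Κ 1#) :* D :+ D :* κ 2 1 := (Κ 1# :+ k :+ (Κ 1# :+ k) :+ Κ 1#) :* D) refl _ D)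
  d≤ : ∀ k -> d k ≤ ι k * ι k * D
  d≤ k = proj₁ (d-upper k)
  -- Insert the upper bound k² D into the second difference: the correction sums squares once,
  -- giving k(k+1)(2k+1)/6, and then once more, giving k²(k²-1)/12.
  d-lower : ∀ k -> (ι k * ι k * D - c 1 12 * (ι k * ι k * (ι k * ι k - 1#)) * (D * D) ≤ d k) ×
   ((ι k + ι k + 1#) * D - c 1 6 * (ι k * (ι k + 1#) * (ι k + ι k + 1#)) * (D * D) ≤ d (suc k) - d k)
  d-lower zero = of≡ (solve 1 (λ D -> Κ 0# :* Κ 0# :* D :- κ 1 12 :* (Κ 0# :* Κ 0# :* (Κ 0# :* Κ 0# :- Κ 1#)) :* (D :* D) := Κ 0#) refl D · sym d-zero) ,
   of≡ (solve 1 (λ D -> (Κ 0# :+ Κ 0# :+ Κ 1#) :* D :- κ 1 6 :* (Κ 0# :* (Κ 0# :+ Κ 1#) :* (Κ 0# :+ Κ 0# :+ Κ 1#)) :* (D :* D) := D :- Κ 0#) refl D · cong (λ p -> D - p) (sym d-zero))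
  d-lower (suc k) = let (p , q) = d-lower k in
   ≤-trans (of≡ (solve 2 (λ k D -> (Κ 1# :+ k) :* (Κ 1# :+ k) :* D :- κ 1 12 :* ((Κ 1# :+ k) :* (Κ 1# :+ k) :* ((Κ 1# :+ k) :* (Κ 1# :+ k) :- Κ 1#)) :* (D :* D) :=
     k :* k :* D :- κ 1 12 :* (k :* k :* (k :* k :- Κ 1#)) :* (D :* D) :+ ((k :+ k :+ Κ 1#) :* D :- κ 1 6 :* (k :* (k :+ Κ 1#) :* (k :+ k :+ Κ 1#)) :* (D :* D))) refl _ D))
    (+≤ p q »≡ solve 2 (λ a b -> a :+ (b :- a) := b) refl _ _) ,
   ≤-trans (of≡ (solve 2 (λ k D -> (Κ 1# :+ k :+ (Κ 1# :+ k) :+ Κ 1#) :* D :- κ 1 6 :* ((Κ 1# :+ k) :* (Κ 1# :+ k :+ Κ 1#) :* (Κ 1# :+ k :+ (Κ 1# :+ k) :+ Κ 1#)) :* (D :* D) :=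
    (k :+ k :+ Κ 1#) :* D :- κ 1 6 :* (k :* (k :+ Κ 1#) :* (k :+ k :+ Κ 1#)) :* (D :* D) :+ D :* (κ 2 1 :- (Κ 1# :+ k) :* (Κ 1# :+ k) :* D)) refl _ D))
    (+≤ q (*≤ʳ D₀ (gap≤ (gap (d≤ (suc k))) (solve 2 (λ x y -> κ 2 1 :- x := κ 2 1 :- y :+ (y :- x)) refl _ _))) »≡ sym (d-rec k))
  d≥ : ∀ k -> ι k * ι k * D - c 1 12 * (ι k * ι k * (ι k * ι k)) * (D * D) ≤ d k
  d≥ k = gap≤ (lit *₀ sq₀ (ι k) *₀ sq₀ D) (solve 2 (λ k D -> k :* k :* D :- κ 1 12 :* (k :* k :* (k :* k :- Κ 1#)) :* (D :* D) :=
    k :* k :* D :- κ 1 12 :* (k :* k :* (k :* k)) :* (D :* D) :+ κ 1 12 :* (k :* k) :* (D :* D)) refl _ D) » proj₁ (d-lower k)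
  q : ℕ -> ℚ
  q k = im (z ^° k)
  -- Chebyshev polynomials of the second kind at cos θ = 1 - D/2, with the index shifted by one: sin
  -- kθ / sin θ.
  cheb : ℕ -> ℚ
  cheb zero = 0#
  cheb (suc zero) = 1#
  cheb (suc (suc k)) = cheb (suc k) + (cheb (suc k) - cheb k) - D * cheb (suc k)
  q-cheb : ∀ k -> (q k ≡ im z * cheb k) × (q (suc k) ≡ im z * cheb (suc k))
  q-cheb zero = sym (*-0ʳ (im z)) , trans (cong im z^1) (sym (*-1ʳ (im z)))
  q-cheb (suc k) = let (p , p') = q-cheb k in p' , trans (cong im (z² (z ^° k)))
   (im-lin (Tr z) (z ^° suc k) (z ^° k) · cong₂ (λ x y -> Tr z * x - y) p' p · cong (λ t -> t * (im z * cheb (suc k)) - im z * cheb k) Tr-z · solve 4 (λ D i x y -> (κ 2 1 :- D) :* (i :* x) :- i :* y := i :* (x :+ (x :- y) :- D :* x)) refl D _ _ _)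
   where
   opaque
    unfolding _+°_
    im-lin : ∀ t x y -> im (ofℚ t *° x -° y) ≡ t * im x - im y
    im-lin t (a +ω b) (u +ω v) = solve 4 (λ t a b v -> t :* b :+ Κ 0# :* a :- Κ 0# :* b :+ (:- v) := t :* b :- v) refl t a b v
  private
   ChebBounds : ℕ -> Set
   ChebBounds k = (cheb k ≤ ι k) × (cheb (suc k) - cheb k ≤ 1#) ×
    (1# - c 1 2 * D * (ι k * (ι k + 1#)) ≤ cheb (suc k) - cheb k) × (ι k - c 1 6 * D * (ι k * (ι k * ι k - 1#)) ≤ cheb k)
   cheb-pos : ∀ k -> ι k * ι k * D ≤ c 6 1 -> ι k - c 1 6 * D * (ι k * (ι k * ι k - 1#)) ≤ cheb k -> 0# ≤ cheb k
   cheb-pos k h p = subst (0# ≤_) (solve 2 (λ k D -> k :* (κ 1 6 :* (κ 6 1 :- k :* k :* D) :+ κ 1 6 :* D) := k :- κ 1 6 :* D :* (k :* (k :* k :- Κ 1#))) refl _ D)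
    (ι₀ k *₀ (lit *₀ gap h +₀ (lit *₀ D₀))) » p
   -- The bounds must be carried together. The second difference is -D times `cheb`, so increments
   -- decrease only while `cheb` is non-negative, and that comes from the lower bound as long as k²
   -- D ≤ 6.
   cheb-bounds : ∀ k -> ι k * ι k * D ≤ c 6 1 -> ChebBounds k
   cheb-bounds zero _ = ≤-refl , of≡ (solve 0 (Κ 1# :- Κ 0# := Κ 1#) refl) ,
    of≡ (solve 1 (λ D -> Κ 1# :- κ 1 2 :* D :* (Κ 0# :* (Κ 0# :+ Κ 1#)) := Κ 1# :- Κ 0#) refl D) ,
    of≡ (solve 1 (λ D -> Κ 0# :- κ 1 6 :* D :* (Κ 0# :* (Κ 0# :* Κ 0# :- Κ 1#)) := Κ 0#) refl D)
   cheb-bounds (suc k) h = let (p₁ , p₂ , p₃ , p₄) = cheb-bounds k (*≤ˡ D₀ (*≤ (ι₀ k) (ι₀ (suc k)) k≤ k≤) » h) ; r₄ = ≤-trans (of≡ (solve 2 (λ k D -> Κ 1# :+ k :- κ 1 6 :* D :* ((Κ 1# :+ k) :* ((Κ 1# :+ k) :* (Κ 1# :+ k) :- Κ 1#)) := k :- κ 1 6 :* D :* (k :* (k :* k :- Κ 1#)) :+ (Κ 1# :- κ 1 2 :* D :* (k :* (k :+ Κ 1#)))) refl _ D)) (+≤ p₄ p₃ »≡ glue k) ; r₁ = ≤-trans (of≡ (sym (glue k))) (+≤ p₁ p₂ »≡ +-comm (ι k) 1#)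
    in r₁ ,
      ≤-trans (gap≤ (D₀ *₀ cheb-pos (suc k) h r₄) (solve 3 (λ D x y -> x :- y := x :+ (x :- y) :- D :* x :- x :+ D :* x) refl D _ _)) p₂ ,
      ≤-trans (of≡ (solve 2 (λ k D -> Κ 1# :- κ 1 2 :* D :* ((Κ 1# :+ k) :* (Κ 1# :+ k :+ Κ 1#)) := Κ 1# :- κ 1 2 :* D :* (k :* (k :+ Κ 1#)) :- D :* (Κ 1# :+ k)) refl _ D))
       (+≤ p₃ (of≡ refl) » gap≤ (D₀ *₀ gap r₁) (solve 4 (λ D x y k -> x :+ (x :- y) :- D :* x :- x := x :- y :- D :* k :+ D :* (k :- x)) refl D _ _ _)) ,
      r₄
    where
    k≤ : ι k ≤ ι (suc k)
    k≤ = ι-mono (ℕP.n≤1+n k)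
    glue : ∀ k -> cheb k + (cheb (suc k) - cheb k) ≡ cheb (suc k)
    glue k = solve 2 (λ x y -> x :+ (y :- x) := y) refl _ _
  cheb₀ : ∀ k -> ι k * ι k * D ≤ c 6 1 -> 0# ≤ cheb k
  cheb₀ k h = cheb-pos k h (proj₂ (proj₂ (proj₂ (cheb-bounds k h))))
 -- Tripling by recursion, so that indices in a fixed class modulo 3 reduce by pattern matching.
 t3 : ℕ -> ℕ
 t3 zero = zero
 t3 (suc i) = suc (suc (suc (t3 i)))
 ι-t3 : ∀ i -> ι (t3 i) ≡ c 3 1 * ι i
 ι-t3 zero = sym (*-0ʳ _)
 ι-t3 (suc i) = cong (λ p -> 1# + (1# + (1# + p))) (ι-t3 i) · solve 1 (λ i -> Κ 1# :+ (Κ 1# :+ (Κ 1# :+ κ 3 1 :* i)) := κ 3 1 :* (Κ 1# :+ i)) refl _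
 a b : ℕ -> ℕ
 a i = suc (t3 i)
 b i = suc (suc (t3 i))
 module PairSum (u : 𝔼) (Nu : N u ≡ 1#) where
  open Unit u Nu using (q; cheb; q-cheb; Tr-z; D) renaming (N-unit to Nu^)
  pair : ℕ -> ℚ
  pair i = Tr (u ^° a i) + Tr (u ^° b i)
  N₃ : ℚ
  N₃ = N (1° -° u ^° 3)
  β : 𝔼
  β = (u +° u *° u) *° conj (1° -° u ^° 3)
  -- A geometric series in u³, whose denominator 1 - u³ is made rational by its conjugate; this
  -- explains `N₃` and `β`.
  closed : ∀ J -> N₃ * sum pair J ≡ Tr (β *° (1° -° u ^° t3 J))
  closed zero = *-0ʳ N₃ · sym (*-0ˡ (Tr β)) · sym (Tr-ofℚ* 0# β) · cong Tr (solve° 1 (λ β -> Κ 0° :* β := β :* (Κ 1° :- Κ 1°)) refl β)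
  closed (suc J) = solve 3 (λ n s p -> n :* (s :+ p) := n :* s :+ n :* p) refl N₃ _ _ · (cong₂ _+_ (closed J) step) · sym (Tr-+ (β *° (1° -° v)) _) · cong Tr (solve° 3 (λ β v x -> β :* (Κ 1° :- v) :+ β :* (v :- x) := β :* (Κ 1° :- x)) refl β v _)
   where
   v : 𝔼
   v = u ^° t3 J
   step : N₃ * pair J ≡ Tr (β *° (v -° u ^° t3 (suc J)))
   step = cong (N₃ *_) (sym (Tr-+ (u *° v) (u *° (u *° v)))) · sym (Tr-ofℚ* N₃ _) · cong Tr (cong (_*° (u *° v +° u *° (u *° v))) (sym (x*conj (1° -° u ^° 3))) · solve° 3 (λ u v y -> (Κ 1° :- u :* (u :* (u :* Κ 1°))) :* y :* (u :* v :+ u :* (u :* v)) := (u :+ u :* u) :* y :* (v :- u :* (u :* (u :* v)))) refl u v _)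
  -- Expanding with u ū = 1 shows that β is purely imaginary, which drives both estimates that
  -- follow.
  β≡ : β ≡ (u -° conj u) +° (u *° u -° conj (u *° u))
  β≡ = cong ((u +° u *° u) *°_) cj · solve° 2 (λ u w -> (u :+ u :* u) :* (Κ 1° :- w :* (w :* (w :* Κ 1°))) :=
    u :+ u :* u :- (u :* w) :* (w :* w) :- (u :* w) :* (u :* w) :* w) refl u _ · cong (λ x -> u +° u *° u -° x *° (conj u *° conj u) -° x *° x *° conj u) (x*conj u · cong ofℚ Nu) · solve° 2 (λ u w -> u :+ u :* u :- Κ 1° :* (w :* w) :- Κ 1° :* Κ 1° :* w := (u :- w) :+ (u :* u :- w :* w)) refl u _ · cong (λ x -> (u -° conj u) +° (u *° u -° x)) (sym (conj-* u u))
   where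
   cj : conj (1° -° u ^° 3) ≡ 1° -° conj u ^° 3
   cj = conj-+ 1° (-° u ^° 3) · (cong₂ _+°_ (conj-ofℚ 1#) (cn (u ^° 3) · (cong -°_ (conj-^ u 3))))
    where
    opaque
     unfolding _+°_
     cn : ∀ x -> conj (-° x) ≡ -° conj x
     cn (x +ω y) = cong₂ _+ω_ (solve 2 (λ x y -> (:- x) :- (:- y) := :- (x :- y)) refl x y) refl
  opaque
   unfolding _+°_
   Tr-imaginary : ∀ x y v -> Tr (((x -° conj x) +° (y -° conj y)) *° (1° -° v)) ≡ c 3 1 * (im x + im y) * im v
   Tr-imaginary (x +ω x') (y +ω y') (v +ω v') = solve 6 (λ x x' y y' v v' ->
    let p = x :+ (:- (x :- x')) :+ (y :+ (:- (y :- y'))) ; p' = x' :+ (:- (:- x')) :+ (y' :+ (:- (:- y'))) ; w = Κ 1# :+ (:- v) ; w' = Κ 0# :+ (:- v') ; s = p :* w :- p' :* w' in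
    s :+ s :- (p :* w' :+ p' :* w :- p' :* w') := κ 3 1 :* (x' :+ y') :* v') refl x x' y y' v v'
  -- Both imaginary parts contain the factor `im u`, so for D ≤ 3 and positive `N₃` the partial sum
  -- has the sign of `cheb (t3 J)`.
  pair-sum : ∀ J -> N₃ * sum pair J ≡ c 3 1 * (im u * im u * (c 3 1 - D)) * cheb (t3 J)
  pair-sum J = closed J · cong (λ x -> Tr (x *° (1° -° u ^° t3 J))) β≡ · Tr-imaginary u (u *° u) (u ^° t3 J) · cong₂ (λ x y -> c 3 1 * (im u + x) * y) (cong im (solve° 1 (λ u -> u :* u := u :* (u :* Κ 1°)) refl u) · proj₂ (q-cheb 1) · cong (λ p -> im u * p) (solve 1 (λ D -> Κ 1# :+ (Κ 1# :- Κ 0#) :- D :* Κ 1# := κ 2 1 :- D) refl D)) (proj₁ (q-cheb (t3 J))) · solve 3 (λ i D x -> κ 3 1 :* (i :+ i :* (κ 2 1 :- D)) :* (i :* x) := κ 3 1 :* (i :* i :* (κ 3 1 :- D)) :* x) refl _ D _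
  -- As β has trace zero, the endpoint 1 of the geometric series contributes nothing; only a unit
  -- multiple of β remains, hence a bound uniform in J.
  pair-sum² : 0# < N₃ -> ∀ J -> N₃ * (sum pair J * sum pair J) ≤ c 4 1 * N (1° +° u)
  pair-sum² h J = cancel≤ h (solve 2 (λ n s -> n :* (n :* (s :* s)) := (n :* s) :* (n :* s)) refl N₃ _ · cong (λ p -> p * p) eq ≡» Tr²≤4N (β *° (-° v)) »≡ cong (c 4 1 *_) Nβ · solve 2 (λ n m -> κ 4 1 :* (m :* n) := n :* (κ 4 1 :* m)) refl N₃ _)
   where
   v : 𝔼
   v = u ^° t3 J
   opaque
    unfolding _+°_
    Tr-im : ∀ x y v -> Tr (((x -° conj x) +° (y -° conj y)) *° (1° -° v)) ≡ Tr (((x -° conj x) +° (y -° conj y)) *° (-° v))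
    Tr-im (x +ω x') (y +ω y') (v +ω v') = solve 6 (λ x x' y y' v v' ->
     let p = x :+ (:- (x :- x')) :+ (y :+ (:- (y :- y'))) ; p' = x' :+ (:- (:- x')) :+ (y' :+ (:- (:- y'))) ; w = Κ 1# :+ (:- v) ; w' = Κ 0# :+ (:- v') ; s = p :* w :- p' :* w' ; o = :- v ; o' = :- v' ; r = p :* o :- p' :* o' in
     s :+ s :- (p :* w' :+ p' :* w :- p' :* w') := r :+ r :- (p :* o' :+ p' :* o :- p' :* o')) refl x x' y y' v v'
   eq : N₃ * sum pair J ≡ Tr (β *° (-° v))
   eq = closed J · cong (λ x -> Tr (x *° (1° -° v))) β≡ · Tr-im u (u *° u) v · cong (λ x -> Tr (x *° (-° v))) (sym β≡)
   Nβ : N (β *° (-° v)) ≡ N (1° +° u) * N₃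
   Nβ = N-* β (-° v) · (cong₂ _*_ (N-* (u +° u *° u) _ · (cong₂ _*_ (cong N (solve° 1 (λ u -> u :+ u :* u := u :* (Κ 1° :+ u)) refl u) · N-* u (1° +° u) · cong (_* N (1° +° u)) Nu · *-1ˡ _) (N-conj (1° -° u ^° 3)))) (N-neg v · Nu^ (t3 J))) · *-1ʳ _

-- Decay of the product relative to its modulus at the peak

module P1 where
 open Q1
 open E1
 open U1
 inv-unique : ∀ {p} h q -> p * q ≡ 1# -> inv p h ≡ q
 inv-unique {p} h q e = sym (*-1ʳ _) · cong (inv p h *_) (sym e) · solve 3 (λ v p q -> v :* (p :* q) := p :* v :* q) refl _ p q · cong (_* q) (*-inv p h) · *-1ˡ q
 P : 𝔼 -> ℕ -> 𝔼
 P s = prod° (λ i -> (1° -° s ^° a i) *° (1° -° s ^° b i))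
 scaled-^ : ∀ r u k -> (ofℚ r *° u) ^° k ≡ ofℚ (r ^ k) *° u ^° k
 scaled-^ r u k = *-^° (ofℚ r) u k · cong (_*° u ^° k) (sym (ofℚ-^ r k))
 N-1-scaled : ∀ ρ v -> N v ≡ 1# -> N (1° -° ofℚ ρ *° v) ≡ 1# + ρ * ρ - ρ * Tr v
 N-1-scaled ρ v Nv = N-+ 1° (-° (ofℚ ρ *° v)) · (cong₂ _+_ (cong₂ _+_ (N-ofℚ 1# · *-1ˡ 1#) (N-neg (ofℚ ρ *° v) · N-* (ofℚ ρ) v · (cong₂ _*_ (N-ofℚ ρ) Nv) · *-1ʳ (ρ * ρ))) (cong Tr (solve° 1 (λ y -> Κ 1° :* y := y) refl _) · Tr-conj (-° (ofℚ ρ *° v)) · Tr-neg (ofℚ ρ *° v) · (cong -_ (Tr-ofℚ* ρ v)))) · refl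
 -- The norm of 1 - ρ ω, which is the size of one factor at the peak.
 G : ℚ -> ℚ
 G ρ = 1# + ρ + ρ * ρ
 opaque
  unfolding _+_ _*_
  ι32 : ι 32 ≡ c 32 1
  ι32 = refl
 module Weights (r : ℚ) (r₊ : 0# < r) (r₁ : r ≤ 1#) where
  r₀ : 0# ≤ r
  r₀ = <⇒≤ r₊
  G₊ : ∀ k -> 0# < G (r ^ k)
  G₊ k = (0<1 +₊ ^₀ k r₀) +₊ sq₀ (r ^ k)
  W : ℕ -> ℚ
  W k = r ^ k * inv (G (r ^ k)) (G₊ k)
  W₀ : ∀ k -> 0# ≤ W k
  W₀ k = ^₀ k r₀ *₀ inv₀ _ _
  GW : ∀ k -> G (r ^ k) * W k ≡ r ^ k
  GW k = solve 3 (λ g x v -> g :* (x :* v) := x :* (g :* v)) refl _ _ _ · cong (r ^ k *_) (*-inv _ (G₊ k)) · *-1ʳ _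
  W≤⅓ : ∀ k -> W k ≤ c 1 3
  W≤⅓ k = cancel≤ (G₊ k) (GW k ≡» gap≤ (lit *₀ sq₀ (1# - r ^ k)) (solve 1 (λ x -> (Κ 1# :+ x :+ x :* x) :* κ 1 3 := x :+ κ 1 3 :* ((Κ 1# :- x) :* (Κ 1# :- x))) refl _))
  W-mono : ∀ j k -> r ^ j ≤ r ^ k -> W j ≤ W k
  W-mono j k h = cancel≤ (G₊ j *₊ G₊ k) (subst₂ _≤_ (cong (_* G y) (sym (GW j)) · solve 3 (λ g w h -> g :* w :* h := g :* h :* w) refl _ _ _) (cong (_* G x) (sym (GW k)) · solve 3 (λ g w h -> g :* w :* h := h :* g :* w) refl _ _ _)
   (gap≤ (gap h *₀ gap (*≤ (^₀ j r₀) lit (^≤1 j r₀ r₁) (^≤1 k r₀ r₁) »≡ *-1ˡ 1#)) (solve 2 (λ x y -> y :* (Κ 1# :+ x :+ x :* x) := x :* (Κ 1# :+ y :+ y :* y) :+ (y :- x) :* (Κ 1# :- x :* y)) refl x y)))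
   where
   x y : ℚ
   x = r ^ j
   y = r ^ k
  W↓ : ∀ {j k} -> j ℕ.≤ k -> W k ≤ W j
  W↓ {j} {k} h = W-mono k j (^-anti r₀ r₁ h)
  Ω : ℕ -> ℚ
  Ω = sum (λ i -> W (b i))
  -- The squared modulus of the product at r ω, the reference for every other point.
  Π² : ℕ -> ℚ
  Π² = prod (λ i -> G (r ^ a i) * G (r ^ b i))
  module Decay (u : 𝔼) (Nu : N u ≡ 1#) where
   open PairSum u Nu using (pair; N₃; pair-sum²; pair-sum)
   open Unit u Nu using (N-unit; D; cheb₀; d₀; d; d-Tr)
   -- The ratio of a factor's squared modulus to its size at the peak; it is 1 where the trace is
   -- -1, as it is for `ω` and `ω̄`.
   f : ℕ -> ℚ
   f k = 1# - W k * (1# + Tr (u ^° k))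
   N-factor : ∀ k -> N (1° -° (ofℚ r *° u) ^° k) ≡ G (r ^ k) * f k
   N-factor k = cong (λ x -> N (1° -° x)) (scaled-^ r u k) · N-1-scaled (r ^ k) (u ^° k) (N-unit k) · sym (solve 3 (λ g w t -> g :* (Κ 1# :- w :* (Κ 1# :+ t)) := g :- g :* w :* (Κ 1# :+ t)) refl _ _ _ · cong (λ p -> G (r ^ k) - p * (1# + Tr (u ^° k))) (GW k) · solve 2 (λ x t -> Κ 1# :+ x :+ x :* x :- x :* (Κ 1# :+ t) := Κ 1# :+ x :* x :- x :* t) refl _ _)
   f₀ : ∀ k -> 0# ≤ f k
   f₀ k = cancel≤ (G₊ k) (subst₂ _≤_ (sym (*-0ʳ (G (r ^ k)))) (N-factor k) (N₀ (1° -° (ofℚ r *° u) ^° k)))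
   Tr≥-2 : ∀ k -> 0# ≤ c 2 1 + Tr (u ^° k)
   Tr≥-2 k = gap' (Tr-⊑ lit (of≡ (N-neg (u ^° k) · N-unit k · sym (*-1ˡ 1#))))
    where
    gap' : Tr (-° u ^° k) ≤ c 2 1 * 1# -> 0# ≤ c 2 1 + Tr (u ^° k)
    gap' h = subst (0# ≤_) (cong (λ p -> c 2 1 * 1# - p) (Tr-neg (u ^° k)) · solve 1 (λ t -> κ 2 1 :* Κ 1# :- (:- t) := κ 2 1 :+ t) refl _) (gap h)
   Y : ℕ -> ℚ
   Y = sum (λ i -> W (b i) * (c 2 1 + pair i))
   -- Both weights of a pair are lowered to `W (b i)`. As 1 + Tr ≥ -1, this costs at most a
   -- difference of consecutive weights, and these differences telescope.
   excess : ∀ n -> Y n - (W 1 - W (a n)) ≤ sum (λ i -> W (a i) * (1# + Tr (u ^° a i)) + W (b i) * (1# + Tr (u ^° b i))) n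
   excess zero = of≡ (solve 1 (λ w -> Κ 0# :- (w :- w) := Κ 0#) refl _)
   excess (suc n) = solve 7 (λ y ta tb w w₁ w₂ v -> y :+ v :* (κ 2 1 :+ (ta :+ tb)) :- (w :- w₂) :=
     y :- (w :- w₁) :+ (v :* (κ 2 1 :+ (ta :+ tb)) :- (w₁ :- w₂))) refl _ Ta Tb _ _ _ _ ≡» +≤ (excess n) (gap≤ (gap (W↓ (ℕP.n≤1+n (a n))) *₀ Tr≥-2 (a n) +₀ gap (W↓ (ℕP.m≤n⇒m≤1+n (ℕP.n≤1+n (b n))))) (solve 5 (λ ta tb x v x' -> x :* (Κ 1# :+ ta) :+ v :* (Κ 1# :+ tb) :=
      v :* (κ 2 1 :+ (ta :+ tb)) :- (x :- x') :+ ((x :- v) :* (κ 2 1 :+ ta) :+ (v :- x'))) refl Ta Tb _ _ _))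
    where
    Ta Tb : ℚ
    Ta = Tr (u ^° a n)
    Tb = Tr (u ^° b n)
   N-P : ∀ n -> N (P (ofℚ r *° u) n) ≡ Π² n * prod (λ i -> f (a i) * f (b i)) n
   N-P n = N-prod _ n · prod-cong n (λ i -> trans (N-* _ _) ((cong₂ _*_ (N-factor (a i)) (N-factor (b i))) · *-swap (G (r ^ a i)) (f (a i)) (G (r ^ b i)) (f (b i)))) · prod-* _ _ n
   Π²₀ : ∀ n -> 0# ≤ Π² n
   Π²₀ n = prod₀ n (λ i -> <⇒≤ (G₊ (a i) *₊ G₊ (b i)))
   -- The two ratios of a pair are replaced by the square of their average, so `prod-decay` with L =
   -- 32 yields the exponent 64 after squaring. The 1/3 pays for the boundary term `W 1` of
   -- `excess`.
   decay : ∀ n X -> 0# ≤ X -> X + c 1 3 ≤ Y n -> N (P (ofℚ r *° u) n) * (1# + X * c 1 64) ^ 64 ≤ Π² n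
   decay n X X₀ h = cong (_* (1# + X * c 1 64) ^ 64) (N-P n) · *-assoc (Π² n) _ _ ≡» *≤ʳ (Π²₀ n) (*≤ˡ (^₀ 64 e₀)
    (prod-mono n (λ i -> f₀ (a i) *₀ f₀ (b i)) (λ i -> gap≤ (lit *₀ sq₀ _) (solve 2 (λ x y -> κ 1 2 :* (x :+ y) :* (κ 1 2 :* (x :+ y) :* Κ 1#) := x :* y :+ κ 1 4 :* ((x :- y) :* (x :- y))) refl _ _)) »≡ prod-^ h' 2 n) » cong (prod h' n ^ 2 *_) (^-* (1# + X * c 1 64) 2 32) · sym (*-^ (prod h' n) _ 2) ≡» ^≤1 2 (prod₀ n h'₀ *₀ ^₀ 32 e₀) (subst (λ v -> prod h' n * v ^ 32 ≤ 1#) e≡ (prod-decay h' n 31 (c 1 2 * X) h'₀ (lit *₀ X₀) Y≤))) »≡ *-1ʳ (Π² n)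
    where
    h' : ℕ -> ℚ
    h' i = c 1 2 * (f (a i) + f (b i))
    h'₀ : ∀ i -> 0# ≤ h' i
    h'₀ i = lit *₀ (f₀ (a i) +₀ f₀ (b i))
    e₀ : 0# ≤ 1# + X * c 1 64
    e₀ = lit +₀ (X₀ *₀ lit)
    e≡ : 1# + c 1 2 * X * inv (ι 32) (ι₊ 31) ≡ 1# + X * c 1 64
    e≡ = cong (λ v -> 1# + c 1 2 * X * v) (inv-unique (ι₊ 31) (c 1 32) (cong (_* c 1 32) ι32 · solve 0 (κ 32 1 :* κ 1 32 := Κ 1#) refl)) · solve 1 (λ x -> Κ 1# :+ κ 1 2 :* x :* κ 1 32 := Κ 1# :+ x :* κ 1 64) refl X
    Y≤ : c 1 2 * X ≤ sum (λ i -> 1# - h' i) n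
    Y≤ = *≤ʳ lit (gap≤ (gap (W≤⅓ 1) +₀ W₀ (a n)) refl » solve 3 (λ x w v -> x :+ (κ 1 3 :- w :+ v) := x :+ κ 1 3 :- (w :- v)) refl X _ _ ≡» +≤ h ≤-refl » excess n) » sym (sum-*ˡ (c 1 2) _ n) ≡» of≡ (sum-cong n (λ i ->
      solve 4 (λ w s v t -> κ 1 2 :* (w :* (Κ 1# :+ s) :+ v :* (Κ 1# :+ t)) := Κ 1# :- κ 1 2 :* (Κ 1# :- w :* (Κ 1# :+ s) :+ (Κ 1# :- v :* (Κ 1# :+ t)))) refl
       _ _ _ _))
   Y-split : ∀ n -> Y n ≡ c 2 1 * Ω n + sum (λ i -> W (b i) * pair i) n
   Y-split n = sum-cong n (λ i -> solve 2 (λ w p -> w :* (κ 2 1 :+ p) := κ 2 1 :* w :+ w :* p) refl _ _) · sum-+ _ _ n · cong (_+ sum (λ i -> W (b i) * pair i) n) (sum-*ˡ (c 2 1) _ n)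
   -- Away from the peak the traces oscillate: partial sums of `pair` are at least -2 g, and Abel
   -- summation against the decreasing weights leaves the main term 2 Ω.
   Y-far : ∀ n g -> 0# < N₃ -> 0# ≤ g -> N (1° +° u) ≤ g * g * N₃ -> ∀ J -> (∀ j -> j ℕ.≤ J -> 0# ≤ sum pair j) ->
    c 2 1 * Ω n - c 2 1 * g * W (b J) ≤ Y n
   Y-far n g N₃₊ g₀ hg J pos = +≤ ≤-refl
    (abel (λ i -> W (b i)) pair n J (c 2 1 * g) (λ i -> W₀ (b i)) (λ i -> W↓ (ℕP.m≤n⇒m≤1+n (ℕP.m≤n⇒m≤1+n (ℕP.n≤1+n (b i))))) (lit *₀ g₀) (λ j _ -> low j) pos) »≡ sym (Y-split n)
    where
    low : ∀ j -> - (c 2 1 * g) ≤ sum pair j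
    low j = ungap (subst (0# ≤_) (solve 2 (λ g s -> κ 2 1 :* g :- (:- s) := s :- (:- (κ 2 1 :* g))) refl g _)
     (gap (sq-cancel { - sum pair j} (lit *₀ g₀) (cancel≤ N₃₊ (solve 2 (λ n s -> n :* ((:- s) :* (:- s)) := n :* (s :* s)) refl N₃ _ ≡» pair-sum² N₃₊ j » *≤ʳ lit hg »≡ solve 2 (λ g n -> κ 4 1 :* (g :* g :* n) := n :* (κ 2 1 :* g :* (κ 2 1 :* g))) refl g N₃)))))
   Y-positive : ∀ n -> (∀ j -> j ℕ.≤ n -> 0# ≤ sum pair j) -> c 2 1 * Ω n ≤ Y n
   Y-positive n pos = gap≤ (solve 1 (λ w -> Κ 0# := :- (Κ 0# :* w)) refl _ ≡» abel (λ i -> W (b i)) pair n n 0# (λ i -> W₀ (b i)) (λ i -> W↓ (ℕP.m≤n⇒m≤1+n (ℕP.m≤n⇒m≤1+n (ℕP.n≤1+n (b i))))) ≤-refl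
    (λ j l -> ≤-trans (of≡ (solve 0 (:- Κ 0# := Κ 0#) refl)) (pos j l)) pos) refl »≡ sym (Y-split n)
   sum-pair₀ : 0# < N₃ -> D ≤ c 3 1 -> ∀ J -> ι (t3 J) * ι (t3 J) * D ≤ c 6 1 -> 0# ≤ sum pair J
   sum-pair₀ N₃₊ D≤3 J h = cancel≤ N₃₊ (subst₂ _≤_ (sym (*-0ʳ N₃)) (sym (pair-sum J))
    (lit *₀ (sq₀ (im u) *₀ gap D≤3) *₀ cheb₀ (t3 J) h))
 ω^t3 : ∀ i -> ω ^° t3 i ≡ 1°
 ω^t3 zero = refl
 ω^t3 (suc i) = cong (λ x -> ω *° (ω *° (ω *° x))) (ω^t3 i) · solve° 0 (Κ ω :* (Κ ω :* (Κ ω :* Κ 1°)) := Κ 1°) refl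
 ω-a : ∀ z i -> (ω *° z) ^° a i ≡ ω *° z ^° a i
 ω-a z i = *-^° ω z (a i) · cong (_*° z ^° a i) (cong (ω *°_) (ω^t3 i) · solve° 0 (Κ ω :* Κ 1° := Κ ω) refl)
 ω-b : ∀ z i -> (ω *° z) ^° b i ≡ ω̄ *° z ^° b i
 ω-b z i = *-^° ω z (b i) · cong (_*° z ^° b i) (cong (λ x -> ω *° (ω *° x)) (ω^t3 i) · solve° 0 (Κ ω :* (Κ ω :* Κ 1°) := Κ ω̄) refl)
 N-ω* : ∀ z -> N (ω *° z) ≡ N z
 N-ω* z = N-* ω z · cong (_* N z) Nω · *-1ˡ (N z)
  where
  opaque
   unfolding _+°_
   Nω : N ω ≡ 1#
   Nω = solve 0 (Κ 0# :* Κ 0# :- Κ 0# :* Κ 1# :+ Κ 1# :* Κ 1# := Κ 1#) refl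
 opaque
  unfolding _+°_
  Tr-ω-pair : ∀ x y -> c 2 1 + (Tr (ω *° x) + Tr (ω̄ *° y)) ≡ c 1 2 * (c 2 1 - Tr x) + c 1 2 * (c 2 1 - Tr y) + c 3 2 * (im (y -° x))
  Tr-ω-pair (x +ω x') (y +ω y') = solve 4 (λ x x' y y' ->
   let p = Κ 0# :* x :- Κ 1# :* x' ; p' = Κ 0# :* x' :+ Κ 1# :* x :- Κ 1# :* x' ; m = Κ (ℚ.- 1#) ; m' = Κ (ℚ.- 1#) ; s = m :* y :- m' :* y' ; s' = m :* y' :+ m' :* y :- m' :* y' in
   κ 2 1 :+ (p :+ p :- p' :+ (s :+ s :- s')) := κ 1 2 :* (κ 2 1 :- (x :+ x :- x')) :+ κ 1 2 :* (κ 2 1 :- (y :+ y :- y')) :+ κ 3 2 :* (y' :+ (:- x'))) refl x x' y y'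
 module NearOmega (r : ℚ) (r₊ : 0# < r) (r₁ : r ≤ 1#) (z : 𝔼) (Nz : N z ≡ 1#) where
  open Weights r r₊ r₁
  open Unit z Nz
  open Decay (ω *° z) (N-ω* z · Nz) using (Y)
  open PairSum (ω *° z) (N-ω* z · Nz) using (pair)
  ι² ι⁴ : ℕ -> ℚ
  ι² k = ι k * ι k
  ι⁴ k = ι² k * ι² k
  Vₚ Mₚ : ℕ -> ℚ
  Vₚ = sum (λ i -> W (b i) * ι² (a i))
  Mₚ = sum (λ i -> W (b i) * ι⁴ (b i))
  -- Around `ω` the deviation is the mean of two chords plus a term linear in the angle, 3/2 times
  -- the imaginary part of z^b - z^a. Its square is at most 3 D, so `s` absorbs it.
  pair≥ : ∀ s -> 0# ≤ s -> c 3 1 * D ≤ s * s -> ∀ i -> D * ι² (a i) - c 1 12 * (D * D) * ι⁴ (b i) - s ≤ c 2 1 + pair i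
  pair≥ s s₀ hs i = gap≤ (lit *₀ gap (d≥ (a i)) +₀ lit *₀ gap (d≥ (b i)) +₀ Δ≥ +₀ lit *₀ D₀ *₀ AB +₀ lit *₀ sq₀ D *₀ (AB *₀ (sq₀ B +₀ sq₀ A))) (solve 7 (λ A B D x y e s -> κ 1 2 :* x :+ κ 1 2 :* y :+ κ 3 2 :* e := D :* (A :* A) :- κ 1 12 :* (D :* D) :* (B :* B :* (B :* B)) :- s :+
   (κ 1 2 :* (x :- (A :* A :* D :- κ 1 12 :* (A :* A :* (A :* A)) :* (D :* D))) :+ κ 1 2 :* (y :- (B :* B :* D :- κ 1 12 :* (B :* B :* (B :* B)) :* (D :* D)))
     :+ (κ 3 2 :* e :+ s) :+ κ 1 2 :* D :* (B :* B :- A :* A) :+ κ 1 24 :* (D :* D) :* ((B :* B :- A :* A) :* (B :* B :+ A :* A)))) refl A B D x y Δ s) »≡ sym (cong (c 2 1 +_) (cong₂ _+_ (cong Tr (ω-a z i)) (cong Tr (ω-b z i))) · Tr-ω-pair (z ^° a i) (z ^° b i) · cong₂ (λ p q -> c 1 2 * p + c 1 2 * q + c 3 2 * Δ) (sym (d-Tr (a i))) (sym (d-Tr (b i))))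
   where
   A B x y Δ : ℚ
   A = ι (a i)
   B = ι (b i)
   x = d (a i)
   y = d (b i)
   Δ = im (z ^° b i -° z ^° a i)
   AB : 0# ≤ B * B - A * A
   AB = gap (*≤ (ι₀ (a i)) (ι₀ (b i)) (ι-mono (ℕP.n≤1+n (a i))) (ι-mono (ℕP.n≤1+n (a i))))
   NΔ : N (z ^° b i -° z ^° a i) ≡ D
   NΔ = cong N (solve° 2 (λ z w -> z :* w :- w := (:- w) :* (Κ 1° :- z :* Κ 1°)) refl z _) · N-* (-° z ^° a i) (1° -° z ^° 1) · cong (_* D) (N-neg (z ^° a i) · N-unit (a i)) · *-1ˡ D
   Δ≥ : 0# ≤ c 3 2 * Δ + s
   Δ≥ = subst (0# ≤_) (solve 2 (λ e s -> s :- (:- (κ 3 2 :* e)) := κ 3 2 :* e :+ s) refl Δ s) (gap (sq-cancel { - (c 3 2 * Δ)} s₀ (solve 1 (λ e -> (:- (κ 3 2 :* e)) :* (:- (κ 3 2 :* e)) := κ 3 1 :* (κ 3 4 :* (e :* e))) refl Δ ≡» *≤ʳ lit (im²≤ (z ^° b i -° z ^° a i) »≡ NΔ) » hs)))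
  Y-near : ∀ s -> 0# ≤ s -> c 3 1 * D ≤ s * s -> ∀ n -> D * Vₚ n - c 1 12 * (D * D) * Mₚ n - s * Ω n ≤ Y n
  Y-near s s₀ hs zero = of≡ (solve 2 (λ D s -> D :* Κ 0# :- κ 1 12 :* (D :* D) :* Κ 0# :- s :* Κ 0# := Κ 0#) refl D s)
  Y-near s s₀ hs (suc n) = solve 8 (λ D s v m o w x y -> D :* (v :+ w :* x) :- κ 1 12 :* (D :* D) :* (m :+ w :* y) :- s :* (o :+ w) :=
    D :* v :- κ 1 12 :* (D :* D) :* m :- s :* o :+ w :* (D :* x :- κ 1 12 :* (D :* D) :* y :- s)) refl D s _ _ _ _ _ _ ≡» +≤ (Y-near s s₀ hs n) (*≤ʳ (W₀ (b n)) (pair≥ s s₀ hs n))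

-- Comparison with trinomials near the peak: variance, moment and error bounds

module R1 where
 open Q1
 open E1
 open U1
 open P1
 opaque
  unfolding _+_ _*_
  ι64 : ι 64 ≡ c 64 1
  ι64 = refl
 prod-1+≤ : ∀ f n -> (∀ i -> 0# ≤ f i) -> prod (λ i -> 1# + f i) n * (1# - sum f n) ≤ 1#
 prod-1+≤ f zero f₀ = of≡ (solve 0 (Κ 1# :* (Κ 1# :- Κ 0#) := Κ 1#) refl)
 prod-1+≤ f (suc n) f₀ = gap≤ (prod₀ n (λ i -> lit +₀ f₀ i) *₀ (f₀ n *₀ (sum₀ n f₀ +₀ f₀ n))) (solve 3 (λ p s f -> p :* (Κ 1# :- s) := p :* (Κ 1# :+ f) :* (Κ 1# :- (s :+ f)) :+ p :* (f :* (s :+ f))) refl _ _ _) » prod-1+≤ f n f₀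
 e : ℕ -> ℕ
 e i = a i ℕ.+ b i
 module Main (r : ℚ) (r₊ : 0# < r) (r₁ : r ≤ 1#) where
  open Weights r r₊ r₁ using (r₀)
  -- At r ω z a pair of factors is 1 - (ω + r ω̄ z) x z^a + r x² z^e. At z = 1 the middle
  -- coefficient has real part `λ'`; keeping only that leaves a trinomial with positive
  -- coefficients, whose value at 1 is `n i`.
  x A₁ A₂ n : ℕ -> ℚ
  λ' t : ℚ
  λ' = c 1 2 * (1# + r)
  t = 1# - r
  x i = r ^ a i
  A₁ i = λ' * x i
  A₂ i = r * (x i * x i)
  n i = 1# + A₁ i + A₂ i
  x₀ : ∀ i -> 0# ≤ x i
  x₀ i = ^₀ (a i) r₀
  x≤1 : ∀ i -> x i ≤ 1#
  x≤1 i = ^≤1 (a i) r₀ r₁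
  A₁₀ : ∀ i -> 0# ≤ A₁ i
  A₁₀ i = lit *₀ (lit +₀ r₀) *₀ x₀ i
  A₂₀ : ∀ i -> 0# ≤ A₂ i
  A₂₀ i = r₀ *₀ sq₀ (x i)
  n₊ : ∀ i -> 0# < n i
  n₊ i = (0<1 +₊ A₁₀ i) +₊ A₂₀ i
  t₀ : 0# ≤ t
  t₀ = gap r₁
  v : ℕ -> ℚ
  v i = inv (n i) (n₊ i)
  v₀ : ∀ i -> 0# ≤ v i
  v₀ i = inv₀ (n i) (n₊ i)
  nv : ∀ i -> n i * v i ≡ 1#
  nv i = *-inv (n i) (n₊ i)
  -- Mean and variance of the exponent 0, a or e under the weights 1, `A₁`, `A₂`. The variance is
  -- written as a sum over pairs of exponents, with gaps a, b, e; `M̂` has fourth powers of the same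
  -- gaps.
  μ̂ V̂ M̂ : ℕ -> ℚ
  μ̂ i = (A₁ i * ι (a i) + A₂ i * ι (e i)) * v i
  V̂ i = (A₁ i * (ι (a i) * ι (a i)) + A₁ i * A₂ i * (ι (b i) * ι (b i)) + A₂ i * (ι (e i) * ι (e i))) * (v i * v i)
  M̂ i = (A₁ i * (ι (a i) * ι (a i) * (ι (a i) * ι (a i))) + A₁ i * A₂ i * (ι (b i) * ι (b i) * (ι (b i) * ι (b i)))
   + A₂ i * (ι (e i) * ι (e i) * (ι (e i) * ι (e i)))) * (v i * v i)
  μ V M₄ total : ℕ -> ℚ
  μ = sum μ̂
  V = sum V̂
  M₄ = sum M̂
  total = prod n
  total₊ : ∀ k -> 0# < total k
  total₊ k = prod₊ k n₊
  V̂₀ : ∀ i -> 0# ≤ V̂ i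
  V̂₀ i = (A₁₀ i *₀ sq₀ _ +₀ A₁₀ i *₀ A₂₀ i *₀ sq₀ _ +₀ A₂₀ i *₀ sq₀ _) *₀ sq₀ (v i)
  S₁ S₂ : ℕ -> ℚ
  S₁ = sum (λ i -> x i * v i)
  S₂ = sum (λ i -> x i * (ι (a i) + x i * x i * ι (b i)) * (v i * v i))
  -- What the middle coefficient of the true factor has beyond `λ'`.
  Q : 𝔼 -> 𝔼
  Q z = -° ω -° ω̄ *° ofℚ r *° z -° ofℚ λ'
  Q₁ : 𝔼
  Q₁ = Q 1°
  k₁ : ℚ
  k₁ = c 13 15 * t
  opaque
   unfolding _+°_
   NQ₁ : N Q₁ ≡ c 3 4 * (t * t)
   NQ₁ = solve 1 (λ r -> let m = Κ (ℚ.- 1#) ; m' = Κ (ℚ.- 1#) ; p = m :* r :- m' :* Κ 0# ; p' = m :* Κ 0# :+ m' :* r :- m' :* Κ 0# ; s = p :* Κ 1# :- p' :* Κ 0# ; s' = p :* Κ 0# :+ p' :* Κ 1# :- p' :* Κ 0# ; y = (:- Κ 0#) :+ (:- s) :+ (:- (κ 1 2 :* (Κ 1# :+ r))) ; y' = (:- Κ 1#) :+ (:- s') :+ (:- Κ 0#) in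
    y :* y :- y :* y' :+ y' :* y' := κ 3 4 :* ((Κ 1# :- r) :* (Κ 1# :- r))) refl r
  Q₁⊑ : Q₁ ⊑[ k₁ ] 1°
  Q₁⊑ = NQ₁ ≡» gap≤ (lit *₀ sq₀ t) (solve 1 (λ t -> κ 13 15 :* t :* (κ 13 15 :* t) := κ 3 4 :* (t :* t) :+ κ 1 900 :* (t :* t)) refl t) »≡ sym (cong (k₁ * k₁ *_) (N-ofℚ 1# · *-1ˡ 1#) · *-1ʳ (k₁ * k₁))
  ê : ℕ -> 𝔼
  ê i = ofℚ (x i * v i) *° Q₁
  -- Freezing the relative correction of each factor at z = 1 gives a constant, so near the peak the
  -- product is close to `C` times the product of trinomials.
  C : ℕ -> 𝔼
  C = prod° (λ i -> 1° +° ê i)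
  module At (z : 𝔼) (Nz : N z ≡ 1#) where
   open Unit z Nz
   R̂ δ : ℕ -> 𝔼
   R̂ i = 1° +° ofℚ (A₁ i) *° z ^° a i +° ofℚ (A₂ i) *° z ^° e i
   δ i = ofℚ (x i) *° z ^° a i *° Q z
   R : ℕ -> 𝔼
   R = prod° R̂
   F : ℕ -> 𝔼
   F = P (ofℚ r *° (ω *° z))
   factor : ∀ i -> (1° -° (ofℚ r *° (ω *° z)) ^° a i) *° (1° -° (ofℚ r *° (ω *° z)) ^° b i) ≡ R̂ i +° δ i
   factor i = cong₂ (λ p q -> (1° -° p) *° (1° -° q)) (scaled-^ r (ω *° z) (a i) · cong (ofℚ (x i) *°_) (ω-a z i))
    (scaled-^ r (ω *° z) (b i) · (cong₂ _*°_ (ofℚ-* r (x i)) (ω-b z i))) · solve° 5 (λ r x l y z -> (Κ 1° :- x :* (Κ ω :* y)) :* (Κ 1° :- r :* x :* (Κ ω̄ :* (z :* y))) :=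
       Κ 1° :+ l :* x :* y :+ r :* (x :* x) :* (y :* (z :* y)) :+ x :* y :* ((:- Κ ω) :- Κ ω̄ :* r :* z :- l)) refl _ _ _ y z · cong (λ p -> 1° +° p *° y +° ofℚ r *° (ofℚ (x i) *° ofℚ (x i)) *° (y *° (z *° y)) +° δ i) (sym (ofℚ-* λ' (x i))) · cong₂ (λ p q -> 1° +° ofℚ (A₁ i) *° y +° p *° q +° δ i) (sym (ofℚ-* r _ · cong (ofℚ r *°_) (ofℚ-* (x i) (x i)))) (sym (^°-+ z (a i) (b i)))
    where
    y : 𝔼
    y = z ^° a i
   y : ℕ -> ℚ
   y i = (A₁ i * d (a i) + A₁ i * A₂ i * d (b i) + A₂ i * d (e i)) * (v i * v i)
   opaque
    unfolding _+°_
    N-combination : ∀ p q x y -> N (1° +° ofℚ p *° x +° ofℚ q *° (x *° y)) ≡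
     1# + p * p * N x + q * q * (N x * N y) + p * Tr x + p * q * (N x * Tr y) + q * Tr (x *° y)
    N-combination p q (x +ω x') (y +ω y') = solve 6 (λ p q x x' y y' ->
     let xy = x :* y :- x' :* y' ; xy' = x :* y' :+ x' :* y :- x' :* y' ; Nx = x :* x :- x :* x' :+ x' :* x' ; u = Κ 1# :+ (p :* x :- Κ 0# :* x') :+ (q :* xy :- Κ 0# :* xy') ; u' = Κ 0# :+ (p :* x' :+ Κ 0# :* x :- Κ 0# :* x') :+ (q :* xy' :+ Κ 0# :* xy :- Κ 0# :* xy') in
     u :* u :- u :* u' :+ u' :* u' := Κ 1# :+ p :* p :* Nx :+ q :* q :* (Nx :* (y :* y :- y :* y' :+ y' :* y')) :+ p :* (x :+ x :- x')
      :+ p :* q :* (Nx :* (y :+ y :- y')) :+ q :* (xy :+ xy :- xy')) refl p q x x' y y'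
   -- The loss of squared modulus is a positive combination of squared chords, one for each pair of
   -- exponents; this is where the gaps in `V̂` and `M̂` come from.
   N-R̂ : ∀ i -> N (R̂ i) ≡ n i * n i * (1# - y i)
   N-R̂ i = cong (λ w -> N (1° +° ofℚ (A₁ i) *° z ^° a i +° ofℚ (A₂ i) *° w)) (^°-+ z (a i) (b i)) · N-combination (A₁ i) (A₂ i) (z ^° a i) (z ^° b i) · cong₂ (λ p q -> 1# + A₁ i * A₁ i * p + A₂ i * A₂ i * (p * q) + A₁ i * Tr (z ^° a i) + A₁ i * A₂ i * (p * Tr (z ^° b i)) + A₂ i * Tr (z ^° a i *° z ^° b i)) (N-unit (a i)) (N-unit (b i)) · cong (λ w -> 1# + A₁ i * A₁ i * 1# + A₂ i * A₂ i * (1# * 1#) + A₁ i * Tr (z ^° a i) + A₁ i * A₂ i * (1# * Tr (z ^° b i)) + A₂ i * Tr w) (sym (^°-+ z (a i) (b i))) · solve 5 (λ p q s t w -> Κ 1# :+ p :* p :* Κ 1# :+ q :* q :* (Κ 1# :* Κ 1#) :+ p :* s :+ p :* q :* (Κ 1# :* t) :+ q :* w :=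
    (Κ 1# :+ p :+ q) :* (Κ 1# :+ p :+ q) :- (p :* (κ 2 1 :- s) :+ p :* q :* (κ 2 1 :- t) :+ q :* (κ 2 1 :- w))) refl _ _ _ _ _ · cong (λ p -> n i * n i - p) ((cong₂ _+_ (cong₂ (λ p q -> A₁ i * p + A₁ i * A₂ i * q) (sym (d-Tr (a i))) (sym (d-Tr (b i)))) (cong (A₂ i *_) (sym (d-Tr (e i))))) · sym (*-1ʳ Z) · cong (λ p -> Z * p) (sym (*-1ˡ 1#) · (cong₂ _*_ (sym (nv i)) (sym (nv i)))) · solve 3 (λ z n v -> z :* (n :* v :* (n :* v)) := n :* n :* (z :* (v :* v))) refl Z _ _) · solve 2 (λ m y -> m :- m :* y := m :* (Κ 1# :- y)) refl _ _
    where
    Z : ℚ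
    Z = A₁ i * d (a i) + A₁ i * A₂ i * d (b i) + A₂ i * d (e i)
   n²₊ : ∀ i -> 0# < n i * n i
   n²₊ i = n₊ i *₊ n₊ i
   1-y₀ : ∀ i -> 0# ≤ 1# - y i
   1-y₀ i = cancel≤ (n²₊ i) (subst₂ _≤_ (sym (*-0ʳ (n i * n i))) (N-R̂ i) (N₀ (R̂ i)))
   y≤ : ∀ i -> y i ≤ D * V̂ i
   y≤ i = *≤ˡ (sq₀ (v i)) (+≤ (+≤ (*≤ʳ (A₁₀ i) (d≤ (a i))) (*≤ʳ (A₁₀ i *₀ A₂₀ i) (d≤ (b i)))) (*≤ʳ (A₂₀ i) (d≤ (e i)))) »≡ solve 7 (λ p q D a b e v -> (p :* (a :* a :* D) :+ p :* q :* (b :* b :* D) :+ q :* (e :* e :* D)) :* v := D :* ((p :* (a :* a) :+ p :* q :* (b :* b) :+ q :* (e :* e)) :* v)) refl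
     _ _ D _ _ _ _
   y≥ : ∀ i -> D * V̂ i - c 1 12 * (D * D) * M̂ i ≤ y i
   y≥ i = solve 7 (λ p q D a b e v -> D :* ((p :* (a :* a) :+ p :* q :* (b :* b) :+ q :* (e :* e)) :* v) :- κ 1 12 :* (D :* D) :* ((p :* (a :* a :* (a :* a)) :+ p :* q :* (b :* b :* (b :* b)) :+ q :* (e :* e :* (e :* e))) :* v) :=
    (p :* (a :* a :* D :- κ 1 12 :* (a :* a :* (a :* a)) :* (D :* D)) :+ p :* q :* (b :* b :* D :- κ 1 12 :* (b :* b :* (b :* b)) :* (D :* D)) :+ q :* (e :* e :* D :- κ 1 12 :* (e :* e :* (e :* e)) :* (D :* D))) :* v) refl
     _ _ D _ _ _ _ ≡» *≤ˡ (sq₀ (v i)) (+≤ (+≤ (*≤ʳ (A₁₀ i) (d≥ (a i))) (*≤ʳ (A₁₀ i *₀ A₂₀ i) (d≥ (b i)))) (*≤ʳ (A₂₀ i) (d≥ (e i))))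
   Σy≥ : ∀ k -> D * V k - c 1 12 * (D * D) * M₄ k ≤ sum y k
   Σy≥ zero = of≡ (solve 1 (λ D -> D :* Κ 0# :- κ 1 12 :* (D :* D) :* Κ 0# := Κ 0#) refl D)
   Σy≥ (suc k) = solve 5 (λ D v m x y -> D :* (v :+ x) :- κ 1 12 :* (D :* D) :* (m :+ y) := D :* v :- κ 1 12 :* (D :* D) :* m :+ (D :* x :- κ 1 12 :* (D :* D) :* y)) refl D _ _ _ _ ≡» +≤ (Σy≥ k) (y≥ k)
   -- The Gaussian bound: the chord estimates `d≥` turn the sum of the losses into D V, corrected
   -- downwards by the fourth-order term, and `prod-decay` does the rest.
   R-decay : ∀ k Y -> 0# ≤ Y -> Y ≤ D * V k - c 1 12 * (D * D) * M₄ k ->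
    N (R k) * (1# + Y * c 1 64) ^ 64 ≤ total k * total k
   R-decay k Y Y₀ h = cong (_* (1# + Y * c 1 64) ^ 64) (N-prod R̂ k · prod-cong k N-R̂ · prod-* (λ i -> n i * n i) (λ i -> 1# - y i) k · cong (_* prod (λ i -> 1# - y i) k) (prod-* n n k)) · *-assoc (total k * total k) (prod (λ i -> 1# - y i) k) ((1# + Y * c 1 64) ^ 64) ≡» *≤ʳ (sq₀ (total k)) (subst (λ w -> prod (λ i -> 1# - y i) k * (1# + Y * w) ^ 64 ≤ 1#)
    (inv-unique (ι₊ 63) (c 1 64) (cong (_* c 1 64) ι64 · solve 0 (κ 64 1 :* κ 1 64 := Κ 1#) refl))
    (prod-decay (λ i -> 1# - y i) k 63 Y 1-y₀ Y₀ (h » Σy≥ k »≡ sum-cong k (λ i -> solve 1 (λ y -> y := Κ 1# :- (Κ 1# :- y)) refl _)))) »≡ *-1ʳ (total k * total k)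
   -- `δ'` bounds the square root of D, in effect the angle; `σ` bounds n i divided by the modulus
   -- of `R̂ i`, which converts absolute errors into errors relative to `R̂ i`.
   module Error (N₀' : ℕ) (δ' σ : ℚ) (δ'₀ : 0# ≤ δ') (σ₀ : 0# ≤ σ) (D≤ : D ≤ δ' * δ')
    (hσ : ∀ i -> i ℕ.< N₀' -> 1# ≤ σ * σ * (1# - D * V̂ i)) (σ₁ : 1# ≤ σ) where
    n²≤ : ∀ i -> i ℕ.< N₀' -> n i * n i ≤ σ * σ * N (R̂ i)
    n²≤ i l = sym (*-1ʳ (n i * n i)) ≡» *≤ʳ (sq₀ (n i)) (hσ i l » *≤ʳ (sq₀ σ) (gap≤ (gap (y≤ i)) (solve 2 (λ y u -> Κ 1# :- y := Κ 1# :- u :+ (u :- y)) refl _ _))) »≡ solve 3 (λ m s y -> m :* (s :* y) := s :* (m :* y)) refl _ _ _ · cong (σ * σ *_) (sym (N-R̂ i))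
    relative : ∀ {X} i k -> i ℕ.< N₀' -> X ⊑[ k * n i ] 1° -> X ⊑[ k * σ ] R̂ i
    relative {X} i k l h = h » cong (k * n i * (k * n i) *_) (N-ofℚ 1# · *-1ˡ 1#) · solve 2 (λ k n -> k :* n :* (k :* n) :* Κ 1# := k :* k :* (n :* n)) refl k _ ≡» *≤ʳ (sq₀ k) (n²≤ i l) »≡ solve 3 (λ k s m -> k :* k :* (s :* s :* m) := k :* s :* (k :* s) :* m) refl k σ _
    abs : ∀ {X} k m -> N X ≤ k * k -> k ≡ m -> X ⊑[ m ] 1°
    abs k .k h refl = h »≡ sym (*-1ʳ (k * k)) · cong (k * k *_) (sym (N-ofℚ 1# · *-1ˡ 1#))
    unit : ∀ {X k} -> X ⊑[ k ] 1° -> N X ≤ k * k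
    unit {X} {k} h = h »≡ cong (k * k *_) (N-ofℚ 1# · *-1ˡ 1#) · *-1ʳ (k * k)
    times : ∀ {X Y k l} -> X ⊑[ k ] 1° -> Y ⊑[ l ] 1° -> X *° Y ⊑[ k * l ] 1°
    times {X} {Y} {k} {l} p q' = subst (λ w -> N (X *° Y) ≤ k * l * (k * l) * N w) (solve° 0 (Κ 1° :* Κ 1° := Κ 1°) refl) (⊑-* {X} {Y} {1°} {1°} p q')
    real : ∀ k -> ofℚ k ⊑[ k ] 1°
    real k = abs k k (of≡ (N-ofℚ k)) refl
    power : ∀ k -> z ^° k ⊑[ 1# ] 1°
    power k = abs 1# 1# (of≡ (N-unit k · sym (*-1ˡ 1#))) refl
    1-power : ∀ k -> 1° -° z ^° k ⊑[ ι k * δ' ] 1°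
    1-power k = abs (ι k * δ') (ι k * δ') (d≤ k » *≤ʳ (sq₀ (ι k)) D≤ »≡ solve 2 (λ k d -> k :* k :* (d :* d) := k :* d :* (k :* d)) refl _ δ') refl
    k₁₀ : 0# ≤ k₁
    k₁₀ = lit *₀ t₀
    Q-Q₁ : Q z -° Q₁ ⊑[ δ' ] 1°
    Q-Q₁ = abs δ' δ' (cong N (solve° 3 (λ r z l -> (:- Κ ω) :- Κ ω̄ :* r :* z :- l :- ((:- Κ ω) :- Κ ω̄ :* r :* Κ 1° :- l) := Κ ω̄ :* r :* (Κ 1° :- z :* Κ 1°)) refl _ z _) · N-* (ω̄ *° ofℚ r) (1° -° z ^° 1) · cong (_* D) (N-* ω̄ (ofℚ r) · (cong₂ _*_ Nω̄ (N-ofℚ r))) ≡» *≤ˡ D₀ (*-1ˡ (r * r) ≡» *≤ r₀ lit r₁ r₁ »≡ *-1ˡ 1#) » *-1ˡ D ≡» D≤) refl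
     where
     opaque
      unfolding _+°_
      Nω̄ : N ω̄ ≡ 1#
      Nω̄ = solve 0 (let m = Κ (ℚ.- 1#) in m :* m :- m :* m :+ m :* m := Κ 1#) refl
    Qz⊑ : Q z ⊑[ k₁ + δ' ] 1°
    Qz⊑ = subst (_⊑[ k₁ + δ' ] 1°) (solve° 2 (λ p q -> p :+ (q :- p) := q) refl Q₁ _) (⊑-+ {Q₁} {Q z -° Q₁} {1°} k₁₀ δ'₀ Q₁⊑ Q-Q₁)
    ε̂ η̂ : ℕ -> ℚ
    ε̂ i = (k₁ + δ') * (x i * v i) * σ
    η̂ i = (δ' * (x i * v i) + k₁ * δ' * (x i * (ι (a i) + x i * x i * ι (b i)) * (v i * v i))) * σ
    δ⊑ : ∀ i -> i ℕ.< N₀' -> δ i ⊑[ ε̂ i ] R̂ i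
    δ⊑ i l = relative i ((k₁ + δ') * (x i * v i)) l (subst (δ i ⊑[_] 1°) (sym (*-1ʳ (x i * 1# * (k₁ + δ'))) · cong (x i * 1# * (k₁ + δ') *_) (sym (nv i)) · solve 4 (λ x k n v -> x :* Κ 1# :* k :* (n :* v) := k :* (x :* v) :* n) refl _ _ _ _)
     (times {ofℚ (x i) *° z ^° a i} {Q z} (times {ofℚ (x i)} {z ^° a i} (real (x i)) (power (a i))) Qz⊑))
    η⊑ : ∀ i -> i ℕ.< N₀' -> δ i -° R̂ i *° ê i ⊑[ η̂ i ] R̂ i
    η⊑ i l = relative i κᵢ l (subst (_⊑[ κᵢ * n i ] 1°) (sym X≡)
     (⊑-mono {X} (x₀ i *₀ (lit *₀ δ'₀ +₀ (v₀ i *₀ k₁₀ *₀ ((ι₀ (a i) *₀ δ'₀) +₀ (A₂₀ i *₀ lit *₀ (ι₀ (b i) *₀ δ'₀)))))) k≤ X⊑))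
     where
     κᵢ k₂ : ℚ
     κᵢ = δ' * (x i * v i) + k₁ * δ' * (x i * (ι (a i) + x i * x i * ι (b i)) * (v i * v i))
     k₂ = x i * (1# * δ' + v i * k₁ * (ι (a i) * δ' + A₂ i * 1# * (ι (b i) * δ')))
     w X : 𝔼
     w = z ^° a i
     X = ofℚ (x i) *° (w *° (Q z -° Q₁) +° ofℚ (v i) *° Q₁ *° (-° (1° -° w) +° ofℚ (A₂ i) *° w *° (1° -° z ^° b i)))
     X≡ : δ i -° R̂ i *° ê i ≡ X
     X≡ = cong₂ (λ p q -> ofℚ (x i) *° w *° Q z -° (1° +° ofℚ (A₁ i) *° w +° ofℚ (A₂ i) *° p) *° (q *° Q₁)) (^°-+ z (a i) (b i)) (ofℚ-* (x i) (v i)) · solve° 8 (λ x w q p v A B u -> x :* w :* q :- (Κ 1° :+ A :* w :+ B :* (w :* u)) :* (x :* v :* p) :=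
         x :* (w :* (q :- p) :+ v :* p :* ((:- (Κ 1° :- w)) :+ B :* w :* (Κ 1° :- u))) :+ x :* w :* p :* (Κ 1° :- v :* (Κ 1° :+ A :+ B))) refl _ w _ Q₁ _ _ _ _ · cong (λ p -> X +° ofℚ (x i) *° w *° Q₁ *° (1° -° p)) vn · solve° 2 (λ X y -> X :+ y :* (Κ 1° :- Κ 1°) := X) refl X _
      where
      vn : ofℚ (v i) *° (1° +° ofℚ (A₁ i) +° ofℚ (A₂ i)) ≡ 1°
      vn = cong (ofℚ (v i) *°_) (cong (_+° ofℚ (A₂ i)) (sym (ofℚ-+ 1# (A₁ i))) · sym (ofℚ-+ (1# + A₁ i) (A₂ i))) · sym (ofℚ-* (v i) (n i)) · cong ofℚ (*-comm (v i) (n i) · nv i)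
     X⊑ : X ⊑[ k₂ ] 1°
     X⊑ = times {ofℚ (x i)} (real (x i)) (⊑-+ {w *° (Q z -° Q₁)} {_} {1°} (lit *₀ δ'₀) (v₀ i *₀ k₁₀ *₀ ((ι₀ (a i) *₀ δ'₀) +₀ (A₂₀ i *₀ lit *₀ (ι₀ (b i) *₀ δ'₀))))
      (times {w} {Q z -° Q₁} (power (a i)) Q-Q₁)
      (times {ofℚ (v i) *° Q₁} (times {ofℚ (v i)} {Q₁} (real (v i)) Q₁⊑)
       (⊑-+ { -° (1° -° w)} {_} {1°} (ι₀ (a i) *₀ δ'₀) (A₂₀ i *₀ lit *₀ (ι₀ (b i) *₀ δ'₀))
        (N-neg (1° -° w) ≡» 1-power (a i))
        (times {ofℚ (A₂ i) *° w} {1° -° z ^° b i} (times {ofℚ (A₂ i)} {w} (real (A₂ i)) (power (a i))) (1-power (b i))))))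
     k≤ : k₂ ≤ κᵢ * n i
     k≤ = gap≤ (x₀ i *₀ v₀ i *₀ k₁₀ *₀ δ'₀ *₀ t₀ *₀ sq₀ (x i) *₀ ι₀ (b i)) refl »≡ (solve 7 (λ x d v k r A B -> x :* (Κ 1# :* d :+ v :* k :* (A :* d :+ r :* (x :* x) :* Κ 1# :* (B :* d))) :+ x :* v :* k :* d :* (Κ 1# :- r) :* (x :* x) :* B := d :* x :+ k :* d :* (x :* (A :+ x :* x :* B) :* v)) refl _ δ' _ k₁ r _ _ · sym (cong₂ (λ p q -> δ' * x i * p + k₁ * δ' * (x i * (ι (a i) + x i * x i * ι (b i)) * (v i * q))) (nv i) (nv i) · solve 5 (λ d x k y v -> d :* x :* Κ 1# :+ k :* d :* (y :* (v :* Κ 1#)) := d :* x :+ k :* d :* (y :* v)) refl δ' _ k₁ _ _)) · solve 6 (λ d x n v k y -> d :* x :* (n :* v) :+ k :* d :* (y :* (v :* (n :* v))) := (d :* (x :* v) :+ k :* d :* (y :* (v :* v))) :* n) refl δ' _ _ _ k₁ _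
    ε̂₀ : ∀ i -> 0# ≤ ε̂ i
    ε̂₀ i = (k₁₀ +₀ δ'₀) *₀ (x₀ i *₀ v₀ i) *₀ σ₀
    η̂₀ : ∀ i -> 0# ≤ η̂ i
    η̂₀ i = (δ'₀ *₀ (x₀ i *₀ v₀ i) +₀ k₁₀ *₀ δ'₀ *₀ (x₀ i *₀ (ι₀ (a i) +₀ sq₀ (x i) *₀ ι₀ (b i)) *₀ sq₀ (v i))) *₀ σ₀
    E : ℕ -> ℚ
    E = prod (λ i -> 1# + ε̂ i)
    E₀ : ∀ k -> 0# ≤ E k
    E₀ k = prod₀ k (λ i -> lit +₀ ε̂₀ i)
    1+ê⊑ : ∀ i -> 1° +° ê i ⊑[ 1# + ε̂ i ] 1°
    1+ê⊑ i = ⊑-+ {1°} {ê i} {1°} lit (ε̂₀ i) (⊑-refl 1°) (⊑-mono {ê i} {1°} (x₀ i *₀ v₀ i *₀ k₁₀)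
     (gap≤ (x₀ i *₀ v₀ i *₀ k₁₀ *₀ gap σ₁ +₀ x₀ i *₀ v₀ i *₀ δ'₀ *₀ σ₀) (solve 5 (λ x v k s d -> (k :+ d) :* (x :* v) :* s := x :* v :* k :+ (x :* v :* k :* (s :- Κ 1#) :+ x :* v :* d :* s)) refl _ _ k₁ σ δ'))
     (times {ofℚ (x i * v i)} {Q₁} (real (x i * v i)) Q₁⊑))
    C⊑E : ∀ k -> C k ⊑[ E k ] 1°
    C⊑E zero = ⊑-refl 1°
    C⊑E (suc k) = times {C k} {1° +° ê k} (C⊑E k) (1+ê⊑ k)
    -- Telescoping over the factors: the difference gains one factor R̂ + δ and one new defect,
    -- whose size relative to `R̂ k` is `η̂ k`. The products of 1 + `ε̂` collect into `E`.
    F-CR : ∀ k -> k ℕ.≤ N₀' -> F k -° C k *° R k ⊑[ E k * sum η̂ k ] R k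
    F-CR zero _ = cong N (solve° 0 (Κ 1° :- Κ 1° :* Κ 1° := Κ 0°) refl) · N-ofℚ 0# · *-0ˡ 0# ≡» (sq₀ (1# * 0#) *₀ N₀ 1°)
    F-CR (suc k) l = subst (_⊑[ E (suc k) * sum η̂ (suc k) ] R (suc k)) (sym split)
     (⊑-mono {(F k -° C k *° R k) *° (R̂ k +° δ k) +° C k *° R k *° (δ k -° R̂ k *° ê k)} {R (suc k)} (p₀ +₀ q₀)
      (gap≤ (E₀ k *₀ ε̂₀ k *₀ η̂₀ k) (solve 4 (λ E s e h -> E :* (Κ 1# :+ e) :* (s :+ h) := E :* s :* (Κ 1# :+ e) :+ E :* h :+ E :* e :* h) refl _ _ _ _))
      (⊑-+ {(F k -° C k *° R k) *° (R̂ k +° δ k)} {C k *° R k *° (δ k -° R̂ k *° ê k)} {R (suc k)} p₀ q₀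
       (⊑-* {F k -° C k *° R k} {R̂ k +° δ k} {R k} {R̂ k} (F-CR k (ℕP.<⇒≤ l)) (⊑-+ {R̂ k} {δ k} {R̂ k} lit (ε̂₀ k) (⊑-refl (R̂ k)) (δ⊑ k l)))
       (⊑-* {C k *° R k} {δ k -° R̂ k *° ê k} {R k} {R̂ k} CR⊑ (η⊑ k l))))
     where
     p₀ : 0# ≤ E k * sum η̂ k * (1# + ε̂ k)
     p₀ = E₀ k *₀ sum₀ k η̂₀ *₀ (lit +₀ ε̂₀ k)
     q₀ : 0# ≤ E k * η̂ k
     q₀ = E₀ k *₀ η̂₀ k
     CR⊑ : C k *° R k ⊑[ E k ] R k
     CR⊑ = N-* (C k) (R k) ≡» *≤ˡ (N₀ (R k)) (unit {C k} (C⊑E k))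
     split : F (suc k) -° C (suc k) *° R (suc k) ≡ (F k -° C k *° R k) *° (R̂ k +° δ k) +° C k *° R k *° (δ k -° R̂ k *° ê k)
     split = cong (λ p -> F k *° p -° C (suc k) *° R (suc k)) (factor k) · solve° 6 (λ f c r R d e -> f :* (R :+ d) :- c :* (Κ 1° :+ e) :* (r :* R) := (f :- c :* r) :* (R :+ d) :+ c :* r :* (d :- R :* e)) refl _ _ _ _ _ _
    Σε̂ : ∀ k -> sum ε̂ k ≡ (k₁ + δ') * σ * S₁ k
    Σε̂ k = sum-cong k (λ i -> solve 3 (λ k x s -> k :* x :* s := k :* s :* x) refl _ _ σ) · sum-*ˡ ((k₁ + δ') * σ) _ k
    Ση̂ : ∀ k -> sum η̂ k ≡ δ' * σ * (S₁ k + k₁ * S₂ k)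
    Ση̂ k = sum-cong k (λ i -> solve 5 (λ d x k y s -> (d :* x :+ k :* d :* y) :* s := d :* s :* x :+ d :* s :* k :* y) refl δ' _ k₁ _ σ) · sum-+ _ _ k · (cong₂ _+_ (sum-*ˡ (δ' * σ) _ k) (sum-*ˡ (δ' * σ * k₁) _ k)) · solve 4 (λ e s k u -> e :* s :+ e :* k :* u := e :* (s :+ k :* u)) refl _ _ k₁ _
    error : ∀ E' -> 0# ≤ E' -> 1# ≤ E' * (1# - (k₁ + δ') * σ * S₁ N₀') ->
     F N₀' -° C N₀' *° R N₀' ⊑[ E' * (δ' * σ * (S₁ N₀' + k₁ * S₂ N₀')) ] R N₀'
    error E' E'₀ h = ⊑-mono {F N₀' -° C N₀' *° R N₀'} {R N₀'} (E₀ N₀' *₀ sum₀ N₀' η̂₀)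
     (*≤ˡ (sum₀ N₀' η̂₀) E≤ »≡ cong (E' *_) (Ση̂ N₀')) (F-CR N₀' ℕP.≤-refl)
     where
     E≤ : E N₀' ≤ E'
     E≤ = (sym (*-1ʳ (E N₀')) ≡» *≤ʳ (E₀ N₀') h) » cong (λ s -> E N₀' * (E' * (1# - s))) (sym (Σε̂ N₀')) · solve 3 (λ p q s -> p :* (q :* s) := q :* (p :* s)) refl _ E' _ ≡» *≤ʳ E'₀ (prod-1+≤ ε̂ N₀' ε̂₀) »≡ *-1ʳ E'
   -- The bound cos y ≥ 1 - y²/2 averaged over the trinomial distribution. One trinomial is expanded
   -- at a time with `c'` carrying the accumulated exponent; the weighted average of three quadratic
   -- bounds is again quadratic, with means and variances adding up.
   moment : ∀ k c' m -> total k * (c 2 1 - D * (V k + (μ k + ι c' - ι m) * (μ k + ι c' - ι m))) ≤ Tr (R k *° z ^° c' *° conj (z ^° m))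
   moment zero c' m = solve 3 (λ D c m -> Κ 1# :* (κ 2 1 :- D :* (Κ 0# :+ (Κ 0# :+ c :- m) :* (Κ 0# :+ c :- m))) := κ 2 1 :- (c :- m) :* (c :- m) :* D) refl D _ _ ≡» base (ℕP.≤-total m c') »≡ cong Tr (solve° 2 (λ x y -> x :* y := Κ 1° :* x :* y) refl _ _)
    where
    unimod : ∀ k -> z ^° k *° conj (z ^° k) ≡ 1°
    unimod k = x*conj (z ^° k) · cong ofℚ (N-unit k)
    base' : ∀ k w -> w ≡ ι k * ι k -> c 2 1 - w * D ≤ Tr (z ^° k)
    base' k w refl = gap≤ (gap (d≤ k)) (solve 2 (λ x y -> κ 2 1 :- y := κ 2 1 :- x :+ (x :- y)) refl _ _) »≡ cong (λ p -> c 2 1 - p) (d-Tr k) · solve 1 (λ t -> κ 2 1 :- (κ 2 1 :- t) := t) refl _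
    base : (m ℕ.≤ c') ⊎ (c' ℕ.≤ m) -> c 2 1 - (ι c' - ι m) * (ι c' - ι m) * D ≤ Tr (z ^° c' *° conj (z ^° m))
    base (inj₁ h) = base' j _ (cong (λ p -> (p - ι m) * (p - ι m)) (cong ι (sym (ℕP.m∸n+n≡m h)) · ι-+ j m) · solve 2 (λ j m -> (j :+ m :- m) :* (j :+ m :- m) := j :* j) refl _ _) »≡ cong Tr (sym (cong (λ p -> z ^° p *° conj (z ^° m)) (sym (ℕP.m∸n+n≡m h)) · cong (_*° conj (z ^° m)) (^°-+ z j m) · solve° 3 (λ x y w -> x :* y :* w := x :* (y :* w)) refl _ _ _ · cong (z ^° j *°_) (unimod m) · solve° 1 (λ x -> x :* Κ 1° := x) refl _))
     where
     j : ℕ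
     j = c' ℕ.∸ m
    base (inj₂ h) = base' j _ (cong (λ p -> (ι c' - p) * (ι c' - p)) (cong ι (sym (ℕP.m∸n+n≡m h)) · ι-+ j c') · solve 2 (λ j c -> (c :- (j :+ c)) :* (c :- (j :+ c)) := j :* j) refl _ _) »≡ sym (Tr-conj (z ^° j)) · cong Tr (sym (cong (λ p -> z ^° c' *° conj (z ^° p)) (sym (ℕP.m∸n+n≡m h)) · cong (λ p -> z ^° c' *° p) (cong conj (^°-+ z j c') · conj-* (z ^° j) (z ^° c')) · solve° 3 (λ x y w -> y :* (x :* w) := x :* (y :* w)) refl _ _ _ · cong (conj (z ^° j) *°_) (unimod c') · solve° 1 (λ x -> x :* Κ 1° := x) refl _))
     where
     j : ℕ
     j = m ℕ.∸ c'
   moment (suc k) c' m = split ≡» +≤ (+≤ (moment k c' m) (*≤ʳ (A₁₀ k) (moment k (a k ℕ.+ c') m))) (*≤ʳ (A₂₀ k) (moment k (e k ℕ.+ c') m)) »≡ sym Tr-split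
    where
    S Va Ma w : ℚ
    S = total k
    Va = V k
    Ma = μ k
    w = Ma + ι c' - ι m
    g : ℕ -> ℚ
    g p = S * (c 2 1 - D * (Va + (Ma + ι p - ι m) * (Ma + ι p - ι m)))
    g≡ : ∀ p -> g (p ℕ.+ c') ≡ S * (c 2 1 - D * (Va + (w + ι p) * (w + ι p)))
    g≡ p = cong (λ s -> S * (c 2 1 - D * (Va + s * s))) (cong (λ q -> Ma + q - ι m) (ι-+ p c') · solve 4 (λ M p c m -> M :+ (p :+ c) :- m := M :+ c :- m :+ p) refl Ma _ _ _)
    split : total (suc k) * (c 2 1 - D * (V (suc k) + (μ (suc k) + ι c' - ι m) * (μ (suc k) + ι c' - ι m))) ≡ g c' + A₁ k * g (a k ℕ.+ c') + A₂ k * g (e k ℕ.+ c')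
    split = cong (λ s -> S * n k * (c 2 1 - D * (V (suc k) + s * s))) (solve 4 (λ M p c m -> M :+ p :+ c :- m := M :+ c :- m :+ p) refl Ma _ _ _) · alg · sym (cong₂ (λ p q -> g c' + A₁ k * p + A₂ k * q) (g≡ (a k)) (g≡ (e k) · cong (λ q -> S * (c 2 1 - D * (Va + (w + q) * (w + q)))) (ι-+ (a k) (b k))))
     where
     alg : S * n k * (c 2 1 - D * (Va + V̂ k + (w + μ̂ k) * (w + μ̂ k))) ≡ S * (c 2 1 - D * (Va + w * w)) + A₁ k * (S * (c 2 1 - D * (Va + (w + ι (a k)) * (w + ι (a k)))))
      + A₂ k * (S * (c 2 1 - D * (Va + (w + (ι (a k) + ι (b k))) * (w + (ι (a k) + ι (b k))))))
     alg = cong (λ q -> S * n k * (c 2 1 - D * (Va + (A₁ k * (ι (a k) * ι (a k)) + A₁ k * A₂ k * (ι (b k) * ι (b k)) + A₂ k * (q * q)) * (v k * v k)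
        + (w + (A₁ k * ι (a k) + A₂ k * q) * v k) * (w + (A₁ k * ι (a k) + A₂ k * q) * v k)))) (ι-+ (a k) (b k)) · solve 9 (λ S D Va w p q a b v ->
        let nn = Κ 1# :+ p :+ q ; e = a :+ b ; m = p :* a :+ q :* e in
        S :* nn :* (κ 2 1 :- D :* (Va :+ (p :* (a :* a) :+ p :* q :* (b :* b) :+ q :* (e :* e)) :* (v :* v) :+ (w :+ m :* v) :* (w :+ m :* v))) :=
        S :* (nn :* (κ 2 1 :- D :* (Va :+ w :* w)) :- D :* ((p :* (a :* a) :+ q :* (e :* e)) :* (nn :* v :* (nn :* v)) :+ κ 2 1 :* w :* m :* (nn :* v)))) refl S D Va w _ _ _ _ _ · cong (λ p -> S * (n k * (c 2 1 - D * (Va + w * w)) - D * ((A₁ k * (ι (a k) * ι (a k)) + A₂ k * ((ι (a k) + ι (b k)) * (ι (a k) + ι (b k)))) * (p * p) + c 2 1 * w * (A₁ k * ι (a k) + A₂ k * (ι (a k) + ι (b k))) * p))) (nv k) · solve 8 (λ S D Va w p q a b -> let nn = Κ 1# :+ p :+ q ; e = a :+ b in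
         S :* (nn :* (κ 2 1 :- D :* (Va :+ w :* w)) :- D :* ((p :* (a :* a) :+ q :* (e :* e)) :* (Κ 1# :* Κ 1#) :+ κ 2 1 :* w :* (p :* a :+ q :* e) :* Κ 1#)) :=
         S :* (κ 2 1 :- D :* (Va :+ w :* w)) :+ p :* (S :* (κ 2 1 :- D :* (Va :+ (w :+ a) :* (w :+ a)))) :+ q :* (S :* (κ 2 1 :- D :* (Va :+ (w :+ e) :* (w :+ e))))) refl S D Va w _ _ _ _
    T : ℕ -> 𝔼
    T p = R k *° z ^° p *° conj (z ^° m)
    Tr-split : Tr (R (suc k) *° z ^° c' *° conj (z ^° m)) ≡ Tr (T c') + A₁ k * Tr (T (a k ℕ.+ c')) + A₂ k * Tr (T (e k ℕ.+ c'))
    Tr-split = cong Tr (solve° 7 (λ R p x q y Z W -> R :* (Κ 1° :+ p :* x :+ q :* y) :* Z :* W := R :* Z :* W :+ p :* (R :* (x :* Z) :* W) :+ q :* (R :* (y :* Z) :* W)) refl _ _ _ _ _ _ _ · cong₂ (λ p q -> T c' +° ofℚ (A₁ k) *° (R k *° p *° conj (z ^° m)) +° ofℚ (A₂ k) *° (R k *° q *° conj (z ^° m))) (sym (^°-+ z (a k) c')) (sym (^°-+ z (e k) c'))) · Tr-+ _ _ · (cong₂ _+_ (Tr-+ _ _ · cong (Tr (T c') +_) (Tr-ofℚ* (A₁ k) (T (a k ℕ.+ c')))) (Tr-ofℚ* (A₂ k) (T (e k ℕ.+ c'))))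
  C-1⊑ : ∀ k -> C k -° 1° ⊑[ prod (λ i -> 1# + k₁ * (x i * v i)) k - 1# ] 1°
  C-1⊑ zero = of≡ (cong N (solve° 0 (Κ 1° :- Κ 1° := Κ 0°) refl) · N-ofℚ 0# · *-0ˡ 0# · sym (cong (_* N 1°) (solve 0 ((Κ 1# :- Κ 1#) :* (Κ 1# :- Κ 1#) := Κ 0#) refl) · *-0ˡ (N 1°)))
  C-1⊑ (suc k) = subst₂ (λ X κ' -> X ⊑[ κ' ] 1°) (solve° 2 (λ c e -> (c :- Κ 1°) :* (Κ 1° :+ e) :+ e := c :* (Κ 1° :+ e) :- Κ 1°) refl _ _) (solve 2 (λ p s -> (p :- Κ 1#) :* (Κ 1# :+ s) :+ s := p :* (Κ 1# :+ s) :- Κ 1#) refl _ _)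
   (⊑-+ {(C k -° 1°) *° (1° +° ê k)} {ê k} {1°} (p-1₀ *₀ (lit +₀ f₀ k)) (f₀ k) (subst (λ w -> N ((C k -° 1°) *° (1° +° ê k)) ≤ (prod (λ i -> 1# + f i) k - 1#) * (1# + f k) * ((prod (λ i -> 1# + f i) k - 1#) * (1# + f k)) * N w) (solve° 0 (Κ 1° :* Κ 1° := Κ 1°) refl)
     (⊑-* {C k -° 1°} {1° +° ê k} {1°} {1°} (C-1⊑ k) (⊑-+ {1°} {ê k} {1°} lit (f₀ k) (⊑-refl 1°) (ê⊑ k))))
    (ê⊑ k))
   where
   f : ℕ -> ℚ
   f i = k₁ * (x i * v i)
   f₀ : ∀ i -> 0# ≤ f i
   f₀ i = lit *₀ t₀ *₀ (x₀ i *₀ v₀ i)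
   p-1₀ : 0# ≤ prod (λ i -> 1# + f i) k - 1#
   p-1₀ = gap (gap≤ (sum₀ k f₀) refl » 1+sum≤prod f k f₀)
   ê⊑ : ∀ i -> ê i ⊑[ f i ] 1°
   ê⊑ i = N-* (ofℚ (x i * v i)) Q₁ · cong (_* N Q₁) (N-ofℚ (x i * v i)) ≡» *≤ʳ (sq₀ (x i * v i)) Q₁⊑ »≡ solve 3 (λ y k w -> y :* y :* (k :* k :* w) := k :* y :* (k :* y) :* w) refl _ k₁ _
  C-1≤ : ∀ k E' -> 0# ≤ E' -> 1# ≤ E' * (1# - k₁ * S₁ k) -> C k -° 1° ⊑[ E' - 1# ] 1°
  C-1≤ k E' E'₀ h = ⊑-mono {C k -° 1°} {1°} (gap (gap≤ (sum₀ k f₀) refl » 1+sum≤prod f k f₀))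
   (+≤ p≤ ≤-refl) (C-1⊑ k)
   where
   f : ℕ -> ℚ
   f i = k₁ * (x i * v i)
   f₀ : ∀ i -> 0# ≤ f i
   f₀ i = lit *₀ t₀ *₀ (x₀ i *₀ v₀ i)
   p : ℚ
   p = prod (λ i -> 1# + f i) k
   p≤ : p ≤ E'
   p≤ = (sym (*-1ʳ p) ≡» *≤ʳ (prod₀ k (λ i -> lit +₀ f₀ i)) h) » cong (λ s -> p * (E' * (1# - s))) (sym (sum-*ˡ k₁ (λ i -> x i * v i) k)) · solve 3 (λ p q s -> p :* (q :* s) := q :* (p :* s)) refl p E' _ ≡» *≤ʳ E'₀ (prod-1+≤ f k f₀) »≡ *-1ʳ E'
  open Weights r r₊ r₁ using (Π²)
  Π²≡ : ∀ k -> Π² k ≡ N (C k) * (total k * total k)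
  Π²≡ k = prod-cong k local · prod-* _ _ k · (cong₂ _*_ (sym (N-prod _ k)) (prod-* n n k))
   where
   opaque
    unfolding _+°_
    Trω : Tr ω ≡ ℚ.- 1#
    Trω = solve 0 (Κ 0# :+ Κ 0# :- Κ 1# := Κ (ℚ.- 1#)) refl
    Trω̄ : Tr ω̄ ≡ ℚ.- 1#
    Trω̄ = solve 0 (let m = Κ (ℚ.- 1#) in m :+ m :- m := m) refl
    Nω̄ : N ω̄ ≡ 1#
    Nω̄ = solve 0 (let m = Κ (ℚ.- 1#) in m :* m :- m :* m :+ m :* m := Κ 1#) refl
    Nω : N ω ≡ 1#
    Nω = solve 0 (Κ 0# :* Κ 0# :- Κ 0# :* Κ 1# :+ Κ 1# :* Κ 1# := Κ 1#) refl
   G≡ : ∀ ρ w -> N w ≡ 1# -> Tr w ≡ ℚ.- 1# -> G ρ ≡ N (1° -° ofℚ ρ *° w)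
   G≡ ρ w h h' = sym (N-1-scaled ρ w h · cong (λ t -> 1# + ρ * ρ - ρ * t) h' · solve 1 (λ ρ -> Κ 1# :+ ρ :* ρ :- ρ :* Κ (ℚ.- 1#) := Κ 1# :+ ρ :+ ρ :* ρ) refl ρ)
   local : ∀ i -> G (r ^ a i) * G (r ^ b i) ≡ N (1° +° ê i) * (n i * n i)
   local i = (cong₂ _*_ (G≡ (r ^ a i) ω Nω Trω) (G≡ (r ^ b i) ω̄ Nω̄ Trω̄)) · sym (N-* _ _) · cong N eq · N-* (1° +° ê i) (ofℚ (n i)) · cong (N (1° +° ê i) *_) (N-ofℚ (n i))
    where
    eq : (1° -° ofℚ (r ^ a i) *° ω) *° (1° -° ofℚ (r ^ b i) *° ω̄) ≡ (1° +° ê i) *° ofℚ (n i)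
    eq = cong (λ p -> (1° -° ofℚ (x i) *° ω) *° (1° -° p *° ω̄)) (ofℚ-* r (x i)) · solve° 3 (λ r x l -> (Κ 1° :- x :* Κ ω) :* (Κ 1° :- r :* x :* Κ ω̄) := Κ 1° :+ l :* x :+ r :* (x :* x) :+ x :* Κ 1° :* ((:- Κ ω) :- Κ ω̄ :* r :* Κ 1° :- l)) refl _ _ _ · cong₂ (λ p q -> p +° q *° Q₁) n≡ xvn · solve° 3 (λ n w q -> n :+ w :* n :* q := (Κ 1° :+ w :* q) :* n) refl _ _ Q₁ · refl
     where
     n≡ : 1° +° ofℚ λ' *° ofℚ (x i) +° ofℚ r *° (ofℚ (x i) *° ofℚ (x i)) ≡ ofℚ (n i)
     n≡ = sym (ofℚ-+ (1# + A₁ i) (A₂ i) · (cong₂ _+°_ (ofℚ-+ 1# (A₁ i) · cong (1° +°_) (ofℚ-* λ' (x i))) (ofℚ-* r (x i * x i) · cong (ofℚ r *°_) (ofℚ-* (x i) (x i)))))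
     xvn : ofℚ (x i) *° 1° ≡ ofℚ (x i * v i) *° ofℚ (n i)
     xvn = sym (sym (ofℚ-* (x i * v i) (n i)) · cong ofℚ (solve 3 (λ x v n -> x :* v :* n := x :* (n :* v)) refl _ _ _ · cong (x i *_) (nv i)) · ofℚ-* (x i) 1#)

-- Truncated geometric sums

module N1 where
 open Q1
 open E1
 open U1
 open P1
 opaque
  unfolding _+_ _*_
  ι64' : ι 64 ≡ c 64 1
  ι64' = refl
 sum-≤n : ∀ (f : ℕ -> ℚ) {m n} -> (∀ i -> 0# ≤ f i) -> m ℕ.≤ n -> sum f m ≤ sum f n
 sum-≤n f {m} {n} f₀ h = subst (λ k -> sum f m ≤ sum f k) (ℕP.m∸n+n≡m h) (go (n ℕ.∸ m))
  where
  go : ∀ k -> sum f m ≤ sum f (k ℕ.+ m)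
  go zero = ≤-refl
  go (suc k) = go k » gap≤ (f₀ (k ℕ.+ m)) refl
 ceiling : ∀ u n -> 0# ≤ u -> u ≤ ι n -> Σ ℕ λ k -> k ℕ.≤ n × u ≤ ι k × ι k ≤ u + 1#
 ceiling u zero u₀ h = 0 , ℕ.z≤n , h , ≤-trans u₀ (gap≤ lit refl)
 ceiling u (suc n) u₀ h with ≤-total u (ι n)
 ... | inj₁ l = let (k , p , q) = ceiling u n u₀ l in k , ℕP.m≤n⇒m≤1+n p , q
 ... | inj₂ l = suc n , ℕP.≤-refl , h , ≤-trans (of≡ (+-comm 1# (ι n))) (+≤ l ≤-refl)
 pow-decay : ∀ q n Y -> 0# ≤ q -> 0# ≤ Y -> Y ≤ ι n * (1# - q) -> q ^ n * (1# + Y * c 1 64) ^ 64 ≤ 1#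
 pow-decay q n Y q₀ Y₀ h = subst₂ (λ u w -> u * (1# + Y * w) ^ 64 ≤ 1#) (pc n) (inv-unique (ι₊ 63) (c 1 64) (cong (_* c 1 64) ι64' · solve 0 (κ 64 1 :* κ 1 64 := Κ 1#) refl))
  (prod-decay (λ _ -> q) n 63 Y (λ _ -> q₀) Y₀ (h »≡ sym (sum-const (1# - q) n)))
  where
  pc : ∀ n -> prod (λ _ -> q) n ≡ q ^ n
  pc zero = refl
  pc (suc n) = cong (_* q) (pc n) · *-comm (q ^ n) q
 module Geometric (q κ' : ℚ) (q₀ : 0# ≤ q) (κ₀ : 0# ≤ κ') (κq : (1# - q) * κ' ≡ 1#) where
  parts : ∀ (G : ℕ -> ℚ) n -> (1# - q) * sum (λ i -> G (suc i) * q ^ i) n ≡ sum (λ i -> (G (suc i) - G i) * q ^ i) n - G n * q ^ n + G 0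
  parts G zero = solve 2 (λ q g -> (Κ 1# :- q) :* Κ 0# := Κ 0# :- g :* Κ 1# :+ g) refl q _
  parts G (suc n) = solve 3 (λ q s u -> (Κ 1# :- q) :* (s :+ u) := (Κ 1# :- q) :* s :+ (Κ 1# :- q) :* u) refl q _ _ · cong (_+ (1# - q) * (G (suc n) * q ^ n)) (parts G n) · solve 6 (λ q s g g' g₀ p -> s :- g :* p :+ g₀ :+ (Κ 1# :- q) :* (g' :* p) := s :+ (g' :- g) :* p :- g' :* (q :* p) :+ g₀) refl q _ _ _ _ _
  cancel : ∀ {x y} -> (1# - q) * x ≡ y -> x ≡ κ' * y
  cancel {x} {y} h = sym (*-1ˡ x) · cong (_* x) (sym κq) · solve 3 (λ q k x -> q :* k :* x := k :* (q :* x)) refl _ κ' x · cong (κ' *_) h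
  -- Rising factorials (i+1)...(i+p). For these weights summation by parts lowers p by one, and the
  -- complete series would be p! times κ'^(p+1).
  ρ : ℕ -> ℕ -> ℚ
  ρ zero i = 1#
  ρ (suc p) i = ρ p i * (ι i + ι (suc p))
  ρ₀ : ∀ p i -> 0# ≤ ρ p i
  ρ₀ zero i = lit
  ρ₀ (suc p) i = ρ₀ p i *₀ (ι₀ i +₀ ι₀ (suc p))
  S : ℕ -> ℕ -> ℚ
  S p = sum (λ i -> ρ p i * q ^ i)
  S₀ : ∀ p n -> 0# ≤ S p n
  S₀ p n = sum₀ n (λ i -> ρ₀ p i *₀ ^₀ i q₀)
  private
   g : ℕ -> ℕ -> ℚ
   g zero i = ι i
   g (suc p) i = g p i * (ι i + ι (suc p))
   g-suc : ∀ p i -> g p (suc i) ≡ ρ (suc p) i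
   g-suc zero i = solve 1 (λ i -> Κ 1# :+ i := Κ 1# :* (i :+ (Κ 1# :+ Κ 0#))) refl _
   g-suc (suc p) i = cong₂ _*_ (g-suc p i) (solve 2 (λ i p -> Κ 1# :+ i :+ (Κ 1# :+ p) := i :+ (Κ 1# :+ (Κ 1# :+ p))) refl _ _)
   g-ρ : ∀ p i -> g p i ≡ ι i * ρ p i
   g-ρ zero i = sym (*-1ʳ (ι i))
   g-ρ (suc p) i = cong (_* (ι i + ι (suc p))) (g-ρ p i) · *-assoc (ι i) (ρ p i) (ι i + ι (suc p))
   g-diff : ∀ p i -> g p (suc i) - g p i ≡ ι (suc p) * ρ p i
   g-diff p i = (cong₂ _-_ (g-suc p i) (g-ρ p i)) · solve 3 (λ r i p -> r :* (i :+ p) :- i :* r := p :* r) refl _ _ _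
   g-0 : ∀ p -> g p 0 ≡ 0#
   g-0 zero = refl
   g-0 (suc p) = cong (_* (0# + ι (suc p))) (g-0 p) · *-0ˡ (0# + ι (suc p))
  S-step : ∀ p n -> S (suc p) n ≡ κ' * (ι (suc p) * S p n - ι n * ρ p n * q ^ n)
  S-step p n = cancel (cong ((1# - q) *_) (sum-cong n (λ i -> cong (_* q ^ i) (sym (g-suc p i)))) · parts (g p) n · cong₂ (λ u v -> sum (λ i -> (g p (suc i) - g p i) * q ^ i) n - u * q ^ n + v) (g-ρ p n) (g-0 p) · solve 2 (λ s u -> s :- u :+ Κ 0# := s :- u) refl _ _ · cong (_- ι n * ρ p n * q ^ n) (sum-cong n (λ i -> trans (cong (_* q ^ i) (g-diff p i)) (*-assoc (ι (suc p)) (ρ p i) (q ^ i))) · sum-*ˡ (ι (suc p)) _ n))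
  S-zero : ∀ n -> S 0 n ≡ κ' * (1# - q ^ n)
  S-zero n = cancel (parts (λ _ -> 1#) n · cong (λ s -> s - 1# * q ^ n + 1#) (sum-cong n (λ i -> solve 1 (λ x -> (Κ 1# :- Κ 1#) :* x := Κ 0#) refl _) · sum-const 0# n · *-0ʳ (ι n)) · solve 1 (λ x -> Κ 0# :- Κ 1# :* x :+ Κ 1# := Κ 1# :- x) refl _)
  fact : ℕ -> ℚ
  fact zero = 1#
  fact (suc p) = ι (suc p) * fact p
  S≤ : ∀ p n -> S p n ≤ fact p * κ' ^ suc p
  S≤ zero n = S-zero n ≡» gap≤ (κ₀ *₀ ^₀ n q₀) (solve 2 (λ k x -> Κ 1# :* (k :* Κ 1#) := k :* (Κ 1# :- x) :+ k :* x) refl κ' _)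
  S≤ (suc p) n = S-step p n ≡» *≤ʳ κ₀ (gap≤ (ι₀ n *₀ ρ₀ p n *₀ ^₀ n q₀) (solve 2 (λ a b -> a := a :- b :+ b) refl _ _) » *≤ʳ (ι₀ (suc p)) (S≤ p n)) »≡ solve 4 (λ k p f u -> k :* (p :* (f :* u)) := p :* f :* (k :* u)) refl κ' _ _ _
  -- Truncation changes a sum only by terms containing q^n; `ε` bounds this power and `w` bounds the
  -- cutoff in units of 1 / (1 - q).
  module Lower (n : ℕ) (ε w : ℚ) (ε₀ : 0# ≤ ε) (hε : q ^ n ≤ ε) (hw : ι n * (1# - q) ≤ w) (θ₀ : 0# ≤ 1# - q) (κ≥1 : 1# ≤ κ') where
   S0≥ : κ' * (1# - ε) ≤ S 0 n
   S0≥ = *≤ʳ κ₀ (gap≤ (gap hε) (solve 2 (λ e p -> Κ 1# :- p := Κ 1# :- e :+ (e :- p)) refl ε _)) »≡ sym (S-zero n)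
   private
    p M θ : ℚ
    p = q ^ n
    M = ι n
    θ = 1# - q
    M≤ : M ≤ w * κ'
    M≤ = sym (*-1ʳ M) · cong (M *_) (sym κq) · sym (*-assoc M θ κ') ≡» *≤ˡ κ₀ hw
    w₀ : 0# ≤ w
    w₀ = (ι₀ n *₀ θ₀) » hw
    p₀ : 0# ≤ p
    p₀ = ^₀ n q₀
   S2≥ : κ' * κ' * κ' * (c 2 1 - ε * (c 2 1 + c 2 1 * w + w * w)) - κ' * κ' * (ε * w) ≤ S 2 n
   S2≥ = gap≤ (κ₀ *₀ κ₀ *₀ κ₀ *₀ gap hε *₀ (lit +₀ lit *₀ w₀ +₀ w₀ *₀ w₀) +₀ κ₀ *₀ κ₀ *₀ (gap hε *₀ w₀)
      +₀ p₀ *₀ κ₀ *₀ (lit *₀ κ₀ *₀ gap M≤) +₀ p₀ *₀ κ₀ *₀ (gap M≤ *₀ (w₀ *₀ κ₀ +₀ ι₀ n)) +₀ p₀ *₀ κ₀ *₀ gap M≤)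
     (S-step 1 n · cong (λ s -> κ' * (ι 2 * s - M * ρ 1 n * p)) (S-step 0 n · cong (λ s -> κ' * (ι 1 * s - M * ρ 0 n * p)) (S-zero n)) · solve 5 (λ k p M e w -> k :* ((Κ 1# :+ (Κ 1# :+ Κ 0#)) :* (k :* ((Κ 1# :+ Κ 0#) :* (k :* (Κ 1# :- p)) :- M :* Κ 1# :* p)) :- M :* (Κ 1# :* (M :+ (Κ 1# :+ Κ 0#))) :* p) :=
        k :* k :* k :* (κ 2 1 :- e :* (κ 2 1 :+ κ 2 1 :* w :+ w :* w)) :- k :* k :* (e :* w) :+
        (k :* k :* k :* (e :- p) :* (κ 2 1 :+ κ 2 1 :* w :+ w :* w) :+ k :* k :* ((e :- p) :* w) :+ p :* k :* (κ 2 1 :* k :* (w :* k :- M)) :+ p :* k :* ((w :* k :- M) :* (w :* k :+ M)) :+ p :* k :* (w :* k :- M))) refl κ' p M ε w) » ≤-refl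

-- Lower bounds for the variance and the weight sums

module N2 where
 open Q1
 open E1
 open U1
 open P1
 open R1
 open N1
 infixr 8 _^ᶜ_
 -- A power that computes, so that closed numerical inequalities are decided by evaluation.
 _^ᶜ_ : ℚ -> ℕ -> ℚ
 p ^ᶜ zero = 1#
 p ^ᶜ suc n = p ℚ.* p ^ᶜ n
 ^ᶜ≡ : ∀ p n -> p ^ᶜ n ≡ p ^ n
 ^ᶜ≡ p zero = refl
 ^ᶜ≡ p (suc n) = *≡ p (p ^ᶜ n) · cong (p *_) (^ᶜ≡ p n)
 pow3 : ∀ r i -> r ^ t3 i ≡ (r * (r * r)) ^ i
 pow3 r zero = refl
 pow3 r (suc i) = solve 2 (λ r x -> r :* (r :* (r :* x)) := r :* (r :* r) :* x) refl r _ · cong (r * (r * r) *_) (pow3 r i)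
 ι-a : ∀ i -> ι (a i) ≡ 1# + c 3 1 * ι i
 ι-a i = cong (1# +_) (ι-t3 i)
 ι-b : ∀ i -> ι (b i) ≡ c 2 1 + c 3 1 * ι i
 ι-b i = cong (λ p -> 1# + (1# + p)) (ι-t3 i) · solve 1 (λ i -> Κ 1# :+ (Κ 1# :+ i) := κ 2 1 :+ i) refl _
 ι-e : ∀ i -> ι (e i) ≡ c 3 1 + c 6 1 * ι i
 ι-e i = ι-+ (a i) (b i) · (cong₂ _+_ (ι-a i) (ι-b i)) · solve 1 (λ i -> Κ 1# :+ κ 3 1 :* i :+ (κ 2 1 :+ κ 3 1 :* i) := κ 3 1 :+ κ 6 1 :* i) refl _
 weight≥ : ∀ {ρ ρ' w} l -> 0# ≤ ρ' -> ρ' ≤ ρ -> ρ ≤ 1# -> G ρ * w ≡ ρ -> G ρ' * l ≤ ρ' -> l ≤ w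
 weight≥ {ρ} {ρ'} {w} l ρ'₀ h ρ≤1 Gw hl = cancel≤ (Gp ρ' ρ'₀) (hl » cancel≤ (Gp ρ (ρ'₀ » h))
  (gap≤ (gap h *₀ gap (*≤ ρ'₀ lit (h » ρ≤1) ρ≤1 »≡ *-1ˡ 1#)) (solve 2 (λ x y -> y :* (Κ 1# :+ x :+ x :* x) := (Κ 1# :+ y :+ y :* y) :* x :+ (y :- x) :* (Κ 1# :- x :* y)) refl ρ' ρ) »≡ cong (_* G ρ') (sym Gw) · solve 3 (λ g w h -> g :* w :* h := g :* (h :* w)) refl _ w _))
  where
  Gp : ∀ ρ -> 0# ≤ ρ -> 0# < G ρ
  Gp ρ h = (0<1 +₊ h) +₊ sq₀ ρ
 weight-linear : ∀ x -> 0# ≤ x -> G x * (x - x * x) ≤ x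
 weight-linear x x₀ = gap≤ (x₀ *₀ (x₀ *₀ sq₀ x)) (solve 1 (λ x -> x := (Κ 1# :+ x :+ x :* x) :* (x :- x :* x) :+ x :* (x :* (x :* x))) refl x)
 -- The quadratic touches x / (1 + x + x²) at x = 1/2. With Σ x about K and Σ x² about K/2 it gives
 -- 4/7 K for the total, against 1/2 K from `weight-linear`.
 weight-tangent : ∀ x -> 0# ≤ x -> G x * (c 44 49 * x - c 32 49 * (x * x)) ≤ x
 weight-tangent x x₀ = gap≤ (lit *₀ (x₀ *₀ (sq₀ _ *₀ (lit *₀ x₀ +₀ lit)))) (solve 1 (λ x -> x := (Κ 1# :+ x :+ x :* x) :* (κ 44 49 :* x :- κ 32 49 :* (x :* x)) :+ κ 1 49 :* (x :* ((κ 2 1 :* x :- Κ 1#) :* (κ 2 1 :* x :- Κ 1#) :* (κ 8 1 :* x :+ κ 5 1)))) refl x)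
 module Base (q K : ℚ) (q₀ : 0# ≤ q) (qK : (1# - q) * K ≡ 1#) (hK : c 747 10 ≤ K) where
  K₀ : 0# ≤ K
  K₀ = lit » hK
  K₊ : 0# < K
  K₊ = ℚP.<-≤-trans (ℚP.positive⁻¹ (c 747 10)) hK
  θ₀ : 0# ≤ 1# - q
  θ₀ = cancel≤ K₊ (*-0ʳ K ≡» lit »≡ sym (*-comm K (1# - q) · qK))
  θ≤ : 1# - q ≤ c 10 747
  θ≤ = (solve 1 (λ t -> t := κ 10 747 :* (t :* κ 747 10)) refl _ ≡» *≤ʳ lit (*≤ʳ θ₀ hK)) »≡ cong (c 10 747 *_) qK · *-1ʳ _
  q≤1 : q ≤ 1#
  q≤1 = ungap θ₀
  module g₁ = Geometric q K q₀ K₀ qK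
  q² K₂ : ℚ
  q² = q * q
  1+q₊ : 0# < 1# + q
  1+q₊ = 0<1 +₊ q₀
  K₂ = K * inv (1# + q) 1+q₊
  K₂₀ : 0# ≤ K₂
  K₂₀ = K₀ *₀ inv₀ _ _
  q²K₂ : (1# - q²) * K₂ ≡ 1#
  q²K₂ = solve 3 (λ q k i -> (Κ 1# :- q :* q) :* (k :* i) := (Κ 1# :- q) :* k :* ((Κ 1# :+ q) :* i)) refl q K _ · (cong₂ _*_ qK (*-inv _ 1+q₊)) · *-1ˡ 1#
  K₂≤ : K₂ ≤ c 504 1000 * K
  K₂≤ = cancel≤ 1+q₊ (solve 3 (λ p k i -> p :* (k :* i) := k :* (p :* i)) refl _ K _ · cong (K *_) (*-inv _ 1+q₊) · *-1ʳ K ≡» sym (*-1ˡ K) ≡» *≤ˡ K₀ (lit » solve 0 (κ 2 1 :* κ 504 1000 :- κ 504 1000 :* κ 10 747 := Κ (c 2 1 ℚ.* c 504 1000 ℚ.- c 504 1000 ℚ.* c 10 747)) refl ⁻ ≡» gap≤ (lit *₀ gap θ≤) (solve 1 (λ q -> (Κ 1# :+ q) :* κ 504 1000 := κ 2 1 :* κ 504 1000 :- κ 504 1000 :* κ 10 747 :+ κ 504 1000 :* (κ 10 747 :- (Κ 1# :- q))) refl q)) »≡ *-assoc (1# + q) (c 504 1000) K)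
   where
   _⁻ : ∀ {x y : ℚ} -> x ≡ y -> y ≡ x
   _⁻ = sym
  module g₂ = Geometric q² K₂ (q₀ *₀ q₀) K₂₀ q²K₂
  qq^ : ∀ i -> q² ^ i ≡ q ^ i * q ^ i
  qq^ i = *-^ q q i
 -- The sums are cut at about v K terms, where q^m is below `ε`. The constants `cA`, `cV`, `cP` are
 -- in units of K³ and `cΩ` in units of K. Only q ≤ r³ is assumed, so that K may be taken from `n`
 -- when r is very close or equal to 1.
 module LowerBounds (r : ℚ) (r₊ : 0# < r) (r₁ : r ≤ 1#) (hr : c 9954 10000 ≤ r) (q K : ℚ) (q₀ : 0# ≤ q) (qK : (1# - q) * K ≡ 1#) (hK : c 747 10 ≤ K)
  (hq : q ≤ r * (r * r)) (n : ℕ) (v ε cA cV cP cΩ : ℚ) (v₀ : 0# ≤ v) (ε₀ : 0# ≤ ε) (ε≤1 : ε ≤ 1#) (vn : v * K ≤ ι n)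
  (hε : 1# ≤ ε * (1# + v * c 1 64) ^ 64)
  (hA : cA + c 10 747 * (c 21 1 + c 9 1 * (ε * (v + c 10 747))) ≤ c 9 1 * (c 2 1 - ε * (c 2 1 + c 2 1 * (v + c 10 747) + (v + c 10 747) * (v + c 10 747))))
  (cA₀ : c 1 1 ≤ cA) (hV : cV ≤ c 9908 10000 * (c 9954 10000 * cA - c 769 1000)) (hP : cP ≤ c 9908 10000 * cA - c 2305 1000)
  (hΩ : cΩ ≤ c 44 49 * (c 9908 10000 * (1# - ε)) - c 32 49 * c 504 1000) where
  open Base q K q₀ qK hK
  open Weights r r₊ r₁ using (r₀; W; W₀; GW; Ω)
  open Main r r₊ r₁ using (x; x₀; x≤1; A₁; A₂; V; V̂; V̂₀; n₊; t₀; λ'; A₁₀; A₂₀) renaming (n to ν; v to u; nv to νu)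
  private
   found : Σ ℕ λ k -> k ℕ.≤ n × v * K ≤ ι k × ι k ≤ v * K + 1#
   found = ceiling (v * K) n (v₀ *₀ K₀) vn
   m : ℕ
   m = proj₁ found
   m≤n : m ℕ.≤ n
   m≤n = proj₁ (proj₂ found)
   Kθ : ∀ s -> s * K * (1# - q) ≡ s
   Kθ s = solve 3 (λ s k t -> s :* k :* t := s :* (t :* k)) refl s K _ · cong (s *_) qK · *-1ʳ s
   w : ℚ
   w = v + c 10 747
   hw : ι m * (1# - q) ≤ w
   hw = *≤ˡ θ₀ (proj₂ (proj₂ (proj₂ found))) » solve 2 (λ s t -> (s :+ Κ 1#) :* t := s :* t :+ t) refl _ _ · cong (_+ (1# - q)) (Kθ v) ≡» +≤ ≤-refl θ≤
   E₀ : 0# < (1# + v * c 1 64) ^ 64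
   E₀ = ^₊ 64 (0<1 +₊ (v₀ *₀ lit))
   hp : q ^ m ≤ ε
   hp = cancel≤ E₀ (*-comm _ (q ^ m) ≡» pow-decay q m v q₀ v₀ (sym (Kθ v) ≡» *≤ˡ θ₀ (proj₁ (proj₂ (proj₂ found)))) » hε »≡ *-comm ε _)
   module L = g₁.Lower m ε w ε₀ hp hw θ₀ (lit » hK)
   w₀ : 0# ≤ w
   w₀ = v₀ +₀ lit
  a² : ℕ -> ℚ
  a² i = ι (a i) * ι (a i)
  A B : ℚ
  A = sum (λ i -> a² i * q ^ i) n
  B = sum (λ i -> a² i * (q ^ i * q ^ i)) n
  K³ : ℚ
  K³ = K * K * K
  K³₀ : 0# ≤ K³
  K³₀ = K₀ *₀ K₀ *₀ K₀
  A≥ : cA * K³ ≤ A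
  A≥ = ((gap≤ (K³₀ *₀ gap hA +₀ K₀ *₀ K₀ *₀ gap K10 *₀ slack₀) refl »≡ solve 5 (λ K cA b s e -> cA :* (K :* K :* K) :+ (K :* K :* K :* (κ 9 1 :* b :- (cA :+ κ 10 747 :* (κ 21 1 :+ κ 9 1 :* s))) :+ K :* K :* (κ 10 747 :* K :- Κ 1#) :* (κ 21 1 :+ κ 9 1 :* s)) :=
     κ 9 1 :* (K :* K :* K :* b :- K :* K :* s) :- κ 21 1 :* (Κ 1# :* (K :* (K :* Κ 1#)))) refl K cA _ _ ε) » +≤ (*≤ʳ lit L.S2≥) (neg (*≤ʳ lit (g₁.S≤ 1 m »≡ cong (_* (K * (K * 1#))) (solve 0 ((Κ 1# :+ Κ 0#) :* Κ 1# := Κ 1#) refl))) » ≤-refl)) » gap≤ (lit *₀ g₁.S₀ 0 m) refl » sym combo ≡» sum-≤n (λ i -> a² i * q ^ i) (λ i -> sq₀ _ *₀ ^₀ i q₀) m≤n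
   where
   slack bound : ℚ
   slack = c 21 1 + c 9 1 * (ε * w)
   bound = c 9 1 * (c 2 1 - ε * (c 2 1 + c 2 1 * w + w * w))
   slack₀ : 0# ≤ slack
   slack₀ = lit +₀ lit *₀ (ε₀ *₀ w₀)
   K10 : 1# ≤ c 10 747 * K
   K10 = solve 0 (Κ 1# := κ 10 747 :* κ 747 10) refl ≡» *≤ʳ lit hK
   neg : ∀ {x y} -> x ≤ y -> - y ≤ - x
   neg {x} {y} h = gap≤ (gap h) (solve 2 (λ x y -> :- x := :- y :+ (y :- x)) refl x y)
   combo : sum (λ i -> a² i * q ^ i) m ≡ c 9 1 * g₁.S 2 m - c 21 1 * g₁.S 1 m + c 4 1 * g₁.S 0 m
   combo = sum-cong m (λ i -> trans (cong (λ p -> p * p * q ^ i) (ι-a i)) (solve 2 (λ i x -> (Κ 1# :+ κ 3 1 :* i) :* (Κ 1# :+ κ 3 1 :* i) :* x :=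
      κ 9 1 :* (Κ 1# :* (i :+ (Κ 1# :+ Κ 0#)) :* (i :+ (Κ 1# :+ (Κ 1# :+ Κ 0#))) :* x) :+ (:- κ 21 1) :* (Κ 1# :* (i :+ (Κ 1# :+ Κ 0#)) :* x) :+ κ 4 1 :* (Κ 1# :* x)) refl _ _)) · sum-+ (λ i -> c 9 1 * (g₁.ρ 2 i * q ^ i) + (- c 21 1) * (g₁.ρ 1 i * q ^ i)) (λ i -> c 4 1 * (g₁.ρ 0 i * q ^ i)) m · (cong₂ _+_ (sum-+ (λ i -> c 9 1 * (g₁.ρ 2 i * q ^ i)) (λ i -> (- c 21 1) * (g₁.ρ 1 i * q ^ i)) m · (cong₂ _+_ (sum-*ˡ (c 9 1) (λ i -> g₁.ρ 2 i * q ^ i) m)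
       (sum-*ˡ (- c 21 1) (λ i -> g₁.ρ 1 i * q ^ i) m · solve 1 (λ s -> (:- κ 21 1) :* s := :- (κ 21 1 :* s)) refl _)))
      (sum-*ˡ (c 4 1) (λ i -> g₁.ρ 0 i * q ^ i) m))
  B≤ : B ≤ c 2305 1000 * K³
  B≤ = sum-mono n (λ i _ -> ≤-trans (*≤ˡ (sq₀ (q ^ i)) (cong (λ p -> p * p) (ι-a i) ≡» gap≤ (lit *₀ ι₀ i +₀ lit *₀ ι₀ i +₀ lit) (solve 1 (λ i -> κ 9 1 :* (Κ 1# :* (i :+ (Κ 1# :+ Κ 0#)) :* (i :+ (Κ 1# :+ (Κ 1# :+ Κ 0#)))) := (Κ 1# :+ κ 3 1 :* i) :* (Κ 1# :+ κ 3 1 :* i) :+ (κ 9 1 :* i :+ κ 12 1 :* i :+ κ 17 1)) refl _))) (of≡ (*-assoc (c 9 1) (g₂.ρ 2 i) (q ^ i * q ^ i) · cong (λ p -> c 9 1 * (g₂.ρ 2 i * p)) (sym (qq^ i))))) » sum-*ˡ (c 9 1) (λ i -> g₂.ρ 2 i * q² ^ i) n ≡» *≤ʳ lit (g₂.S≤ 2 n) » cong (λ f -> c 9 1 * (f * K₂ ^ 3)) (solve 0 ((Κ 1# :+ (Κ 1# :+ Κ 0#)) :* ((Κ 1# :+ Κ 0#) :* Κ 1#) := κ 2 1) refl) ≡» *≤ʳ lit (*≤ʳ lit (^-mono 3 K₂₀ K₂≤)) » gap≤ (lit *₀ K³₀) (solve 1 (λ K -> κ 2305 1000 :* (K :* K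 :* K) := κ 9 1 :* (κ 2 1 :* (κ 504 1000 :* K :* (κ 504 1000 :* K :* (κ 504 1000 :* K :* Κ 1#)))) :+ κ 8857 15625000 :* (K :* K :* K)) refl K)
  x* : ℕ -> ℚ
  x* i = r * q ^ i
  x*≤ : ∀ i -> x* i ≤ x i
  x*≤ i = *≤ʳ r₀ (^-mono i q₀ hq »≡ sym (pow3 r i))
  ρ* : ℕ -> ℚ
  ρ* i = r * r * q ^ i
  ρ*₀ : ∀ i -> 0# ≤ ρ* i
  ρ*₀ i = r₀ *₀ r₀ *₀ ^₀ i q₀
  ρ*≤ : ∀ i -> ρ* i ≤ r ^ b i
  ρ*≤ i = *-assoc r r (q ^ i) ≡» *≤ʳ r₀ (x*≤ i)
  r²≥ : c 9908 10000 ≤ r * r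
  r²≥ = lit » *≡ (c 9954 10000) (c 9954 10000) ≡» *≤ lit r₀ hr hr
  -- With n ≤ 1 + X + X², the quotient of X + 4X² + X³ by its square is at least X - X²/3 on [0, 1].
  -- That quadratic increases there, so X may be lowered to the geometric term `x* i`.
  V̂≥ : ∀ i -> r * r * (a² i * (x* i - c 1 3 * (x* i * x* i))) ≤ V̂ i
  V̂≥ i = *≤ʳ (r₀ *₀ r₀) (*≤ʳ (sq₀ (ι (a i))) mono) » core » *≤ˡ (sq₀ (u i)) terms
   where
   X Y u² : ℚ
   X = x i
   Y = x* i
   u² = u i * u i
   mono : Y - c 1 3 * (Y * Y) ≤ X - c 1 3 * (X * X)
   mono = gap≤ (gap (x*≤ i) *₀ (lit +₀ lit *₀ gap (x≤1 i) +₀ lit *₀ gap (x*≤ i » x≤1 i))) (solve 2 (λ X Y -> X :- κ 1 3 :* (X :* X) := Y :- κ 1 3 :* (Y :* Y) :+ (X :- Y) :* (κ 1 3 :+ κ 1 3 :* (Κ 1# :- X) :+ κ 1 3 :* (Κ 1# :- Y))) refl X Y)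
   ν≤ : ν i ≤ 1# + X + X * X
   ν≤ = gap≤ (lit *₀ t₀ *₀ x₀ i +₀ t₀ *₀ sq₀ X) (solve 2 (λ r X -> Κ 1# :+ X :+ X :* X := Κ 1# :+ κ 1 2 :* (Κ 1# :+ r) :* X :+ r :* (X :* X) :+ (κ 1 2 :* (Κ 1# :- r) :* X :+ (Κ 1# :- r) :* (X :* X))) refl r X)
   poly : ℚ
   poly = X + c 4 1 * (X * X) + X * X * X
   core : r * r * (a² i * (X - c 1 3 * (X * X))) ≤ r * r * (a² i * poly) * u²
   core = solve 3 (λ r a p -> r :* (a :* p) := r :* (a :* (p :* (Κ 1# :* Κ 1#)))) refl _ _ _ · cong₂ (λ p q -> r * r * (a² i * ((X - c 1 3 * (X * X)) * (p * q)))) (sym (νu i)) (sym (νu i)) · solve 5 (λ r a p n u -> r :* (a :* (p :* (n :* u :* (n :* u)))) := r :* (a :* (p :* (n :* n))) :* (u :* u)) refl _ _ _ _ _ ≡» *≤ˡ (sq₀ (u i)) (*≤ʳ (r₀ *₀ r₀) (*≤ʳ (sq₀ (ι (a i)))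
    (*≤ʳ p₀ (*≤ (<⇒≤ (n₊ i)) (lit +₀ x₀ i +₀ sq₀ X) ν≤ ν≤) » gap≤ (sq₀ X *₀ gap (x≤1 i) *₀ (lit +₀ x₀ i +₀ lit *₀ gap (x≤1 i) *₀ (lit +₀ x₀ i +₀ sq₀ X))) (solve 1 (λ X -> X :+ κ 4 1 :* (X :* X) :+ X :* X :* X := (X :- κ 1 3 :* (X :* X)) :* ((Κ 1# :+ X :+ X :* X) :* (Κ 1# :+ X :+ X :* X)) :+ X :* X :* (Κ 1# :- X) :* (κ 2 1 :+ X :+ κ 1 3 :* (Κ 1# :- X) :* (Κ 1# :+ X :+ X :* X))) refl X))))
    where
    p₀ : 0# ≤ X - c 1 3 * (X * X)
    p₀ = subst (0# ≤_) (solve 1 (λ X -> X :* (κ 2 3 :+ κ 1 3 :* (Κ 1# :- X)) := X :- κ 1 3 :* (X :* X)) refl X) (x₀ i *₀ (lit +₀ lit *₀ gap (x≤1 i)))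
   terms : r * r * (a² i * poly) ≤ A₁ i * a² i + A₁ i * A₂ i * (ι (b i) * ι (b i)) + A₂ i * (ι (e i) * ι (e i))
   terms = gap≤ (t₀ *₀ (lit +₀ r₀) *₀ x₀ i *₀ sq₀ (ι (a i)) +₀ lit *₀ r₀ *₀ t₀ *₀ sq₀ X *₀ sq₀ (ι (a i)) +₀ lit *₀ r₀ *₀ t₀ *₀ (sq₀ X *₀ x₀ i) *₀ sq₀ (ι (a i))) (solve 3 (λ r X A -> κ 1 2 :* (Κ 1# :+ r) :* X :* A :+ κ 1 2 :* (Κ 1# :+ r) :* X :* (r :* (X :* X)) :* A :+ r :* (X :* X) :* (κ 4 1 :* A) :=
      r :* r :* (A :* (X :+ κ 4 1 :* (X :* X) :+ X :* X :* X)) :+ ((Κ 1# :- r) :* (κ 1 2 :+ r) :* X :* A :+ κ 4 1 :* r :* (Κ 1# :- r) :* (X :* X) :* A :+ κ 1 2 :* r :* (Κ 1# :- r) :* (X :* X :* X) :* A)) refl r X _) » +≤ (+≤ ≤-refl (*≤ʳ (A₁₀ i *₀ A₂₀ i) (*≤ (ι₀ (a i)) (ι₀ (b i)) ab ab)))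
     (*≤ʳ (A₂₀ i) (solve 1 (λ a -> κ 4 1 :* (a :* a) := (a :+ a) :* (a :+ a)) refl _ ≡» *≤ (ι₀ (a i) +₀ ι₀ (a i)) (ι₀ (e i)) ae ae))
    where
    ab : ι (a i) ≤ ι (b i)
    ab = ι-mono (ℕP.n≤1+n (a i))
    ae : ι (a i) + ι (a i) ≤ ι (e i)
    ae = +≤ ≤-refl ab »≡ sym (ι-+ (a i) (b i))
  neg-mono : ∀ {x y} -> x ≤ y -> - y ≤ - x
  neg-mono {x} {y} h = gap≤ (gap h) (solve 2 (λ x y -> :- x := :- y :+ (y :- x)) refl x y)
  V≥ : cV * K³ ≤ V n
  V≥ = (*≤ˡ K³₀ hV » *-assoc (c 9908 10000) (c 9954 10000 * cA - c 769 1000) K³ ≡» *≤ lit low₀ r²≥ low) » sym total≡ ≡» sum-mono n (λ i _ -> V̂≥ i)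
   where
   A₀ : 0# ≤ A
   A₀ = sum₀ n (λ i -> sq₀ _ *₀ ^₀ i q₀)
   low : (c 9954 10000 * cA - c 769 1000) * K³ ≤ r * A - c 1 3 * (r * r * B)
   low = solve 2 (λ a k -> (κ 9954 10000 :* a :- κ 769 1000) :* k := κ 9954 10000 :* (a :* k) :- κ 769 1000 :* k) refl cA K³ ≡» +≤ (*≤ lit A₀ hr A≥) (neg-mono (*≤ʳ lit (*≤ (r₀ *₀ r₀) (lit *₀ K³₀) (*≤ r₀ lit r₁ r₁ »≡ *-1ˡ 1#) B≤ » ≤-refl) » gap≤ (lit *₀ K³₀) (solve 1 (λ k -> κ 769 1000 :* k := κ 1 3 :* (Κ 1# :* (κ 2305 1000 :* k)) :+ κ 1 1500 :* k) refl K³)))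
   low₀ : 0# ≤ r * A - c 1 3 * (r * r * B)
   low₀ = (≤-trans lit (of≡ (solve 0 (Κ (c 9954 10000 ℚ.- c 769 1000) := κ 9954 10000 :* κ 1 1 :- κ 769 1000) refl)) *₀ K³₀) » *≤ˡ K³₀ (+≤ (*≤ʳ lit cA₀) ≤-refl) » low
   total≡ : sum (λ i -> r * r * (a² i * (x* i - c 1 3 * (x* i * x* i)))) n ≡ r * r * (r * A - c 1 3 * (r * r * B))
   total≡ = sum-*ˡ (r * r) (λ i -> a² i * (x* i - c 1 3 * (x* i * x* i))) n · cong (r * r *_)
    (sum-cong n (λ i -> solve 3 (λ r s p -> s :* (r :* p :- κ 1 3 :* (r :* p :* (r :* p))) := r :* (s :* p) :+ (:- (κ 1 3 :* (r :* r))) :* (s :* (p :* p))) refl r _ _) · sum-+ (λ i -> r * (a² i * q ^ i)) (λ i -> (- (c 1 3 * (r * r))) * (a² i * (q ^ i * q ^ i))) n · (cong₂ _+_ (sum-*ˡ r (λ i -> a² i * q ^ i) n) (sum-*ˡ (- (c 1 3 * (r * r))) (λ i -> a² i * (q ^ i * q ^ i)) n)) · solve 3 (λ r A B -> r :* A :+ (:- (κ 1 3 :* (r :* r))) :* B := r :* A :- κ 1 3 :* (r :* r :* B)) refl r A B)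
  Vₚ : ℕ -> ℚ
  Vₚ = sum (λ i -> W (b i) * a² i)
  W≥ : ∀ i l -> G (ρ* i) * l ≤ ρ* i -> l ≤ W (b i)
  W≥ i l = weight≥ l (ρ*₀ i) (ρ*≤ i) (^≤1 (b i) r₀ r₁) (GW (b i))
  r⁴≤1 : r * r * (r * r) ≤ 1#
  r⁴≤1 = *≤ (r₀ *₀ r₀) lit r²≤1 r²≤1 »≡ *-1ˡ 1#
   where
   r²≤1 : r * r ≤ 1#
   r²≤1 = *≤ r₀ lit r₁ r₁ »≡ *-1ˡ 1#
  Vₚ≥ : cP * K³ ≤ Vₚ n
  Vₚ≥ = (*≤ˡ K³₀ hP » solve 2 (λ a k -> (κ 9908 10000 :* a :- κ 2305 1000) :* k := κ 9908 10000 :* (a :* k) :- Κ 1# :* (κ 2305 1000 :* k)) refl cA K³ ≡» +≤ (*≤ lit (sum₀ n (λ i -> sq₀ _ *₀ ^₀ i q₀)) r²≥ A≥) (neg-mono (*≤ (r₀ *₀ r₀ *₀ (r₀ *₀ r₀)) (lit *₀ K³₀) r⁴≤1 B≤))) » sym total≡ ≡» sum-mono n (λ i _ -> *≤ˡ (sq₀ (ι (a i))) (W≥ i (ρ* i - ρ* i * ρ* i) (weight-linear (ρ* i) (ρ*₀ i))))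
   where
   total≡ : sum (λ i -> (ρ* i - ρ* i * ρ* i) * a² i) n ≡ r * r * A - r * r * (r * r) * B
   total≡ = sum-cong n (λ i -> solve 3 (λ r s p -> (r :* p :- r :* p :* (r :* p)) :* s := r :* (s :* p) :+ (:- (r :* r)) :* (s :* (p :* p))) refl _ _ _) · sum-+ (λ i -> r * r * (a² i * q ^ i)) (λ i -> (- (r * r * (r * r))) * (a² i * (q ^ i * q ^ i))) n · (cong₂ _+_ (sum-*ˡ (r * r) (λ i -> a² i * q ^ i) n) (sum-*ˡ (- (r * r * (r * r))) (λ i -> a² i * (q ^ i * q ^ i)) n)) · solve 3 (λ r A B -> r :* A :+ (:- (r :* r)) :* B := r :* A :- r :* r :* B) refl _ A B
  Ω≥ : cΩ * K ≤ Ω n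
  Ω≥ = (*≤ˡ K₀ hΩ » solve 2 (λ e k -> (κ 44 49 :* (κ 9908 10000 :* (Κ 1# :- e)) :- κ 32 49 :* κ 504 1000) :* k := κ 44 49 :* (κ 9908 10000 :* (k :* (Κ 1# :- e))) :- κ 32 49 :* (Κ 1# :* (κ 504 1000 :* k))) refl ε K ≡» +≤ (*≤ʳ lit (*≤ lit (g₁.S₀ 0 n) r²≥ (L.S0≥ » sum-≤n (λ i -> 1# * q ^ i) (λ i -> lit *₀ ^₀ i q₀) m≤n)))
   (neg-mono (*≤ʳ lit (*≤ (r₀ *₀ r₀ *₀ (r₀ *₀ r₀)) (lit *₀ K₀) r⁴≤1 S2≤)))) » sym total≡ ≡» sum-mono n (λ i _ -> W≥ i (c 44 49 * ρ* i - c 32 49 * (ρ* i * ρ* i)) (weight-tangent (ρ* i) (ρ*₀ i)))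
   where
   S2≤ : g₂.S 0 n ≤ c 504 1000 * K
   S2≤ = g₂.S≤ 0 n » solve 1 (λ k -> Κ 1# :* (k :* Κ 1#) := k) refl K₂ ≡» K₂≤
   total≡ : sum (λ i -> c 44 49 * ρ* i - c 32 49 * (ρ* i * ρ* i)) n ≡ c 44 49 * (r * r * g₁.S 0 n) - c 32 49 * (r * r * (r * r) * g₂.S 0 n)
   total≡ = sum-cong n (λ i -> trans (solve 2 (λ r p -> κ 44 49 :* (r :* p) :- κ 32 49 :* (r :* p :* (r :* p)) := κ 44 49 :* r :* (Κ 1# :* p) :+ (:- (κ 32 49 :* (r :* r))) :* (Κ 1# :* (p :* p))) refl _ _) (cong (λ s -> c 44 49 * (r * r) * (1# * q ^ i) + (- (c 32 49 * (r * r * (r * r)))) * (1# * s)) (sym (qq^ i)))) · sum-+ (λ i -> c 44 49 * (r * r) * (1# * q ^ i)) (λ i -> (- (c 32 49 * (r * r * (r * r)))) * (1# * q² ^ i)) n · (cong₂ _+_ (sum-*ˡ (c 44 49 * (r * r)) (λ i -> 1# * q ^ i) n) (sum-*ˡ (- (c 32 49 * (r * r * (r * r)))) (λ i -> 1# * q² ^ i) n)) · solve 3 (λ r A B -> κ 44 49 :* r :* A :+ (:- (κ 32 49 :* (r :* r))) :* B := κ 44 49 :* (r :* A) :- κ 32 49 :* (r :* r :* B)) refl _ _ _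

-- Upper bounds when the geometric series converges

module N3 where
 open Q1
 open E1
 open U1
 open P1
 open R1
 open N1
 open N2
 scale≤ : ∀ {p q} X -> 0# ≤ X -> p ≤ q -> p * X ≤ q * X
 scale≤ X h l = *≤ˡ h l
 ≤1* : ∀ {p} X -> 0# ≤ X -> p ≤ 1# -> p * X ≤ X
 ≤1* X h l = scale≤ X h l »≡ *-1ˡ X
 module Common (r : ℚ) (r₊ : 0# < r) (r₁ : r ≤ 1#) (hr : c 9954 10000 ≤ r) where
  open Weights r r₊ r₁ public using (r₀; W; W₀; GW; W≤⅓; Ω; G₊)
  open Main r r₊ r₁ public using (x; x₀; x≤1; A₁; A₂; V; V̂; V̂₀; M₄; M̂; n₊; t₀; t; λ'; A₁₀; A₂₀; S₁; S₂; k₁; μ; μ̂) renaming (n to ν; v to u; v₀ to u₀; nv to νu)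
  r²≥ : c 9908 10000 ≤ r * r
  r²≥ = lit » *≡ (c 9954 10000) (c 9954 10000) ≡» *≤ lit r₀ hr hr
  g : ℕ -> ℚ
  g i = G (x i)
  g₊ : ∀ i -> 0# < g i
  g₊ i = G₊ (a i)
  -- Lets every upper estimate use the denominator 1 + x + x², at the price of a factor r, which is
  -- close to 1.
  rg≤ν : ∀ i -> r * g i ≤ ν i
  rg≤ν i = gap≤ (t₀ *₀ (lit +₀ lit *₀ x₀ i)) (solve 2 (λ r x -> Κ 1# :+ κ 1 2 :* (Κ 1# :+ r) :* x :+ r :* (x :* x) := r :* (Κ 1# :+ x :+ x :* x) :+ (Κ 1# :- r) :* (Κ 1# :+ κ 1 2 :* x)) refl r _)
  over : ∀ i p q -> 0# ≤ q -> p ≤ q * g i -> r * (p * u i) ≤ q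
  over i p q q₀ h = *≤ʳ r₀ (*≤ˡ (u₀ i) h) » solve 4 (λ r q g u -> r :* (q :* g :* u) := q :* (r :* g :* u)) refl r q _ _ ≡» *≤ʳ q₀ (*≤ˡ (u₀ i) (rg≤ν i) »≡ νu i) »≡ *-1ʳ q
  over² : ∀ i p q -> 0# ≤ q -> p ≤ q * (g i * g i) -> r * r * (p * (u i * u i)) ≤ q
  over² i p q q₀ h = *≤ʳ (r₀ *₀ r₀) (*≤ˡ (sq₀ (u i)) h) » solve 4 (λ r q g u -> r :* r :* (q :* (g :* g) :* (u :* u)) := q :* ((r :* g :* u) :* (r :* g :* u))) refl r q _ _ ≡» *≤ʳ q₀ (*≤ (r₀ *₀ <⇒≤ (g₊ i) *₀ u₀ i) lit one one »≡ *-1ˡ 1#) »≡ *-1ʳ q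
   where
   one : r * g i * u i ≤ 1#
   one = *≤ˡ (u₀ i) (rg≤ν i) »≡ νu i
  I : ℕ -> ℚ
  I i = 1# + ι i
  I₀ : ∀ i -> 0# ≤ I i
  I₀ i = lit +₀ ι₀ i
  a≤ : ∀ i -> ι (a i) ≤ c 3 1 * I i
  a≤ i = ι-a i ≡» gap≤ lit (solve 1 (λ i -> κ 3 1 :* (Κ 1# :+ i) := Κ 1# :+ κ 3 1 :* i :+ κ 2 1) refl _)
  b≤ : ∀ i -> ι (b i) ≤ c 3 1 * I i
  b≤ i = ι-b i ≡» gap≤ lit (solve 1 (λ i -> κ 3 1 :* (Κ 1# :+ i) := κ 2 1 :+ κ 3 1 :* i :+ κ 1 1) refl _)
  e≤ : ∀ i -> ι (e i) ≤ c 6 1 * I i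
  e≤ i = ι-e i ≡» gap≤ lit (solve 1 (λ i -> κ 6 1 :* (Κ 1# :+ i) := κ 3 1 :+ κ 6 1 :* i :+ κ 3 1) refl _)
  sq≤ : ∀ {x y} -> 0# ≤ x -> x ≤ y -> x * x ≤ y * y
  sq≤ x₀ h = *≤ x₀ (x₀ » h) h h
  λ≤1 : λ' ≤ 1#
  λ≤1 = gap≤ (lit *₀ t₀) (solve 1 (λ r -> Κ 1# := κ 1 2 :* (Κ 1# :+ r) :+ κ 1 2 :* (Κ 1# :- r)) refl r)
  A₁≤ : ∀ i -> A₁ i ≤ x i
  A₁≤ i = ≤1* (x i) (x₀ i) λ≤1
  A₂≤ : ∀ i -> A₂ i ≤ x i * x i
  A₂≤ i = ≤1* (x i * x i) (sq₀ (x i)) r₁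
  A₁₂≤ : ∀ i -> A₁ i * A₂ i ≤ x i * (x i * x i)
  A₁₂≤ i = *≤ (A₁₀ i) (sq₀ (x i)) (A₁≤ i) (A₂≤ i)
  V̂≤ : ∀ i -> r * r * V̂ i ≤ c 9 1 * (I i * I i) * (x i + c 2 1 * (x i * x i))
  V̂≤ i = over² i _ _ (lit *₀ sq₀ (I i) *₀ (x₀ i +₀ lit *₀ sq₀ (x i)))
   (+≤ (+≤ (*≤ (A₁₀ i) (sq₀ (c 3 1 * I i)) (A₁≤ i) (sq≤ (ι₀ (a i)) (a≤ i))) (*≤ (A₁₀ i *₀ A₂₀ i) (sq₀ (c 3 1 * I i)) (A₁₂≤ i) (sq≤ (ι₀ (b i)) (b≤ i))))
    (*≤ (A₂₀ i) (sq₀ (c 6 1 * I i)) (A₂≤ i) (sq≤ (ι₀ (e i)) (e≤ i))) » gap≤ (lit *₀ sq₀ (I i) *₀ (sq₀ X *₀ x₀ i *₀ (lit +₀ lit *₀ x₀ i +₀ lit *₀ sq₀ X +₀ lit *₀ (sq₀ X *₀ x₀ i)))) (solve 2 (λ I X -> κ 9 1 :* (I :* I) :* (X :+ κ 2 1 :* (X :* X)) :* ((Κ 1# :+ X :+ X :* X) :* (Κ 1# :+ X :+ X :* X)) :=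
      X :* (κ 3 1 :* I :* (κ 3 1 :* I)) :+ X :* (X :* X) :* (κ 3 1 :* I :* (κ 3 1 :* I)) :+ X :* X :* (κ 6 1 :* I :* (κ 6 1 :* I)) :+
      κ 9 1 :* (I :* I) :* (X :* X :* X :* (κ 6 1 :+ κ 8 1 :* X :+ κ 5 1 :* (X :* X) :+ κ 2 1 :* (X :* X :* X)))) refl _ X))
   where
   X : ℚ
   X = x i
  M̂≤ : ∀ i -> r * r * M̂ i ≤ c 81 1 * (I i * I i * (I i * I i)) * (x i + c 14 1 * (x i * x i))
  M̂≤ i = over² i _ _ (lit *₀ sq₀ (I i * I i) *₀ (x₀ i +₀ lit *₀ sq₀ (x i)))
   (+≤ (+≤ (*≤ (A₁₀ i) (sq₀ _) (A₁≤ i) (sq≤ (sq₀ _) (sq≤ (ι₀ (a i)) (a≤ i)))) (*≤ (A₁₀ i *₀ A₂₀ i) (sq₀ _) (A₁₂≤ i) (sq≤ (sq₀ _) (sq≤ (ι₀ (b i)) (b≤ i)))))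
    (*≤ (A₂₀ i) (sq₀ _) (A₂≤ i) (sq≤ (sq₀ _) (sq≤ (ι₀ (e i)) (e≤ i)))) » gap≤ (lit *₀ sq₀ (I i * I i) *₀ (sq₀ X *₀ x₀ i *₀ (lit +₀ lit *₀ x₀ i +₀ lit *₀ sq₀ X +₀ lit *₀ (sq₀ X *₀ x₀ i)))) (solve 2 (λ I X -> let p = κ 3 1 :* I ; q = κ 6 1 :* I in κ 81 1 :* (I :* I :* (I :* I)) :* (X :+ κ 14 1 :* (X :* X)) :* ((Κ 1# :+ X :+ X :* X) :* (Κ 1# :+ X :+ X :* X)) :=
      X :* (p :* p :* (p :* p)) :+ X :* (X :* X) :* (p :* p :* (p :* p)) :+ X :* X :* (q :* q :* (q :* q)) :+
      κ 81 1 :* (I :* I :* (I :* I)) :* (X :* X :* X :* (κ 30 1 :+ κ 44 1 :* X :+ κ 29 1 :* (X :* X) :+ κ 14 1 :* (X :* X :* X)))) refl _ X))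
   where
   X : ℚ
   X = x i
  xu≤ : ∀ i -> r * (x i * u i) ≤ x i - c 2 3 * (x i * x i)
  xu≤ i = over i (x i) (x i - c 2 3 * (x i * x i)) nn
   (gap≤ (lit *₀ sq₀ X *₀ (gap (x≤1 i) *₀ (lit +₀ lit *₀ x₀ i))) (solve 1 (λ X -> (X :- κ 2 3 :* (X :* X)) :* (Κ 1# :+ X :+ X :* X) := X :+ κ 1 3 :* (X :* X) :* ((Κ 1# :- X) :* (Κ 1# :+ κ 2 1 :* X))) refl X))
   where
   X : ℚ
   X = x i
   nn : 0# ≤ x i - c 2 3 * (x i * x i)
   nn = subst (0# ≤_) (solve 1 (λ X -> X :* (κ 1 3 :+ κ 2 3 :* (Κ 1# :- X)) := X :- κ 2 3 :* (X :* X)) refl X) (x₀ i *₀ (lit +₀ lit *₀ gap (x≤1 i)))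
 module UpperI (r : ℚ) (r₊ : 0# < r) (r₁ : r ≤ 1#) (hr : c 9954 10000 ≤ r) (K : ℚ) (yK : (1# - r * (r * r)) * K ≡ 1#) (hK : c 747 10 ≤ K) where
  open Common r r₊ r₁ hr
  y : ℚ
  y = r * (r * r)
  y₀ : 0# ≤ y
  y₀ = r₀ *₀ (r₀ *₀ r₀)
  open Base y K y₀ yK hK
  x≤y : ∀ i -> x i ≤ y ^ i
  x≤y i = ≤1* (r ^ t3 i) (^₀ (t3 i) r₀) r₁ »≡ pow3 r i
  x²≤y : ∀ i -> x i * x i ≤ q² ^ i
  x²≤y i = sq≤ (x₀ i) (x≤y i) »≡ sym (qq^ i)
  y^₀ : ∀ i -> 0# ≤ y ^ i
  y^₀ i = ^₀ i y₀
  q²^₀ : ∀ i -> 0# ≤ q² ^ i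
  q²^₀ i = ^₀ i (y₀ *₀ y₀)
  I²≤ : ∀ i -> I i * I i ≤ g₁.ρ 2 i
  I²≤ i = gap≤ (I₀ i) (solve 1 (λ i -> Κ 1# :* (i :+ (Κ 1# :+ Κ 0#)) :* (i :+ (Κ 1# :+ (Κ 1# :+ Κ 0#))) := (Κ 1# :+ i) :* (Κ 1# :+ i) :+ (Κ 1# :+ i)) refl _)
  I⁴≤ : ∀ i -> I i * I i * (I i * I i) ≤ g₁.ρ 4 i
  I⁴≤ i = gap≤ (I₀ i *₀ I₀ i *₀ (lit *₀ I₀ i +₀ lit) +₀ lit *₀ I₀ i) (solve 1 (λ i -> let o = Κ 1# :+ Κ 0# ; J = Κ 1# :+ i in Κ 1# :* (i :+ o) :* (i :+ (Κ 1# :+ o)) :* (i :+ (Κ 1# :+ (Κ 1# :+ o))) :* (i :+ (Κ 1# :+ (Κ 1# :+ (Κ 1# :+ o)))) :=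
    J :* J :* (J :* J) :+ (J :* J :* (κ 6 1 :* J :+ κ 11 1) :+ κ 6 1 :* J)) refl _)
   where
   J : ℚ
   J = I i
  K³ K⁵ : ℚ
  K³ = K * K * K
  K⁵ = K * K * K * (K * K)
  K³₀ : 0# ≤ K³
  K³₀ = K₀ *₀ K₀ *₀ K₀
  K⁵₀ : 0# ≤ K⁵
  K⁵₀ = K³₀ *₀ (K₀ *₀ K₀)
  S2y S4y S2q S4q : ∀ n -> ℚ
  S2y n = g₁.S 2 n
  S4y n = g₁.S 4 n
  S2q n = g₂.S 2 n
  S4q n = g₂.S 4 n
  S2y≤ : ∀ n -> S2y n ≤ c 2 1 * K³
  S2y≤ n = g₁.S≤ 2 n »≡ solve 1 (λ K -> (Κ 1# :+ (Κ 1# :+ Κ 0#)) :* ((Κ 1# :+ Κ 0#) :* Κ 1#) :* (K :* (K :* (K :* Κ 1#))) := κ 2 1 :* (K :* K :* K)) refl K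
  S2q≤ : ∀ n -> S2q n ≤ c 257 1000 * K³
  S2q≤ n = g₂.S≤ 2 n » *≤ʳ (ι₀ 2 *₀ (ι₀ 1 *₀ lit)) (^-mono 3 K₂₀ K₂≤) » gap≤ (lit *₀ K³₀) (solve 1 (λ K -> κ 257 1000 :* (K :* K :* K) := (Κ 1# :+ (Κ 1# :+ Κ 0#)) :* ((Κ 1# :+ Κ 0#) :* Κ 1#) :* (κ 504 1000 :* K :* (κ 504 1000 :* K :* (κ 504 1000 :* K :* Κ 1#))) :+ κ 14873 15625000 :* (K :* K :* K)) refl K)
  private
   o₁ o₂ o₃ o₄ : Expr ℚ 1
   o₁ = Κ 1# :+ Κ 0#
   o₂ = Κ 1# :+ o₁
   o₃ = Κ 1# :+ o₂
   o₄ = Κ 1# :+ o₃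
   f₄ : Expr ℚ 1
   f₄ = o₄ :* (o₃ :* (o₂ :* (o₁ :* Κ 1#)))
  S4y≤ : ∀ n -> S4y n ≤ c 24 1 * K⁵
  S4y≤ n = g₁.S≤ 4 n »≡ solve 1 (λ K -> f₄ :* (K :* (K :* (K :* (K :* (K :* Κ 1#))))) := κ 24 1 :* (K :* K :* K :* (K :* K))) refl K
  S4q≤ : ∀ n -> S4q n ≤ c 781 1000 * K⁵
  S4q≤ n = g₂.S≤ 4 n » *≤ʳ (ι₀ 4 *₀ (ι₀ 3 *₀ (ι₀ 2 *₀ (ι₀ 1 *₀ lit)))) (^-mono 5 K₂₀ K₂≤) » gap≤ (lit *₀ K⁵₀) (solve 1 (λ K -> let k = κ 504 1000 :* K in κ 781 1000 :* (K :* K :* K :* (K :* K)) := f₄ :* (k :* (k :* (k :* (k :* (k :* Κ 1#))))) :+ κ 126011869 244140625000 :* (K :* K :* K :* (K :* K))) refl K)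
  clear : ∀ {X Y} p s -> 0# ≤ X -> 0# ≤ Y -> p ≤ c 9908 10000 * s -> r * r * X ≤ p * Y -> X ≤ s * Y
  clear {X} {Y} p s X₀ Y₀ h l = cancel≤ {c 9908 10000} (ℚP.positive⁻¹ (c 9908 10000)) (scale≤ X X₀ r²≥ » l » scale≤ Y Y₀ h »≡ *-assoc (c 9908 10000) s Y)
  V≤ : ∀ n -> V n ≤ c 229 10 * K³
  V≤ n = clear (c 22626 1000) (c 229 10) (sum₀ n V̂₀) K³₀ (lit »≡ *≡ _ _) (sym (sum-*ˡ (r * r) V̂ n) ≡» sum-mono n (λ i _ -> ≤-trans (V̂≤ i)
    (*≤ (lit *₀ sq₀ (I i)) (y^₀ i +₀ lit *₀ q²^₀ i) (*≤ʳ lit (I²≤ i)) (+≤ (x≤y i) (*≤ʳ lit (x²≤y i))) »≡ solve 3 (λ s p q -> κ 9 1 :* s :* (p :+ κ 2 1 :* q) := κ 9 1 :* (s :* p) :+ κ 18 1 :* (s :* q)) refl _ _ _)) » sum-+ (λ i -> c 9 1 * (g₁.ρ 2 i * y ^ i)) (λ i -> c 18 1 * (g₁.ρ 2 i * q² ^ i)) n · (cong₂ _+_ (sum-*ˡ (c 9 1) _ n) (sum-*ˡ (c 18 1) _ n)) ≡» +≤ (*≤ʳ lit (S2y≤ n)) (*≤ʳ lit (S2q≤ n)) »≡ solve 1 (λ k -> κ 9 1 :* (κ 2 1 :* k) :+ κ 18 1 :* (κ 257 1000 :* k) := κ 22626 1000 :* k) refl K³)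
  M₄≤ : ∀ n -> M₄ n ≤ c 2858 1 * K⁵
  M₄≤ n = clear (c 2829654 1000) (c 2858 1) (sum₀ n M̂₀) K⁵₀ (lit »≡ *≡ _ _) (sym (sum-*ˡ (r * r) M̂ n) ≡» sum-mono n (λ i _ -> ≤-trans (M̂≤ i)
    (*≤ (lit *₀ sq₀ (I i * I i)) (y^₀ i +₀ lit *₀ q²^₀ i) (*≤ʳ lit (I⁴≤ i)) (+≤ (x≤y i) (*≤ʳ lit (x²≤y i))) »≡ solve 3 (λ s p q -> κ 81 1 :* s :* (p :+ κ 14 1 :* q) := κ 81 1 :* (s :* p) :+ κ 1134 1 :* (s :* q)) refl _ _ _)) » sum-+ (λ i -> c 81 1 * (g₁.ρ 4 i * y ^ i)) (λ i -> c 1134 1 * (g₁.ρ 4 i * q² ^ i)) n · (cong₂ _+_ (sum-*ˡ (c 81 1) _ n) (sum-*ˡ (c 1134 1) _ n)) ≡» +≤ (*≤ʳ lit (S4y≤ n)) (*≤ʳ lit (S4q≤ n)) »≡ solve 1 (λ k -> κ 81 1 :* (κ 24 1 :* k) :+ κ 1134 1 :* (κ 781 1000 :* k) := κ 2829654 1000 :* k) refl K⁵)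
   where
   M̂₀ : ∀ i -> 0# ≤ M̂ i
   M̂₀ i = (A₁₀ i *₀ sq₀ _ +₀ A₁₀ i *₀ A₂₀ i *₀ sq₀ _ +₀ A₂₀ i *₀ sq₀ _) *₀ sq₀ (u i)
  module Peak (q k : ℚ) (q₀' : 0# ≤ q) (k₀ : 0# ≤ k) (qk : (1# - q) * k ≡ 1#) (q≤1' : q ≤ 1#) where
   w : ℕ -> ℚ
   w i = c 1 4 * (ι i * (1# - q))
   w₀ : ∀ i -> 0# ≤ w i
   w₀ i = lit *₀ (ι₀ i *₀ gap q≤1')
   -- The fourth-power stand-in for an exponential. Maximising against it gives the constants 1 and
   -- 27/64 where the exponential would give 4/e² and 1/e.
   decay4 : ∀ i -> q ^ i * (1# + w i) ^ 4 ≤ 1#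
   decay4 i = cong (λ s -> q ^ i * (1# + s) ^ 4) (sym ww) ≡» subst (λ p -> p * (1# + ι i * (1# - q) * inv (ι 4) (ι₊ 3)) ^ 4 ≤ 1#) (pc i) (prod-decay (λ _ -> q) i 3 (ι i * (1# - q)) (λ _ -> q₀') (ι₀ i *₀ gap q≤1') (of≡ (sym (sum-const (1# - q) i))))
    where
    ww : ι i * (1# - q) * inv (ι 4) (ι₊ 3) ≡ w i
    ww = cong (ι i * (1# - q) *_) (inv-unique (ι₊ 3) (c 1 4) (solve 0 ((Κ 1# :+ (Κ 1# :+ (Κ 1# :+ (Κ 1# :+ Κ 0#)))) :* κ 1 4 := Κ 1#) refl)) · *-comm _ (c 1 4)
    pc : ∀ n -> prod (λ _ -> q) n ≡ q ^ n
    pc zero = refl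
    pc (suc n) = cong (_* q) (pc n) · *-comm (q ^ n) q
   undo : ∀ i -> ι i ≡ c 4 1 * w i * k
   undo i = sym (solve 3 (λ i q k -> κ 4 1 :* (κ 1 4 :* (i :* (Κ 1# :- q))) :* k := i :* ((Κ 1# :- q) :* k)) refl _ q k · cong (ι i *_) qk · *-1ʳ (ι i))
   square : ∀ i -> ι i * ι i * q ^ i ≤ k * k
   square i = cong (λ s -> s * s * q ^ i) (undo i) · solve 3 (λ w k p -> κ 4 1 :* w :* k :* (κ 4 1 :* w :* k) :* p := k :* k :* (p :* (κ 16 1 :* (w :* w)))) refl _ k _ ≡» *≤ʳ (sq₀ k) (*≤ʳ (^₀ i q₀') (gap≤ (sq₀ (1# - w i) *₀ (sq₀ (1# + w i) +₀ lit *₀ w₀ i)) (solve 1 (λ w -> let v = Κ 1# :+ w in v :* (v :* (v :* (v :* Κ 1#))) := κ 16 1 :* (w :* w) :+ (Κ 1# :- w) :* (Κ 1# :- w) :* (v :* v :+ κ 4 1 :* w)) refl _)) » decay4 i) »≡ *-1ʳ (k * k)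
   linear : ∀ i -> ι i * q ^ i ≤ c 27 64 * k
   linear i = cong (_* q ^ i) (undo i) · solve 3 (λ w k p -> κ 4 1 :* w :* k :* p := κ 27 64 :* k :* (p :* (κ 256 27 :* w))) refl _ k _ ≡» *≤ʳ (lit *₀ k₀) (*≤ʳ (^₀ i q₀') (gap≤ (sq₀ (w i - c 1 3) *₀ (sq₀ (w i) +₀ lit *₀ w₀ i +₀ lit)) (solve 1 (λ w -> let v = Κ 1# :+ w in v :* (v :* (v :* (v :* Κ 1#))) := κ 256 27 :* w :+ (w :- κ 1 3) :* (w :- κ 1 3) :* (w :* w :+ κ 14 3 :* w :+ κ 9 1)) refl _)) » decay4 i) »≡ *-1ʳ (c 27 64 * k)
  module Py = Peak y K y₀ K₀ yK q≤1
  module Pq = Peak q² K₂ (y₀ *₀ y₀) K₂₀ q²K₂ (≤1* y y₀ q≤1 » q≤1)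
  -- Multiplying by r⁶ completes the weights to powers y^(i+1), so the peak bounds apply at i + 1;
  -- dividing by the lower bound for r⁶ gives 13.96.
  V̂-max : ∀ i -> V̂ i ≤ c 1396 100 * (K * K)
  V̂-max i = cancel≤ r⁶₊ ((solve 2 (λ r v -> r :* r :* (r :* r) :* (r :* r) :* v := r :* r :* (r :* r) :* (r :* r :* v)) refl r _ ≡» *≤ʳ (sq₀ (r * r)) (V̂≤ i)) » cong₂ (λ p q -> r * r * (r * r) * (c 9 1 * (I i * I i) * (p + c 2 1 * q))) (cong (r *_) (pow3 r i)) (cong (λ s -> s * s) (cong (r *_) (pow3 r i))) · solve 3 (λ r I p -> r :* r :* (r :* r) :* (κ 9 1 :* (I :* I) :* (r :* p :+ κ 2 1 :* (r :* p :* (r :* p)))) := κ 9 1 :* (r :* r :* (I :* I :* (r :* (r :* r) :* p)) :+ κ 2 1 :* (I :* I :* (r :* (r :* r) :* p :* (r :* (r :* r) :* p))))) refl r _ _ ≡» *≤ʳ lit (+≤ (≤1* _ (sq₀ (I i) *₀ (y₀ *₀ y^₀ i)) (≤1* r r₀ r₁ » r₁) » Py.square (suc i))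
   (*≤ʳ lit (cong (I i * I i *_) (sym (qq^ (suc i))) ≡» Pq.square (suc i) » sq≤ K₂₀ K₂≤ »≡ solve 1 (λ K -> κ 504 1000 :* K :* (κ 504 1000 :* K) := κ 254016 1000000 :* (K :* K)) refl K))) » gap≤ (lit *₀ sq₀ K) (solve 1 (λ k -> κ 13574288 1000000 :* k := κ 9 1 :* (k :+ κ 2 1 :* (κ 254016 1000000 :* k)) :+ κ 2 1000 :* k) refl _) » scale≤ (K * K) (sq₀ K) r⁶lit »≡ *-assoc (r * r * (r * r) * (r * r)) (c 1396 100) (K * K))
   where
   r⁶ : ℚ
   r⁶ = r * r * (r * r) * (r * r)
   r²₊ : 0# < r * r
   r²₊ = r₊ *₊ r₊
   r⁶₊ : 0# < r⁶
   r⁶₊ = (r²₊ *₊ r²₊) *₊ r²₊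
   r⁶lit : c 13574288 1000000 ≤ r⁶ * c 1396 100
   r⁶lit = lit » *≡ _ _ · cong (_* c 1396 100) (*≡ _ _ · cong (_* c 9908 10000) (*≡ _ _)) ≡» scale≤ (c 1396 100) lit (*≤ (lit *₀ lit) (<⇒≤ r²₊) (*≤ lit (<⇒≤ r²₊) r²≥ r²≥) r²≥)
  W≤ : ∀ k -> W k ≤ r ^ k
  W≤ k = (sym (*-1ˡ (W k)) ≡» scale≤ (W k) (W₀ k) (gap≤ (^₀ k r₀ +₀ sq₀ (r ^ k)) (solve 1 (λ x -> Κ 1# :+ x :+ x :* x := Κ 1# :+ (x :+ x :* x)) refl _))) »≡ GW k
  Wb≤ : ∀ i -> W (b i) ≤ y ^ i
  Wb≤ i = W≤ (b i) » ≤1* (x i) (x₀ i) r₁ » x≤y i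
  Mₚ : ℕ -> ℚ
  Mₚ = sum (λ i -> W (b i) * (ι (b i) * ι (b i) * (ι (b i) * ι (b i))))
  Mₚ≤ : ∀ n -> Mₚ n ≤ c 1944 1 * K⁵
  Mₚ≤ n = sum-mono n (λ i _ -> ≤-trans (*≤ (W₀ (b i)) (lit *₀ g₁.ρ₀ 4 i) (Wb≤ i) (sq≤ (sq₀ (ι (b i))) (sq≤ (ι₀ (b i)) (b≤ i)) » solve 1 (λ I -> κ 3 1 :* I :* (κ 3 1 :* I) :* (κ 3 1 :* I :* (κ 3 1 :* I)) := κ 81 1 :* (I :* I :* (I :* I))) refl _ ≡» *≤ʳ lit (I⁴≤ i))) (of≡ (solve 2 (λ p s -> p :* (κ 81 1 :* s) := κ 81 1 :* (s :* p)) refl _ _))) » sum-*ˡ (c 81 1) (λ i -> g₁.ρ 4 i * y ^ i) n ≡» *≤ʳ lit (S4y≤ n) »≡ solve 1 (λ k -> κ 81 1 :* (κ 24 1 :* k) := κ 1944 1 :* k) refl K⁵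
  Ω≤ : ∀ n -> Ω n ≤ K
  Ω≤ n = sum-mono n (λ i _ -> ≤-trans (Wb≤ i) (of≡ (sym (*-1ˡ (y ^ i))))) » g₁.S≤ 0 n »≡ solve 1 (λ k -> Κ 1# :* (k :* Κ 1#) := k) refl K
  Wb-peak : ∀ j -> ι j * W (b j) ≤ c 27 64 * K
  Wb-peak j = *≤ʳ (ι₀ j) (Wb≤ j) » Py.linear j
  tK : t * K * (1# + r + r * r) ≡ 1#
  tK = solve 2 (λ r K -> (Κ 1# :- r) :* K :* (Κ 1# :+ r :+ r :* r) := (Κ 1# :- r :* (r :* r)) :* K) refl r K · yK
  tK₀ : 0# ≤ t * K
  tK₀ = t₀ *₀ K₀
  tK≤ : t * K * c 29862 10000 ≤ 1#
  tK≤ = *≤ʳ tK₀ (lit » +≡ _ _ · cong (_+ c 9908 10000) (+≡ 1# (c 9954 10000)) ≡» +≤ (+≤ ≤-refl hr) r²≥) »≡ tK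
  k₁K≤ : k₁ * K ≤ c 2903 10000
  k₁K≤ = *-assoc (c 13 15) t K · solve 1 (λ s -> κ 13 15 :* s := (κ 13 15 :* κ 10000 29862) :* (s :* κ 29862 10000)) refl _ ≡» *≤ʳ (lit *₀ lit) tK≤ » *-1ʳ _ · sym (*≡ _ _) ≡» lit
  private
   K₂≥ : c 1 2 * K ≤ K₂
   K₂≥ = cancel≤ 1+q₊ ((sym (*-assoc (1# + y) (c 1 2) K) ≡» ≤1* K K₀ (*≤ˡ lit (+≤ ≤-refl q≤1) »≡ solve 0 ((Κ 1# :+ Κ 1#) :* κ 1 2 := Κ 1#) refl)) »≡ sym (solve 3 (λ p k i -> p :* (k :* i) := k :* (p :* i)) refl _ K _ · cong (K *_) (*-inv _ 1+q₊) · *-1ʳ K))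
  S₁≤' : ∀ n -> S₁ n ≤ K * (1# - c 1 3 * r)
  S₁≤' n = cancel≤ r₊ (sym (sum-*ˡ r (λ i -> x i * u i) n) ≡» sum-mono n (λ i _ -> xu≤ i) » total≡ ≡» +≤ (of≡ (cong (r *_) (g₁.S-zero n))) (neg-mono' (*≤ʳ (lit *₀ sq₀ r) (*≤ˡ p²₀ K₂≥ »≡ sym (g₂.S-zero n · cong (λ s -> K₂ * (1# - s)) (qq^ n))))) » gap≤ (r₀ *₀ K₀ *₀ (p₀ *₀ r3 +₀ gap p≤1 *₀ (lit *₀ (r₀ *₀ p₀)))) (solve 3 (λ r K p -> r :* (K :* (Κ 1# :- κ 1 3 :* r)) := r :* (K :* (Κ 1# :- p)) :+ (:- (κ 2 3 :* (r :* r) :* (κ 1 2 :* K :* (Κ 1# :- p :* p)))) :+ r :* K :* (p :* (Κ 1# :- κ 1 3 :* r) :+ (Κ 1# :- p) :* (κ 1 3 :* (r :* p)))) refl r K p))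
   where
   p : ℚ
   p = y ^ n
   p₀ : 0# ≤ p
   p₀ = y^₀ n
   p≤1 : p ≤ 1#
   p≤1 = ^≤1 n y₀ q≤1
   p²₀ : 0# ≤ 1# - p * p
   p²₀ = gap (≤1* p p₀ p≤1 » p≤1)
   r3 : 0# ≤ 1# - c 1 3 * r
   r3 = subst (0# ≤_) (solve 1 (λ r -> κ 2 3 :+ κ 1 3 :* (Κ 1# :- r) := Κ 1# :- κ 1 3 :* r) refl r) (lit +₀ lit *₀ t₀)
   neg-mono' : ∀ {x y} -> x ≤ y -> - y ≤ - x
   neg-mono' {x} {y} h = gap≤ (gap h) (solve 2 (λ x y -> :- x := :- y :+ (y :- x)) refl x y)
   total≡ : sum (λ i -> x i - c 2 3 * (x i * x i)) n ≡ r * g₁.S 0 n + (- (c 2 3 * (r * r) * g₂.S 0 n))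
   total≡ = sum-cong n (λ i -> trans (cong (λ s -> r * s - c 2 3 * (r * s * (r * s))) (pow3 r i)) (solve 2 (λ r p -> r :* p :- κ 2 3 :* (r :* p :* (r :* p)) := r :* (Κ 1# :* p) :+ (:- (κ 2 3 :* (r :* r))) :* (Κ 1# :* (p :* p))) refl r _ · cong (λ s -> r * (1# * y ^ i) + (- (c 2 3 * (r * r))) * (1# * s)) (sym (qq^ i)))) · sum-+ (λ i -> r * (1# * y ^ i)) (λ i -> (- (c 2 3 * (r * r))) * (1# * q² ^ i)) n · (cong₂ _+_ (sum-*ˡ r (λ i -> 1# * y ^ i) n) (sum-*ˡ (- (c 2 3 * (r * r))) (λ i -> 1# * q² ^ i) n)) · solve 4 (λ r s q z -> r :* s :+ (:- q) :* z := r :* s :+ (:- (q :* z))) refl r _ _ _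
  S₁≤ : ∀ n -> S₁ n ≤ c 6682 10000 * K
  S₁≤ n = S₁≤' n » *≤ʳ K₀ (+≤ ≤-refl (gap≤ (lit *₀ gap hr) (solve 1 (λ r -> :- κ 3318 10000 := :- (κ 1 3 :* r) :+ κ 1 3 :* (r :- κ 9954 10000)) refl r)) »≡ solve 0 (Κ 1# :+ (:- κ 3318 10000) := κ 6682 10000) refl) »≡ *-comm K _
  k₁₀ : 0# ≤ k₁
  k₁₀ = lit *₀ t₀
  k₁S₁≤ : ∀ n -> k₁ * S₁ n ≤ c 1947 10000
  k₁S₁≤ n = *≤ʳ k₁₀ (S₁≤ n) » solve 2 (λ k K -> k :* (κ 6682 10000 :* K) := k :* K :* κ 6682 10000) refl k₁ K ≡» *≤ˡ lit k₁K≤ » sym (*≡ _ _) ≡» lit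
  S₂≤ : ∀ n -> S₂ n ≤ c 3028 1000 * (K * K)
  S₂≤ n = clear (c 3 1) (c 3028 1000) (sum₀ n (λ i -> x₀ i *₀ (ι₀ (a i) +₀ sq₀ (x i) *₀ ι₀ (b i)) *₀ sq₀ (u i))) (sq₀ K) (lit »≡ *≡ _ _) (sym (sum-*ˡ (r * r) _ n) ≡» sum-mono n (λ i _ -> ≤-trans (over² i _ (c 3 1 * I i * x i) (lit *₀ I₀ i *₀ x₀ i)
    (*≤ʳ (x₀ i) (+≤ (a≤ i) (*≤ʳ (sq₀ (x i)) (b≤ i))) » gap≤ (lit *₀ I₀ i *₀ x₀ i *₀ (x₀ i *₀ (lit +₀ lit *₀ x₀ i +₀ lit *₀ sq₀ (x i) +₀ sq₀ (x i) *₀ x₀ i))) (solve 2 (λ I x -> κ 3 1 :* I :* x :* ((Κ 1# :+ x :+ x :* x) :* (Κ 1# :+ x :+ x :* x)) := x :* (κ 3 1 :* I :+ x :* x :* (κ 3 1 :* I)) :+ κ 3 1 :* I :* x :* (x :* (κ 2 1 :+ κ 2 1 :* x :+ κ 2 1 :* (x :* x) :+ x :* x :* x))) refl _ _)))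
    (*≤ʳ (lit *₀ I₀ i) (x≤y i) »≡ solve 2 (λ i p -> κ 3 1 :* (Κ 1# :+ i) :* p := κ 3 1 :* (Κ 1# :* (i :+ (Κ 1# :+ Κ 0#)) :* p)) refl _ _)) » sum-*ˡ (c 3 1) (λ i -> g₁.ρ 1 i * y ^ i) n ≡» *≤ʳ lit (g₁.S≤ 1 n »≡ solve 1 (λ K -> (Κ 1# :+ Κ 0#) :* Κ 1# :* (K :* (K :* Κ 1#)) := K :* K) refl K))
  S₁₂≤ : ∀ n -> S₁ n + k₁ * S₂ n ≤ c 15473 10000 * K
  S₁₂≤ n = +≤ (S₁≤ n) (*≤ʳ k₁₀ (S₂≤ n) » solve 2 (λ k K -> k :* (κ 3028 1000 :* (K :* K)) := k :* K :* (κ 3028 1000 :* K)) refl k₁ K ≡» *≤ˡ (lit *₀ K₀) k₁K≤) » solve 1 (λ K -> κ 6682 10000 :* K :+ κ 2903 10000 :* (κ 3028 1000 :* K) := Κ (c 6682 10000 ℚ.+ c 2903 10000 ℚ.* c 3028 1000) :* K) refl K ≡» scale≤ K K₀ lit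

-- Upper bounds under truncation, and the interface of estimates

module N4 where
 open Q1
 open E1
 open U1
 open P1
 open R1
 open N1
 open N2
 open N3
 open import Data.Bool using (T)
 module Ratios (r : ℚ) (r₊ : 0# < r) (r₁ : r ≤ 1#) (hr : c 9954 10000 ≤ r) where
  open Common r r₊ r₁ hr public
  r³≥ : c 9862 10000 ≤ r * (r * r)
  r³≥ = lit » *≡ _ _ ≡» *≤ lit (r₀ *₀ r₀) hr r²≥
  Vₚ Mₚ : ℕ -> ℚ
  Vₚ = sum (λ i -> W (b i) * (ι (a i) * ι (a i)))
  Mₚ = sum (λ i -> W (b i) * (ι (b i) * ι (b i) * (ι (b i) * ι (b i))))
  rWa≤ : ∀ i -> r * W (a i) ≤ W (b i)
  rWa≤ i = cancel≤ (G₊ (b i)) (*≤ˡ (r₀ *₀ W₀ (a i)) G≤ »≡ solve 3 (λ g r w -> g :* (r :* w) := r :* (g :* w)) refl _ r _ · cong (r *_) (GW (a i)) · sym (GW (b i)))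
   where
   G≤ : G (r ^ b i) ≤ g i
   G≤ = +≤ (+≤ ≤-refl rx) (sq≤ (^₀ (b i) r₀) rx)
    where
    rx : r ^ b i ≤ x i
    rx = ≤1* (x i) (x₀ i) r₁
  -- At x = 1 the leading ratio of the trinomial variance to W a² is 2/3 over 1/3, that is 2. The
  -- constant 601/300 leaves a little room, and the terms of lower order in a are covered by 534 W.
  V̂≤W : ∀ i -> r * (r * r) * V̂ i ≤ c 601 300 * (W (b i) * (ι (a i) * ι (a i))) + c 534 1 * W (b i)
  V̂≤W i = *-assoc r (r * r) (V̂ i) ≡» *≤ʳ r₀ (over² i _ ((c 601 300 * (A * A) + c 534 1) * w) (q₀ *₀ W₀ (a i))
   (+≤ (+≤ (*≤ˡ (sq₀ A) (A₁≤ i)) (*≤ (A₁₀ i *₀ A₂₀ i) (sq₀ (A + 1#)) (A₁₂≤ i) (of≡ (cong (λ s -> s * s) (+-comm 1# A)))))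
   (*≤ (A₂₀ i) (sq₀ (A + A + 1#)) (A₂≤ i) (of≡ (cong (λ s -> s * s) (ι-+ (a i) (b i) · solve 1 (λ A -> A :+ (Κ 1# :+ A) := A :+ A :+ Κ 1#) refl A)))) » main »≡ cong (λ s -> (c 601 300 * (A * A) + c 534 1) * (g i * s)) (sym (GW (a i))) · solve 3 (λ q g w -> q :* (g :* (g :* w)) := q :* w :* (g :* g)) refl _ _ w)) » solve 3 (λ r q w -> r :* (q :* w) := q :* (r :* w)) refl r _ w ≡» *≤ʳ q₀ (rWa≤ i) »≡ solve 2 (λ A w -> (κ 601 300 :* (A :* A) :+ κ 534 1) :* w := κ 601 300 :* (w :* (A :* A)) :+ κ 534 1 :* w) refl A _
   where
   A w X : ℚ
   A = ι (a i)
   w = W (a i)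
   X = x i
   q₀ : 0# ≤ c 601 300 * (A * A) + c 534 1
   q₀ = lit *₀ sq₀ A +₀ lit
   main : X * (A * A) + X * (X * X) * ((A + 1#) * (A + 1#)) + X * X * ((A + A + 1#) * (A + A + 1#)) ≤ (c 601 300 * (A * A) + c 534 1) * (g i * X)
   main = gap≤ (x₀ i *₀ sq₀ A *₀ sq₀ (1# - X) +₀ x₀ i *₀ (lit *₀ sq₀ A +₀ lit) *₀ sq₀ (1# - X) +₀ sq₀ X *₀ gap (x≤1 i) *₀ (lit *₀ ι₀ (a i) +₀ lit) +₀ sq₀ X *₀ lit *₀ sq₀ _ +₀ sq₀ X *₀ lit +₀ lit *₀ x₀ i *₀ <⇒≤ (g₊ i)) (solve 2 (λ X A -> (κ 601 300 :* (A :* A) :+ κ 534 1) :* ((Κ 1# :+ X :+ X :* X) :* X) := X :* (A :* A) :+ X :* (X :* X) :* ((A :+ Κ 1#) :* (A :+ Κ 1#)) :+ X :* X :* ((A :+ A :+ Κ 1#) :* (A :+ A :+ Κ 1#)) :+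
     (X :* (A :* A) :* ((Κ 1# :- X) :* (Κ 1# :- X)) :+ X :* (κ 1 300 :* (A :* A) :+ κ 1600 3) :* ((Κ 1# :- X) :* (Κ 1# :- X)) :+ X :* X :* (Κ 1# :- X) :* (κ 2 1 :* A :+ Κ 1#) :+ X :* X :* κ 1 100 :* ((A :- κ 300 1) :* (A :- κ 300 1)) :+ X :* X :* (κ 698 1) :+ κ 2 3 :* X :* (Κ 1# :+ X :+ X :* X))) refl X A)
  V≤Vₚ : ∀ n -> r * (r * r) * V n ≤ c 601 300 * Vₚ n + c 534 1 * Ω n
  V≤Vₚ n = sym (sum-*ˡ (r * (r * r)) V̂ n) ≡» sum-mono n (λ i _ -> V̂≤W i) »≡ sum-+ (λ i -> c 601 300 * (W (b i) * (ι (a i) * ι (a i)))) (λ i -> c 534 1 * W (b i)) n · (cong₂ _+_ (sum-*ˡ (c 601 300) _ n) (sum-*ˡ (c 534 1) (λ i -> W (b i)) n))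
 ι<⇒ : ∀ {i n} -> i ℕ.< n -> 1# + ι i ≤ ι n
 ι<⇒ h = ι-mono h
 -- For 1 - r³ at most 4/n the geometric decay is too slow to help; every term is bounded by its
 -- maximum and there are n = 4 K of them.
 module UpperII (r : ℚ) (r₊ : 0# < r) (r₁ : r ≤ 1#) (hr : c 9954 10000 ≤ r) (n : ℕ) (K : ℚ) (nK : ι n ≡ c 4 1 * K) (K₊ : 0# < K)
  (hθ : (1# - r * (r * r)) * K ≤ 1#) where
  open Ratios r r₊ r₁ hr
  K₀ : 0# ≤ K
  K₀ = <⇒≤ K₊
  I≤ : ∀ i -> i ℕ.< n -> I i ≤ c 4 1 * K
  I≤ i h = ι<⇒ h »≡ nK
  e≤K : ∀ i -> i ℕ.< n -> ι (e i) ≤ c 24 1 * K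
  e≤K i h = e≤ i » *≤ʳ lit (I≤ i h) »≡ solve 1 (λ K -> κ 6 1 :* (κ 4 1 :* K) := κ 24 1 :* K) refl K
  b≤e : ∀ i -> ι (b i) ≤ ι (e i)
  b≤e i = ι-mono (ℕP.m≤n+m (b i) (a i))
  a≤e : ∀ i -> ι (a i) ≤ ι (e i)
  a≤e i = ι-mono (ℕP.m≤m+n (a i) (b i))
  e² : ℕ -> ℚ
  e² i = ι (e i) * ι (e i)
  a²≤e² : ∀ i -> ι (a i) * ι (a i) ≤ e² i
  a²≤e² i = sq≤ (ι₀ (a i)) (a≤e i)
  b²≤e² : ∀ i -> ι (b i) * ι (b i) ≤ e² i
  b²≤e² i = sq≤ (ι₀ (b i)) (b≤e i)
  e²≤ : ∀ i -> i ℕ.< n -> e² i ≤ c 576 1 * (K * K)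
  e²≤ i h = sq≤ (ι₀ (e i)) (e≤K i h) »≡ solve 1 (λ K -> κ 24 1 :* K :* (κ 24 1 :* K) := κ 576 1 :* (K :* K)) refl K
  V̂≤II : ∀ i -> i ℕ.< n -> V̂ i ≤ c 192 1 * (K * K)
  V̂≤II i h = *≤ˡ (sq₀ (u i)) (+≤ (+≤ (*≤ʳ (A₁₀ i) (a²≤e² i)) (*≤ʳ (A₁₀ i *₀ A₂₀ i) (b²≤e² i))) ≤-refl » gap≤ (sq₀ (ι (e i)) *₀ (lit *₀ (sq₀ (1# - A₁ i) +₀ sq₀ (1# - A₂ i) +₀ sq₀ (A₁ i - A₂ i)))) (solve 3 (λ p q s -> s :* (κ 1 3 :* ((Κ 1# :+ p :+ q) :* (Κ 1# :+ p :+ q))) := p :* s :+ p :* q :* s :+ q :* s :+ s :* (κ 1 6 :* ((Κ 1# :- p) :* (Κ 1# :- p) :+ (Κ 1# :- q) :* (Κ 1# :- q) :+ (p :- q) :* (p :- q)))) refl _ _ _)) » solve 3 (λ s n u -> s :* (κ 1 3 :* (n :* n)) :* (u :* u) := κ 1 3 :* s :* (n :* u :* (n :* u))) refl _ _ _ · cong (λ p -> c 1 3 * e² i * (p * p)) (νu i) · solve 1 (λ s -> κ 1 3 :* s :* (Κ 1# :* Κ 1#) := κ 1 3 :* s) refl _ ≡» *≤ʳ lit (e²≤ i h) »≡ solve 1 (λ k -> κ 1 3 :* (κ 576 1 :* k) := κ 192 1 :* k) refl _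
  V≤II : V n ≤ c 768 1 * (K * K * K)
  V≤II = sum-mono n V̂≤II » sum-const (c 192 1 * (K * K)) n · cong (_* (c 192 1 * (K * K))) nK ≡» of≡ (solve 1 (λ K -> κ 4 1 :* K :* (κ 192 1 :* (K :* K)) := κ 768 1 :* (K :* K :* K)) refl K)
  M̂≤V̂ : ∀ i -> i ℕ.< n -> M̂ i ≤ c 576 1 * (K * K) * V̂ i
  M̂≤V̂ i h = *≤ˡ (sq₀ (u i)) (+≤ (+≤ (*≤ʳ (A₁₀ i) (*≤ʳ (sq₀ (ι (a i))) (a²≤e² i » e²≤ i h))) (*≤ʳ (A₁₀ i *₀ A₂₀ i) (*≤ʳ (sq₀ (ι (b i))) (b²≤e² i » e²≤ i h))))
   (*≤ʳ (A₂₀ i) (*≤ʳ (sq₀ (ι (e i))) (e²≤ i h)))) »≡ solve 7 (λ p q a b e m u -> (p :* (a :* m) :+ p :* q :* (b :* m) :+ q :* (e :* m)) :* u := m :* ((p :* a :+ p :* q :* b :+ q :* e) :* u)) refl _ _ _ _ _ _ _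
   where
   A B : ℕ -> ℚ
   A i = ι (a i) * ι (a i)
   B i = ι (b i) * ι (b i)
  M₄≤II : M₄ n ≤ c 576 1 * (K * K) * V n
  M₄≤II = sum-mono n M̂≤V̂ »≡ sum-*ˡ (c 576 1 * (K * K)) V̂ n
  xu≤⅓ : ∀ i -> r * (x i * u i) ≤ c 1 3
  xu≤⅓ i = over i (x i) (c 1 3) lit (gap≤ (lit *₀ sq₀ (1# - x i)) (solve 1 (λ x -> κ 1 3 :* (Κ 1# :+ x :+ x :* x) := x :+ κ 1 3 :* ((Κ 1# :- x) :* (Κ 1# :- x))) refl _))
  S₁≤II : r * S₁ n ≤ c 4 3 * K
  S₁≤II = sym (sum-*ˡ r (λ i -> x i * u i) n) ≡» sum-mono n (λ i _ -> xu≤⅓ i) »≡ sum-const (c 1 3) n · cong (_* c 1 3) nK · solve 1 (λ K -> κ 4 1 :* K :* κ 1 3 := κ 4 3 :* K) refl K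
  S₂≤II : r * r * S₂ n ≤ c 16 1 * (K * K)
  S₂≤II = sym (sum-*ˡ (r * r) _ n) ≡» sum-mono n step »≡ sum-const (c 4 1 * K) n · cong (_* (c 4 1 * K)) nK · solve 1 (λ K -> κ 4 1 :* K :* (κ 4 1 :* K) := κ 16 1 :* (K :* K)) refl K
   where
   step : ∀ i -> i ℕ.< n -> r * r * (x i * (ι (a i) + x i * x i * ι (b i)) * (u i * u i)) ≤ c 4 1 * K
   step i h = over² i _ (I i) (I₀ i) (*≤ʳ (x₀ i) (+≤ (a≤ i) (*≤ʳ (sq₀ (x i)) (b≤ i))) » gap≤ (I₀ i *₀ (sq₀ (1# - x i) +₀ x₀ i *₀ sq₀ (1# - x i) +₀ sq₀ (x i) *₀ (sq₀ (1# - x i) +₀ lit))) (solve 2 (λ I x -> I :* ((Κ 1# :+ x :+ x :* x) :* (Κ 1# :+ x :+ x :* x)) := x :* (κ 3 1 :* I :+ x :* x :* (κ 3 1 :* I)) :+ I :* ((Κ 1# :- x) :* (Κ 1# :- x) :+ x :* ((Κ 1# :- x) :* (Κ 1# :- x)) :+ x :* x :* ((Κ 1# :- x) :* (Κ 1# :- x) :+ κ 3 1))) refl _ _)) » I≤ i h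
  t≤II : t * K * c 29862 10000 ≤ 1#
  t≤II = *≤ʳ (t₀ *₀ K₀) (lit » +≡ _ _ · cong (_+ c 9908 10000) (+≡ 1# (c 9954 10000)) ≡» +≤ (+≤ ≤-refl hr) r²≥) » solve 2 (λ r K -> (Κ 1# :- r) :* K :* (Κ 1# :+ r :+ r :* r) := (Κ 1# :- r :* (r :* r)) :* K) refl r K ≡» hθ
  b²≤ : ∀ i -> ι (b i) * ι (b i) ≤ c 101 100 * (ι (a i) * ι (a i)) + c 101 1
  b²≤ i = gap≤ (lit *₀ sq₀ (A - c 100 1)) (solve 1 (λ A -> κ 101 100 :* (A :* A) :+ κ 101 1 := (Κ 1# :+ A) :* (Κ 1# :+ A) :+ κ 1 100 :* ((A :- κ 100 1) :* (A :- κ 100 1))) refl A)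
   where
   A : ℚ
   A = ι (a i)
  Mₚ≤II : Mₚ n ≤ c 144 1 * (K * K) * (c 101 100 * Vₚ n + c 101 1 * Ω n)
  Mₚ≤II = sum-mono n (λ i h -> ≤-trans (*≤ʳ (W₀ (b i)) (*≤ (sq₀ (ι (b i))) (lit *₀ sq₀ (ι (a i)) +₀ lit) (sq≤ (ι₀ (b i)) (b≤ i » *≤ʳ lit (I≤ i h)) »≡ solve 1 (λ K -> κ 3 1 :* (κ 4 1 :* K) :* (κ 3 1 :* (κ 4 1 :* K)) := κ 144 1 :* (K :* K)) refl K) (b²≤ i))) (of≡ (solve 3 (λ w m A -> w :* (m :* (κ 101 100 :* A :+ κ 101 1)) := m :* (κ 101 100 :* (w :* A) :+ κ 101 1 :* w)) refl _ _ _))) »≡ sum-*ˡ (c 144 1 * (K * K)) (λ i -> c 101 100 * (W (b i) * (ι (a i) * ι (a i))) + c 101 1 * W (b i)) n · cong (c 144 1 * (K * K) *_)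
   (sum-+ (λ i -> c 101 100 * (W (b i) * (ι (a i) * ι (a i)))) (λ i -> c 101 1 * W (b i)) n · (cong₂ _+_ (sum-*ˡ (c 101 100) (λ i -> W (b i) * (ι (a i) * ι (a i))) n) (sum-*ˡ (c 101 1) (λ i -> W (b i)) n)))
  Ω≤II : Ω n ≤ c 4 3 * K
  Ω≤II = sum-mono n (λ i _ -> W≤⅓ (b i)) »≡ sum-const (c 1 3) n · cong (_* c 1 3) nK · solve 1 (λ K -> κ 4 1 :* K :* κ 1 3 := κ 4 3 :* K) refl K
 -- All that the tail and core estimates need from r and n: powers of K with numerical coefficients,
 -- and the size of every auxiliary sum relative to the variance V. `Peak` serves only points close
 -- to 1.
 record Bounds (c₁ c₃ c₄ c₅ κ₀ p cV CV ω ω̄ m : ℚ) (V̂-bound : Set) (Peak : ℚ -> Set) (V Vp Mp Ω M₄ k₁ S₁ S₂ : ℚ) : Set where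
  no-eta-equality
  field
   K : ℚ
   K≥ : κ₀ ≤ K
   V≥ : cV * (K * K * K) ≤ V
   V≤ : V ≤ CV * (K * K * K)
   Vp≥ : p * V ≤ Vp
   Ω≥ : ω * K ≤ Ω
   Ω≤ : Ω ≤ ω̄ * K
   Mp≤ : Mp ≤ m * (K * K) * Vp
   M₄≤ : M₄ ≤ c₁ * (V * V)
   V̂≤ : V̂-bound
   k₁S₁≤ : k₁ * S₁ ≤ c₃
   S₁≤ : S₁ * S₁ ≤ c₄ * c₄ * V
   S₁₂≤ : (S₁ + k₁ * S₂) * (S₁ + k₁ * S₂) ≤ c₅ * c₅ * V
   peak : Peak K
 module Num (r : ℚ) (r₊ : 0# < r) (r₁ : r ≤ 1#) (n : ℕ) where
  open Weights r r₊ r₁ using (W; Ω)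
  open Main r r₊ r₁ using (V; V̂; M₄; S₁; S₂; k₁)
  Vp Mp : ℚ
  Vp = sum (λ i -> W (b i) * (ι (a i) * ι (a i))) n
  Mp = sum (λ i -> W (b i) * (ι (b i) * ι (b i) * (ι (b i) * ι (b i)))) n
  V̂-bound : Set
  V̂-bound = ∀ i -> i ℕ.< n -> V̂ i ≤ c 1 80 * V n
  Peak : ℚ -> ℚ -> Set
  Peak η K = ∀ j -> j ℕ.≤ n -> c 1673 1000 * (ι j * W (b j)) + η * K ≤ c 2 1 * Ω n
  -- In the first kind n ≥ 8 K, so the sums are practically complete while K may be as small as
  -- 74.7. In the second only n ≥ 4 K is available, with weaker constants, but K ≥ 875.
  TypeA TypeB : Set
  TypeA = Bounds (c 3 20) (c 1947 10000) (c 195 10000) (c 445 10000) (c 747 10) (c 648 1000) (c 1630 100) (c 229 10) (c 560 1000) (c 1 1) (c 131 1) V̂-bound (Peak (c 414 1000)) (V n) Vp Mp (Ω n) (M₄ n) k₁ (S₁ n) (S₂ n)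
  TypeB = Bounds (c 3 20) (c 1947 10000) (c 195 10000) (c 445 10000) (c 875 1) (c 49 100) (c 119 10) (c 768 1) (c 542 1000) (c 4 3) (c 188 1) V̂-bound (Peak (c 177 1000)) (V n) Vp Mp (Ω n) (M₄ n) k₁ (S₁ n) (S₂ n)
 closed : ∀ {p q} p' q' -> p ≡ p' -> q ≡ q' -> T (p' ℚ.≤ᵇ q') -> p ≤ q
 closed p' q' refl refl h = ℚP.≤ᵇ⇒≤ h
 module Lift (K κ₀ cV V : ℚ) (cV₀ : 0# ≤ cV) (κ₀₀ : 0# ≤ κ₀) (K≥ : κ₀ ≤ K) (V≥ : cV * (K * K * K) ≤ V) where
  K₀ : 0# ≤ K
  K₀ = κ₀₀ » K≥
  up₁ : ∀ {X} p s -> 0# ≤ s -> p ≤ s * cV * (κ₀ * κ₀) -> X ≤ p * K -> X ≤ s * V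
  up₁ {X} p s s₀ h l = l » scale≤ K K₀ h » solve 4 (λ s v k K -> s :* v :* (k :* k) :* K := s :* v :* K :* (k :* k)) refl s cV κ₀ K ≡» *≤ʳ (s₀ *₀ cV₀ *₀ K₀) (*≤ κ₀₀ K₀ K≥ K≥) » solve 3 (λ s v K -> s :* v :* K :* (K :* K) := s :* (v :* (K :* K :* K))) refl s cV K ≡» *≤ʳ s₀ V≥
  up₂ : ∀ {X} p s -> 0# ≤ s -> p ≤ s * cV * κ₀ -> X ≤ p * (K * K) -> X ≤ s * V
  up₂ {X} p s s₀ h l = l » scale≤ (K * K) (sq₀ K) h » solve 4 (λ s v k K -> s :* v :* k :* (K :* K) := s :* v :* (K :* K) :* k) refl s cV κ₀ K ≡» *≤ʳ (s₀ *₀ cV₀ *₀ sq₀ K) K≥ » solve 3 (λ s v K -> s :* v :* (K :* K) :* K := s :* (v :* (K :* K :* K))) refl s cV K ≡» *≤ʳ s₀ V≥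
 θ⇒r : ∀ r -> 0# < r -> (1# - r * (r * r)) * c 747 10 ≤ 1# -> c 9954 10000 ≤ r
 θ⇒r r r₊ h = cancel≤ g₊ (ungap (subst (0# ≤_) (solve 2 (λ r s -> κ 10 747 :* (Κ 1# :- (Κ 1# :- r :* (r :* r)) :* κ 747 10) :+ (Κ 1# :- κ 10 747 :- s :* s :* s) :=
  (r :* r :+ r :* s :+ s :* s) :* r :- (r :* r :+ r :* s :+ s :* s) :* s) refl r s)
  (lit *₀ gap h +₀ subst (0# ≤_) (solve 0 (Κ (1# ℚ.- c 10 747 ℚ.- c 9954 10000 ℚ.* c 9954 10000 ℚ.* c 9954 10000) := Κ 1# :- κ 10 747 :- κ 9954 10000 :* κ 9954 10000 :* κ 9954 10000) refl) lit)))
  where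
  s : ℚ
  s = c 9954 10000
  g₊ : 0# < r * r + r * s + s * s
  g₊ = ((r₊ *₊ r₊) +₊ (<⇒≤ r₊ *₀ lit)) +₊ sq₀ s

-- The two regimes of the scale K

module N5 where
 open Q1
 open E1
 open U1
 open P1
 open R1
 open N1
 open N2
 open N3
 open N4
 open import Relation.Binary using (tri<; tri≈; tri>)
 opaque
  unfolding _+_ _*_
  ι10 : ι 10 ≡ c 10 1
  ι10 = refl
 ι7000 : ι 7000 ≡ c 7000 1
 ι7000 = ι-* 700 10 · cong (_* ι 10) (ι-* 70 10 · cong (_* ι 10) (ι-* 7 10)) · cong (λ x -> ι 7 * x * x * x) ι10 · cong (λ x -> x * c 10 1 * c 10 1 * c 10 1) ι7 · solve 0 (κ 7 1 :* κ 10 1 :* κ 10 1 :* κ 10 1 := κ 7000 1) refl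
  where
  opaque
   unfolding _+_ _*_
   ι7 : ι 7 ≡ c 7 1
   ι7 = refl
 7000<⇒ : ∀ {n} -> 7000 ℕ.< n -> c 7000 1 ≤ ι n
 7000<⇒ {n} h = sym ι7000 ≡» ι-mono {7000} {n} (ℕP.<⇒≤ h)
 module _ (r : ℚ) (r₊ : 0# < r) (r₁ : r ≤ 1#) (n : ℕ) where
  open Num r r₊ r₁ n
  open Weights r r₊ r₁ using (W; Ω)
  open Main r r₊ r₁ using (V; V̂; M₄; S₁; S₂; k₁)
  typeA : ∀ K -> (1# - r * (r * r)) * K ≡ 1# -> c 747 10 ≤ K -> c 8 1 * K ≤ ι n -> c 9954 10000 ≤ r -> TypeA
  typeA K yK hK hn hr = record
   { K = K ; K≥ = hK ; V≥ = L.V≥ ; V≤ = U.V≤ n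
   ; Vp≥ = ≤-trans (*≤ʳ lit (U.V≤ n)) ((sym (*-assoc (c 648 1000) (c 229 10) K³) ≡» scale≤ K³ K³₀ (sym (*≡ _ _) ≡» lit)) » L.Vₚ≥)
   ; Ω≥ = L.Ω≥ ; Ω≤ = ≤-trans (U.Ω≤ n) (of≡ (sym (*-1ˡ K)))
   ; Mp≤ = ≤-trans (U.Mₚ≤ n) (scale≤ (K³ * (K * K)) (K³₀ *₀ sq₀ K) (lit »≡ *≡ _ _) » solve 4 (λ m p k s -> m :* p :* (k :* s) := m :* s :* (p :* k)) refl _ _ K³ _ ≡» *≤ʳ (lit *₀ sq₀ K) L.Vₚ≥)
   ; M₄≤ = ≤-trans (U.M₄≤ n) (m4 » *≤ʳ lit (U.sq≤' (lit *₀ K³₀) L.V≥))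
   ; V̂≤ = λ i _ -> Lf.up₂ (c 1396 100) (c 1 80) lit (lit »≡ *≡ _ _ · cong (_* c 747 10) (*≡ _ _)) (U.V̂-max i)
   ; k₁S₁≤ = U.k₁S₁≤ n
   ; S₁≤ = Lf.up₂ (c 6682 10000 * c 6682 10000) _ (lit *₀ lit) (sym (*≡ _ _) ≡» lit »≡ *≡ _ _ · cong (_* c 747 10) (*≡ _ _ · cong (_* c 1630 100) (*≡ _ _)))
    (U.sq≤' (sum₀ n (λ i -> x₀ i *₀ v₀ i)) (U.S₁≤ n) »≡ *-swap (c 6682 10000) K (c 6682 10000) K)
   ; S₁₂≤ = Lf.up₂ (c 15473 10000 * c 15473 10000) _ (lit *₀ lit) (sym (*≡ _ _) ≡» lit »≡ *≡ _ _ · cong (_* c 747 10) (*≡ _ _ · cong (_* c 1630 100) (*≡ _ _)))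
    (U.sq≤' S₁₂₀ (U.S₁₂≤ n) »≡ *-swap (c 15473 10000) K (c 15473 10000) K)
   ; peak = λ j _ -> ≤-trans (+≤ (*≤ʳ lit (U.Wb-peak j)) ≤-refl) (solve 1 (λ K -> κ 1673 1000 :* (κ 27 64 :* K) :+ κ 414 1000 :* K := Κ (c 1673 1000 ℚ.* c 27 64 ℚ.+ c 414 1000) :* K) refl K ≡» scale≤ K K₀ lit » solve 1 (λ K -> κ 112 100 :* K := κ 2 1 :* (κ 560 1000 :* K)) refl K ≡» *≤ʳ lit L.Ω≥) }
   where
   K₀ : 0# ≤ K
   K₀ = lit » hK
   K³ : ℚ
   K³ = K * K * K
   K³₀ : 0# ≤ K³
   K³₀ = K₀ *₀ K₀ *₀ K₀
   ε w : ℚ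
   -- An upper bound for (1 + 8/64)^(-64), the stand-in for e^(-8).
   ε = c 54 100000
   w = c 8 1 ℚ.+ c 10 747
   open Main r r₊ r₁ using (x₀; v₀)
   module U where
    open UpperI r r₊ r₁ hr K yK hK public
    open Common r r₊ r₁ hr public using () renaming (sq≤ to sq≤')
   module L = LowerBounds r r₊ r₁ hr (r * (r * r)) K (<⇒≤ r₊ *₀ (<⇒≤ r₊ *₀ <⇒≤ r₊)) yK hK ≤-refl n (c 8 1) ε (c 1731 100) (c 1630 100) (c 1484 100) (c 560 1000)
    lit lit lit hn
    (lit »≡ *≡ _ _ · cong (ε *_) (^ᶜ≡ _ 64 · cong (_^ 64) (+≡ _ _ · cong (1# +_) (*≡ _ _))))
    (closed _ _ (solve 0 (κ 1731 100 :+ κ 10 747 :* (κ 21 1 :+ κ 9 1 :* (Κ ε :* (κ 8 1 :+ κ 10 747))) := Κ (c 1731 100 ℚ.+ c 10 747 ℚ.* (c 21 1 ℚ.+ c 9 1 ℚ.* (ε ℚ.* w)))) refl) (solve 0 ((λ v -> κ 9 1 :* (κ 2 1 :- Κ ε :* (κ 2 1 :+ κ 2 1 :* v :+ v :* v)) := Κ (c 9 1 ℚ.* (c 2 1 ℚ.- ε ℚ.* (c 2 1 ℚ.+ c 2 1 ℚ.* w ℚ.+ w ℚ.* w)))) (κ 8 1 :+ κ 10 747)) refl) _)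
    lit
    (closed _ _ refl (solve 0 (κ 9908 10000 :* (κ 9954 10000 :* κ 1731 100 :- κ 769 1000) := Κ (c 9908 10000 ℚ.* (c 9954 10000 ℚ.* c 1731 100 ℚ.- c 769 1000))) refl) _)
    (closed _ _ refl (solve 0 (κ 9908 10000 :* κ 1731 100 :- κ 2305 1000 := Κ (c 9908 10000 ℚ.* c 1731 100 ℚ.- c 2305 1000)) refl) _)
    (closed _ _ refl (solve 0 (κ 44 49 :* (κ 9908 10000 :* (Κ 1# :- Κ ε)) :- κ 32 49 :* κ 504 1000 := Κ (c 44 49 ℚ.* (c 9908 10000 ℚ.* (1# ℚ.- ε)) ℚ.- c 32 49 ℚ.* c 504 1000)) refl) _)
   module Lf = Lift K (c 747 10) (c 1630 100) (V n) lit lit hK L.V≥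
   S₁₂₀ : 0# ≤ Main.S₁ r r₊ r₁ n + Main.k₁ r r₊ r₁ * Main.S₂ r r₊ r₁ n
   S₁₂₀ = sum₀ n (λ i -> x₀ i *₀ v₀ i) +₀ U.k₁₀ *₀ sum₀ n (λ i -> x₀ i *₀ (ι₀ (a i) +₀ sq₀ _ *₀ ι₀ (b i)) *₀ sq₀ _)
   m4 : c 2858 1 * U.K⁵ ≤ c 3 20 * (c 1630 100 * K³ * (c 1630 100 * K³))
   m4 = scale≤ U.K⁵ U.K⁵₀ (lit »≡ *≡ _ _ · cong (_* c 747 10) (*≡ _ _ · cong (_* c 1630 100) (*≡ _ _))) » solve 2 (λ k K -> κ 3 20 :* κ 1630 100 :* κ 1630 100 :* k :* (K :* K :* K :* (K :* K)) := κ 3 20 :* κ 1630 100 :* κ 1630 100 :* (K :* K :* K :* (K :* K)) :* k) refl _ K ≡» *≤ʳ (lit *₀ lit *₀ lit *₀ U.K⁵₀) hK »≡ solve 1 (λ K -> κ 3 20 :* κ 1630 100 :* κ 1630 100 :* (K :* K :* K :* (K :* K)) :* K := κ 3 20 :* (κ 1630 100 :* (K :* K :* K) :* (κ 1630 100 :* (K :* K :* K)))) refl K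
  -- What the two subcases of the second regime share: lower bounds come from a common q and K, and
  -- the estimates that are proved differently are passed in.
  typeB : ∀ q K -> 0# ≤ q -> (1# - q) * K ≡ 1# -> c 875 1 ≤ K -> q ≤ r * (r * r) -> c 4 1 * K ≤ ι n -> c 9954 10000 ≤ r ->
   V n ≤ c 768 1 * (K * K * K) -> Ω n ≤ c 4 3 * K ->
   (c 1041 100 * (K * K * K) ≤ Vp -> Mp ≤ c 188 1 * (K * K) * Vp) ->
   (c 119 10 * (K * K * K) ≤ V n -> M₄ n ≤ c 3 20 * (V n * V n)) ->
   (c 119 10 * (K * K * K) ≤ V n -> V̂-bound) ->
   k₁ * S₁ n ≤ c 1947 10000 -> S₁ n ≤ c 134 100 * K ->
   (c 119 10 * (K * K * K) ≤ V n -> (S₁ n + k₁ * S₂ n) * (S₁ n + k₁ * S₂ n) ≤ c 445 10000 * c 445 10000 * V n) ->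
   (c 542 1000 * K ≤ Ω n -> ∀ j -> j ℕ.≤ n -> c 1673 1000 * (ι j * W (b j)) + c 177 1000 * K ≤ c 2 1 * Ω n) -> TypeB
  typeB q K q₀ qK hK hq hn hr V≤ Ω≤ Mp≤ M₄≤ V̂≤ k₁S₁≤ S₁≤ S₁₂≤ peak = record
   { K = K ; K≥ = hK ; V≥ = L.V≥ ; V≤ = V≤ ; Ω≥ = L.Ω≥ ; Ω≤ = Ω≤ ; Mp≤ = Mp≤ L.Vₚ≥ ; M₄≤ = M₄≤ L.V≥
   -- 712 = 534 * 4/3 is the cost of the Ω term of `V≤Vₚ`; for K ≥ 875 it is below V / 10000, which
   -- keeps the ratio above 0.49.
   ; Vp≥ = cancel≤ (ℚP.positive⁻¹ (c 601 300)) (ungap (subst (0# ≤_) (solve 5 (λ v p o k y -> (κ 601 300 :* p :+ κ 534 1 :* o :- y :* v) :+ (κ 1 10000 :* v :- κ 712 1 :* k) :+ κ 534 1 :* (κ 4 3 :* k :- o) :+ (y :- κ 9862 10000) :* v :+ κ 134 30000 :* v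
      := κ 601 300 :* p :- κ 601 300 :* (κ 49 100 :* v)) refl _ Vp _ K _)
     (gap (Rt.V≤Vₚ n) +₀ gap (Lf.up₁ (c 712 1) (c 1 10000) lit (lit »≡ *≡ _ _ · (cong₂ _*_ (*≡ _ _) (*≡ _ _))) ≤-refl)
      +₀ lit *₀ gap Ω≤ +₀ gap Rt.r³≥ *₀ Vn₀ +₀ lit *₀ Vn₀)))
   ; V̂≤ = V̂≤ L.V≥
   ; k₁S₁≤ = k₁S₁≤
   ; S₁≤ = Lf.up₂ (c 134 100 * c 134 100) _ (lit *₀ lit) (sym (*≡ _ _) ≡» lit »≡ *≡ _ _ · cong (_* c 875 1) (*≡ _ _ · cong (_* c 119 10) (*≡ _ _)))
    (sq≤' (sum₀ n (λ i -> x₀ i *₀ v₀ i)) S₁≤ »≡ *-swap (c 134 100) K (c 134 100) K)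
   ; S₁₂≤ = S₁₂≤ L.V≥
   ; peak = peak L.Ω≥ }
   where
   K₀ : 0# ≤ K
   K₀ = lit » hK
   ε w : ℚ
   -- An upper bound for (1 + 4/64)^(-64), the stand-in for e^(-4).
   ε = c 207 10000
   w = c 4 1 ℚ.+ c 10 747
   open Main r r₊ r₁ using (x₀; v₀; V̂₀)
   Vn₀ : 0# ≤ V n
   Vn₀ = sum₀ n V̂₀
   open Common r r₊ r₁ hr using () renaming (sq≤ to sq≤'; t₀ to t₀')
   module Rt = Ratios r r₊ r₁ hr
   module L = LowerBounds r r₊ r₁ hr q K q₀ qK (lit » hK) hq n (c 4 1) ε (c 1284 100) (c 119 10) (c 1041 100) (c 542 1000)
    lit lit lit hn
    (lit »≡ *≡ _ _ · cong (ε *_) (^ᶜ≡ _ 64 · cong (_^ 64) (+≡ _ _ · cong (1# +_) (*≡ _ _))))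
    (closed _ _ (solve 0 (κ 1284 100 :+ κ 10 747 :* (κ 21 1 :+ κ 9 1 :* (Κ ε :* (κ 4 1 :+ κ 10 747))) := Κ (c 1284 100 ℚ.+ c 10 747 ℚ.* (c 21 1 ℚ.+ c 9 1 ℚ.* (ε ℚ.* w)))) refl) (solve 0 ((λ v -> κ 9 1 :* (κ 2 1 :- Κ ε :* (κ 2 1 :+ κ 2 1 :* v :+ v :* v)) := Κ (c 9 1 ℚ.* (c 2 1 ℚ.- ε ℚ.* (c 2 1 ℚ.+ c 2 1 ℚ.* w ℚ.+ w ℚ.* w)))) (κ 4 1 :+ κ 10 747)) refl) _)
    lit
    (closed _ _ refl (solve 0 (κ 9908 10000 :* (κ 9954 10000 :* κ 1284 100 :- κ 769 1000) := Κ (c 9908 10000 ℚ.* (c 9954 10000 ℚ.* c 1284 100 ℚ.- c 769 1000))) refl) _)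
    (closed _ _ refl (solve 0 (κ 9908 10000 :* κ 1284 100 :- κ 2305 1000 := Κ (c 9908 10000 ℚ.* c 1284 100 ℚ.- c 2305 1000)) refl) _)
    (closed _ _ refl (solve 0 (κ 44 49 :* (κ 9908 10000 :* (Κ 1# :- Κ ε)) :- κ 32 49 :* κ 504 1000 := Κ (c 44 49 ℚ.* (c 9908 10000 ℚ.* (1# ℚ.- ε)) ℚ.- c 32 49 ℚ.* c 504 1000)) refl) _)
   module Lf = Lift K (c 875 1) (c 119 10) (V n) lit lit hK L.V≥
  quintic : ∀ {K X V} p s q k -> 0# ≤ s -> 0# ≤ q -> 0# ≤ k -> k ≤ K -> p ≤ s * (q * q) * k -> X ≤ p * (K * K * K * (K * K)) -> q * (K * K * K) ≤ V -> X ≤ s * (V * V)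
  quintic {K} {X} {V} p s q k s₀ q₀ k₀ hk hp hX hV = hX » scale≤ _ K⁵₀ hp » solve 4 (λ s q k K -> s :* (q :* q) :* k :* (K :* K :* K :* (K :* K)) := s :* (q :* q) :* (K :* K :* K :* (K :* K)) :* k) refl s q k K ≡» *≤ʳ (s₀ *₀ (q₀ *₀ q₀) *₀ K⁵₀) hk » solve 3 (λ s q K -> s :* (q :* q) :* (K :* K :* K :* (K :* K)) :* K := s :* (q :* (K :* K :* K) :* (q :* (K :* K :* K)))) refl s q K ≡» *≤ʳ s₀ (*≤ qK₀ (qK₀ » hV) hV hV)
   where
   K₀ : 0# ≤ K
   K₀ = k₀ » hk
   K⁵₀ : 0# ≤ K * K * K * (K * K)
   K⁵₀ = K₀ *₀ K₀ *₀ K₀ *₀ (K₀ *₀ K₀)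
   qK₀ : 0# ≤ q * (K * K * K)
   qK₀ = q₀ *₀ (K₀ *₀ K₀ *₀ K₀)
  S₁₂² : ∀ K k p -> 0# ≤ k -> k ≤ K -> 0# ≤ p -> p * p ≤ c 445 10000 * c 445 10000 * c 119 10 * k -> S₁ n + k₁ * S₂ n ≤ p * K -> c 119 10 * (K * K * K) ≤ V n ->
   (S₁ n + k₁ * S₂ n) * (S₁ n + k₁ * S₂ n) ≤ c 445 10000 * c 445 10000 * V n
  S₁₂² K k p k₀ hk p₀ hp h hV = Lift.up₂ K k (c 119 10) (V n) lit k₀ hk hV (p * p) _ (lit *₀ lit) hp
   (*≤ S₁₂₀ (p₀ *₀ ≤-trans k₀ hk) h h »≡ *-swap p K p K)
   where
   open Main r r₊ r₁ using (x₀; v₀; t₀)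
   S₁₂₀ : 0# ≤ S₁ n + k₁ * S₂ n
   S₁₂₀ = sum₀ n (λ i -> x₀ i *₀ v₀ i) +₀ lit *₀ t₀ *₀ sum₀ n (λ i -> x₀ i *₀ (ι₀ (a i) +₀ sq₀ _ *₀ ι₀ (b i)) *₀ sq₀ _)
  typeB₁ : ∀ K -> (1# - r * (r * r)) * K ≡ 1# -> c 875 1 ≤ K -> c 4 1 * K ≤ ι n -> c 9954 10000 ≤ r -> TypeB
  typeB₁ K yK hK hn hr = typeB (r * (r * r)) K (<⇒≤ r₊ *₀ (<⇒≤ r₊ *₀ <⇒≤ r₊)) yK hK ≤-refl hn hr
   (U.V≤ n » scale≤ K³ K³₀ lit) (U.Ω≤ n » sym (*-1ˡ K) ≡» scale≤ K K₀ lit)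
   (λ h -> ≤-trans (U.Mₚ≤ n) (scale≤ (K³ * (K * K)) (K³₀ *₀ sq₀ K) (lit »≡ *≡ _ _) » solve 4 (λ m p k s -> m :* p :* (k :* s) := m :* s :* (p :* k)) refl _ _ K³ _ ≡» *≤ʳ (lit *₀ sq₀ K) h))
   (quintic (c 2858 1) (c 3 20) (c 119 10) (c 875 1) lit lit lit hK (lit »≡ *≡ _ _ · cong (_* c 875 1) (*≡ _ _ · cong (c 3 20 *_) (*≡ _ _))) (U.M₄≤ n))
   (λ h i _ -> Lift.up₂ K (c 875 1) (c 119 10) (V n) lit lit hK h (c 1396 100) (c 1 80) lit (lit »≡ *≡ _ _ · cong (_* c 875 1) (*≡ _ _)) (U.V̂-max i)) (U.k₁S₁≤ n) (U.S₁≤ n » scale≤ K K₀ lit)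
   (S₁₂² K (c 875 1) (c 15473 10000) lit hK lit (sym (*≡ _ _) ≡» lit »≡ *≡ _ _ · cong (_* c 875 1) (*≡ _ _ · cong (_* c 119 10) (*≡ _ _))) (U.S₁₂≤ n))
   (λ h j _ -> ≤-trans (+≤ (*≤ʳ lit (U.Wb-peak j)) ≤-refl) (solve 1 (λ K -> κ 1673 1000 :* (κ 27 64 :* K) :+ κ 177 1000 :* K := Κ (c 1673 1000 ℚ.* c 27 64 ℚ.+ c 177 1000) :* K) refl K ≡» scale≤ K K₀ lit » solve 1 (λ K -> κ 1084 1000 :* K := κ 2 1 :* (κ 542 1000 :* K)) refl K ≡» *≤ʳ lit h))
   where
   K₀ : 0# ≤ K
   K₀ = lit » hK
   K³ : ℚ
   K³ = K * K * K
   K³₀ : 0# ≤ K³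
   K³₀ = K₀ *₀ K₀ *₀ K₀
   module U = UpperI r r₊ r₁ hr K yK (lit » hK)
  ιW≤Ω : ∀ j -> ι j * W (b j) ≤ Ω j
  ιW≤Ω j = sym (sum-const (W (b j)) j) ≡» sum-mono j (λ i h -> Wt.W↓ (ℕ.s≤s (ℕ.s≤s (t3-mono (ℕP.<⇒≤ h)))))
   where
   module Wt = Weights r r₊ r₁
   t3-mono : ∀ {i j} -> i ℕ.≤ j -> t3 i ℕ.≤ t3 j
   t3-mono ℕ.z≤n = ℕ.z≤n
   t3-mono (ℕ.s≤s h) = ℕ.s≤s (ℕ.s≤s (ℕ.s≤s (t3-mono h)))
  -- K is n/4 here, and q = 1 - 1/K ≤ r³ feeds the lower bounds even though 1 / (1 - r³) may be far
  -- larger or, at r = 1, meaningless.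
  typeB₂ : c 7000 1 ≤ ι n -> (1# - r * (r * r)) * (c 1 4 * ι n) ≤ 1# -> c 9954 10000 ≤ r -> k₁ * S₁ n ≤ c 1947 10000 -> TypeB
  typeB₂ hn hθ hr hk = typeB q K (gap q≤) (solve 2 (λ i k -> (Κ 1# :- (Κ 1# :- i)) :* k := k :* i) refl _ K · *-inv K K₊) hK
   (ungap (cancel≤ K₊ (subst₂ _≤_ (solve 1 (λ k -> Κ 0# := k :* Κ 0#) refl K) (cong (λ o -> o - (1# - r * (r * r)) * K) (sym (*-inv K K₊)) · solve 3 (λ k i y -> k :* i :- (Κ 1# :- y) :* k := k :* (y :- (Κ 1# :- i))) refl K _ _) (gap hθ)))) (of≡ (sym nK)) hr U.V≤II U.Ω≤II
   (λ h -> ≤-trans U.Mₚ≤II (*≤ʳ (lit *₀ sq₀ K) (+≤ ≤-refl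
    (Lift.up₁ K (c 875 1) (c 1041 100) Vp lit lit hK h (c 135 1) (c 1 1000) lit (lit »≡ *≡ _ _ · (cong₂ _*_ (*≡ _ _) (*≡ _ _)))
    (*≤ʳ lit U.Ω≤II » gap≤ (lit *₀ K₀) (solve 1 (λ k -> κ 135 1 :* k := κ 101 1 :* (κ 4 3 :* k) :+ κ 1 3 :* k) refl K)))) » gap≤ (lit *₀ (sq₀ K *₀ ≤-trans (lit *₀ (K₀ *₀ K₀ *₀ K₀)) h)) (solve 2 (λ s v -> κ 188 1 :* s :* v := κ 144 1 :* s :* (κ 101 100 :* v :+ κ 1 1000 :* v) :+ κ 42416 1000 :* (s :* v)) refl _ Vp)))
   (λ h -> ≤-trans U.M₄≤II (*≤ˡ (Vn₀) (Lift.up₂ K (c 875 1) (c 119 10) (V n) lit lit hK h (c 576 1) (c 3 20) lit (lit »≡ *≡ _ _ · cong (_* c 875 1) (*≡ _ _)) ≤-refl) »≡ *-assoc (c 3 20) (V n) (V n)))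
   (λ h i hi -> Lift.up₂ K (c 1750 1) (c 119 10) (V n) lit lit hK' h (c 192 1) (c 1 80) lit (lit »≡ *≡ _ _ · cong (_* c 1750 1) (*≡ _ _)) (U.V̂≤II i hi)) hk
   S₁≤' (S₁₂² K (c 1750 1) (c 605 100) lit hK' lit (sym (*≡ _ _) ≡» lit »≡ *≡ _ _ · cong (_* c 1750 1) (*≡ _ _ · cong (_* c 119 10) (*≡ _ _))) S₁₂≤')
   (λ h j hj -> ≤-trans (+≤ (*≤ʳ lit (ιW≤Ω j » sum-≤n (λ i -> W (b i)) (λ i -> Cm.W₀ (b i)) hj)) (scale≤ K K₀ (lit »≡ *≡ _ _) »≡ *-assoc (c 327 1000) (c 542 1000) K))
    (+≤ ≤-refl (*≤ʳ lit h) »≡ solve 1 (λ o -> κ 1673 1000 :* o :+ κ 327 1000 :* o := κ 2 1 :* o) refl _))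
   where
   K : ℚ
   K = c 1 4 * ι n
   nK : ι n ≡ c 4 1 * K
   nK = solve 1 (λ x -> x := κ 4 1 :* (κ 1 4 :* x)) refl _
   hK' : c 1750 1 ≤ K
   hK' = lit » *≡ _ _ ≡» *≤ʳ lit hn
   hK : c 875 1 ≤ K
   hK = lit » hK'
   K₊ : 0# < K
   K₊ = ℚP.<-≤-trans (ℚP.positive⁻¹ (c 875 1)) hK
   K₀ : 0# ≤ K
   K₀ = <⇒≤ K₊
   q : ℚ
   q = 1# - inv K K₊
   q≤ : inv K K₊ ≤ 1#
   q≤ = cancel≤ K₊ (*-inv K K₊ ≡» lit » hK »≡ sym (*-1ʳ K))
   module Cm = Common r r₊ r₁ hr
   module U = UpperII r r₊ r₁ hr n K nK K₊ hθ
   Vn₀ : 0# ≤ V n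
   Vn₀ = sum₀ n Cm.V̂₀
   hr₊ : 0# < c 9954 10000
   hr₊ = ℚP.positive⁻¹ (c 9954 10000)
   S₁₀ : 0# ≤ S₁ n
   S₁₀ = sum₀ n (λ i -> Cm.x₀ i *₀ Cm.u₀ i)
   S₂₀ : 0# ≤ S₂ n
   S₂₀ = sum₀ n (λ i -> Cm.x₀ i *₀ (ι₀ (a i) +₀ sq₀ _ *₀ ι₀ (b i)) *₀ sq₀ _)
   S₁≤' : S₁ n ≤ c 134 100 * K
   S₁≤' = cancel≤ hr₊ ((*≤ˡ S₁₀ hr » U.S₁≤II) » gap≤ (lit *₀ K₀) (solve 1 (λ k -> κ 9954 10000 :* (κ 134 100 :* k) := κ 4 3 :* k :+ Κ Κd :* k) refl K))
    where
    Κd : ℚ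
    Κd = c 9954 10000 ℚ.* c 134 100 ℚ.- c 4 3
   S₂≤' : S₂ n ≤ c 1615 100 * (K * K)
   S₂≤' = cancel≤ (ℚP.positive⁻¹ (c 9908 10000)) ((*≤ˡ S₂₀ Cm.r²≥ » U.S₂≤II) » gap≤ (lit *₀ sq₀ K) (solve 1 (λ k -> κ 9908 10000 :* (κ 1615 100 :* k) := κ 16 1 :* k :+ Κ Κd :* k) refl _))
    where
    Κd : ℚ
    Κd = c 9908 10000 ℚ.* c 1615 100 ℚ.- c 16 1
   tK≤ : Cm.t * K ≤ c 335 1000
   tK≤ = cancel≤ (ℚP.positive⁻¹ (c 29862 10000)) (*-comm _ _ ≡» U.t≤II » lit »≡ *≡ _ _)
   S₁₂≤' : S₁ n + k₁ * S₂ n ≤ c 605 100 * K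
   S₁₂≤' = +≤ S₁≤' (*≤ʳ (lit *₀ Cm.t₀) S₂≤' » solve 2 (λ t k -> κ 13 15 :* t :* (κ 1615 100 :* (k :* k)) := κ 13 15 :* κ 1615 100 :* k :* (t :* k)) refl Cm.t K ≡» *≤ʳ (lit *₀ lit *₀ K₀) tK≤) » gap≤ (lit *₀ K₀) (solve 1 (λ k -> κ 605 100 :* k := κ 134 100 :* k :+ κ 13 15 :* κ 1615 100 :* k :* κ 335 1000 :+ Κ Κd :* k) refl K)
    where
    Κd : ℚ
    Κd = c 605 100 ℚ.- c 134 100 ℚ.- c 13 15 ℚ.* c 1615 100 ℚ.* c 335 1000
  -- Compare n with 8 K and 4 K. In the lower cases n ≥ 7000 forces K ≥ 875; r = 1 is split off
  -- because K would not exist.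
  bounds : 7000 ℕ.< n -> (1# - r * (r * r)) * c 747 10 ≤ 1# -> TypeA ⊎ TypeB
  bounds hn hr747 = by-r (≤-<1 r₁)
   where
   ≤-<1 : ∀ {r} -> r ≤ 1# -> r < 1# ⊎ r ≡ 1#
   ≤-<1 {r} h with ℚP.<-cmp r 1#
   ... | tri≈ _ p _ = inj₂ p
   ... | tri> _ _ r>1 = ⊥-elim (ℚP.<-irrefl refl (ℚP.<-≤-trans r>1 h))
   ... | tri< p _ _ = inj₁ p
   ιn : c 7000 1 ≤ ι n
   ιn = 7000<⇒ hn
   hr : c 9954 10000 ≤ r
   hr = θ⇒r r r₊ hr747
   below : r < 1# -> TypeA ⊎ TypeB
   below r<1 = cases (≤-total (c 8 1 * K) (ι n)) (≤-total (c 4 1 * K) (ι n))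
    where
    θ₊ : 0# < 1# - r * (r * r)
    θ₊ = subst (0# <_) (solve 1 (λ r -> (Κ 1# :- r) :* (Κ 1# :+ r :+ r :* r) := Κ 1# :- r :* (r :* r)) refl r) (gap< r<1 *₊ ((0<1 +₊ <⇒≤ r₊) +₊ sq₀ r))
    K : ℚ
    K = inv (1# - r * (r * r)) θ₊
    yK : (1# - r * (r * r)) * K ≡ 1#
    yK = *-inv _ θ₊
    hK : c 747 10 ≤ K
    hK = cancel≤ θ₊ (hr747 »≡ sym yK)
    module U = UpperI r r₊ r₁ hr K yK hK
    K≥875 : ι n ≤ c 8 1 * K -> c 875 1 ≤ K
    K≥875 h = cancel≤ (ℚP.positive⁻¹ (c 8 1)) (solve 0 (κ 8 1 :* κ 875 1 := κ 7000 1) refl ≡» ιn » h)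
    cases : (c 8 1 * K ≤ ι n) ⊎ (ι n ≤ c 8 1 * K) -> (c 4 1 * K ≤ ι n) ⊎ (ι n ≤ c 4 1 * K) -> TypeA ⊎ TypeB
    cases (inj₁ h) _ = inj₁ (typeA K yK hK h hr)
    cases (inj₂ h) (inj₁ h') = inj₂ (typeB₁ K yK (K≥875 h) h' hr)
    cases (inj₂ _) (inj₂ h) = inj₂ (typeB₂ ιn (*≤ʳ (<⇒≤ θ₊) (*≤ʳ lit h »≡ solve 1 (λ k -> κ 1 4 :* (κ 4 1 :* k) := k) refl K) »≡ yK) hr (U.k₁S₁≤ n))
   at : r ≡ 1# -> TypeA ⊎ TypeB
   at r≡1 = inj₂ (typeB₂ ιn (cong (λ r -> (1# - r * (r * r)) * (c 1 4 * ι n)) r≡1 · solve 1 (λ x -> (Κ 1# :- Κ 1# :* (Κ 1# :* Κ 1#)) :* x := Κ 0#) refl _ ≡» lit) hr (cong (λ r -> c 13 15 * (1# - r) * S₁ n) r≡1 · solve 1 (λ x -> κ 13 15 :* (Κ 1# :- Κ 1#) :* x := Κ 0#) refl _ ≡» lit))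
   by-r : r < 1# ⊎ r ≡ 1# -> TypeA ⊎ TypeB
   by-r (inj₁ h) = below h
   by-r (inj₂ h) = at h

-- Propagating numerical inequalities from one value to all larger ones

module W1 where
 open Q1
 open E1
 open U1
 open P1
 open R1
 open N1
 open N2
 open N3
 open import Data.Bool using (T)
 sq-mono : ∀ {x y} -> 0# ≤ x -> x ≤ y -> x * x ≤ y * y
 sq-mono x₀ h = *≤ x₀ (x₀ » h) h h
 -- The 32nd power of an affine function outgrows the cube. The tenth power beats one factor k by
 -- Bernoulli, where A ≤ 10 β k₀ says the relative growth is fast enough; three such steps use 30 of
 -- the 32 factors and monotonicity the other two.
 grow : ∀ α β k₀ k -> 0# ≤ β -> 0# ≤ k₀ -> k₀ ≤ k -> 0# ≤ α + β * k₀ -> α + β * k₀ ≤ c 10 1 * (β * k₀) ->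
  (α + β * k₀) ^ 32 * (k * (k * k)) ≤ k₀ * (k₀ * k₀) * (α + β * k) ^ 32
 grow α β k₀ k β₀ k₀₀ h A₀ hA = cong (_* (k * (k * k))) (^-+ A 30 2 · cong (_* A ^ 2) (^-* A 3 10)) · solve 3 (λ p q k -> p :* (p :* (p :* Κ 1#)) :* q :* (k :* (k :* k)) := (p :* k) :* ((p :* k) :* (p :* k)) :* q) refl _ _ k ≡» *≤ (u₀ *₀ (u₀ *₀ u₀)) (^₀ 2 B₀) (*≤ u₀ (v₀ *₀ v₀) ten (*≤ u₀ v₀ ten ten)) (^-mono 2 A₀ A≤B) »≡ sym (cong (k₀ * (k₀ * k₀) *_) (^-+ B 30 2 · cong (_* B ^ 2) (^-* B 3 10)) · solve 3 (λ p q k -> (k :* (k :* k)) :* (p :* (p :* (p :* Κ 1#)) :* q) := (k :* p) :* ((k :* p) :* (k :* p)) :* q) refl _ _ k₀)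
  where
  A B : ℚ
  A = α + β * k₀
  B = α + β * k
  A≤B : A ≤ B
  A≤B = +≤ ≤-refl (*≤ʳ β₀ h)
  B₀ : 0# ≤ B
  B₀ = A₀ » A≤B
  u₀ : 0# ≤ A ^ 10 * k
  u₀ = ^₀ 10 A₀ *₀ ≤-trans k₀₀ h
  v₀ : 0# ≤ k₀ * B ^ 10
  v₀ = k₀₀ *₀ ^₀ 10 B₀
  ι₉ : ι 9 ≡ c 9 1
  ι₉ = solve 0 (let o = Κ 1# in o :+ (o :+ (o :+ (o :+ (o :+ (o :+ (o :+ (o :+ (o :+ Κ 0#)))))))) := κ 9 1) refl
  ten : A ^ 10 * k ≤ k₀ * B ^ 10
  ten = gap≤ (^₀ 9 A₀ *₀ (gap h *₀ gap hA)) (solve 5 (λ p α β k₀ k -> let A = α :+ β :* k₀ ; B = α :+ β :* k in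
     k₀ :* ((Κ 1# :+ κ 9 1) :* p :* B :- κ 9 1 :* (A :* p)) := A :* p :* k :+ p :* ((k :- k₀) :* (κ 10 1 :* (β :* k₀) :- A))) refl _ α β k₀ k) » *≤ʳ k₀₀ (cong (λ i -> (1# + i) * A ^ 9 * B - i * (A * A ^ 9)) (sym ι₉) ≡» bernoulli-homogeneous 9 A₀ B₀)
 grow₃ : ∀ T α β k₀ k -> 0# ≤ β -> 0# < k₀ -> k₀ ≤ k -> 0# ≤ α + β * k₀ -> α + β * k₀ ≤ c 10 1 * (β * k₀) ->
  T * (k₀ * (k₀ * k₀)) ≤ (α + β * k₀) ^ 32 -> T * (k * (k * k)) ≤ (α + β * k) ^ 32
 grow₃ T α β k₀ k β₀ k₊ h A₀ hA hT = cancel≤ (k₊ *₊ (k₊ *₊ k₊)) (solve 3 (λ t k j -> j :* (t :* k) := t :* j :* k) refl T _ _ ≡» *≤ˡ (k₀' *₀ (k₀' *₀ k₀')) hT » grow α β k₀ k β₀ (<⇒≤ k₊) h A₀ hA)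
  where
  k₀' : 0# ≤ k
  k₀' = <⇒≤ k₊ » h
 grow₁ : ∀ T α β k₀ k -> 0# ≤ T -> 0# ≤ β -> 0# < k₀ -> k₀ ≤ k -> 0# ≤ α + β * k₀ -> α + β * k₀ ≤ c 10 1 * (β * k₀) ->
  T * k₀ ≤ (α + β * k₀) ^ 32 -> T * k ≤ (α + β * k) ^ 32
 grow₁ T α β k₀ k T₀ β₀ k₊ h A₀ hA hT = cancel≤ (k₊ *₊ (k₊ *₊ k₊)) (gap≤ (T₀ *₀ <⇒≤ k₊ *₀ k₀' *₀ gap (sq-mono (<⇒≤ k₊) h)) (solve 3 (λ t k j -> t :* j :* (k :* (k :* k)) := j :* (j :* j) :* (t :* k) :+ t :* j :* k :* (k :* k :- j :* j)) refl T k k₀) » *≤ˡ (k₀' *₀ (k₀' *₀ k₀')) hT » grow α β k₀ k β₀ (<⇒≤ k₊) h A₀ hA)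
  where
  k₀' : 0# ≤ k
  k₀' = <⇒≤ k₊ » h
 -- The square root of the factor in `decay`: it applies to moduli, not to their squares.
 decayFactor : ℚ -> ℚ
 decayFactor Y = (1# + Y * c 1 64) ^ 32
 -- The triple-angle formula for squared chords, by way of d 2 = 4 D - D².
 d₃≡ : ∀ z (Nz : N z ≡ 1#) -> N (1° -° z ^° 3) ≡ N (1° -° z ^° 1) * ((c 3 1 - N (1° -° z ^° 1)) * (c 3 1 - N (1° -° z ^° 1)))
 d₃≡ z Nz = solve 2 (λ x y -> x := x :- y :+ y) refl _ _ · cong (_+ d 2) (d-rec 1) · cong (λ p -> p - D + D * (c 2 1 - p) + p) d₂ · solve 1 (λ D -> κ 4 1 :* D :- D :* D :- D :+ D :* (κ 2 1 :- (κ 4 1 :* D :- D :* D)) :+ (κ 4 1 :* D :- D :* D) := D :* ((κ 3 1 :- D) :* (κ 3 1 :- D))) refl D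
  where
  open Unit z Nz
  d₂ : d 2 ≡ c 4 1 * D - D * D
  d₂ = solve 2 (λ x y -> x := x :- y :+ y) refl _ D · cong (_+ D) (d-rec 0 · cong (λ p -> D - p + D * (c 2 1 - D)) d-zero) · solve 1 (λ D -> D :- Κ 0# :+ D :* (κ 2 1 :- D) :+ D := κ 4 1 :* D :- D :* D) refl D
 N-1+ω : ∀ z δ -> 0# ≤ δ -> N (1° -° z ^° 1) ≤ δ * δ -> N (1° +° ω *° z) ≤ (1# + δ) * (1# + δ)
 N-1+ω z δ δ₀ h = cong N (solve° 1 (λ z -> Κ 1° :+ Κ ω :* z := (:- Κ ω̄) :+ (:- Κ ω) :* (Κ 1° :- z :* Κ 1°)) refl z) ≡» ⊑-+ { -° ω̄} { -° ω *° (1° -° z ^° 1)} {1°} lit δ₀ (of≡ (N-neg ω̄ · Nω̄ · sym one))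
  (N-* (-° ω) (1° -° z ^° 1) · cong (_* N (1° -° z ^° 1)) (N-neg ω · Nω) · *-1ˡ _ ≡» h »≡ sym (*-1ʳ (δ * δ)) · cong (δ * δ *_) (sym N1)) »≡ cong ((1# + δ) * (1# + δ) *_) N1 · *-1ʳ _
  where
  N1 : N 1° ≡ 1#
  N1 = N-ofℚ 1# · *-1ˡ 1#
  one : 1# * 1# * N 1° ≡ 1#
  one = cong (1# * 1# *_) N1 · solve 0 (Κ 1# :* Κ 1# :* Κ 1# := Κ 1#) refl
  opaque
   unfolding _+°_
   Nω̄ : N ω̄ ≡ 1#
   Nω̄ = solve 0 (let m = Κ (ℚ.- 1#) in m :* m :- m :* m :+ m :* m := Κ 1#) refl
   Nω : N ω ≡ 1#
   Nω = solve 0 (Κ 0# :* Κ 0# :- Κ 0# :* Κ 1# :+ Κ 1# :* Κ 1# := Κ 1#) refl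
 N-+≤ : ∀ x y -> N (x +° y) ≤ c 2 1 * (N x + N y)
 N-+≤ x y = gap≤ (N₀ _) (sym ((cong₂ _+_ (N-+ x y) (N-+ x (-° y) · cong₂ (λ p q -> N x + p + q) (N-neg y) (cong Tr (cong (x *°_) (conj-neg y) · solve° 2 (λ x y -> x :* (:- y) := :- (x :* y)) refl x _) · Tr-neg _))) · solve 3 (λ p q t -> p :+ q :+ t :+ (p :+ q :+ (:- t)) := κ 2 1 :* (p :+ q)) refl _ _ _))
  where
  opaque
   unfolding _+°_
   conj-neg : ∀ x -> conj (-° x) ≡ -° conj x
   conj-neg (x +ω y) = cong₂ _+ω_ (solve 2 (λ x y -> (:- x) :- (:- y) := :- (x :- y)) refl x y) refl
 N-1+≤4 : ∀ u -> N u ≡ 1# -> N (1° +° u) ≤ c 4 1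
 N-1+≤4 u h = N-+≤ 1° u »≡ cong₂ (λ p q -> c 2 1 * (p + q)) (N-ofℚ 1# · *-1ˡ 1#) h · solve 0 (κ 2 1 :* (Κ 1# :+ Κ 1#) := κ 4 1) refl
 -- All four conditions are closed comparisons, so an inequality for every k ≥ k₀ reduces to one
 -- evaluation at k₀.
 module Growth (b ρ k₀ : ℚ) (h₁ : T (0# ℚ.≤ᵇ b)) (h₂ : T (1# ℚ.≤ᵇ k₀)) (h₃ : T (ρ ℚ.≤ᵇ b ℚ.* k₀)) (h₄ : T ((c 64 1 ℚ.- ρ ℚ.+ b ℚ.* k₀) ℚ.≤ᵇ c 10 1 ℚ.* (b ℚ.* k₀))) where
  private
   b₀ : 0# ≤ b
   b₀ = ℚP.≤ᵇ⇒≤ h₁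
   k₊ : 0# < k₀
   k₊ = ℚP.<-≤-trans 0<1 (ℚP.≤ᵇ⇒≤ h₂)
   α β : ℚ
   α = 1# - ρ * c 1 64
   β = b * c 1 64
   linear : ∀ k -> α + β * k ≡ 1# + (b * k - ρ) * c 1 64
   linear k = solve 3 (λ b ρ k -> Κ 1# :- ρ :* κ 1 64 :+ b :* κ 1 64 :* k := Κ 1# :+ (b :* k :- ρ) :* κ 1 64) refl b ρ k
   Y₀₀ : 0# ≤ b * k₀ - ρ
   Y₀₀ = gap (ℚP.≤ᵇ⇒≤ h₃ »≡ *≡ b k₀)
   A₀ : 0# ≤ α + β * k₀
   A₀ = subst (0# ≤_) (sym (linear k₀)) (lit +₀ (Y₀₀ *₀ lit))
   hA : α + β * k₀ ≤ c 10 1 * (β * k₀)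
   hA = subst₂ _≤_ (solve 3 (λ b ρ k -> κ 1 64 :* (κ 64 1 :- ρ :+ b :* k) := Κ 1# :- ρ :* κ 1 64 :+ b :* κ 1 64 :* k) refl b ρ k₀) (solve 2 (λ b k -> κ 1 64 :* (κ 10 1 :* (b :* k)) := κ 10 1 :* (b :* κ 1 64 :* k)) refl b k₀)
    (*≤ʳ lit (subst₂ _≤_ (+≡ _ _ · (cong₂ _+_ (+≡ _ _ · cong (c 64 1 +_) (-≡ ρ)) (*≡ b k₀))) (*≡ _ _ · cong (c 10 1 *_) (*≡ b k₀)) (ℚP.≤ᵇ⇒≤ h₄)))
   power≡ : (1# ℚ.+ (b ℚ.* k₀ ℚ.- ρ) ℚ.* c 1 64) ^ᶜ 32 ≡ (α + β * k₀) ^ 32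
   power≡ = ^ᶜ≡ _ 32 · cong (_^ 32) ((+≡ _ _ · cong (1# +_) (*≡ _ _ · cong (_* c 1 64) (+≡ _ _ · (cong₂ _+_ (*≡ b k₀) (-≡ ρ))))) · sym (linear k₀))
  nonneg : ∀ k -> k₀ ≤ k -> 0# ≤ b * k - ρ
  nonneg k h = Y₀₀ » +≤ (*≤ʳ b₀ h) ≤-refl
  cubic : ∀ τ -> T (τ ℚ.* (k₀ ℚ.* (k₀ ℚ.* k₀)) ℚ.≤ᵇ (1# ℚ.+ (b ℚ.* k₀ ℚ.- ρ) ℚ.* c 1 64) ^ᶜ 32) -> ∀ k -> k₀ ≤ k -> τ * (k * (k * k)) ≤ decayFactor (b * k - ρ)
  cubic τ h k hk = grow₃ τ α β k₀ k (b₀ *₀ lit) k₊ hk A₀ hA (sym (*≡ _ _ · cong (τ *_) (*≡ _ _ · cong (k₀ *_) (*≡ _ _))) ≡» ℚP.≤ᵇ⇒≤ h »≡ power≡) »≡ cong (_^ 32) (linear k)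
  first-order : ∀ τ -> 0# ≤ τ -> T (τ ℚ.* k₀ ℚ.≤ᵇ (1# ℚ.+ (b ℚ.* k₀ ℚ.- ρ) ℚ.* c 1 64) ^ᶜ 32) -> ∀ k -> k₀ ≤ k -> τ * k ≤ decayFactor (b * k - ρ)
  first-order τ τ₀ h k hk = grow₁ τ α β k₀ k τ₀ (b₀ *₀ lit) k₊ hk A₀ hA (sym (*≡ _ _) ≡» ℚP.≤ᵇ⇒≤ h »≡ power≡) »≡ cong (_^ 32) (linear k)

-- Tail estimates by distance from the peak

module W2 where
 open Q1
 open E1
 open U1
 open P1
 open R1
 open N1
 open N2
 open N3
 open W1
 open import Data.Bool using (T)
 open import Relation.Binary using (tri<; tri≈; tri>)
 neg-mono : ∀ {x y} -> x ≤ y -> - y ≤ - x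
 neg-mono {x} {y} h = gap≤ (gap h) (solve 2 (λ x y -> :- x := :- y :+ (y :- x)) refl x y)
 factor₊ : ∀ {x y} -> 0# ≤ x -> 0# < x * y -> 0# < x
 factor₊ {x} {y} x₀ h with ℚP.<-cmp 0# x
 ... | tri< l _ _ = l
 ... | tri≈ _ l _ = ⊥-elim (ℚP.<-irrefl refl (ℚP.<-≤-trans h (of≡ (cong (_* y) (sym l) · *-0ˡ y))))
 ... | tri> _ _ l = ⊥-elim (ℚP.<-irrefl refl (ℚP.<-≤-trans l x₀))
 module Tail (r : ℚ) (r₊ : 0# < r) (r₁ : r ≤ 1#) (n : ℕ) (K κ₀ p cV CV ωc ω̄ m : ℚ)
  (κ₀≥ : c 747 10 ≤ κ₀) (p₀ : 0# ≤ p) (cV≥ : 1# ≤ cV) (ωc₀ : 0# ≤ ωc) (ω̄₊ : 0# < ω̄) (m₀ : 0# ≤ m)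
  (K≥ : κ₀ ≤ K) where
  open Weights r r₊ r₁ using (W; W₀; Ω; W≤⅓; Π²)
  open Main r r₊ r₁ using (V; V̂₀)
  Vp Mp : ℚ
  Vp = sum (λ i -> W (b i) * (ι (a i) * ι (a i))) n
  Mp = sum (λ i -> W (b i) * (ι (b i) * ι (b i) * (ι (b i) * ι (b i)))) n
  K³ : ℚ
  K³ = K * (K * K)
  K₊ : 0# < K
  K₊ = ℚP.<-≤-trans (ℚP.positive⁻¹ (c 747 10)) (κ₀≥ » K≥)
  K₀ : 0# ≤ K
  K₀ = <⇒≤ K₊
  K³₀ : 0# ≤ K³
  K³₀ = K₀ *₀ (K₀ *₀ K₀)
  κ₀₊ : 0# < κ₀
  κ₀₊ = ℚP.<-≤-trans (ℚP.positive⁻¹ (c 747 10)) κ₀≥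
  cV₀ : 0# ≤ cV
  cV₀ = lit » cV≥
  module Facts (V≥ : cV * K³ ≤ V n) (V≤ : V n ≤ CV * K³) (Vp≥ : p * V n ≤ Vp) (Ω≥ : ωc * K ≤ Ω n) (Ω≤ : Ω n ≤ ω̄ * K) (Mp≤ : Mp ≤ m * (K * K) * Vp)
   (S : ℚ) (S≥ : V n ≤ S) (S≤ : S ≤ c 1003 1000 * V n) where
   Vn₀ : 0# ≤ V n
   Vn₀ = sum₀ n V̂₀
   S₀ : 0# ≤ S
   S₀ = Vn₀ » S≥
   CV₀ : 0# ≤ CV
   CV₀ = cancel≤ (K₊ *₊ (K₊ *₊ K₊)) (*-0ʳ K³ ≡» Vn₀ » V≤ »≡ *-comm CV K³)
   -- `X` is the angle of z up to a small relative error and `S` is V within 0.3 percent, so X² S is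
   -- the Gaussian exponent. Cases are distinguished by D, by D K² and by w = D V.
   module At (z : 𝔼) (Nz : N z ≡ 1#) (X : ℚ) (X₀ : 0# ≤ X) (X≤ : X ≤ c 11 10) (D≤X² : N (1° -° z ^° 1) ≤ X * X)
    (D≥X² : c 9997 10000 * (X * X * (1# - c 1 12 * (X * X))) ≤ N (1° -° z ^° 1)) where
    open Unit z Nz using (D; D₀)
    Nωz : N (ω *° z) ≡ 1#
    Nωz = N-ω* z · Nz
    module Dω = Weights.Decay r r₊ r₁ (ω *° z) Nωz
    module D₀' = Weights.Decay r r₊ r₁ z Nz
    w x² : ℚ
    w = D * V n
    x² = X * X * S
    w₀ : 0# ≤ w
    w₀ = D₀ *₀ Vn₀
    X²≤ : X * X ≤ c 121 100
    X²≤ = sq-mono X₀ X≤ » sym (*≡ _ _) ≡» lit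
    D≤121 : D ≤ c 121 100
    D≤121 = D≤X² » X²≤
    w≤x² : w ≤ x²
    w≤x² = *≤ D₀ S₀ D≤X² S≥
    x²₀ : 0# ≤ x²
    x²₀ = sq₀ X *₀ S₀
    small : D ≤ c 1 2500 -> c 9996 10000 * (X * X) ≤ D
    small h = gap≤ (sq₀ X *₀ (lit *₀ gap X²s +₀ lit)) (solve 1 (λ y -> κ 9997 10000 :* (y :* (Κ 1# :- κ 1 12 :* y)) := κ 9996 10000 :* y :+ y :* (κ 9997 120000 :* (κ 12 10000 :- y) :+ Κ Κd)) refl _) » D≥X²
     where
     Κd : ℚ
     Κd = c 1 10000 ℚ.- c 9997 120000 ℚ.* c 12 10000
     X²s : X * X ≤ c 12 10000
     X²s = gap≤ (sq₀ X *₀ (lit *₀ gap X²≤) *₀ lit +₀ lit *₀ sq₀ X *₀ lit) (solve 1 (λ y -> κ 3 1 :* (κ 9997 10000 :* (y :* (Κ 1# :- κ 1 12 :* y))) := y :+ (y :* (κ 9997 120000 :* (κ 121 100 :- y)) :* κ 3 1 :+ κ 3 1 :* y :* Κ Κe)) refl X²) » *≤ʳ lit (D≥X² » h) » sym (*≡ _ _) ≡» lit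
      where
      X² : ℚ
      X² = X * X
      Κe : ℚ
      Κe = c 9997 10000 ℚ.- c 9997 120000 ℚ.* c 121 100 ℚ.- c 1 3
    w≥ : D ≤ c 1 2500 -> c 9966 10000 * x² ≤ w
    w≥ h = cancel≤ (ℚP.positive⁻¹ (c 1003 1000)) ((solve 1 (λ x -> κ 1003 1000 :* (κ 9966 10000 :* x) := Κ (c 1003 1000 ℚ.* c 9966 10000) :* x) refl x² ≡» scale≤ x² x²₀ lit) » sym (*-assoc (c 9996 10000) (X * X) S) ≡» *≤ (lit *₀ sq₀ X) (lit *₀ Vn₀) (small h) S≤ »≡ solve 3 (λ d v k -> d :* (k :* v) := k :* (d :* v)) refl D _ _)
    x²≤ : D ≤ c 1 2500 -> x² ≤ c 10035 10000 * w
    x²≤ h = sym (*-1ˡ x²) ≡» scale≤ x² x²₀ lit » cong (_* x²) (*≡ _ _) · *-assoc _ _ x² ≡» *≤ʳ lit (w≥ h)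
    x²≤big : x² ≤ c 121364 100000 * (CV * K³)
    x²≤big = *≤ (sq₀ X) (lit *₀ (CV₀ *₀ K³₀)) X²≤ (S≤ » *≤ʳ lit V≤) » sym (*-assoc _ _ _) ≡» scale≤ (CV * K³) (CV₀ *₀ K³₀) (sym (*≡ _ _) ≡» lit)
    -- Close to the peak the decay is quadratic with variance `Vp`. The slack s of `Y-near` is
    -- chosen as q / (ω̄ K), so that s Ω costs at most q.
    near : ∀ e q -> 0# ≤ e -> 0# ≤ q -> D * (K * K) ≤ e -> e * m ≤ c 12 1 -> c 3 1 * e * (ω̄ * ω̄) ≤ q * q -> p * (1# - c 1 12 * (e * m)) * w - q ≤ Dω.Y n
    near e q e₀ q₀ De em hq = +≤ ≤-refl (neg-mono sΩ) » gap≤ (e12 *₀ D₀ *₀ gap Vp≥ +₀ lit *₀ D₀ *₀ gap DM) (solve 8 (λ D v mp o s p e' v' -> D :* v' :- κ 1 12 :* (D :* D) :* mp :- s :* o := p :* (Κ 1# :- κ 1 12 :* e') :* (D :* v) :- s :* o :+ ((Κ 1# :- κ 1 12 :* e') :* D :* (v' :- p :* v) :+ κ 1 12 :* D :* (e' :* v' :- D :* mp)))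
         refl D _ Mp _ s p _ Vp) » NearOmega.Y-near r r₊ r₁ z Nz s s₀ hs n
     where
     v s : ℚ
     v = inv (ω̄ * K) (ω̄₊ *₊ K₊)
     s = q * v
     s₀ : 0# ≤ s
     s₀ = q₀ *₀ inv₀ _ _
     Vp₀ : 0# ≤ Vp
     Vp₀ = sum₀ n (λ i -> W₀ (b i) *₀ sq₀ (ι (a i)))
     e12 : 0# ≤ 1# - c 1 12 * (e * m)
     e12 = subst (0# ≤_) (solve 1 (λ x -> κ 1 12 :* (κ 12 1 :- x) := Κ 1# :- κ 1 12 :* x) refl _) (lit *₀ gap em)
     sK : s * (ω̄ * K) ≡ q
     sK = solve 3 (λ q v k -> q :* v :* k := q :* (k :* v)) refl q v _ · cong (q *_) (*-inv _ _) · *-1ʳ q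
     sΩ : s * Ω n ≤ q
     sΩ = *≤ʳ s₀ Ω≤ »≡ sK
     DM : D * Mp ≤ e * m * Vp
     DM = *≤ʳ D₀ Mp≤ » solve 4 (λ D m k v -> D :* (m :* k :* v) := D :* k :* (m :* v)) refl D m _ Vp ≡» *≤ˡ (m₀ *₀ Vp₀) De »≡ sym (*-assoc e m Vp)
     hs : c 3 1 * D ≤ s * s
     hs = cancel≤ ((ω̄₊ *₊ K₊) *₊ (ω̄₊ *₊ K₊)) (solve 3 (λ o k D -> o :* k :* (o :* k) :* (κ 3 1 :* D) := κ 3 1 :* (o :* o) :* (D :* (k :* k))) refl ω̄ K D ≡» *≤ʳ (lit *₀ sq₀ ω̄) De » solve 2 (λ o e -> κ 3 1 :* o :* e := κ 3 1 :* e :* o) refl _ e ≡» hq »≡ cong (λ q -> q * q) (sym sK) · solve 2 (λ s k -> s :* k :* (s :* k) := k :* k :* (s :* s)) refl s _)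
    N₃ : ℚ
    N₃ = D * ((c 3 1 - D) * (c 3 1 - D))
    3-D : 0# < c 3 1 - D
    3-D = ℚP.<-≤-trans (ℚP.positive⁻¹ (c 179 100)) (solve 0 (κ 179 100 := κ 3 1 :- κ 121 100) refl ≡» +≤ ≤-refl (neg-mono D≤121))
    N₃₊ : 0# < D -> 0# < N₃
    N₃₊ h = h *₊ (3-D *₊ 3-D)
    N₃≥ : ∀ d -> d ≤ c 3 1 -> D ≤ d -> D * ((c 3 1 - d) * (c 3 1 - d)) ≤ N₃
    N₃≥ d d≤ h = *≤ʳ D₀ (sq-mono (gap d≤) (+≤ ≤-refl (neg-mono h)))
    open PairSum using () renaming (N₃ to pairN₃)
    N₃z : pairN₃ z Nz ≡ N₃
    N₃z = d₃≡ z Nz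
    N₃ω : pairN₃ (ω *° z) Nωz ≡ N₃
    N₃ω = cong (λ u -> N (1° -° u)) (solve° 1 (λ z -> (Κ ω :* z) :* ((Κ ω :* z) :* ((Κ ω :* z) :* Κ 1°)) := z :* (z :* (z :* Κ 1°))) refl z) · N₃z
    weaken : ∀ g y -> 0# ≤ g -> c 2 1 * Ω n - c 2 1 * g * W (b 0) ≤ y -> c 2 1 * ωc * K - c 2 3 * g ≤ y
    weaken g y g₀ h = gap≤ (lit *₀ gap Ω≥ +₀ lit *₀ g₀ *₀ gap (W≤⅓ (b 0))) (solve 5 (λ o c k g w -> κ 2 1 :* o :- κ 2 1 :* g :* w := κ 2 1 :* c :* k :- κ 2 3 :* g :+ (κ 2 1 :* (o :- c :* k) :+ κ 2 1 :* g :* (κ 1 3 :- w))) refl _ ωc K g _) » h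
    pos₀ : ∀ {u} {Nu : N u ≡ 1#} j -> j ℕ.≤ 0 -> 0# ≤ sum (PairSum.pair u Nu) j
    pos₀ .0 ℕ.z≤n = ≤-refl
    far-ω : ∀ g -> 0# ≤ g -> 0# < D -> N (1° +° ω *° z) ≤ g * g * N₃ -> c 2 1 * ωc * K - c 2 3 * g ≤ Dω.Y n
    far-ω g g₀ D₊ h = weaken g _ g₀ (Dω.Y-far n g (subst (0# <_) (sym N₃ω) (N₃₊ D₊)) g₀ (h »≡ cong (g * g *_) (sym N₃ω)) 0 (pos₀ {ω *° z} {Nωz}))
    far-0 : ∀ g -> 0# ≤ g -> 0# < D -> c 4 1 ≤ g * g * N₃ -> c 2 1 * ωc * K - c 2 3 * g ≤ D₀'.Y n
    far-0 g g₀ D₊ h = weaken g _ g₀ (D₀'.Y-far n g (subst (0# <_) (sym N₃z) (N₃₊ D₊)) g₀ (N-1+≤4 z Nz » h »≡ cong (g * g *_) (sym N₃z)) 0 (pos₀ {z} {Nz}))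
    -- The squared form of: t times the modulus at r u is at most the modulus at r ω.
    Small : 𝔼 -> ℚ -> Set
    Small u t = N (P (ofℚ r *° u) n) * (t * t) ≤ Π² n
    decay : ∀ u (Nu : N u ≡ 1#) t Y -> 0# ≤ t -> t ≤ decayFactor Y -> 0# ≤ Y -> Y + c 1 3 ≤ Weights.Decay.Y r r₊ r₁ u Nu n -> Small u t
    decay u Nu t Y t₀ h Y₀ hY = *≤ʳ (N₀ _) (sq-mono t₀ h »≡ sym (^-* (1# + Y * c 1 64) 2 32 · cong (decayFactor Y *_) (*-1ʳ _))) » Weights.Decay.decay r r₊ r₁ u Nu n Y Y₀ hY
    ⟦_⟧ : ∀ {x y} -> T (x ℚ.≤ᵇ y) -> x ≤ y
    ⟦ h ⟧ = ℚP.≤ᵇ⇒≤ h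
    DK : ∀ e -> D * (K * K) ≤ e -> D * (κ₀ * κ₀) ≤ e
    DK e h = *≤ʳ D₀ (sq-mono (<⇒≤ κ₀₊) K≥) » h
    D≤ : ∀ e d -> T (e ℚ.≤ᵇ d ℚ.* (κ₀ ℚ.* κ₀)) -> D * (K * K) ≤ e -> D ≤ d
    D≤ e d h l = cancel≤ (κ₀₊ *₊ κ₀₊) (*-comm _ D ≡» DK e l » ≤-trans ⟦ h ⟧ (of≡ (*≡ _ _ · cong (d *_) (*≡ _ _) · *-comm d _)))
    slope : ∀ {y} γ b -> T (b ℚ.+ c 2 3 ℚ.* γ ℚ.≤ᵇ c 2 1 ℚ.* ωc) -> c 2 1 * ωc * K - c 2 3 * (γ * K) ≤ y -> b * K ≤ y
    slope γ b h l = (gap≤ (gap (sym (+≡ _ _ · cong (b +_) (*≡ _ _)) ≡» ≤-trans ⟦ h ⟧ (of≡ (*≡ _ _))) *₀ K₀) (solve 4 (λ o k g b -> κ 2 1 :* o :* k :- κ 2 3 :* (g :* k) := b :* k :+ (κ 2 1 :* o :- (b :+ κ 2 3 :* g)) :* k) refl ωc K γ b) » ≤-refl) » l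
    module Finish (b ρ : ℚ) (h₁ : T (0# ℚ.≤ᵇ b)) (h₂ : T (1# ℚ.≤ᵇ κ₀)) (h₃ : T (ρ ℚ.≤ᵇ b ℚ.* κ₀)) (h₄ : T ((c 64 1 ℚ.- ρ ℚ.+ b ℚ.* κ₀) ℚ.≤ᵇ c 10 1 ℚ.* (b ℚ.* κ₀))) where
     module Gr = Growth b ρ κ₀ h₁ h₂ h₃ h₄
     cubic : ∀ τ -> T (τ ℚ.* (κ₀ ℚ.* (κ₀ ℚ.* κ₀)) ℚ.≤ᵇ (1# ℚ.+ (b ℚ.* κ₀ ℚ.- ρ) ℚ.* c 1 64) ^ᶜ 32) -> ∀ u (Nu : N u ≡ 1#) t -> 0# ≤ t -> t ≤ τ * K³ ->
      b * K - ρ + c 1 3 ≤ Weights.Decay.Y r r₊ r₁ u Nu n -> Small u t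
     cubic τ h u Nu t t₀ ht hY = decay u Nu t (b * K - ρ) t₀ (ht » Gr.cubic τ h K K≥) (Gr.nonneg K K≥) hY
     first-order : ∀ τ -> T (0# ℚ.≤ᵇ τ) -> T (τ ℚ.* κ₀ ℚ.≤ᵇ (1# ℚ.+ (b ℚ.* κ₀ ℚ.- ρ) ℚ.* c 1 64) ^ᶜ 32) -> ∀ u (Nu : N u ≡ 1#) t -> 0# ≤ t -> t ≤ τ * K ->
      b * K - ρ + c 1 3 ≤ Weights.Decay.Y r r₊ r₁ u Nu n -> Small u t
     first-order τ τ₀ h u Nu t t₀ ht hY = decay u Nu t (b * K - ρ) t₀ (ht » Gr.first-order τ ⟦ τ₀ ⟧ h K K≥) (Gr.nonneg K K≥) hY
    third : ∀ {x y} -> x ≤ y -> x - c 1 3 + c 1 3 ≤ y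
    third {x} h = solve 1 (λ x -> x :- κ 1 3 :+ κ 1 3 := x) refl x ≡» h
    x²≤eK : ∀ e τ f -> 0# ≤ f -> T (f ℚ.* c 10035 10000 ℚ.* e ℚ.* CV ℚ.≤ᵇ τ) -> D ≤ c 1 2500 -> D * (K * K) ≤ e -> f * x² ≤ τ * K
    x²≤eK e τ f f₀ h Ds De = *≤ʳ f₀ (x²≤ Ds » *≤ʳ lit (*≤ʳ D₀ V≤)) » solve 5 (λ f q D v k -> f :* (q :* (D :* (v :* (k :* (k :* k))))) := f :* q :* v :* k :* (D :* (k :* k))) refl f _ D CV K ≡» *≤ʳ (f₀ *₀ lit *₀ CV₀ *₀ K₀) De » solve 5 (λ f q v k e -> f :* q :* v :* k :* e := f :* q :* e :* v :* k) refl f _ CV K e ≡» scale≤ K K₀ (≤-trans (of≡ (sym (*≡ _ _ · cong (_* CV) (*≡ _ _ · cong (_* e) (*≡ _ _))))) ⟦ h ⟧)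
    x²≤dK³ : ∀ τ f -> 0# ≤ f -> T (f ℚ.* c 10035 10000 ℚ.* c 1 2500 ℚ.* CV ℚ.≤ᵇ τ) -> D ≤ c 1 2500 -> f * x² ≤ τ * K³
    x²≤dK³ τ f f₀ h Ds = *≤ʳ f₀ (x²≤ Ds » *≤ʳ lit (*≤ D₀ (CV₀ *₀ K³₀) Ds V≤)) » solve 5 (λ f q d v k -> f :* (q :* (d :* (v :* k))) := f :* q :* d :* v :* k) refl f _ _ CV K³ ≡» scale≤ K³ K³₀ (≤-trans (of≡ (sym (*≡ _ _ · cong (_* CV) (*≡ _ _ · cong (_* c 1 2500) (*≡ _ _))))) ⟦ h ⟧)
    x²≤K³ : ∀ τ f -> 0# ≤ f -> T (f ℚ.* c 121364 100000 ℚ.* CV ℚ.≤ᵇ τ) -> f * x² ≤ τ * K³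
    x²≤K³ τ f f₀ h = *≤ʳ f₀ x²≤big » solve 4 (λ f q v k -> f :* (q :* (v :* k)) := f :* q :* v :* k) refl f _ CV K³ ≡» scale≤ K³ K³₀ (≤-trans (of≡ (sym (*≡ _ _ · cong (_* CV) (*≡ _ _)))) ⟦ h ⟧)
    -- N₃ is close to 9 D for small D, so a factor γ K suffices once D K² ≥ e; 8.9976 is a lower
    -- bound for (3 - 1/2500)².
    N₃-e : ∀ e γ ν -> T (ν ℚ.≤ᵇ γ ℚ.* γ ℚ.* e ℚ.* c 89976 10000) -> 0# ≤ e -> D ≤ c 1 2500 -> e ≤ D * (K * K) -> ν ≤ γ * K * (γ * K) * N₃
    N₃-e e γ ν h e₀ Ds De = ≤-trans ⟦ h ⟧ (of≡ (*≡ _ _ · cong (_* c 89976 10000) (*≡ _ _ · cong (_* e) (*≡ _ _)))) » *≤ (sq₀ γ *₀ e₀) (sq₀ (c 3 1 - c 1 2500)) (*≤ʳ (sq₀ γ) De) (lit »≡ solve 0 (Κ ((c 3 1 ℚ.- c 1 2500) ℚ.* (c 3 1 ℚ.- c 1 2500)) := (κ 3 1 :- κ 1 2500) :* (κ 3 1 :- κ 1 2500)) refl) » solve 4 (λ g D k d -> g :* g :* (D :* (k :* k)) :* d := g :* k :* (g :* k) :* (D :* d)) refl γ D K _ ≡» *≤ʳ (sq₀ (γ * K)) (N₃≥ (c 1 2500) lit Ds)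
    N₃-big : c 1 2500 ≤ D -> c 35759 10000000 ≤ N₃
    N₃-big h = go (≤-total D (c 1 100))
     where
     go : D ≤ c 1 100 ⊎ c 1 100 ≤ D -> c 35759 10000000 ≤ N₃
     go (inj₁ l) = (lit » solve 0 (Κ (c 1 2500 ℚ.* ((c 3 1 ℚ.- c 1 100) ℚ.* (c 3 1 ℚ.- c 1 100))) := κ 1 2500 :* ((κ 3 1 :- κ 1 100) :* (κ 3 1 :- κ 1 100))) refl ≡» *≤ˡ (sq₀ (c 3 1 - c 1 100)) h) » N₃≥ (c 1 100) lit l
     go (inj₂ l) = (lit » solve 0 (Κ (c 1 100 ℚ.* ((c 3 1 ℚ.- c 121 100) ℚ.* (c 3 1 ℚ.- c 121 100))) := κ 1 100 :* ((κ 3 1 :- κ 121 100) :* (κ 3 1 :- κ 121 100))) refl ≡» *≤ˡ (sq₀ (c 3 1 - c 121 100)) l) » N₃≥ (c 121 100) lit D≤121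
    -- Points near 1 instead of near `ω`. The suffixes of the constants mark the ranges: N for D K²
    -- ≤ 0.3, M up to 1, F beyond that with D ≤ 1/2500, and B for larger D. All remaining conditions
    -- are closed comparisons.
    module Zero (η bM bF bB τN τM τF τB : ℚ) (X₊ : 0# < X) (Peak : ∀ j -> j ℕ.≤ n -> c 1673 1000 * (ι j * W (b j)) + η * K ≤ c 2 1 * Ω n)
     (k₁ : T (η ℚ.≤ᵇ c 2 1 ℚ.* ωc)) (k₂ : T (c 3 10 ℚ.≤ᵇ c 125 1000000 ℚ.* (κ₀ ℚ.* κ₀))) (g₁ : T (0# ℚ.≤ᵇ η)) (g₂ : T (1# ℚ.≤ᵇ κ₀)) (g₃ : T (c 1 3 ℚ.≤ᵇ η ℚ.* κ₀)) (g₄ : T ((c 64 1 ℚ.- c 1 3 ℚ.+ η ℚ.* κ₀) ℚ.≤ᵇ c 10 1 ℚ.* (η ℚ.* κ₀)))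
     (n₁ : T (0# ℚ.≤ᵇ τN)) (n₂ : T (τN ℚ.* κ₀ ℚ.≤ᵇ (1# ℚ.+ (η ℚ.* κ₀ ℚ.- c 1 3) ℚ.* c 1 64) ^ᶜ 32)) (n₃ : T (c 6 1 ℚ.* c 10035 10000 ℚ.* c 3 10 ℚ.* CV ℚ.≤ᵇ τN)) (n₄ : T (c 486 1 ℚ.≤ᵇ τN ℚ.* κ₀))
     (m₁ : T (0# ℚ.≤ᵇ bM)) (m₂ : T (c 1 3 ℚ.≤ᵇ bM ℚ.* κ₀)) (m₃ : T ((c 64 1 ℚ.- c 1 3 ℚ.+ bM ℚ.* κ₀) ℚ.≤ᵇ c 10 1 ℚ.* (bM ℚ.* κ₀)))
     (m₄ : T (0# ℚ.≤ᵇ τM)) (m₅ : T (τM ℚ.* κ₀ ℚ.≤ᵇ (1# ℚ.+ (bM ℚ.* κ₀ ℚ.- c 1 3) ℚ.* c 1 64) ^ᶜ 32)) (m₆ : T (c 6 1 ℚ.* c 10035 10000 ℚ.* c 1 1 ℚ.* CV ℚ.≤ᵇ τM)) (m₇ : T (c 486 1 ℚ.≤ᵇ τM ℚ.* κ₀)) (m₈ : T (bM ℚ.+ c 2 3 ℚ.* c 12174 10000 ℚ.≤ᵇ c 2 1 ℚ.* ωc))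
     (f₁ : T (0# ℚ.≤ᵇ bF)) (f₂ : T (c 1 3 ℚ.≤ᵇ bF ℚ.* κ₀)) (f₃ : T ((c 64 1 ℚ.- c 1 3 ℚ.+ bF ℚ.* κ₀) ℚ.≤ᵇ c 10 1 ℚ.* (bF ℚ.* κ₀)))
     (f₅ : T (τF ℚ.* (κ₀ ℚ.* (κ₀ ℚ.* κ₀)) ℚ.≤ᵇ (1# ℚ.+ (bF ℚ.* κ₀ ℚ.- c 1 3) ℚ.* c 1 64) ^ᶜ 32)) (f₆ : T (c 6 1 ℚ.* c 10035 10000 ℚ.* c 1 2500 ℚ.* CV ℚ.≤ᵇ τF)) (f₇ : T (c 1 1 ℚ.* c 486 1 ℚ.≤ᵇ τF ℚ.* (κ₀ ℚ.* (κ₀ ℚ.* κ₀)))) (f₈ : T (bF ℚ.+ c 2 3 ℚ.* c 6668 10000 ℚ.≤ᵇ c 2 1 ℚ.* ωc))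
     (d₁ : T (0# ℚ.≤ᵇ bB)) (d₂ : T (c 2264 100 ℚ.≤ᵇ bB ℚ.* κ₀)) (d₃ : T ((c 64 1 ℚ.- c 2264 100 ℚ.+ bB ℚ.* κ₀) ℚ.≤ᵇ c 10 1 ℚ.* (bB ℚ.* κ₀)))
     (d₅ : T (τB ℚ.* (κ₀ ℚ.* (κ₀ ℚ.* κ₀)) ℚ.≤ᵇ (1# ℚ.+ (bB ℚ.* κ₀ ℚ.- c 2264 100) ℚ.* c 1 64) ^ᶜ 32)) (d₆ : T (c 6 1 ℚ.* c 121364 100000 ℚ.* CV ℚ.≤ᵇ τB)) (d₇ : T (c 1 1 ℚ.* c 486 1 ℚ.≤ᵇ τB ℚ.* (κ₀ ℚ.* (κ₀ ℚ.* κ₀)))) (d₈ : T (bB ℚ.≤ᵇ c 2 1 ℚ.* ωc)) where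
     Claim : Set
     Claim = Small z (c 486 1) × Small z (c 6 1 * x²)
     D₊ : 0# < D
     D₊ = ℚP.<-≤-trans (ℚP.positive⁻¹ (c 1 4) *₊ (X₊ *₊ X₊)) (gap≤ (sq₀ X *₀ (lit *₀ gap X²≤ +₀ lit)) (solve 1 (λ y -> κ 9997 10000 :* (y :* (Κ 1# :- κ 1 12 :* y)) := κ 1 4 :* y :+ y :* (κ 9997 120000 :* (κ 121 100 :- y) :+ Κ Κd)) refl _) » D≥X²)
      where
      Κd : ℚ
      Κd = c 9997 10000 ℚ.- c 9997 120000 ℚ.* c 121 100 ℚ.- c 1 4
     both : (∀ t -> 0# ≤ t -> t ≤ c 486 1 ⊎ t ≤ c 6 1 * x² -> Small z t) -> Claim
     both f = f (c 486 1) lit (inj₁ ≤-refl) , f (c 6 1 * x²) (lit *₀ x²₀) (inj₂ ≤-refl)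
     either : ∀ {u v t y : ℚ} -> u ≤ y -> v ≤ y -> t ≤ u ⊎ t ≤ v -> t ≤ y
     either p q (inj₁ h) = h » p
     either p q (inj₂ h) = h » q
     K486 : ∀ τ -> T (0# ℚ.≤ᵇ τ) -> T (c 486 1 ℚ.≤ᵇ τ ℚ.* κ₀) -> c 486 1 ≤ τ * K
     K486 τ τ₀ h = ≤-trans ⟦ h ⟧ (*≡ _ _ ≡» *≤ʳ ⟦ τ₀ ⟧ K≥)
     K³486 : ∀ τ -> c 0 1 ≤ τ -> T (c 1 1 ℚ.* c 486 1 ℚ.≤ᵇ τ ℚ.* (κ₀ ℚ.* (κ₀ ℚ.* κ₀))) -> c 486 1 ≤ τ * K³
     K³486 τ τ₀ h = ≤-trans ⟦ h ⟧ (*≡ _ _ · cong (τ *_) (*≡ _ _ · cong (κ₀ *_) (*≡ _ _)) ≡» *≤ʳ τ₀ (*≤ (<⇒≤ κ₀₊) (K₀ *₀ K₀) K≥ (sq-mono (<⇒≤ κ₀₊) K≥)))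
     cv-nonneg : ∀ q τ -> 0# ≤ q -> T (q ℚ.* CV ℚ.≤ᵇ τ) -> 0# ≤ τ
     cv-nonneg q τ q₀ h = (q₀ *₀ CV₀) » ≤-trans (of≡ (sym (*≡ _ _))) ⟦ h ⟧
     -- For tiny angles the Abel boundary term at weight `W (b 0)` would be too large. The partial
     -- pair sums stay non-negative up to an index J of order 1/X, which moves the boundary to
     -- `W (b J)`, and `Peak` controls J times this weight.
     near-peak : D * (K * K) ≤ c 3 10 -> η * K ≤ D₀'.Y n
     near-peak De = go (≤-total u (ι n))
      where
      Ds : D ≤ c 125 1000000
      Ds = D≤ (c 3 10) (c 125 1000000) k₂ De
      Ds' : D ≤ c 1 2500
      Ds' = Ds » lit
      X≤s : X ≤ c 1122 100000
      X≤s = sq-cancel lit (cancel≤ (ℚP.positive⁻¹ (c 9996 10000)) (small Ds' » Ds » lit »≡ *≡ _ _ · cong (c 9996 10000 *_) (*≡ _ _)))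
      v u g : ℚ
      v = inv X X₊
      v₀ : 0# ≤ v
      v₀ = inv₀ X X₊
      Xv : X * v ≡ 1#
      Xv = *-inv X X₊
      v≥ : c 100000 1122 ≤ v
      v≥ = cancel≤ X₊ ((*≤ˡ lit X≤s »≡ solve 0 (κ 1122 100000 :* κ 100000 1122 := Κ 1#) refl) »≡ sym Xv)
      -- Here v = 1/X. Three times 0.8164 is just below √6, the range in which the pair sums are
      -- non-negative; subtracting 1 leaves room for rounding up to J.
      u = c 8164 10000 * v - 1#
      u₀ : 0# ≤ u
      u₀ = gap (lit » *≡ _ _ ≡» *≤ʳ lit v≥)
      -- Slightly more than 2/3, so that g² N₃ ≥ 4 with N₃ close to 9 X².
      g = c 6735 10000 * v
      XXv : ∀ q -> q * v * (q * v) * (X * X) ≡ q * q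
      XXv q = solve 3 (λ q v x -> q :* v :* (q :* v) :* (x :* x) := q :* q :* (x :* v :* (x :* v))) refl q v X · cong (λ p -> q * q * (p * p)) Xv · cong (q * q *_) (*-1ˡ 1#) · *-1ʳ _
      pos : ∀ J -> ι J ≤ c 8164 10000 * v -> ∀ j -> j ℕ.≤ J -> 0# ≤ sum (PairSum.pair z Nz) j
      pos J hJ j hj = D₀'.sum-pair₀ (subst (0# <_) (sym N₃z) (N₃₊ D₊)) (D≤121 » lit) j
       (*≤ (sq₀ (ι (t3 j))) (sq₀ X) (sq-mono (ι₀ (t3 j)) (ι-t3 j ≡» *≤ʳ lit (ι-mono hj » hJ))) D≤X² » cong (λ p -> p * p * (X * X)) (sym (*-assoc (c 3 1) (c 8164 10000) v)) · XXv (c 3 1 * c 8164 10000) ≡» solve 0 (κ 3 1 :* κ 8164 10000 :* (κ 3 1 :* κ 8164 10000) := Κ (c 3 1 ℚ.* c 8164 10000 ℚ.* (c 3 1 ℚ.* c 8164 10000))) refl ≡» lit)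
      g² : c 4 1 ≤ g * g * N₃
      g² = lit » solve 0 (Κ (c 6735 10000 ℚ.* c 6735 10000 ℚ.* (c 9996 10000 ℚ.* c 89976 10000)) := κ 6735 10000 :* κ 6735 10000 :* (κ 9996 10000 :* κ 89976 10000)) refl · cong (_* (c 9996 10000 * c 89976 10000)) (sym (XXv (c 6735 10000))) · solve 4 (λ g x p q -> g :* x :* (p :* q) := g :* (p :* x :* q)) refl _ _ _ _ ≡» *≤ʳ (sq₀ g) (*≤ (lit *₀ sq₀ X) (sq₀ (c 3 1 - c 1 2500)) (small Ds') (lit »≡ solve 0 (Κ ((c 3 1 ℚ.- c 1 2500) ℚ.* (c 3 1 ℚ.- c 1 2500)) := (κ 3 1 :- κ 1 2500) :* (κ 3 1 :- κ 1 2500)) refl) » N₃≥ (c 1 2500) lit Ds')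
      go : u ≤ ι n ⊎ ι n ≤ u -> η * K ≤ D₀'.Y n
      go (inj₂ h) = (scale≤ K K₀ (≤-trans ⟦ k₁ ⟧ (of≡ (*≡ _ _))) » *-assoc _ ωc K ≡» *≤ʳ lit Ω≥) » D₀'.Y-positive n (pos n (h » gap≤ lit (solve 1 (λ v -> v := v :- Κ 1# :+ Κ 1#) refl _)))
      go (inj₁ h) = found (ceiling u n u₀ h)
       where
       found : Σ ℕ (λ k -> k ℕ.≤ n × u ≤ ι k × ι k ≤ u + 1#) -> η * K ≤ D₀'.Y n
       found (J , J≤n , uJ , Ju) = (ungap (subst (0# ≤_) (solve 5 (λ o q e j w -> (o :- (κ 1673 1000 :* (j :* w) :+ e)) :+ (κ 1673 1000 :* j :- q) :* w := o :- q :* w :- e) refl _ _ _ _ _)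
        (gap (Peak J J≤n) +₀ gap g≤ *₀ W₀ (b J))) » ≤-refl) » D₀'.Y-far n g (subst (0# <_) (sym N₃z) (N₃₊ D₊)) (lit *₀ v₀) (N-1+≤4 z Nz » g² »≡ cong (g * g *_) (sym N₃z)) J
        (pos J (Ju »≡ solve 1 (λ v -> v :- Κ 1# :+ Κ 1# := v) refl _))
        where
        g≤ : c 2 1 * g ≤ c 1673 1000 * ι J
        -- The origin of 1.673: as X ≤ 0.01122, twice 0.6735 is at most 1.673 (0.8164 - X).
        g≤ = gap≤ (lit *₀ gap v≥ +₀ lit) (solve 1 (λ v -> κ 1673 1000 :* (κ 8164 10000 :* v :- Κ 1#) := κ 2 1 :* (κ 6735 10000 :* v) :+ (Κ Κa :* (v :- κ 100000 1122) :+ Κ Κb)) refl v) » *≤ʳ lit uJ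
         where
         Κa Κb : ℚ
         Κa = c 1673 1000 ℚ.* c 8164 10000 ℚ.- c 2 1 ℚ.* c 6735 10000
         Κb = Κa ℚ.* c 100000 1122 ℚ.- c 1673 1000
     by-size : D ≤ c 1 2500 ⊎ c 1 2500 ≤ D -> Claim
     by-size (inj₁ Ds) = by-E (≤-total (D * (K * K)) (c 3 10)) (≤-total (D * (K * K)) (c 1 1))
      where
      by-E : D * (K * K) ≤ c 3 10 ⊎ c 3 10 ≤ D * (K * K) -> D * (K * K) ≤ c 1 1 ⊎ c 1 1 ≤ D * (K * K) -> Claim
      by-E (inj₁ h) _ = both (λ t t₀ ht -> Finish.first-order η (c 1 3) g₁ g₂ g₃ g₄ τN n₁ n₂ z Nz t t₀ (either (K486 τN n₁ n₄) (x²≤eK (c 3 10) τN (c 6 1) lit n₃ Ds h) ht) (third (near-peak h)))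
      by-E (inj₂ h) (inj₁ h') = both (λ t t₀ ht -> Finish.first-order bM (c 1 3) m₁ g₂ m₂ m₃ τM m₄ m₅ z Nz t t₀ (either (K486 τM m₄ m₇) (x²≤eK (c 1 1) τM (c 6 1) lit m₆ Ds h') ht)
       (third (slope (c 12174 10000) bM m₈ (far-0 (c 12174 10000 * K) (lit *₀ K₀) D₊ (N₃-e (c 3 10) (c 12174 10000) (c 4 1) _ lit Ds h)))))
      by-E (inj₂ _) (inj₂ h) = both (λ t t₀ ht -> Finish.cubic bF (c 1 3) f₁ g₂ f₂ f₃ τF f₅ z Nz t t₀ (either (K³486 τF τF₀ f₇) (x²≤dK³ τF (c 6 1) lit f₆ Ds) ht)
       (third (slope (c 6668 10000) bF f₈ (far-0 (c 6668 10000 * K) (lit *₀ K₀) D₊ (N₃-e (c 1 1) (c 6668 10000) (c 4 1) _ lit Ds h)))))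
       where
       τF₀ : 0# ≤ τF
       τF₀ = cv-nonneg (c 6 1 ℚ.* c 10035 10000 ℚ.* c 1 2500) τF lit f₆
     by-size (inj₂ Db) = both (λ t t₀ ht -> Finish.cubic bB (c 2264 100) d₁ g₂ d₂ d₃ τB d₅ z Nz t t₀ (either (K³486 τB τB₀ d₇) (x²≤K³ τB (c 6 1) lit d₆) ht)
      ((gap≤ (gap (≤-trans ⟦ d₈ ⟧ (of≡ (*≡ _ _))) *₀ K₀ +₀ lit) (solve 3 (λ o k q -> κ 2 1 :* o :* k :- κ 2 3 :* κ 3345 100 := q :* k :- κ 2264 100 :+ κ 1 3 :+ ((κ 2 1 :* o :- q) :* k :+ Κ Κd)) refl ωc K bB) » ≤-refl) » far-0 (c 3345 100) lit D₊ ((lit »≡ *≡ _ _ · cong (_* c 35759 10000000) (*≡ _ _)) » *≤ʳ (sq₀ (c 3345 100)) (N₃-big Db))))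
      where
      Κd : ℚ
      Κd = c 2264 100 ℚ.- c 1 3 ℚ.- c 2 3 ℚ.* c 3345 100
      τB₀ : 0# ≤ τB
      τB₀ = cv-nonneg (c 6 1 ℚ.* c 121364 100000) τB lit d₆
     claim : Claim
     claim = by-size (≤-total D (c 1 2500))
    -- The decay grows linearly in w with slope b while the target 5 x² is essentially 5 w, so
    -- checking at the smallest admissible w is enough.
    near-claim : ∀ e q b ρ w₀ -> T (0# ℚ.≤ᵇ e) -> T (0# ℚ.≤ᵇ q) -> T (e ℚ.* m ℚ.≤ᵇ c 12 1) -> T (c 3 1 ℚ.* e ℚ.* (ω̄ ℚ.* ω̄) ℚ.≤ᵇ q ℚ.* q) -> T (b ℚ.≤ᵇ p ℚ.* (1# ℚ.- c 1 12 ℚ.* (e ℚ.* m))) -> T (q ℚ.+ c 1 3 ℚ.≤ᵇ ρ) ->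
     (h₁ : T (0# ℚ.≤ᵇ b)) (h₂ : T (1# ℚ.≤ᵇ w₀)) (h₃ : T (ρ ℚ.≤ᵇ b ℚ.* w₀)) (h₄ : T ((c 64 1 ℚ.- ρ ℚ.+ b ℚ.* w₀) ℚ.≤ᵇ c 10 1 ℚ.* (b ℚ.* w₀))) ->
     T (c 50175 10000 ℚ.* w₀ ℚ.≤ᵇ (1# ℚ.+ (b ℚ.* w₀ ℚ.- ρ) ℚ.* c 1 64) ^ᶜ 32) -> D ≤ c 1 2500 -> D * (K * K) ≤ e -> w₀ ≤ w -> Small (ω *° z) (c 5 1 * x²)
    near-claim e q b ρ wₗ e₀ q₀ em eq bp qρ h₁ h₂ h₃ h₄ h₅ Ds De hw = decay (ω *° z) Nωz (c 5 1 * x²) (b * w - ρ) (lit *₀ x²₀)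
     ((*≤ʳ lit (x²≤ Ds) »≡ solve 1 (λ w -> κ 5 1 :* (κ 10035 10000 :* w) := κ 50175 10000 :* w) refl w) » Gr.first-order (c 50175 10000) lit h₅ w hw)
     (Gr.nonneg w hw)
     (gap≤ (gap (≤-trans ⟦ bp ⟧ (of≡ (*≡ _ _ · cong (p *_) (+≡ _ _ · cong (1# +_) (-≡ _ · (cong -_ (*≡ _ _ · cong (c 1 12 *_) (*≡ e m))))))) ) *₀ w₀ +₀ gap (≤-trans (of≡ (sym (+≡ _ _))) ⟦ qρ ⟧)) (solve 5 (λ α w q b ρ -> α :* w :- q := b :* w :- ρ :+ κ 1 3 :+ ((α :- b) :* w :+ (ρ :- (q :+ κ 1 3)))) refl _ w q b ρ) » near e q ⟦ e₀ ⟧ ⟦ q₀ ⟧ De (≤-trans (of≡ (sym (*≡ e m))) ⟦ em ⟧) (sym (*≡ _ _ · (cong₂ _*_ (*≡ _ _) (*≡ _ _))) ≡» ≤-trans ⟦ eq ⟧ (of≡ (*≡ q q))))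
     where
     module Gr = Growth b ρ wₗ h₁ h₂ h₃ h₄
    D-small : ∀ ε -> T (0# ℚ.≤ᵇ ε) -> T (1# ℚ.≤ᵇ ε ℚ.* (cV ℚ.* κ₀)) -> T (c 81 1 ℚ.* ε ℚ.≤ᵇ c 1 2500 ℚ.* (κ₀ ℚ.* κ₀)) -> x² ≤ c 81 1 -> (D * (K * K) ≤ ε * w) × (ε * w ≤ c 81 1 * ε) × (D ≤ c 1 2500)
    D-small ε ε₀ h₁ h₆ hi = De , εw , D≤ (c 81 1 ℚ.* ε) (c 1 2500) h₆ (De » εw »≡ sym (*≡ _ _))
     where
     εw : ε * w ≤ c 81 1 * ε
     εw = *≤ʳ ⟦ ε₀ ⟧ (w≤x² » hi) »≡ *-comm ε (c 81 1)
     De : D * (K * K) ≤ ε * w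
     De = sym (*-1ˡ _) ≡» *≤ˡ (D₀ *₀ sq₀ K) (≤-trans ⟦ h₁ ⟧ (of≡ (*≡ _ _ · cong (ε *_) (*≡ _ _)))) » solve 5 (λ e v k D s -> e :* (v :* k) :* (D :* s) := e :* (D :* (v :* (k :* s)))) refl ε cV κ₀ D _ ≡» *≤ʳ ⟦ ε₀ ⟧ (*≤ʳ D₀ (*≤ʳ cV₀ (*≤ˡ (sq₀ K) K≥) » V≥))
    -- The exponent is concave in w, hence on [30.1, 81] at least its chord; 111.1 and 2438.1 are
    -- the sum and the product of the endpoints. The value 13.2 makes `decayFactor` exceed 400.
    mid-claim : ∀ ε q -> T (0# ℚ.≤ᵇ ε) -> T (0# ℚ.≤ᵇ q) -> T (1# ℚ.≤ᵇ ε ℚ.* (cV ℚ.* κ₀)) -> T (c 81 1 ℚ.* ε ℚ.* m ℚ.≤ᵇ c 12 1) -> T (c 3 1 ℚ.* (c 81 1 ℚ.* ε) ℚ.* (ω̄ ℚ.* ω̄) ℚ.≤ᵇ q ℚ.* q) ->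
     T (c 1111 10 ℚ.* (c 1 12 ℚ.* (ε ℚ.* m)) ℚ.≤ᵇ 1#) ->
     T (c 132 10 ℚ.+ c 1 3 ℚ.+ q ℚ.≤ᵇ p ℚ.* ((1# ℚ.- c 1111 10 ℚ.* (c 1 12 ℚ.* (ε ℚ.* m))) ℚ.* c 301 10 ℚ.+ c 1 12 ℚ.* (ε ℚ.* m) ℚ.* c 24381 10)) ->
     T (c 81 1 ℚ.* ε ℚ.≤ᵇ c 1 2500 ℚ.* (κ₀ ℚ.* κ₀)) -> c 3025 100 ≤ x² -> x² ≤ c 81 1 -> Small (ω *° z) (c 400 1)
    mid-claim ε q ε₀ q₀ h₁ h₂ h₃ h₄ h₅ h₆ lo hi = decay (ω *° z) Nωz (c 400 1) (c 132 10) lit (lit »≡ ^ᶜ≡ _ 32 · cong (_^ 32) (+≡ _ _ · cong (1# +_) (*≡ _ _))) lit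
     (gap≤ (p₀ *₀ ε'₀ *₀ (gap w≥' *₀ gap w≤81) +₀ p₀ *₀ gap h₄' *₀ gap w≥' +₀ gap h₅') (solve 4 (λ p e w q -> p :* (Κ 1# :- e :* w) :* w :- q := κ 132 10 :+ κ 1 3 :+ (p :* e :* ((w :- κ 301 10) :* (κ 81 1 :- w)) :+ p :* (Κ 1# :- κ 1111 10 :* e) :* (w :- κ 301 10) :+ (p :* ((Κ 1# :- κ 1111 10 :* e) :* κ 301 10 :+ e :* κ 24381 10) :- (κ 132 10 :+ κ 1 3 :+ q)))) refl p ε' w q) » cong (λ s -> p * (1# - s) * w - q) (solve 3 (λ e m w -> κ 1 12 :* (e :* m) :* w := κ 1 12 :* (e :* w :* m)) refl ε m w) ≡» near (ε * w) q (ε⁰ *₀ w₀) ⟦ q₀ ⟧ De (*≤ˡ m₀ εw » ≤-trans (of≡ (sym (*≡ _ _ · cong (_* m) (*≡ _ _)))) ⟦ h₂ ⟧)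
      (*≤ˡ (sq₀ ω̄) (*≤ʳ lit εw) » sym (*≡ _ _ · (cong₂ _*_ (*≡ _ _ · cong (c 3 1 *_) (*≡ _ _)) (*≡ _ _))) ≡» ≤-trans ⟦ h₃ ⟧ (of≡ (*≡ q q))))
     where
     ε⁰ : 0# ≤ ε
     ε⁰ = ⟦ ε₀ ⟧
     ε' : ℚ
     ε' = c 1 12 * (ε * m)
     ε'₀ : 0# ≤ ε'
     ε'₀ = lit *₀ (ε⁰ *₀ m₀)
     w≤81 : w ≤ c 81 1
     w≤81 = w≤x² » hi
     small' : (D * (K * K) ≤ ε * w) × (ε * w ≤ c 81 1 * ε) × (D ≤ c 1 2500)
     small' = D-small ε ε₀ h₁ h₆ hi
     De : D * (K * K) ≤ ε * w
     De = proj₁ small'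
     εw : ε * w ≤ c 81 1 * ε
     εw = proj₁ (proj₂ small')
     Ds : D ≤ c 1 2500
     Ds = proj₂ (proj₂ small')
     w≥' : c 301 10 ≤ w
     w≥' = lit » *≡ _ _ ≡» *≤ʳ lit lo » w≥ Ds
     1-≡ : 1# ℚ.- c 1111 10 ℚ.* (c 1 12 ℚ.* (ε ℚ.* m)) ≡ 1# - c 1111 10 * ε'
     1-≡ = +≡ _ _ · cong (1# +_) (-≡ _ · (cong -_ (*≡ _ _ · cong (c 1111 10 *_) (*≡ _ _ · cong (c 1 12 *_) (*≡ _ _)))))
     h₄' : c 1111 10 * ε' ≤ 1#
     h₄' = ≤-trans (of≡ (sym (*≡ _ _ · cong (c 1111 10 *_) (*≡ _ _ · cong (c 1 12 *_) (*≡ _ _))))) ⟦ h₄ ⟧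
     h₅' : c 132 10 + c 1 3 + q ≤ p * ((1# - c 1111 10 * ε') * c 301 10 + ε' * c 24381 10)
     h₅' = sym (+≡ _ _ · cong (_+ q) (+≡ _ _)) ≡» ≤-trans ⟦ h₅ ⟧ (of≡ (*≡ _ _ · cong (p *_) (+≡ _ _ · (cong₂ _+_ (*≡ _ _ · cong (_* c 301 10) 1-≡) (*≡ _ _ · cong (_* c 24381 10) (*≡ _ _ · cong (c 1 12 *_) (*≡ _ _)))))))
    D₊' : ∀ e -> 0# < e -> e ≤ D * (K * K) -> 0# < D
    D₊' e e₊ h = factor₊ D₀ (ℚP.<-≤-trans e₊ h)
    far-Y : ∀ e γ δ b -> T (0# ℚ.≤ᵇ e) -> 0# < e -> 0# ≤ γ -> 0# ≤ δ -> T ((1# ℚ.+ δ) ℚ.* (1# ℚ.+ δ) ℚ.≤ᵇ γ ℚ.* γ ℚ.* e ℚ.* c 89976 10000) -> T (b ℚ.+ c 2 3 ℚ.* γ ℚ.≤ᵇ c 2 1 ℚ.* ωc) ->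
     D ≤ c 1 2500 -> D ≤ δ * δ -> e ≤ D * (K * K) -> b * K - c 1 3 + c 1 3 ≤ Dω.Y n
    far-Y e γ δ b e₀ e₊ γ₀ δ₀ h hb Ds Dδ De = third (slope γ b hb (far-ω (γ * K) (γ₀ *₀ K₀) (D₊' e e₊ De)
     (N-1+ω z δ δ₀ Dδ » sym (*≡ _ _ · (cong₂ _*_ (+≡ _ _) (+≡ _ _))) ≡» N₃-e e γ _ h ⟦ e₀ ⟧ Ds De)))
    -- For D ≥ 1/2500 the oscillation bound no longer depends on K, so the decay is exponential in K
    -- and beats the cubic growth of x².
    far-claim : ∀ b τ -> (h₁ : T (0# ℚ.≤ᵇ b)) (h₂ : T (1# ℚ.≤ᵇ κ₀)) (h₃ : T (c 2674 100 ℚ.≤ᵇ b ℚ.* κ₀)) (h₄ : T ((c 64 1 ℚ.- c 2674 100 ℚ.+ b ℚ.* κ₀) ℚ.≤ᵇ c 10 1 ℚ.* (b ℚ.* κ₀))) ->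
     T (τ ℚ.* (κ₀ ℚ.* (κ₀ ℚ.* κ₀)) ℚ.≤ᵇ (1# ℚ.+ (b ℚ.* κ₀ ℚ.- c 2674 100) ℚ.* c 1 64) ^ᶜ 32) -> T (c 5 1 ℚ.* c 121364 100000 ℚ.* CV ℚ.≤ᵇ τ) -> T (b ℚ.≤ᵇ c 2 1 ℚ.* ωc) ->
     c 1 2500 ≤ D -> Small (ω *° z) (c 5 1 * x²)
    far-claim b τ h₁ h₂ h₃ h₄ h₅ h₆ h₇ Db = Finish.cubic b (c 2674 100) h₁ h₂ h₃ h₄ τ h₅ (ω *° z) Nωz (c 5 1 * x²) (lit *₀ x²₀) (x²≤K³ τ (c 5 1) lit h₆)
     (gap≤ (gap (≤-trans ⟦ h₇ ⟧ (of≡ (*≡ _ _))) *₀ K₀ +₀ lit) (solve 3 (λ o k q -> κ 2 1 :* o :* k :- κ 2 3 :* κ 396 10 := q :* k :- κ 2674 100 :+ κ 1 3 :+ ((κ 2 1 :* o :- q) :* k :+ Κ Κd)) refl ωc K b) » far-ω (c 396 10) lit (ℚP.<-≤-trans (ℚP.positive⁻¹ (c 1 2500)) Db) big)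
     where
     Κd : ℚ
     Κd = c 2674 100 ℚ.- c 1 3 ℚ.- c 2 3 ℚ.* c 396 10
     big : N (1° +° ω *° z) ≤ c 396 10 * c 396 10 * N₃
     big = N-1+≤4 (ω *° z) Nωz » (lit »≡ *≡ _ _ · cong (_* c 35759 10000000) (*≡ _ _)) » *≤ʳ (sq₀ (c 396 10)) (N₃-big Db)

-- Numerical instances of the tail estimates

module W3 where
 open Q1
 open E1
 open U1
 open P1
 open R1
 open N1
 open N2
 open N3
 open N4
 open N5
 open W1
 open W2
 module Claims (r : ℚ) (r₊ : 0# < r) (r₁ : r ≤ 1#) (n : ℕ) where
  open Weights r r₊ r₁ using (Π²)
  open Main r r₊ r₁ using (V)
  open Num r r₊ r₁ n using (TypeA; TypeB)
  Small : 𝔼 -> ℚ -> Set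
  Small u t = N (P (ofℚ r *° u) n) * (t * t) ≤ Π² n
  -- With x = X √S, the first two parts cover 5.5 ≤ x ≤ 9 and x ≥ 9 around `ω`, and the third covers
  -- the neighbourhood of 1. The fourth tells the core estimate that D V is almost x².
  Tails : ℚ -> Set
  Tails S = ∀ z -> N z ≡ 1# -> ∀ X -> 0# ≤ X -> X ≤ c 11 10 -> N (1° -° z ^° 1) ≤ X * X -> c 9997 10000 * (X * X * (1# - c 1 12 * (X * X))) ≤ N (1° -° z ^° 1) ->
   (c 3025 100 ≤ X * X * S -> X * X * S ≤ c 81 1 -> Small (ω *° z) (c 400 1)) × (c 81 1 ≤ X * X * S -> Small (ω *° z) (c 5 1 * (X * X * S))) ×
   (0# < X -> Small z (c 486 1) × Small z (c 6 1 * (X * X * S))) ×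
   (X * X * S ≤ c 81 1 -> c 9966 10000 * (X * X * S) ≤ N (1° -° z ^° 1) * V n)
  assoc³ : ∀ v K -> v * (K * K * K) ≡ v * (K * (K * K))
  assoc³ v K = cong (v *_) (*-assoc K K K)
  tailsA : TypeA -> ∀ S -> V n ≤ S -> S ≤ c 1003 1000 * V n -> Tails S
  tailsA bd S S≥ S≤ z Nz X X₀ X≤ D≤ D≥ = mid , far , zero' , weight
   where
   open Bounds bd
   module TT = Tail r r₊ r₁ n K (c 747 10) (c 648 1000) (c 1630 100) (c 229 10) (c 560 1000) (c 1 1) (c 131 1) lit lit lit lit 0<1 lit K≥
   module TA = TT.Facts.At (sym (assoc³ _ K) ≡» V≥) (V≤ »≡ assoc³ _ K) Vp≥ Ω≥ Ω≤ Mp≤ S S≥ S≤ z Nz X X₀ X≤ D≤ D≥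
   open Unit z Nz using (D; D₀)
   weight : X * X * S ≤ c 81 1 -> c 9966 10000 * (X * X * S) ≤ D * V n
   weight hi = TA.w≥ (proj₂ (proj₂ (TA.D-small (c 822 1000000) _ _ _ hi)))
   mid : c 3025 100 ≤ X * X * S -> X * X * S ≤ c 81 1 -> Small (ω *° z) (c 400 1)
   mid = TA.mid-claim (c 822 1000000) (c 447 1000) _ _ _ _ _ _ _ _
   far : c 81 1 ≤ X * X * S -> Small (ω *° z) (c 5 1 * (X * X * S))
   far hx = by-D (≤-total D (c 1 2500))
    where
    by-D : D ≤ c 1 2500 ⊎ c 1 2500 ≤ D -> Small (ω *° z) (c 5 1 * (X * X * S))
    by-D (inj₂ h) = TA.far-claim (c 112 100) (c 139 1) _ _ _ _ _ _ _ h
    by-D (inj₁ Ds) = by-E (≤-total (D * (K * K)) (c 66 1000)) (≤-total (D * (K * K)) (c 25 100))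
     where
     by-E : D * (K * K) ≤ c 66 1000 ⊎ c 66 1000 ≤ D * (K * K) -> D * (K * K) ≤ c 25 100 ⊎ c 25 100 ≤ D * (K * K) -> Small (ω *° z) (c 5 1 * (X * X * S))
     by-E (inj₁ h) _ = TA.near-claim (c 66 1000) (c 445 1000) (c 1811 10000) (c 779 1000) (c 807 10) _ _ _ _ _ _ _ _ _ _ _ Ds h
      (lit » *≡ _ _ ≡» *≤ʳ lit hx » TA.w≥ Ds)
     by-E (inj₂ h) (inj₁ h') = TA.Finish.first-order (c 249 1000) (c 1 3) _ _ _ _ (c 2873 100) _ _ (ω *° z) TA.Nωz _ (lit *₀ TA.x²₀)
      (TA.x²≤eK (c 25 100) (c 2873 100) (c 5 1) lit _ Ds h')
      (TA.far-Y (c 66 1000) (c 13064 10000) (c 67 10000) (c 249 1000) _ (ℚP.positive⁻¹ (c 66 1000)) lit lit _ _ Ds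
       (TA.D≤ (c 25 100) (c 4489 100000000) _ h' » lit »≡ *≡ _ _) h)
     by-E (inj₂ _) (inj₂ h) = TA.Finish.cubic (c 666 1000) (c 1 3) _ _ _ _ (c 46 1000) _ (ω *° z) TA.Nωz _ (lit *₀ TA.x²₀)
      (TA.x²≤dK³ (c 46 1000) (c 5 1) lit _ Ds)
      (TA.far-Y (c 25 100) (c 6802 10000) (c 2 100) (c 666 1000) _ (ℚP.positive⁻¹ (c 25 100)) lit lit _ _ Ds
       (Ds » lit »≡ *≡ _ _) h)
   zero' : 0# < X -> Small z (c 486 1) × Small z (c 6 1 * (X * X * S))
   zero' X₊ = TA.Zero.claim (c 414 1000) (c 3083 10000) (c 6754 10000) (c 112 100) (c 415 10) (c 1379 10) (c 552 10000) (c 1668 10) X₊ peak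
    _ _ _ _ _ _ _ _ _ _ _ _ _ _ _ _ _ _ _ _ _ _ _ _ _ _ _ _ _ _ _ _
  tailsB : TypeB -> ∀ S -> V n ≤ S -> S ≤ c 1003 1000 * V n -> Tails S
  tailsB bd S S≥ S≤ z Nz X X₀ X≤ D≤ D≥ = mid , far , zero' , weight
   where
   open Bounds bd
   module TT = Tail r r₊ r₁ n K (c 875 1) (c 49 100) (c 119 10) (c 768 1) (c 542 1000) (c 4 3) (c 188 1) lit lit lit lit (ℚP.positive⁻¹ (c 4 3)) lit K≥
   module TA = TT.Facts.At (sym (assoc³ _ K) ≡» V≥) (V≤ »≡ assoc³ _ K) Vp≥ Ω≥ Ω≤ Mp≤ S S≥ S≤ z Nz X X₀ X≤ D≤ D≥
   open Unit z Nz using (D; D₀)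
   weight : X * X * S ≤ c 81 1 -> c 9966 10000 * (X * X * S) ≤ D * V n
   weight hi = TA.w≥ (proj₂ (proj₂ (TA.D-small (c 961 10000000) _ _ _ hi)))
   mid : c 3025 100 ≤ X * X * S -> X * X * S ≤ c 81 1 -> Small (ω *° z) (c 400 1)
   mid = TA.mid-claim (c 961 10000000) (c 204 1000) _ _ _ _ _ _ _ _
   far : c 81 1 ≤ X * X * S -> Small (ω *° z) (c 5 1 * (X * X * S))
   far hx = by-D (≤-total D (c 1 2500))
    where
    by-D : D ≤ c 1 2500 ⊎ c 1 2500 ≤ D -> Small (ω *° z) (c 5 1 * (X * X * S))
    by-D (inj₂ h) = TA.far-claim (c 1084 1000) (c 4661 1) _ _ _ _ _ _ _ h
    by-D (inj₁ Ds) = by-E (≤-total (D * (K * K)) (c 2 100)) (≤-total (D * (K * K)) (c 5 100))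
     where
     by-E : D * (K * K) ≤ c 2 100 ⊎ c 2 100 ≤ D * (K * K) -> D * (K * K) ≤ c 5 100 ⊎ c 5 100 ≤ D * (K * K) -> Small (ω *° z) (c 5 1 * (X * X * S))
     by-E (inj₁ h) _ = TA.near-claim (c 2 100) (c 327 1000) (c 3364 10000) (c 661 1000) (c 807 10) _ _ _ _ _ _ _ _ _ _ _ Ds h
      (lit » *≡ _ _ ≡» *≤ʳ lit hx » TA.w≥ Ds)
     -- A second use of the quadratic estimate: 0.02 ≤ D K², V ≥ 11.9 K³ and K ≥ 875 force w ≥ 208,
     -- which makes up for the smaller slope.
     by-E (inj₂ h) (inj₁ h') = TA.near-claim (c 5 100) (c 517 1000) (c 106 1000) (c 851 1000) (c 208 1) _ _ _ _ _ _ _ _ _ _ _ Ds h'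
      ((lit » *≡ _ _ · cong (c 2 100 *_) (*≡ _ _) ≡» *≤ lit (lit *₀ TT.K₀) h (*≤ʳ lit K≥)) » solve 3 (λ D k v -> D :* (k :* k) :* (v :* k) := D :* (v :* (k :* k :* k))) refl D K _ ≡» *≤ʳ D₀ V≥)
     by-E (inj₂ _) (inj₂ h) = TA.Finish.cubic (c 701 10000) (c 1 3) _ _ _ _ (c 1542 1000) _ (ω *° z) TA.Nωz _ (lit *₀ TA.x²₀)
      (TA.x²≤dK³ (c 1542 1000) (c 5 1) lit _ Ds)
      (TA.far-Y (c 5 100) (c 15208 10000) (c 2 100) (c 701 10000) _ (ℚP.positive⁻¹ (c 5 100)) lit lit _ _ Ds
       (Ds » lit »≡ *≡ _ _) h)
   zero' : 0# < X -> Small z (c 486 1) × Small z (c 6 1 * (X * X * S))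
   zero' X₊ = TA.Zero.claim (c 177 1000) (c 2723 10000) (c 6394 10000) (c 1084 1000) (c 1388 1) (c 4625 1) (c 1851 1000) (c 5593 1) X₊ peak
    _ _ _ _ _ _ _ _ _ _ _ _ _ _ _ _ _ _ _ _ _ _ _ _ _ _ _ _ _ _ _ _

-- The core: the contribution of conjugate pairs around the peak

module C1 where
 open Q1
 open E1
 open U1
 open P1
 open R1
 open N2
 open N3
 open W1
 open W2
 open import Data.Bool using (T)
 Tr≥ : ∀ {x k} -> 0# ≤ k -> N x ≤ k * k -> - (c 2 1 * k) ≤ Tr x
 Tr≥ {x} {k} k₀ h = ungap (subst (0# ≤_) (cong (λ t -> c 2 1 * k - t) (Tr-neg x) · solve 2 (λ k t -> κ 2 1 :* k :- (:- t) := t :- (:- (κ 2 1 :* k))) refl k _)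
  (gap (Tr-⊑ { -° x} k₀ (N-neg x ≡» h))))
 N1° : N 1° ≡ 1#
 N1° = N-ofℚ 1# · *-1ˡ 1#
 conj-neg : ∀ x -> conj (-° x) ≡ -° conj x
 conj-neg x = cong conj (solve° 1 (λ x -> :- x := (:- Κ 1°) :* x) refl x) · conj-* (-° 1°) x · cong (_*° conj x) (cong conj (sym (ofℚ-neg 1#)) · conj-ofℚ (- 1#) · ofℚ-neg 1#) · solve° 1 (λ x -> (:- Κ 1°) :* x := :- x) refl _
 N-1-conj : ∀ x -> N (1° -° conj x) ≡ N (1° -° x)
 N-1-conj x = cong N (sym (conj-+ 1° (-° x) · (cong₂ _+°_ (conj-ofℚ 1#) (conj-neg x)))) · N-conj (1° -° x)
 squareᶜ : ℚ -> ℚ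
 squareᶜ p = p ℚ.* p
 -- Repeated squaring keeps the evaluation of the numerical table cheap.
 pow32 : ℚ -> ℚ
 pow32 p = squareᶜ (squareᶜ (squareᶜ (squareᶜ (squareᶜ p))))
 pow32≡ : ∀ p -> pow32 p ≡ p ^ 32
 pow32≡ p = step 16 (step 8 (step 4 (step 2 (*≡ p p · cong (p *_) (sym (*-1ʳ p)))))) · refl
  where
  step : ∀ k {x} -> x ≡ p ^ k -> squareᶜ x ≡ p ^ (k ℕ.+ k)
  step k {x} h = *≡ x x · (cong₂ _*_ h h) · sym (^-+ p k k)
 module Core (r : ℚ) (r₊ : 0# < r) (r₁ : r ≤ 1#) (n : ℕ) where
  open Main r r₊ r₁ using (V; V̂; V̂₀; M₄; S₁; S₂; k₁; C; total; total₊; μ; x₀; v₀; t₀)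
  F : 𝔼 -> 𝔼
  F u = P (ofℚ r *° (ω *° u)) n
  R : ∀ z -> N z ≡ 1# -> 𝔼
  R z Nz = Main.At.R r r₊ r₁ z Nz n
  τ : ℚ
  τ = total n
  τ₊ : 0# < τ
  τ₊ = total₊ n
  τ₀ : 0# ≤ τ
  τ₀ = <⇒≤ τ₊
  R-conj : ∀ z Nz Nz̄ -> R (conj z) Nz̄ ≡ conj (R z Nz)
  R-conj z Nz Nz̄ = go n
   where
   module A = Main.At r r₊ r₁ z Nz
   module B = Main.At r r₊ r₁ (conj z) Nz̄
   open Main r r₊ r₁ using (A₁; A₂)
   hat : ∀ i -> B.R̂ i ≡ conj (A.R̂ i)
   hat i = sym (conj-+ _ _ · (cong₂ _+°_ (conj-+ _ _ · (cong₂ _+°_ (conj-ofℚ 1#) (term (A₁ i) (a i)))) (term (A₂ i) (e i))))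
    where
    term : ∀ p k -> conj (ofℚ p *° z ^° k) ≡ ofℚ p *° conj z ^° k
    term p k = conj-* _ _ · (cong₂ _*°_ (conj-ofℚ p) (conj-^ z k))
   go : ∀ k -> B.R k ≡ conj (A.R k)
   go zero = sym (conj-ofℚ 1#)
   go (suc k) = (cong₂ _*°_ (go k) (hat k)) · sym (conj-* _ _)
  module Facts (M₄≤ : M₄ n ≤ c 3 20 * (V n * V n)) (V̂≤ : ∀ i -> i ℕ.< n -> V̂ i ≤ c 1 80 * V n) (k₁S₁≤ : k₁ * S₁ n ≤ c 1947 10000)
   (S₁≤ : S₁ n * S₁ n ≤ c 195 10000 * c 195 10000 * V n) (S₁₂≤ : (S₁ n + k₁ * S₂ n) * (S₁ n + k₁ * S₂ n) ≤ c 445 10000 * c 445 10000 * V n)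
   (s : ℚ) (s₀ : 0# ≤ s) (V≤S : V n ≤ s * s) where
   k₁₀ : 0# ≤ k₁
   k₁₀ = lit *₀ t₀
   S₁₀ : 0# ≤ S₁ n
   S₁₀ = sum₀ n (λ i -> x₀ i *₀ v₀ i)
   S₁₂₀ : 0# ≤ S₁ n + k₁ * S₂ n
   S₁₂₀ = S₁₀ +₀ k₁₀ *₀ sum₀ n (λ i -> x₀ i *₀ (ι₀ (a i) +₀ sq₀ _ *₀ ι₀ (b i)) *₀ sq₀ _)
   NC : ∀ X -> N (C n *° X) ≤ c 12418 10000 * c 12418 10000 * N X
   NC X = N-* (C n) X ≡» *≤ˡ (N₀ X) (subst (λ y -> N y ≤ (c 12418 10000 - 1# + 1#) * (c 12418 10000 - 1# + 1#) * N 1°) (solve° 1 (λ c -> (c :- Κ 1°) :+ Κ 1° := c) refl _)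
    (⊑-+ {C n -° 1°} {1°} {1°} (lit »≡ +≡ _ _ · cong (c 12418 10000 +_) (-≡ 1#)) lit
    (Main.C-1≤ r r₊ r₁ n (c 12418 10000) lit C-hyp) (⊑-refl 1°)) »≡ cong ((c 12418 10000 - 1# + 1#) * (c 12418 10000 - 1# + 1#) *_) N1° · solve 1 (λ q -> (q :- Κ 1# :+ Κ 1#) :* (q :- Κ 1# :+ Κ 1#) :* Κ 1# := q :* q) refl _)
    where
    C-hyp : 1# ≤ c 12418 10000 * (1# - k₁ * S₁ n)
    C-hyp = (lit »≡ solve 0 (Κ (c 12418 10000 ℚ.* (1# ℚ.- c 1947 10000)) := κ 12418 10000 :* (Κ 1# :- κ 1947 10000)) refl) » *≤ʳ lit (+≤ ≤-refl (neg-mono k₁S₁≤))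
   C-1 : C n -° 1° ⊑[ c 2418 10000 ] 1°
   C-1 = subst (λ k -> C n -° 1° ⊑[ k ] 1°) (solve 0 (κ 12418 10000 :- Κ 1# := κ 2418 10000) refl) (Main.C-1≤ r r₊ r₁ n (c 12418 10000) lit
    ((lit »≡ solve 0 (Κ (c 12418 10000 ℚ.* (1# ℚ.- c 1947 10000)) := κ 12418 10000 :* (Κ 1# :- κ 1947 10000)) refl) » *≤ʳ lit (+≤ ≤-refl (neg-mono k₁S₁≤))))
   module At (z : 𝔼) (Nz : N z ≡ 1#) (X : ℚ) (X₀ : 0# ≤ X) (D≤X² : N (1° -° z ^° 1) ≤ X * X) (w≥ : c 9966 10000 * (X * X * (s * s)) ≤ N (1° -° z ^° 1) * V n) where
    open Unit z Nz using (D; D₀)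
    x : ℚ
    x = X * s
    x₀' : 0# ≤ x
    x₀' = X₀ *₀ s₀
    xx : X * X * (s * s) ≡ x * x
    xx = *-swap X X s s
    DV≤ : D * V n ≤ x * x
    DV≤ = *≤ D₀ (sq₀ s) D≤X² V≤S »≡ xx
    module A = Main.At r r₊ r₁ z Nz
    -- From M₄ ≤ 3/20 V² the Gaussian exponent is at least v - v²/80 with v = D V. This increases up
    -- to v = 40, beyond the reach of x ≤ 5.5, so v may be replaced by 0.996 e².
    R-bound : ∀ e h -> T (0# ℚ.≤ᵇ e) -> T (e ℚ.≤ᵇ c 55 10) -> T (0# ℚ.≤ᵇ h) -> T (1# ℚ.≤ᵇ h ℚ.* pow32 (1# ℚ.+ (c 996 1000 ℚ.* (e ℚ.* e) ℚ.- c 1 80 ℚ.* (c 996 1000 ℚ.* (e ℚ.* e) ℚ.* (c 996 1000 ℚ.* (e ℚ.* e)))) ℚ.* c 1 64)) ->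
     e ≤ x -> x ≤ c 55 10 -> N (R z Nz) ≤ h * τ * (h * τ)
    R-bound e h e₀ e≤ h₀ hh ex x5 = (sym (*-1ʳ NR) ≡» *≤ʳ (N₀ _) (sym (*-1ˡ 1#) ≡» sq-mono lit hh')) » solve 3 (λ r h d -> r :* (h :* d :* (h :* d)) := h :* h :* (r :* (d :* d))) refl NR h _ ≡» *≤ʳ (sq₀ h) (cong (NR *_) (sym (^-* (1# + Y * c 1 64) 2 32 · cong (decayFactor Y *_) (*-1ʳ _))) ≡» A.R-decay n Y Y₀ Y≤) »≡ *-swap h h τ τ
     where
     NR w Y DV : ℚ
     NR = N (R z Nz)
     w = c 996 1000 * (e * e)
     Y = w - c 1 80 * (w * w)
     DV = D * V n
     e₀' : 0# ≤ e
     e₀' = ℚP.≤ᵇ⇒≤ e₀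
     w₀ : 0# ≤ w
     w₀ = lit *₀ sq₀ e
     w≤40 : w ≤ c 40 1
     w≤40 = *≤ʳ lit (sq-mono {e} {c 55 10} e₀' (ℚP.≤ᵇ⇒≤ e≤)) » solve 0 (κ 996 1000 :* (κ 55 10 :* κ 55 10) := Κ (c 996 1000 ℚ.* (c 55 10 ℚ.* c 55 10))) refl ≡» lit
     DV40 : DV ≤ c 40 1
     DV40 = DV≤ » sq-mono x₀' x5 » sym (*≡ _ _) ≡» lit
     w≤DV : w ≤ DV
     w≤DV = (scale≤ (e * e) (sq₀ e) lit » *≤ʳ lit (sq-mono e₀' ex »≡ sym xx)) » w≥
     Y₀ : 0# ≤ Y
     Y₀ = subst (0# ≤_) (solve 1 (λ w -> κ 1 80 :* (w :* (κ 40 1 :- w)) :+ κ 1 2 :* w := w :- κ 1 80 :* (w :* w)) refl w) (lit *₀ (w₀ *₀ gap w≤40) +₀ lit *₀ w₀)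
     Y≤ : Y ≤ DV - c 1 12 * (D * D) * M₄ n
     Y≤ = gap≤ (lit *₀ (gap w≤DV *₀ (gap DV40 +₀ gap w≤40))) (solve 2 (λ w v -> v :- κ 1 80 :* (v :* v) := w :- κ 1 80 :* (w :* w) :+ κ 1 80 :* ((v :- w) :* ((κ 40 1 :- v) :+ (κ 40 1 :- w)))) refl w DV) » gap≤ (lit *₀ sq₀ D *₀ gap M₄≤) (solve 3 (λ D v m -> D :* v :- κ 1 12 :* (D :* D) :* m := D :* v :- κ 1 80 :* (D :* v :* (D :* v)) :+ κ 1 12 :* (D :* D) :* (κ 3 20 :* (v :* v) :- m)) refl D _ _)
     hh' : 1# ≤ h * decayFactor Y
     hh' = ℚP.≤ᵇ⇒≤ hh »≡ *≡ _ _ · cong (h *_) (pow32≡ _ · cong (_^ 32) (+≡ _ _ · cong (1# +_) (*≡ _ _ · cong (_* c 1 64) Y≡)))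
      where
      w≡ : c 996 1000 ℚ.* (e ℚ.* e) ≡ w
      w≡ = *≡ _ _ · cong (c 996 1000 *_) (*≡ _ _)
      Y≡ : c 996 1000 ℚ.* (e ℚ.* e) ℚ.- c 1 80 ℚ.* (c 996 1000 ℚ.* (e ℚ.* e) ℚ.* (c 996 1000 ℚ.* (e ℚ.* e))) ≡ Y
      Y≡ = +≡ _ _ · (cong₂ _+_ w≡ (-≡ _ · (cong -_ (*≡ _ _ · cong (c 1 80 *_) (*≡ _ _ · (cong₂ _*_ w≡ w≡))))))
    -- The bound V̂ ≤ V/80 gives `σ`; `E` bounds the accumulated products. The sums of corrections
    -- are 0.0195 and 0.0445 times √V, hence errors linear in x.
    error-bound : ∀ σ E fm q f -> T (1# ℚ.≤ᵇ σ) -> T (0# ℚ.≤ᵇ E) -> T (1# ℚ.≤ᵇ σ ℚ.* σ ℚ.* (1# ℚ.- c 1 80 ℚ.* (fm ℚ.* fm))) -> T (1# ℚ.≤ᵇ E ℚ.* (1# ℚ.- (c 1947 10000 ℚ.+ c 195 10000 ℚ.* fm) ℚ.* σ)) -> T (E ℚ.* (σ ℚ.* c 445 10000) ℚ.≤ᵇ q) ->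
     x ≤ f -> f ≤ fm -> F z -° C n *° R z Nz ⊑[ q * f ] R z Nz
    error-bound σ E fm q f σ₁ E₀ h₁ h₂ h₃ xf f≤ = ⊑-mono {F z -° C n *° R z Nz} {R z Nz} (E₀' *₀ (X₀ *₀ σ₀ *₀ S₁₂₀)) final
     (Main.At.Error.error r r₊ r₁ z Nz n X σ X₀ σ₀ D≤X² hσ σ₁' E E₀' hE)
     where
     σ₁' : 1# ≤ σ
     σ₁' = ℚP.≤ᵇ⇒≤ σ₁
     σ₀ : 0# ≤ σ
     σ₀ = lit » σ₁'
     E₀' : 0# ≤ E
     E₀' = ℚP.≤ᵇ⇒≤ E₀
     hσ : ∀ i -> i ℕ.< n -> 1# ≤ σ * σ * (1# - D * V̂ i)
     hσ i l = (ℚP.≤ᵇ⇒≤ h₁ »≡ *≡ _ _ · (cong₂ _*_ (*≡ σ σ) (+≡ _ _ · cong (1# +_) (-≡ _ · (cong -_ (*≡ _ _ · cong (c 1 80 *_) (*≡ _ _))))))) » *≤ʳ (sq₀ σ) (+≤ ≤-refl (neg-mono (*≤ʳ D₀ (V̂≤ i l) » solve 2 (λ D v -> D :* (κ 1 80 :* v) := κ 1 80 :* (D :* v)) refl D _ ≡» *≤ʳ lit (DV≤ » sq-mono x₀' (xf » f≤)))))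
     XS : ∀ q Y -> 0# ≤ q -> Y * Y ≤ q * q * V n -> X * Y ≤ q * x
     XS q Y q₀ h = sq-cancel (q₀ *₀ x₀') (*-swap X Y X Y ≡» *≤ʳ (sq₀ X) (h » *≤ʳ (sq₀ q) V≤S) »≡ solve 3 (λ X q s -> X :* X :* (q :* q :* (s :* s)) := q :* (X :* s) :* (q :* (X :* s))) refl X q s)
     hE : 1# ≤ E * (1# - (k₁ + X) * σ * S₁ n)
     hE = (ℚP.≤ᵇ⇒≤ h₂ »≡ *≡ _ _ · cong (E *_) closed≡) » *≤ʳ E₀' (+≤ ≤-refl (neg-mono (solve 4 (λ k X σ s -> (k :+ X) :* σ :* s := (k :* s :+ X :* s) :* σ) refl k₁ X σ _ ≡» *≤ˡ σ₀ (+≤ k₁S₁≤ (XS (c 195 10000) (S₁ n) lit S₁≤ » *≤ʳ lit (xf » f≤))))))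
      where
      closed≡ : 1# ℚ.- (c 1947 10000 ℚ.+ c 195 10000 ℚ.* fm) ℚ.* σ ≡ 1# - (c 1947 10000 + c 195 10000 * fm) * σ
      closed≡ = +≡ _ _ · cong (1# +_) (-≡ _ · (cong -_ (*≡ _ _ · cong (_* σ) (+≡ _ _ · cong (c 1947 10000 +_) (*≡ _ _)))))
     final : E * (X * σ * (S₁ n + k₁ * S₂ n)) ≤ q * f
     final = solve 4 (λ E X σ y -> E :* (X :* σ :* y) := E :* σ :* (X :* y)) refl E X σ _ ≡» *≤ʳ (E₀' *₀ σ₀) (XS (c 445 10000) _ lit S₁₂≤ » *≤ʳ lit xf) » solve 4 (λ E σ p f -> E :* σ :* (p :* f) := E :* (σ :* p) :* f) refl E σ _ f ≡» *≤ˡ (x₀' » xf) (sym (*≡ _ _ · cong (E *_) (*≡ _ _)) ≡» ℚP.≤ᵇ⇒≤ h₃)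
   module Pair (z : 𝔼) (Nz : N z ≡ 1#) (X : ℚ) (X₀ : 0# ≤ X) (D≤X² : N (1° -° z ^° 1) ≤ X * X) (w≥ : c 9966 10000 * (X * X * (s * s)) ≤ N (1° -° z ^° 1) * V n) (w : 𝔼) (Nw : N w ≡ 1#) (m : ℕ) where
    Nz̄ : N (conj z) ≡ 1#
    Nz̄ = N-conj z · Nz
    D≡ : N (1° -° conj z ^° 1) ≡ N (1° -° z ^° 1)
    D≡ = cong (λ y -> N (1° -° y)) (sym (conj-^ z 1)) · N-1-conj (z ^° 1)
    module Z = At z Nz X X₀ D≤X² w≥
    module Z̄ = At (conj z) Nz̄ X X₀ (D≡ ≡» D≤X²) (w≥ »≡ cong (_* V n) (sym D≡))
    Rm : 𝔼
    Rm = R z Nz *° conj (z ^° m)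
    B : ℚ
    B = Tr (C n *° w)
    pair : ℚ
    pair = Tr (F z *° (w *° conj (z ^° m))) + Tr (F (conj z) *° (w *° conj (conj z ^° m)))
    err : ∀ u Nu -> 𝔼
    err u Nu = F u -° C n *° R u Nu
    -- Adding the values at z and its conjugate makes the trinomial part real: it factors out as
    -- `Tr Rm`, leaving `B`, the trace of C times the phase, and two error terms.
    pair≡ : pair ≡ B * Tr Rm + (Tr (err z Nz *° (w *° conj (z ^° m))) + Tr (err (conj z) Nz̄ *° (w *° conj (conj z ^° m))))
    pair≡ = (cong₂ _+_ (half z Nz) (half (conj z) Nz̄)) · +-swap _ _ _ _ · cong (_+ (Tr (err z Nz *° (w *° conj (z ^° m))) + Tr (err (conj z) Nz̄ *° (w *° conj (conj z ^° m))))) (sym (Tr-+ _ _) · cong Tr (cong (λ y -> C n *° R z Nz *° (w *° conj (z ^° m)) +° C n *° y *° (w *° conj (conj z ^° m))) (R-conj z Nz Nz̄) · solve° 6 (λ c r w y r' y' -> c :* r :* (w :* y) :+ c :* r' :* (w :* y') := (r :* y :+ r' :* y') :* (c :* w)) refl _ _ w _ _ _ · cong (_*° (C n *° w)) (cong (Rm +°_) (cong (λ y -> conj (R z Nz) *° conj y) (sym (conj-^ z m)) · sym (conj-* _ _)) · x+conj Rm)) · Tr-ofℚ* (Tr Rm) (C n *° w) · *-comm (Tr Rm) B)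
     where
     half : ∀ u Nu -> Tr (F u *° (w *° conj (u ^° m))) ≡ Tr (C n *° R u Nu *° (w *° conj (u ^° m))) + Tr (err u Nu *° (w *° conj (u ^° m)))
     half u Nu = cong Tr (solve° 3 (λ f c y -> f :* y := c :* y :+ (f :- c) :* y) refl _ _ _) · Tr-+ _ _
    Nw* : ∀ u -> N u ≡ 1# -> N (w *° conj (u ^° m)) ≡ 1#
    Nw* u Nu = N-* w _ · (cong₂ _*_ Nw (N-conj _ · Unit.N-unit u Nu m)) · *-1ˡ 1#
    err≥ : ∀ u Nu k h -> 0# ≤ k -> 0# ≤ h -> err u Nu ⊑[ k ] R u Nu -> N (R u Nu) ≤ h * τ * (h * τ) -> - (c 2 1 * (k * (h * τ))) ≤ Tr (err u Nu *° (w *° conj (u ^° m)))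
    err≥ u Nu k h k₀ h₀ p q = Tr≥ (k₀ *₀ (h₀ *₀ τ₀)) (N-* _ _ · cong (N (err u Nu) *_) (Nw* u Nu) · *-1ʳ _ ≡» p » *≤ʳ (sq₀ k) q »≡ *-swap k k (h * τ) (h * τ))
    pair≥ : ∀ k h y -> 0# ≤ k -> 0# ≤ h -> 0# ≤ B -> err z Nz ⊑[ k ] R z Nz -> err (conj z) Nz̄ ⊑[ k ] R (conj z) Nz̄ -> N (R z Nz) ≤ h * τ * (h * τ) -> N (R (conj z) Nz̄) ≤ h * τ * (h * τ) ->
     y * τ ≤ Tr Rm -> τ * (B * y - c 4 1 * (k * h)) ≤ pair
    pair≥ k h y k₀ h₀ B₀ e₁ e₂ r₁' r₂ hy = solve 5 (λ t B y k h -> t :* (B :* y :- κ 4 1 :* (k :* h)) := B :* (y :* t) :+ ((:- (κ 2 1 :* (k :* (h :* t)))) :+ (:- (κ 2 1 :* (k :* (h :* t)))))) refl τ B y k h ≡» +≤ (*≤ʳ B₀ hy) (+≤ (err≥ z Nz k h k₀ h₀ e₁ r₁') (err≥ (conj z) Nz̄ k h k₀ h₀ e₂ r₂)) »≡ sym pair≡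
    Rm-moment : V n + (μ n - ι m) * (μ n - ι m) ≤ s * s -> ∀ f -> 0# ≤ f -> X * s ≤ f -> (c 2 1 - f * f) * τ ≤ Tr Rm
    Rm-moment hm f f₀ xf = (*-comm _ τ ≡» *≤ʳ τ₀ (+≤ ≤-refl (neg-mono (*≤ (N₀ _) (sq₀ s) D≤X² (cong (V n +_) (cong (λ y -> y * y) (solve 2 (λ u m -> u :+ Κ 0# :- m := u :- m) refl _ _)) ≡» hm) » *-swap X X s s ≡» sq-mono (X₀ *₀ s₀) xf)))) » Main.At.moment r r₊ r₁ z Nz n 0 m »≡ cong (λ y -> Tr (y *° conj (z ^° m))) (solve° 1 (λ y -> y :* Κ 1° := y) refl _)
    Rm-trivial : ∀ h -> 0# ≤ h -> N (R z Nz) ≤ h * τ * (h * τ) -> - (c 2 1 * h) * τ ≤ Tr Rm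
    Rm-trivial h h₀ hR = solve 2 (λ h t -> (:- (κ 2 1 :* h)) :* t := :- (κ 2 1 :* (h :* t))) refl h τ ≡» Tr≥ (h₀ *₀ τ₀)
     (N-* _ _ · cong (N (R z Nz) *_) (N-conj _ · Unit.N-unit z Nz m) · *-1ʳ _ ≡» hR)

-- Dirichlet kernels and coefficient extraction without roots of unity

module F1 where
 open Q1
 open E1
 open U1
 open P1
 open W1
 open W2 using (neg-mono; factor₊)
 open C1 using (Tr≥; N1°; conj-neg)
 open import Relation.Nullary using (Dec; yes; no)
 unit-conj : ∀ u -> N u ≡ 1# -> u *° conj u ≡ 1°
 unit-conj u h = x*conj u · cong ofℚ h
 dirichlet : 𝔼 -> ℕ -> ℚ
 dirichlet v n = 1# + sum (λ t -> Tr (v ^° suc t)) n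
 module Dirichlet (v : 𝔼) (Nv : N v ≡ 1#) where
  open Unit v Nv
  -- Multiplication by D telescopes the sum, by the three-term recurrence of the traces.
  kernel : ∀ n -> D * dirichlet v n ≡ Tr (v ^° n) - Tr (v ^° suc n)
  kernel zero = (cong (D *_) (+-0ʳ 1#) · *-1ʳ D) · d-Tr 1 · cong (_- Tr (v ^° 1)) (sym (Tr-ofℚ 1# · solve 0 (Κ 1# :+ Κ 1# := κ 2 1) refl))
  kernel (suc n) = solve 3 (λ D s t -> D :* (Κ 1# :+ (s :+ t)) := D :* (Κ 1# :+ s) :+ D :* t) refl D _ _ · cong (_+ D * Tr (v ^° suc n)) (kernel n) · solve 3 (λ x y D -> x :- y :+ D :* y := y :- ((κ 2 1 :- D) :* y :- x)) refl _ _ D · cong (λ p -> Tr (v ^° suc n) - p) (sym (Tr-rec n · cong (λ p -> p * Tr (v ^° suc n) - Tr (v ^° n)) Tr-z))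
  kernel² : ∀ n -> (Tr (v ^° n) - Tr (v ^° suc n)) * (Tr (v ^° n) - Tr (v ^° suc n)) ≡ D * d (suc (n ℕ.+ n))
  kernel² n = sym (N-ofℚ _) · cong N X≡ · N-* (1° -° v) (y -° conj v *° conj y) · (cong₂ _*_ (cong (λ u -> N (1° -° u)) (sym z^1)) N≡)
   where
   y : 𝔼
   y = v ^° n
   X≡ : ofℚ (Tr y - Tr (v *° y)) ≡ (1° -° v) *° (y -° conj v *° conj y)
   X≡ = (ofℚ-+ (Tr y) (- Tr (v *° y)) · cong (ofℚ (Tr y) +°_) (ofℚ-neg _)) · cong₂ (λ p q -> p -° q) (sym (x+conj y)) (sym (x+conj (v *° y)) · cong (v *° y +°_) (conj-* v y)) · solve° 4 (λ v w y x -> (y :+ x) :- (v :* y :+ w :* x) := (y :- v :* y :- w :* x) :+ Κ 1° :* x) refl v _ y _ · cong (λ p -> (y -° v *° y -° conj v *° conj y) +° p *° conj y) (sym (unit-conj v Nv)) · solve° 4 (λ v w y x -> (y :- v :* y :- w :* x) :+ v :* w :* x := (Κ 1° :- v) :* (y :- w :* x)) refl v _ y _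
   N≡ : N (y -° conj v *° conj y) ≡ d (suc (n ℕ.+ n))
   N≡ = sym (cong (_* N (y -° conj v *° conj y)) (N-* v y · (cong₂ _*_ Nv (N-unit n)) · *-1ˡ 1#) · *-1ˡ _) · sym (N-* (v *° y) _) · cong N (solve° 4 (λ v w y x -> v :* y :* (y :- w :* x) := :- (v :* w :* (y :* x) :- v :* (y :* y))) refl v _ y _ · cong₂ (λ p q -> -° (p -° v *° q)) ((cong₂ _*°_ (unit-conj v Nv) (unit-conj y (N-unit n))) · solve° 0 (Κ 1° :* Κ 1° := Κ 1°) refl) (sym (^°-+ v n n))) · N-neg _
  -- The classical quotient sin²((2n+1)θ/2) / sin²(θ/2) in terms of squared chords.
  dirichlet² : 0# < D -> ∀ n -> D * (dirichlet v n * dirichlet v n) ≡ d (suc (n ℕ.+ n))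
  dirichlet² D₊ n = cancel≡ (solve 2 (λ D x -> D :* (D :* (x :* x)) := D :* x :* (D :* x)) refl D _ · cong (λ p -> p * p) (kernel n) · kernel² n)
   where
   cancel≡ : ∀ {x y} -> D * x ≡ D * y -> x ≡ y
   cancel≡ h = ℚP.≤-antisym (cancel≤ D₊ (of≡ h)) (cancel≤ D₊ (of≡ (sym h)))
 module QuarterTurn (ξ : 𝔼) (Nξ : N ξ ≡ 1#) where
  open Unit ξ Nξ hiding (q)
  -- The trace starts at 2, so it changes sign before any power at which it is non-positive; q is
  -- about a quarter turn.
  first-turn : ∀ k -> Tr (ξ ^° k) ≤ 0# -> Σ ℕ λ q -> suc q ℕ.≤ k × 0# ≤ Tr (ξ ^° q) × Tr (ξ ^° suc q) ≤ 0#
  first-turn zero h = ⊥-elim (ℚP.<-irrefl refl (ℚP.<-≤-trans (ℚP.<-≤-trans (ℚP.positive⁻¹ (c 2 1)) (of≡ (solve 0 (κ 2 1 := Κ 1# :+ Κ 1#) refl · sym (Tr-ofℚ 1#)))) h))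
  first-turn (suc k) h with ≤-total 0# (Tr (ξ ^° k))
  ... | inj₁ p = k , ℕP.≤-refl , p , h
  ... | inj₂ p = let (q , a , b) = first-turn k p in q , ℕP.m≤n⇒m≤1+n a , b
  module Turn (q' : ℕ) (h₁ : 0# ≤ Tr (ξ ^° q')) (h₂ : Tr (ξ ^° suc q') ≤ 0#) where
   q : ℕ
   q = suc q'
   p : ℚ
   p = Tr (ξ ^° q)
   -- At the sign change the trace is no larger than the jump between two consecutive traces, and
   -- one step of `ξ` moves a trace by at most 2 √D.
   p²≤ : p * p ≤ c 4 1 * D
   p²≤ = solve 1 (λ p -> p :* p := (:- p) :* (:- p)) refl p ≡» sq-mono (solve 0 (Κ 0# := :- Κ 0#) refl ≡» neg-mono h₂)
    (gap≤ h₁ (solve 2 (λ p r -> r :- p := (:- p) :+ r) refl p _)) » cong (λ x -> x * x) (sym (cong Tr (solve° 2 (λ x y -> y :* (Κ 1° :- x :* Κ 1°) := y :- x :* y) refl ξ _) · Tr-+ _ _ · cong (Tr (ξ ^° q') +_) (Tr-neg _))) ≡» Tr²≤4N (ξ ^° q' *° (1° -° ξ ^° 1)) »≡ cong (c 4 1 *_) (N-* _ _ · cong (_* D) (N-unit q') · *-1ˡ D)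
   -- If y + ȳ = p is small then y is nearly i or -i, so y⁴ is nearly 1: indeed 1 - y⁴ = (1 - y²) p
   -- y.
   d4q : d (4 ℕ.* q) ≤ c 16 1 * D
   d4q = cong (λ x -> N (1° -° x)) (^°-* ξ 4 q) · cong N factor · N-* _ _ · cong (N (1° -° y *° y) *_) (N-* _ _ · (cong₂ _*_ (N-ofℚ p) (N-unit q)) · *-1ʳ _) ≡» *≤ (N₀ _) (lit *₀ D₀) (N-+≤ 1° (-° (y *° y)) »≡ cong₂ (λ a b -> c 2 1 * (a + b)) N1° (N-neg _ · N-* y y · (cong₂ _*_ (N-unit q) (N-unit q)) · *-1ˡ 1#) · solve 0 (κ 2 1 :* (Κ 1# :+ Κ 1#) := κ 4 1) refl) p²≤ »≡ solve 1 (λ D -> κ 4 1 :* (κ 4 1 :* D) := κ 16 1 :* D) refl D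
    where
    y : 𝔼
    y = ξ ^° q
    factor : 1° -° y ^° 4 ≡ (1° -° y *° y) *° (ofℚ p *° y)
    factor = solve° 1 (λ y -> Κ 1° :- y :* (y :* (y :* (y :* Κ 1°))) := (Κ 1° :- y :* y) :* (Κ 1° :+ y :* y)) refl y · cong ((1° -° y *° y) *°_) (cong (_+° y *° y) (sym (unit-conj y (N-unit q))) · solve° 2 (λ y x -> y :* x :+ y :* y := (y :+ x) :* y) refl y _ · cong (_*° y) (x+conj y))
   n : ℕ
   n = q ℕ.+ q
   d-end : d (suc (n ℕ.+ n)) ≤ c 34 1 * D
   d-end = cong N (cong (λ k -> 1° -° ξ ^° suc k) (sym 4q) · solve° 2 (λ x y -> Κ 1° :- x :* y := (Κ 1° :- y) :+ y :* (Κ 1° :- x :* Κ 1°)) refl ξ _) ≡» N-+≤ _ _ » *≤ʳ lit (+≤ d4q (of≡ (N-* _ _ · cong (_* D) (N-unit (4 ℕ.* q)) · *-1ˡ D))) »≡ solve 1 (λ D -> κ 2 1 :* (κ 16 1 :* D :+ D) := κ 34 1 :* D) refl D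
    where
    4q : 4 ℕ.* q ≡ n ℕ.+ n
    4q = cong (λ k -> q ℕ.+ (q ℕ.+ (q ℕ.+ k))) (ℕP.+-identityʳ q) · sym (ℕP.+-assoc q q (q ℕ.+ q))
   -- As ξ^(2n+1) nearly closes a full turn, its l-th power has squared chord at most 34 l² D, while
   -- that of ξ^l is at least l² D / 2. The quotient 68 is below 81.
   dirichlet-bound : 0# < D -> ∀ l -> 0# < ι l -> ι l * ι l * D ≤ c 6 1 -> dirichlet (ξ ^° l) n * dirichlet (ξ ^° l) n ≤ c 9 1 * c 9 1
   dirichlet-bound D₊ l l₊ h = (cancel≤ {p = c 1 2 * (ι l * ι l * D)} (ℚP.positive⁻¹ (c 1 2) *₊ ((l₊ *₊ l₊) *₊ D₊))
    (*≤ˡ (sq₀ Δ) half » V.dirichlet² V₊ n ≡» cong (λ u -> N (1° -° u)) swap ≡» Unit.d≤ (ξ ^° suc (n ℕ.+ n)) (N-unit (suc (n ℕ.+ n))) l » *≤ʳ (sq₀ (ι l)) (cong (λ u -> N (1° -° u)) (solve° 1 (λ x -> x :* Κ 1° := x) refl _) ≡» d-end) »≡ solve 2 (λ l D -> l :* (κ 34 1 :* D) := κ 1 2 :* (l :* D) :* κ 68 1) refl _ D)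
     ) » lit »≡ solve 0 (κ 81 1 := κ 9 1 :* κ 9 1) refl
    where
    v : 𝔼
    v = ξ ^° l
    module V = Dirichlet v (N-unit l)
    Δ : ℚ
    Δ = dirichlet v n
    Dv : ℚ
    Dv = N (1° -° v ^° 1)
    half : c 1 2 * (ι l * ι l * D) ≤ Dv
    half = gap≤ (lit *₀ (sq₀ (ι l) *₀ D₀ *₀ gap h)) (solve 2 (λ l D -> l :* D :- κ 1 12 :* (l :* l) :* (D :* D) := κ 1 2 :* (l :* D) :+ κ 1 12 :* (l :* D :* (κ 6 1 :- l :* D))) refl _ D) » d≥ l »≡ cong (λ u -> N (1° -° u)) (solve° 1 (λ x -> x := x :* Κ 1°) refl v)
    V₊ : 0# < Dv
    V₊ = ℚP.<-≤-trans (ℚP.positive⁻¹ (c 1 2) *₊ ((l₊ *₊ l₊) *₊ D₊)) half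
    swap : v ^° suc (n ℕ.+ n) ≡ (ξ ^° suc (n ℕ.+ n)) ^° l
    swap = sym (^°-* ξ (suc (n ℕ.+ n)) l) · cong (ξ ^°_) (ℕP.*-comm (suc (n ℕ.+ n)) l) · ^°-* ξ l (suc (n ℕ.+ n))
 when : ∀ {A : Set} -> Dec A -> ℚ -> ℚ
 when (yes _) k = k
 when (no _) _ = 0#
 sum-indicator : ∀ k m L -> m ℕ.< L -> sum (λ j -> when (j ℕP.≟ m) k) L ≡ k
 sum-indicator k m (suc L) h with L ℕP.≟ m
 ... | yes refl = cong (_+ k) (zero-below L ℕP.≤-refl) · +-0ˡ k
  where
  zero-below : ∀ i -> i ℕ.≤ L -> sum (λ j -> when (j ℕP.≟ L) k) i ≡ 0#
  zero-below zero _ = refl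
  zero-below (suc i) l with i ℕP.≟ L
  ... | yes refl = ⊥-elim (ℕP.<-irrefl refl l)
  ... | no _ = +-0ʳ _ · zero-below i (ℕP.<⇒≤ l)
 ... | no p = +-0ʳ _ · sum-indicator k m L (ℕP.≤∧≢⇒< (ℕP.≤-pred h) (λ e -> p (sym e)))
 Trω^ : ∀ k -> (Σ ℕ λ l -> k ≡ 3 ℕ.* l × ω ^° k ≡ 1°) ⊎ (1# + Tr (ω ^° k) ≡ 0#)
 Trω^ 0 = inj₁ (0 , refl , refl)
 Trω^ 1 = inj₂ t
  where
  opaque
   unfolding _+°_
   t : 1# + Tr (ω ^° 1) ≡ 0#
   t = solve 0 (Κ 1# :+ (Κ 0# :* Κ 1# :- Κ 1# :* Κ 0# :+ (Κ 0# :* Κ 1# :- Κ 1# :* Κ 0#) :- (Κ 0# :* Κ 0# :+ Κ 1# :* Κ 1# :- Κ 1# :* Κ 0#)) := Κ 0#) refl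
 Trω^ 2 = inj₂ (cong (λ x -> 1# + Tr x) (solve° 0 (Κ ω :* (Κ ω :* Κ 1°) := Κ ω̄) refl) · t)
  where
  opaque
   unfolding _+°_
   t : 1# + Tr ω̄ ≡ 0#
   t = solve 0 (let m = Κ (ℚ.- 1#) in Κ 1# :+ (m :+ m :- m) := Κ 0#) refl
 Trω^ (suc (suc (suc k))) = shift (Trω^ k)
  where
  cube : ω ^° suc (suc (suc k)) ≡ ω ^° k
  cube = solve° 1 (λ x -> Κ ω :* (Κ ω :* (Κ ω :* x)) := x) refl _
  shift : _ -> _
  shift (inj₁ (l , e , p)) = inj₁ (suc l , trans (cong (3 ℕ.+_) e) (sym (ℕP.*-suc 3 l)) , trans cube p)
  shift (inj₂ p) = inj₂ (cong (λ x -> 1# + Tr x) cube · p)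
 eval : (ℕ -> ℚ) -> ℕ -> 𝔼 -> 𝔼
 eval a L u = sum° (λ j -> ofℚ (a j) *° u ^° j) L
 Tr-eval : ∀ a L u x -> Tr (eval a L u *° x) ≡ sum (λ j -> a j * Tr (u ^° j *° x)) L
 Tr-eval a zero u x = cong Tr (solve° 1 (λ x -> Κ 0° :* x := Κ 0°) refl x) · Tr-ofℚ 0# · +-0ʳ 0#
 Tr-eval a (suc L) u x = cong Tr (solve° 4 (λ s a y x -> (s :+ a :* y) :* x := s :* x :+ a :* (y :* x)) refl _ _ _ x) · Tr-+ _ _ · (cong₂ _+_ (Tr-eval a L u x) (Tr-ofℚ* (a L) _))
 module Extraction (ζ : 𝔼) (Nζ : N ζ ≡ 1#) (n m : ℕ) where
  tr : 𝔼 -> ℕ -> ℚ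
  tr u j = Tr (u ^° j *° conj (u ^° m))
  z : ℕ -> 𝔼
  z t = ζ ^° suc t
  Nz : ∀ t -> N (z t) ≡ 1#
  Nz t = Unit.N-unit ζ Nζ (suc t)
  -- With traces standing for conjugate pairs, these are the points ω^j ζ^t with j modulo 3 and |t|
  -- ≤ n; 1 is its own conjugate and so gets weight 1/2.
  points : (𝔼 -> ℚ) -> ℚ
  points f = c 1 2 * f 1° + f ω + sum (λ t -> f (z t) + (f (ω *° z t) + f (ω *° conj (z t)))) n
  κ' : ℕ -> ℚ
  κ' j = points (λ u -> tr u j)
  points-sum : ∀ a L -> points (λ u -> Tr (eval a L u *° conj (u ^° m))) ≡ sum (λ j -> a j * κ' j) L
  points-sum a L = (cong₂ _+_ (cong₂ (λ p q -> c 1 2 * p + q) (T 1°) (T ω)) (sum-cong n (λ t -> cong₂ _+_ (T (z t)) (cong₂ _+_ (T (ω *° z t)) (T (ω *° conj (z t))))))) · go L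
   where
   T : ∀ u -> Tr (eval a L u *° conj (u ^° m)) ≡ sum (λ j -> a j * tr u j) L
   T u = Tr-eval a L u _
   S : 𝔼 -> ℕ -> ℚ
   S u L = sum (λ j -> a j * tr u j) L
   go : ∀ L -> points (λ u -> S u L) ≡ sum (λ j -> a j * κ' j) L
   go zero = cong (c 1 2 * 0# + 0# +_) (sum-const (0# + (0# + 0#)) n · cong (ι n *_) (solve 0 (Κ 0# :+ (Κ 0# :+ Κ 0#) := Κ 0#) refl) · *-0ʳ (ι n)) · solve 0 (κ 1 2 :* Κ 0# :+ Κ 0# :+ Κ 0# := Κ 0#) refl
   go (suc L) = cong (λ s -> c 1 2 * (S 1° L + a L * tr 1° L) + (S ω L + a L * tr ω L) + s) (sum-cong n (λ t -> solve 7 (λ x y z k p q r -> (x :+ k :* p) :+ ((y :+ k :* q) :+ (z :+ k :* r)) := (x :+ (y :+ z)) :+ k :* (p :+ (q :+ r))) refl _ _ _ _ _ _ _) · sum-+ _ _ n · cong (sum (λ t -> S (z t) L + (S (ω *° z t) L + S (ω *° conj (z t)) L)) n +_) (sum-*ˡ (a L) _ n)) · solve 7 (λ h x y s k p r -> h :* (x :+ k :* p) :+ y :+ (s :+ k :* r) := h :* x :+ h :* (k :* p) :+ y :+ s :+ k :* r) refl _ _ _ _ _ _ _ · solve 8 (λ h x y w s k p r -> h :* x :+ h :* (k :* p) :+ (y :+ k :* w) :+ s :+ k :* r := (h :* x :+ y :+ s) :+ k :* (h :* p :+ w :+ r)) refl _ _ _ _ _ _ _ _ · cong (_+ a L * κ'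 L) (go L)
  Trω* : ∀ x y -> Tr (x *° y) + Tr (x *° conj y) ≡ Tr x * Tr y
  Trω* x y = sym (Tr-+ _ _) · cong Tr (solve° 3 (λ x y w -> x :* y :+ x :* w := (y :+ w) :* x) refl x y _ · cong (_*° x) (x+conj y)) · Tr-ofℚ* (Tr y) x · *-comm (Tr y) (Tr x)
  module Term (k : ℕ) where
   value : (𝔼 -> ℚ) -> Set
   value f = ∀ u -> N u ≡ 1# -> f u ≡ Tr (u ^° k)
   Nω' : N ω ≡ 1#
   Nω' = cong N (solve° 0 (Κ ω := Κ ω :* Κ 1°) refl) · N-ω* 1° · N1°
   -- The sum over the three cosets factors. Its first factor vanishes unless 3 divides k, which is
   -- why only powers of ζ³ matter later.
   factored : ∀ f -> value f -> points f ≡ (1# + Tr (ω ^° k)) * dirichlet (ζ ^° k) n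
   factored f h = (cong₂ _+_ (cong₂ (λ p q -> c 1 2 * p + q) (h 1° N1° · cong Tr (one k) · Tr-ofℚ 1#) (h ω Nω'))
    (sum-cong n (λ t -> trans (cong₂ _+_ (h (z t) (Nz t) · cong Tr (zk t)) ((cong₂ _+_ (h _ (N-ω* (z t) · Nz t) · cong Tr (*-^° ω (z t) k · cong (ω ^° k *°_) (zk t)))
    (h _ (N-ω* (conj (z t)) · N-conj (z t) · Nz t) · cong Tr (*-^° ω (conj (z t)) k · cong (ω ^° k *°_) (sym (conj-^ (z t) k) · cong conj (zk t))))) · Trω* (ω ^° k) _)) (solve 2 (λ w y -> y :+ w :* y := (Κ 1# :+ w) :* y) refl _ _)) · sum-*ˡ (1# + Tr (ω ^° k)) _ n)) · solve 2 (λ w s -> κ 1 2 :* (Κ 1# :+ Κ 1#) :+ w :+ (Κ 1# :+ w) :* s := (Κ 1# :+ w) :* (Κ 1# :+ s)) refl _ _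
    where
    one : ∀ k -> 1° ^° k ≡ 1°
    one zero = refl
    one (suc k) = cong (1° *°_) (one k) · solve° 0 (Κ 1° :* Κ 1° := Κ 1°) refl
    zk : ∀ t -> z t ^° k ≡ (ζ ^° k) ^° suc t
    zk t = sym (^°-* ζ k (suc t)) · cong (ζ ^°_) (ℕP.*-comm k (suc t)) · ^°-* ζ (suc t) k
  difference : ∀ j -> Σ ℕ λ k -> (∀ u -> N u ≡ 1# -> tr u j ≡ Tr (u ^° k)) × (k ≡ 0 -> j ≡ m) × (k ℕ.≤ j ℕ.+ m)
  difference j with ℕP.≤-total m j
  ... | inj₁ h = j ℕ.∸ m , (λ u Nu -> cong Tr (cong (λ p -> u ^° p *° conj (u ^° m)) (sym (ℕP.m∸n+n≡m h)) · cong (_*° conj (u ^° m)) (^°-+ u (j ℕ.∸ m) m) · solve° 3 (λ x y w -> x :* y :* w := x :* (y :* w)) refl _ _ _ · cong (u ^° (j ℕ.∸ m) *°_) (unit-conj _ (Unit.N-unit u Nu m)) · solve° 1 (λ x -> x :* Κ 1° := x) refl _)) ,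
   (λ e -> ℕP.≤-antisym (ℕP.m∸n≡0⇒m≤n e) h) , ℕP.≤-trans (ℕP.m∸n≤m j m) (ℕP.m≤m+n j m)
  ... | inj₂ h = m ℕ.∸ j , (λ u Nu -> trans (sym (Tr-conj _)) (cong Tr (conj-* _ _ · (cong₂ _*°_ refl (conj-conj (u ^° m))) · cong (λ p -> conj (u ^° j) *° u ^° p) (sym (ℕP.m∸n+n≡m h)) · cong (conj (u ^° j) *°_) (^°-+ u (m ℕ.∸ j) j) · solve° 3 (λ w x y -> w :* (x :* y) := x :* (y :* w)) refl _ _ _ · cong (u ^° (m ℕ.∸ j) *°_) (unit-conj _ (Unit.N-unit u Nu j)) · solve° 1 (λ x -> x :* Κ 1° := x) refl _))) ,
   (λ e -> ℕP.≤-antisym h (ℕP.m∸n≡0⇒m≤n e)) , ℕP.≤-trans (ℕP.m∸n≤m m j) (ℕP.m≤n+m m j)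
  module Bound (L : ℕ) (m<L : m ℕ.< L) (β : ∀ l -> 0# < ι l -> 3 ℕ.* l ℕ.≤ L ℕ.+ m -> dirichlet (ζ ^° (3 ℕ.* l)) n * dirichlet (ζ ^° (3 ℕ.* l)) n ≤ c 9 1 * c 9 1) where
   diag : κ' m ≡ c 3 1 * (1# + c 2 1 * ι n)
   diag = Term.factored 0 (λ u -> tr u m) (λ u Nu -> cong Tr (unit-conj (u ^° m) (Unit.N-unit u Nu m))) · (cong₂ (λ p q -> (1# + p) * (1# + q)) two
    (sum-cong n (λ t -> trans (cong Tr (one (suc t))) two) · sum-const (c 2 1) n · *-comm (ι n) (c 2 1)) ⟨≡⟩ solve 1 (λ i -> (Κ 1# :+ κ 2 1) :* (Κ 1# :+ κ 2 1 :* i) := κ 3 1 :* (Κ 1# :+ κ 2 1 :* i)) refl _)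
    where
    _⟨≡⟩_ : ∀ {x y z : ℚ} -> x ≡ y -> y ≡ z -> x ≡ z
    _⟨≡⟩_ = trans
    two : Tr 1° ≡ c 2 1
    two = Tr-ofℚ 1# · solve 0 (Κ 1# :+ Κ 1# := κ 2 1) refl
    one : ∀ k -> 1° ^° k ≡ 1°
    one zero = refl
    one (suc k) = cong (1° *°_) (one k) · solve° 0 (Κ 1° :* Κ 1° := Κ 1°) refl
   off-diag : ∀ j -> j ℕ.< L -> j ≢ m -> κ' j * κ' j ≤ c 27 1 * c 27 1
   off-diag j j<L j≢m = go (difference j)
    where
    go : (Σ ℕ λ k -> (∀ u -> N u ≡ 1# -> tr u j ≡ Tr (u ^° k)) × (k ≡ 0 -> j ≡ m) × (k ℕ.≤ j ℕ.+ m)) -> κ' j * κ' j ≤ c 27 1 * c 27 1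
    go (k , hk , k0 , k≤) = cong (λ x -> x * x) (Term.factored k (λ u -> tr u j) hk) ≡» by3 (Trω^ k)
     where
     by3 : (Σ ℕ λ l -> k ≡ 3 ℕ.* l × ω ^° k ≡ 1°) ⊎ (1# + Tr (ω ^° k) ≡ 0#) -> (1# + Tr (ω ^° k)) * dirichlet (ζ ^° k) n * ((1# + Tr (ω ^° k)) * dirichlet (ζ ^° k) n) ≤ c 27 1 * c 27 1
     by3 (inj₂ p) = cong (λ w -> w * dirichlet (ζ ^° k) n * (w * dirichlet (ζ ^° k) n)) p · solve 1 (λ x -> Κ 0# :* x :* (Κ 0# :* x) := Κ 0#) refl _ ≡» sq₀ (c 27 1)
     by3 (inj₁ (zero , e , p)) = ⊥-elim (j≢m (k0 e))
     by3 (inj₁ (l@(suc l') , e , p)) = cong (λ w -> (1# + Tr w) * Δ * ((1# + Tr w) * Δ)) p · cong (λ w -> (1# + w) * Δ * ((1# + w) * Δ)) (Tr-ofℚ 1#) · solve 1 (λ x -> (Κ 1# :+ (Κ 1# :+ Κ 1#)) :* x :* ((Κ 1# :+ (Κ 1# :+ Κ 1#)) :* x) := κ 9 1 :* (x :* x)) refl Δ ≡» *≤ʳ lit (subst (λ k -> dirichlet (ζ ^° k) n * dirichlet (ζ ^° k) n ≤ c 9 1 * c 9 1) (sym e) (β l (ι₊ l') (ℕP.≤-trans (ℕP.≤-reflexive (sym e)) (ℕP.≤-trans k≤ (ℕP.+-monoˡ-≤ m (ℕP.<⇒≤ j<L)))))) »≡ solve 0 (κ 9 1 :* (κ 9 1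 :* κ 9 1) := κ 27 1 :* κ 27 1) refl
      where
      Δ : ℚ
      Δ = dirichlet (ζ ^° k) n
   -- The diagonal multiplier grows with n while every other one is at most 3 * 9 = 27 in modulus;
   -- `b` is a majorant of |a|.
   extraction : ∀ a b -> (∀ j -> a j ≤ b j) -> (∀ j -> - a j ≤ b j) ->
    points (λ u -> Tr (eval a L u *° conj (u ^° m))) ≤ c 3 1 * (1# + c 2 1 * ι n) * a m + c 27 1 * sum b L
   extraction a b a≤ -a≤ = points-sum a L ≡» sum-mono L term »≡ sum-+ _ _ L · (cong₂ _+_ (sum-indicator _ m L m<L) (sum-*ˡ (c 27 1) b L))
    where
    b₀ : ∀ j -> 0# ≤ b j
    b₀ j = solve 1 (λ a -> Κ 0# := κ 1 2 :* (a :+ (:- a))) refl _ ≡» *≤ʳ lit (+≤ (a≤ j) (-a≤ j)) »≡ solve 1 (λ b -> κ 1 2 :* (b :+ b) := b) refl _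
    term : ∀ j -> j ℕ.< L -> a j * κ' j ≤ when (j ℕP.≟ m) (c 3 1 * (1# + c 2 1 * ι n) * a m) + c 27 1 * b j
    term j l with j ℕP.≟ m
    ... | yes refl = *-comm (a j) (κ' j) · cong (_* a j) diag ≡» gap≤ (lit *₀ b₀ j) refl
    ... | no p = sq-cancel (lit *₀ b₀ j) (*-swap (a j) (κ' j) (a j) (κ' j) ≡» *≤ (sq₀ (a j)) (sq₀ (c 27 1)) a²≤ (off-diag j l p) »≡ *-comm _ _ · *-swap (c 27 1) (c 27 1) (b j) (b j)) »≡ sym (+-0ˡ _)
     where
     a²≤ : a j * a j ≤ b j * b j
     a²≤ = ungap (subst (0# ≤_) (solve 2 (λ a b -> (b :- a) :* (b :- (:- a)) := b :* b :- a :* a) refl _ _) (gap (a≤ j) *₀ gap (-a≤ j)))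

-- A unit-norm Eisenstein number of prescribed small angle

module F2 where
 open Q1
 open E1
 open U1
 open P1
 open W1
 open W2 using (neg-mono; factor₊)
 open C1 using (Tr≥; N1°; conj-neg)
 open F1
 open import Data.Integer using (ℤ)
 open import Data.Rational using (mkℚ)
 natural : ℕ -> ℚ
 natural k = mkℚ (ℤ.+ k) 0 (Cop.sym (Cop.1-coprimeTo k))
 opaque
  unfolding _+_
  ι≡natural : ∀ k -> ι k ≡ natural k
  ι≡natural zero = refl
  ι≡natural (suc k) = cong (1# ℚ.+_) (ι≡natural k) · cong (λ x -> x ℚ./ 1) ((cong₂ ℤ._+_ (ℤP.*-identityʳ (ℤ.+ 1)) (ℤP.*-identityʳ (ℤ.+ k))) · refl) · ℚP.↥p/↧p≡p (natural (suc k))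
 archimedes : ∀ q -> Σ ℕ λ k -> q ≤ ι k
 archimedes (mkℚ (ℤ.+ k) d p) = k , ≤-trans (ℚ.*≤* (≤-trans' (ℤP.≤-reflexive (ℤP.*-identityʳ (ℤ.+ k))) (ℤP.≤-trans (ℤP.≤-reflexive (sym (ℤP.*-identityʳ (ℤ.+ k)))) (ℤP.*-monoˡ-≤-nonNeg (ℤ.+ k) (ℤ.+≤+ (ℕ.s≤s ℕ.z≤n)))))) (of≡ (sym (ι≡natural k)))
  where
  ≤-trans' : ∀ {a b c} -> a ℤ.≤ b -> b ℤ.≤ c -> a ℤ.≤ c
  ≤-trans' = ℤP.≤-trans
 archimedes (mkℚ ℤ.-[1+ k ] d p) = 0 , ℚ.*≤* ℤ.-≤+
 module Point (M : ℚ) (hM : c 5432 1 ≤ M) where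
  M₊ : 0# < M
  M₊ = ℚP.<-≤-trans (ℚP.positive⁻¹ (c 5432 1)) hM
  M₀ : 0# ≤ M
  M₀ = <⇒≤ M₊
  -- ζ = v / v̄ has unit norm. The numbers 97 and 56 solve 97² - 3 * 56² = 1, so the squared chord
  -- of ζ, 9408 / `Nv`, is almost exactly 1/M².
  v : 𝔼
  v = (c 97 1 * M) +ω c 56 1
  Nv : ℚ
  Nv = c 9409 1 * (M * M) - c 5432 1 * M + c 3136 1
  opaque
   unfolding _+°_
   Nv≡ : N v ≡ Nv
   Nv≡ = solve 1 (λ M -> κ 97 1 :* M :* (κ 97 1 :* M) :- κ 97 1 :* M :* κ 56 1 :+ κ 56 1 :* κ 56 1 := κ 9409 1 :* (M :* M) :- κ 5432 1 :* M :+ κ 3136 1) refl M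
   Nv- : N (conj v -° v) ≡ c 9408 1
   Nv- = solve 1 (λ M -> let x = κ 97 1 :* M ; y = κ 56 1 ; p = x :- y :+ (:- x) ; q = (:- y) :+ (:- y) in p :* p :- p :* q :+ q :* q := κ 9408 1) refl M
  Nv≥ : c 9408 1 * (M * M) ≤ Nv
  Nv≥ = gap≤ (M₀ *₀ gap hM +₀ lit) (solve 1 (λ M -> κ 9409 1 :* (M :* M) :- κ 5432 1 :* M :+ κ 3136 1 := κ 9408 1 :* (M :* M) :+ (M :* (M :- κ 5432 1) :+ κ 3136 1)) refl M)
  Nv≤ : Nv ≤ c 9409 1 * (M * M)
  Nv≤ = gap≤ (lit *₀ gap hM +₀ lit) (solve 1 (λ M -> κ 9409 1 :* (M :* M) := κ 9409 1 :* (M :* M) :- κ 5432 1 :* M :+ κ 3136 1 :+ (κ 5432 1 :* (M :- κ 5432 1) :+ κ 29503488 1)) refl M)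
  Nv₊ : 0# < Nv
  Nv₊ = ℚP.<-≤-trans (ℚP.positive⁻¹ (c 9408 1) *₊ (M₊ *₊ M₊)) Nv≥
  i : ℚ
  i = inv Nv Nv₊
  ζ : 𝔼
  ζ = ofℚ i *° (v *° v)
  iN : i * Nv ≡ 1#
  iN = *-comm i Nv · *-inv Nv Nv₊
  Nζ : N ζ ≡ 1#
  Nζ = N-* _ _ · (cong₂ _*_ (N-ofℚ i) (N-* v v · (cong₂ _*_ Nv≡ Nv≡))) · *-swap i i Nv Nv · (cong₂ _*_ iN iN) · *-1ˡ 1#
  open Unit ζ Nζ public using (D; D₀; d; d≤; d≥; N-unit; z^1)
  D≡ : D * Nv ≡ c 9408 1
  D≡ = cong (_* Nv) (cong N (cong (λ y -> 1° -° y) z^1 · cong (_-° ζ) (sym (sym (ofℚ-* i Nv) · cong ofℚ iN)) · cong (λ y -> ofℚ i *° y -° ζ) (sym (x*conj v · cong ofℚ Nv≡)) · solve° 3 (λ i v w -> i :* (v :* w) :- i :* (v :* v) := i :* (v :* (w :- v))) refl _ v _) · N-* _ _ · (cong₂ _*_ (N-ofℚ i) (N-* _ _ · (cong₂ _*_ Nv≡ Nv-)))) · solve 3 (λ i n k -> i :* i :* (n :* k) :* n := i :* n :* (i :* n) :* k) refl i Nv _ · cong (λ p -> p * p * c 9408 1) iN · solve 1 (λ k -> Κ 1# :* Κ 1# :* k := k) refl _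
  DM≤ : D * (M * M) ≤ 1#
  DM≤ = cancel≤ (ℚP.positive⁻¹ (c 9408 1)) (solve 3 (λ k D M -> k :* (D :* M) := D :* (k :* M)) refl _ D _ ≡» *≤ʳ D₀ Nv≥ »≡ D≡ · sym (*-1ʳ _))
  DM≥ : c 9998 10000 ≤ D * (M * M)
  DM≥ = cancel≤ (ℚP.positive⁻¹ (c 9409 1)) ((sym (*≡ _ _) ≡» lit) » sym D≡ ≡» *≤ʳ D₀ Nv≤ »≡ solve 3 (λ k D M -> D :* (k :* M) := k :* (D :* M)) refl _ D _)
  X : ℕ -> ℚ
  X t = ι t * inv M M₊
  XM : ∀ t -> X t * M ≡ ι t
  XM t = solve 3 (λ t i m -> t :* i :* m := t :* (m :* i)) refl _ _ M · cong (ι t *_) (*-inv M M₊) · *-1ʳ _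
  X₀ : ∀ t -> 0# ≤ X t
  X₀ t = ι₀ t *₀ inv₀ M M₊
  tD : ∀ t -> ι t * ι t * D ≡ X t * X t * (D * (M * M))
  tD t = cong (λ p -> p * p * D) (sym (XM t)) · solve 3 (λ x m D -> x :* m :* (x :* m) :* D := x :* x :* (D :* (m :* m))) refl _ M D
  z1 : ∀ t -> N (1° -° (ζ ^° t) ^° 1) ≡ d t
  z1 t = cong (λ u -> N (1° -° u)) (solve° 1 (λ u -> u :* Κ 1° := u) refl _)
  upper : ∀ t -> N (1° -° (ζ ^° t) ^° 1) ≤ X t * X t
  upper t = z1 t ≡» d≤ t » tD t ≡» *≤ʳ (sq₀ (X t)) DM≤ »≡ *-1ʳ _
  lower : ∀ t -> X t ≤ c 11 10 -> c 9997 10000 * (X t * X t * (1# - c 1 12 * (X t * X t))) ≤ N (1° -° (ζ ^° t) ^° 1)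
  lower t h = gap≤ (sq₀ (X t) *₀ gap DM≥ +₀ lit *₀ sq₀ Y *₀ (gap DM≤ *₀ (lit +₀ (D₀ *₀ sq₀ M))) +₀ sq₀ (X t) *₀ (lit *₀ gap Y≤ +₀ lit)) (solve 2 (λ Y E -> Y :* E :- κ 1 12 :* (Y :* E :* (Y :* E)) := κ 9997 10000 :* (Y :* (Κ 1# :- κ 1 12 :* Y)) :+ (Y :* (E :- κ 9998 10000) :+ κ 1 12 :* (Y :* Y) :* ((Κ 1# :- E) :* (Κ 1# :+ E)) :+ Y :* (κ 3 120000 :* (κ 121 100 :- Y) :+ Κ Κd))) refl Y E) » sym (cong₂ (λ p q -> p - q) (tD t) (solve 2 (λ t D -> κ 1 12 :* (t :* t) :* (D :* D) := κ 1 12 :* (t :* D :* (t :* D))) refl _ D · cong (λ p -> c 1 12 * (p * p)) (tD t)) · refl) ≡» d≥ t »≡ sym (z1 t)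
   where
   Y E Κd : ℚ
   Y = X t * X t
   E = D * (M * M)
   Κd = c 1 10000 ℚ.- c 3 120000 ℚ.* c 121 100
   Y≤ : Y ≤ c 121 100
   Y≤ = sq-mono (X₀ t) h » sym (*≡ _ _) ≡» lit
  ξ : 𝔼
  ξ = ζ ^° 3
  Nξ : N ξ ≡ 1#
  Nξ = N-unit 3
  module Ξ = Unit ξ Nξ
  D≤s : D ≤ c 1 10000
  D≤s = cancel≤ (M₊ *₊ M₊) (*-comm (M * M) D ≡» DM≤ » big » *≤ˡ lit (sq-mono {c 5432 1} {M} lit hM))
   where
   big : 1# ≤ c 5432 1 * c 5432 1 * c 1 10000
   big = lit »≡ *≡ (c 5432 1 ℚ.* c 5432 1) (c 1 10000) · cong (_* c 1 10000) (*≡ (c 5432 1) (c 5432 1))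
  Dξ : Ξ.D ≡ D * ((c 3 1 - D) * (c 3 1 - D))
  Dξ = cong (λ u -> N (1° -° u)) Ξ.z^1 · d₃≡ ζ Nζ
  Dξ≤ : Ξ.D * (M * M) ≤ c 9 1
  Dξ≤ = cong (_* (M * M)) Dξ · solve 3 (λ D e m -> D :* e :* m := D :* m :* e) refl D _ _ ≡» *≤ (D₀ *₀ sq₀ M) lit DM≤ (sq-mono (gap (D≤s » lit)) (gap≤ D₀ (solve 1 (λ D -> κ 3 1 := κ 3 1 :- D :+ D) refl D)) » sym (*≡ _ _) ≡» lit) »≡ *-1ˡ _
  Dξ≥ : c 8997 1000 ≤ Ξ.D * (M * M)
  Dξ≥ = (lit »≡ solve 0 (Κ (c 9998 10000 ℚ.* ((c 3 1 ℚ.- c 1 10000) ℚ.* (c 3 1 ℚ.- c 1 10000))) := κ 9998 10000 :* ((κ 3 1 :- κ 1 10000) :* (κ 3 1 :- κ 1 10000))) refl) » *≤ lit (sq₀ (c 3 1 - D)) DM≥ (sq-mono (lit »≡ +≡ _ _ · cong (c 3 1 +_) (-≡ _)) (+≤ ≤-refl (neg-mono D≤s))) »≡ solve 3 (λ D e m -> D :* m :* e := D :* e :* m) refl D _ _ · cong (_* (M * M)) (sym Dξ)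
  Dξ₊ : 0# < Ξ.D
  Dξ₊ = factor₊ Ξ.D₀ (ℚP.<-≤-trans (ℚP.positive⁻¹ (c 8997 1000)) Dξ≥)
  -- The angle of ζ³ is about 3/M, and 3 * 0.55 = 1.65 exceeds π/2.
  past : ∀ t -> ι t ≡ c 55 100 * M -> Tr (ξ ^° t) ≤ 0#
  past t h = solve 1 (λ x -> x := κ 2 1 :- (κ 2 1 :- x)) refl _ · cong (λ p -> c 2 1 - p) (sym (Ξ.d-Tr t)) ≡» +≤ ≤-refl (neg-mono (two » Ξ.d≥ t)) »≡ solve 0 (κ 2 1 :- κ 2 1 := Κ 0#) refl
   where
   y : ℚ
   y = ι t * ι t * Ξ.D
   y≡ : y ≡ c 3025 10000 * (Ξ.D * (M * M))
   y≡ = cong (λ p -> p * p * Ξ.D) h · solve 2 (λ m D -> κ 55 100 :* m :* (κ 55 100 :* m) :* D := κ 3025 10000 :* (D :* (m :* m))) refl M Ξ.D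
   y≥ : c 27 10 ≤ y
   y≥ = lit » *≡ _ _ ≡» *≤ʳ lit Dξ≥ »≡ sym y≡
   y≤ : y ≤ c 9 1
   y≤ = y≡ ≡» *≤ʳ lit Dξ≤ » sym (*≡ _ _) ≡» lit
   two : c 2 1 ≤ ι t * ι t * Ξ.D - c 1 12 * (ι t * ι t * (ι t * ι t)) * (Ξ.D * Ξ.D)
   two = gap≤ (lit *₀ (gap y≥ *₀ gap y≤) +₀ lit *₀ gap y≥ +₀ lit) (solve 2 (λ t D -> t :* D :- κ 1 12 :* (t :* t) :* (D :* D) := t :* D :- κ 1 12 :* (t :* D :* (t :* D))) refl _ Ξ.D · solve 1 (λ y -> y :- κ 1 12 :* (y :* y) := κ 2 1 :+ (κ 1 12 :* ((y :- κ 27 10) :* (κ 9 1 :- y)) :+ κ 1 40 :* (y :- κ 27 10) :+ κ 37 400)) refl y)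

-- The numerical table for the core

module G1 where
 open Q1
 open E1
 open U1
 open P1
 open R1
 open N1
 open N2
 open N4
 open N5
 open W1
 open W2
 open W3
 open C1
 open F1
 open F2
 open import Data.Rational using (_≤ᵇ_)
 open import Data.List using (List; []; _∷_)
 open import Data.Bool using (T; Bool; true; false; _∧_)
 open import Data.Unit using (tt)
 ιᶜ : ℕ -> ℚ
 ιᶜ zero = 0#
 ιᶜ (suc k) = 1# ℚ.+ ιᶜ k
 ιᶜ≡ : ∀ k -> ιᶜ k ≡ ι k
 ιᶜ≡ zero = refl
 ιᶜ≡ (suc k) = +≡ _ _ · cong (1# +_) (ιᶜ≡ k)
 sumᶜ : (ℕ -> ℚ) -> ℕ -> ℚ
 sumᶜ f zero = 0#
 sumᶜ f (suc k) = sumᶜ f k ℚ.+ f k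
 sumᶜ≡ : ∀ f k -> sumᶜ f k ≡ sum f k
 sumᶜ≡ f zero = refl
 sumᶜ≡ f (suc k) = +≡ _ _ · cong (_+ f k) (sumᶜ≡ f k)
 allBelow : ℕ -> (ℕ -> Bool) -> Bool
 allBelow zero p = true
 allBelow (suc k) p = allBelow k p ∧ p k
 ∧-T : ∀ x {y} -> T (x ∧ y) -> T x × T y
 ∧-T true h = tt , h
 allBelow-T : ∀ k p -> T (allBelow k p) -> ∀ j -> j ℕ.< k -> T (p j)
 allBelow-T (suc k) p h j l = go (ℕP.m<1+n⇒m<n∨m≡n l)
  where
  go : j ℕ.< k ⊎ j ≡ k -> T (p j)
  go (inj₁ l') = allBelow-T k p (proj₁ (∧-T (allBelow k p) h)) j l'
  go (inj₂ refl) = proj₂ (∧-T (allBelow k p) h)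
 -- Entry j, in units of 1/10000, is an upper bound for |R| / τ when j/10 ≤ x ≤ 5.5, slightly above
 -- exp (-x²/2) because of the fourth-order correction; `rowCheck` verifies it.
 profile : List ℕ
 profile = 10000 ∷ 9951 ∷ 9803 ∷ 9563 ∷ 9237 ∷ 8835 ∷ 8370 ∷ 7854 ∷ 7301 ∷ 6725 ∷ 6139 ∷ 5555 ∷ 4983 ∷ 4434 ∷ 3913 ∷ 3427 ∷ 2979 ∷ 2572 ∷ 2205 ∷ 1878 ∷ 1590 ∷ 1339 ∷ 1121 ∷ 934 ∷ 775 ∷ 641 ∷ 527 ∷ 433 ∷ 354 ∷ 289 ∷ 235 ∷ 192 ∷ 156 ∷ 126 ∷ 103 ∷ 83 ∷ 68 ∷ 55 ∷ 45 ∷ 37 ∷ 30 ∷ 25 ∷ 21 ∷ 17 ∷ 14 ∷ 12 ∷ 10 ∷ 9 ∷ 7 ∷ 6 ∷ 6 ∷ 5 ∷ 4 ∷ 4 ∷ 3 ∷ []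
 lookup : List ℕ -> ℕ -> ℕ
 lookup [] _ = 0
 lookup (x ∷ _) zero = x
 lookup (_ ∷ xs) (suc j) = lookup xs j
 -- `true` is the range x ≤ 2 and `false` x ≤ 5.5. The values of `qsel` are the products E σ 0.0445
 -- of `error-bound`, for E = 1.316, σ = 1.026 and for E = 1.621, σ = 1.2681.
 qsel fmsel : Bool -> ℚ
 qsel true = c 60085 1000000
 qsel false = c 91474 1000000
 fmsel true = c 2 1
 fmsel false = c 55 10
 -- Either the moment bound or the trivial one. The switch is at row 16, the first where 2 - f² is
 -- smaller than -2 h.
 gainsel : Bool -> ℚ -> ℚ -> ℚ
 gainsel true f h = c 2 1 ℚ.- f ℚ.* f
 gainsel false f h = ℚ.- (c 2 1 ℚ.* h)
 h e' f' gain cost : ℕ -> ℚ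
 h j = c (lookup profile j) 10000
 e' j = ιᶜ j ℚ.* c 1 10
 f' j = e' (suc j)
 gain j = gainsel (j ℕ.<ᵇ 16) (f' j) (h j)
 cost j = c 4 1 ℚ.* (qsel (j ℕ.<ᵇ 20) ℚ.* f' j ℚ.* h j)
 rowCheck : ℕ -> Bool
 rowCheck j = (f' j ≤ᵇ fmsel (j ℕ.<ᵇ 20)) ∧ (f' j ≤ᵇ c 55 10) ∧ (0# ≤ᵇ e' j) ∧ (e' j ≤ᵇ c 55 10) ∧ (0# ≤ᵇ h j) ∧ (1# ≤ᵇ h j ℚ.* pow32 (1# ℚ.+ (c 996 1000 ℚ.* (e' j ℚ.* e' j) ℚ.- c 1 80 ℚ.* (c 996 1000 ℚ.* (e' j ℚ.* e' j) ℚ.* (c 996 1000 ℚ.* (e' j ℚ.* e' j)))) ℚ.* c 1 64))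
 rows : T (allBelow 55 rowCheck)
 rows = tt
 -- 0.5164 is the lower bound for `B`; a non-negative total gain allows `B` to be replaced by it.
 totals : T (0# ≤ᵇ sumᶜ gain 55) × T (c 356 100 ≤ᵇ c 5164 10000 ℚ.* sumᶜ gain 55 ℚ.- sumᶜ cost 55)
 totals = tt , tt

-- Block sums, tail sums and the collected facts

module G2 where
 open Q1
 open E1
 open U1
 open P1
 open R1
 open N1
 open N2
 open N3
 open N4
 open N5
 open W1
 open W2
 open W3
 open C1
 open F1
 open F2
 open G1
 open import Data.Rational using (_≤ᵇ_)
 open import Data.Bool using (T)
 sum-split : ∀ f p q -> sum f (p ℕ.+ q) ≡ sum f p + sum (λ i -> f (p ℕ.+ i)) q
 sum-split f p zero = cong (sum f) (ℕP.+-identityʳ p) · sym (+-0ʳ _)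
 sum-split f p (suc q) = cong (sum f) (ℕP.+-suc p q) · cong (_+ f (p ℕ.+ q)) (sum-split f p q) · solve 3 (λ x y z -> x :+ y :+ z := x :+ (y :+ z)) refl _ _ _
 sum-blocks : ∀ (f L : ℕ -> ℚ) t k -> (∀ j -> j ℕ.< k -> ∀ i -> i ℕ.< t -> L j ≤ f (j ℕ.* t ℕ.+ i)) -> ι t * sum L k ≤ sum f (k ℕ.* t)
 sum-blocks f L t zero h = of≡ (*-0ʳ (ι t))
 sum-blocks f L t (suc k) h = solve 3 (λ t s l -> t :* (s :+ l) := t :* s :+ t :* l) refl _ _ _ ≡» +≤ (sum-blocks f L t k (λ j l -> h j (ℕP.m<n⇒m<1+n l))) (sym (sum-const (L k) t) ≡» sum-mono t (λ i l -> h k (ℕP.n<1+n k) i l)) »≡ sym (sum-split f (k ℕ.* t) t) · cong (sum f) (ℕP.+-comm (k ℕ.* t) t)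
 recip : ℕ -> ℚ
 recip k = inv (ι (suc k)) (ι₊ k)
 recip₀ : ∀ k -> 0# ≤ recip k
 recip₀ k = inv₀ _ (ι₊ k)
 recip* : ∀ k -> ι (suc k) * recip k ≡ 1#
 recip* k = *-inv _ (ι₊ k)
 recip-step : ∀ k -> recip (suc k) * recip (suc k) ≤ recip k - recip (suc k)
 recip-step k = gap≤ (recip₀ (suc k) *₀ recip₀ (suc k) *₀ recip₀ k) two »≡ sym diff
  where
  u u' : ℚ
  u = recip k
  u' = recip (suc k)
  one : (1# + ι (suc k)) * u' ≡ 1#
  one = recip* (suc k)
  diff : u - u' ≡ u' * u
  diff = (cong₂ _-_ (sym (*-1ˡ u) · cong (_* u) (sym one)) (sym (*-1ˡ u') · cong (_* u') (sym (recip* k)))) · solve 3 (λ s u u' -> (Κ 1# :+ s) :* u' :* u :- s :* u :* u' := u' :* u) refl _ u u'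
  two : u' * u ≡ u' * u' + u' * u' * u
  two = (sym (*-1ˡ _) · cong (_* (u' * u)) (sym one)) · solve 3 (λ s u u' -> (Κ 1# :+ s) :* u' :* (u' :* u) := u' :* u' :* (s :* u) :+ u' :* u' :* u) refl _ u u' · cong (λ p -> u' * u' * p + u' * u' * u) (recip* k) · cong (_+ u' * u' * u) (*-1ʳ (u' * u'))
 -- Inverse squares are dominated by differences of consecutive reciprocals, so the far range
 -- telescopes.
 tail-sum : ∀ f q a -> 0# ≤ q -> ∀ k -> (∀ i -> i ℕ.< k -> - (q * (recip (suc a ℕ.+ i) * recip (suc a ℕ.+ i))) ≤ f i) -> - (q * (recip a - recip (a ℕ.+ k))) ≤ sum f k
 tail-sum f q a q₀ zero h = of≡ (cong (λ j -> - (q * (recip a - recip j))) (ℕP.+-identityʳ a) · solve 2 (λ q u -> :- (q :* (u :- u)) := Κ 0#) refl q _)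
 tail-sum f q a q₀ (suc k) h = (cong (λ j -> - (q * (recip a - recip j))) (ℕP.+-suc a k) ≡» gap≤ (q₀ *₀ gap (recip-step (a ℕ.+ k))) (solve 4 (λ q x y z -> :- (q :* (x :- y)) :+ (:- (q :* (z :* z))) := :- (q :* (x :- z)) :+ q :* (y :- z :- z :* z)) refl q _ _ _)) » +≤ (tail-sum f q a q₀ k (λ i l -> h i (ℕP.m<n⇒m<1+n l))) (h k (ℕP.n<1+n k))
 ι-reflect : ∀ {a b} -> ι a ≤ ι b -> a ℕ.≤ b
 ι-reflect {a} {b} h = go (ℕP.≤-<-connex a b)
  where
  go : a ℕ.≤ b ⊎ b ℕ.< a -> a ℕ.≤ b
  go (inj₁ l) = l
  go (inj₂ l) = ⊥-elim (ℚP.<-irrefl refl (ℚP.<-≤-trans (by-gap< {ι b} {1# + ι b} 1# 0<1 (+-comm 1# (ι b))) (ι-mono l » h)))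
 sum-affine : ∀ B (f k : ℕ -> ℚ) z n -> sum (λ j -> B * f j + (- (k j + z))) n ≡ B * sum f n - (sum k n + ι n * z)
 sum-affine B f k z zero = solve 2 (λ B z -> Κ 0# := B :* Κ 0# :- (Κ 0# :+ Κ 0# :* z)) refl B z
 sum-affine B f k z (suc n) = cong (_+ (B * f n + (- (k n + z)))) (sum-affine B f k z n) · solve 7 (λ B F K i z f k -> B :* F :- (K :+ i :* z) :+ (B :* f :+ (:- (k :+ z))) := B :* (F :+ f) :- (K :+ k :+ (Κ 1# :+ i) :* z)) refl B _ _ _ z _ _
 module Assemble (r : ℚ) (r₊ : 0# < r) (r₁ : r ≤ 1#) (n : ℕ) (hn : 7000 ℕ.< n) (h747 : (1# - r * (r * r)) * c 747 10 ≤ 1#) where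
  open Weights r r₊ r₁ using (Π²)
  open Main r r₊ r₁ using (V; V̂; V̂₀; M₄; S₁; S₂; k₁; C; total; total₊; μ)
  open Num r r₊ r₁ n using (TypeA; TypeB; V̂-bound)
  open Claims r r₊ r₁ n using (Tails; Small; tailsA; tailsB)
  module Co = Core r r₊ r₁ n
  FactSet : Set
  FactSet = (M₄ n ≤ c 3 20 * (V n * V n)) × V̂-bound × (k₁ * S₁ n ≤ c 1947 10000) × (S₁ n * S₁ n ≤ c 195 10000 * c 195 10000 * V n) ×
   ((S₁ n + k₁ * S₂ n) * (S₁ n + k₁ * S₂ n) ≤ c 445 10000 * c 445 10000 * V n) × (c 4000000 1 ≤ V n) × (∀ S -> V n ≤ S -> S ≤ c 1003 1000 * V n -> Tails S)
  cube≥ : ∀ q k K v -> T (c 4000000 1 ≤ᵇ q ℚ.* (k ℚ.* k ℚ.* k)) -> 0# ≤ q -> 0# ≤ k -> k ≤ K -> q * (K * K * K) ≤ v -> c 4000000 1 ≤ v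
  cube≥ q k K v h q₀ k₀ hk hv = ℚP.≤ᵇ⇒≤ h » *≡ _ _ · cong (q *_) (*≡ _ _ · cong (_* k) (*≡ k k)) ≡» *≤ʳ q₀ (*≤ (k₀ *₀ k₀) (k₀ » hk) (sq-mono k₀ hk) hk) » hv
  facts : FactSet
  facts = go (bounds r r₊ r₁ n hn h747)
   where
   go : TypeA ⊎ TypeB -> FactSet
   go (inj₁ b) = M₄≤ , V̂≤ , k₁S₁≤ , S₁≤ , S₁₂≤ , cube≥ (c 1630 100) (c 747 10) K _ _ lit lit K≥ V≥ , tailsA b
    where open Bounds b
   go (inj₂ b) = M₄≤ , V̂≤ , k₁S₁≤ , S₁≤ , S₁₂≤ , cube≥ (c 119 10) (c 875 1) K _ _ lit lit K≥ V≥ , tailsB b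
    where open Bounds b
  V-large : c 4000000 1 ≤ V n
  V-large = proj₁ (proj₂ (proj₂ (proj₂ (proj₂ (proj₂ facts)))))
  tails : ∀ S -> V n ≤ S -> S ≤ c 1003 1000 * V n -> Tails S
  tails = proj₂ (proj₂ (proj₂ (proj₂ (proj₂ (proj₂ facts)))))

-- Assembly of the saddle-point estimate

module G3 where
 open Q1
 open E1
 open U1
 open P1
 open R1
 open N1
 open N2
 open N3
 open N4
 open N5
 open W1
 open W2
 open W3
 open C1
 open F1
 open F2
 open G1
 open G2
 open import Data.Rational using (_≤ᵇ_)
 open import Data.Bool using (T; Bool; true; false)
 module Saddle (r : ℚ) (r₊ : 0# < r) (r₁ : r ≤ 1#) (n : ℕ) (hn : 7000 ℕ.< n) (h747 : (1# - r * (r * r)) * c 747 10 ≤ 1#) where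
  open Weights r r₊ r₁ using (Π²)
  open Main r r₊ r₁ using (V; V̂₀; C; total; total₊; μ; Π²≡)
  open Claims r r₊ r₁ n using (Tails; Small)
  open Assemble r r₊ r₁ n hn h747
  τ : ℚ
  τ = total n
  τ₊ : 0# < τ
  τ₊ = total₊ n
  τ₀ : 0# ≤ τ
  τ₀ = <⇒≤ τ₊
  -- `s` is an integer whose square barely exceeds the variance plus the squared offset of m from
  -- the mean; being an integer, it can set the mesh. `ε` is the expected sign and `w` the resulting
  -- phase.
  module At (m s : ℕ) (hs : V n + (μ n - ι m) * (μ n - ι m) ≤ ι s * ι s) (hs' : ι s * ι s ≤ c 1003 1000 * V n)
   (ε : ℚ) (w≥ : 1# ≤ Tr (ofℚ ε *° conj (ω ^° m))) (Nw : N (ofℚ ε *° conj (ω ^° m)) ≡ 1#) (εε : ε * ε ≡ 1#)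
   (α β : ℕ -> ℚ) (L : ℕ) (m<L : m ℕ.< L) (α≤ : ∀ j -> α j ≤ β j) (-α≤ : ∀ j -> - α j ≤ β j)
   (heval : ∀ u -> eval α L u ≡ ofℚ ε *° P (ofℚ r *° u) n) where
   S : ℚ
   S = ι s * ι s
   S≥ : V n ≤ S
   S≥ = gap≤ (sq₀ _) refl » hs
   s≥10 : c 2000 1 ≤ ι s
   s≥10 = sq-cancel (ι₀ s) ((sym (*≡ (c 2000 1) (c 2000 1)) ≡» lit) » V-large » S≥)
   w : 𝔼
   w = ofℚ ε *° conj (ω ^° m)
   module CF = Co.Facts (proj₁ facts) (proj₁ (proj₂ facts)) (proj₁ (proj₂ (proj₂ facts))) (proj₁ (proj₂ (proj₂ (proj₂ facts)))) (proj₁ (proj₂ (proj₂ (proj₂ (proj₂ facts))))) (ι s) (ι₀ s) S≥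
   TS : Tails S
   TS = tails S S≥ hs'
   f : 𝔼 -> ℚ
   f u = Tr (eval α L u *° conj (u ^° m))
   pt : 𝔼 -> 𝔼
   pt u = P (ofℚ r *° u) n
   f≡ : ∀ u -> f u ≡ Tr (pt u *° (ofℚ ε *° conj (u ^° m)))
   f≡ u = cong Tr (cong (_*° conj (u ^° m)) (heval u) · solve° 3 (λ e p y -> e :* p :* y := p :* (e :* y)) refl _ _ _)
   fω≡ : ∀ z -> f (ω *° z) ≡ Tr (Co.F z *° (w *° conj (z ^° m)))
   fω≡ z = f≡ (ω *° z) · cong (λ y -> Tr (pt (ω *° z) *° y)) (cong (ofℚ ε *°_) (cong conj (*-^° ω z m) · conj-* _ _) · solve° 3 (λ e x y -> e :* (x :* y) := e :* x :* y) refl _ _ _)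
   Nf : ∀ u -> N u ≡ 1# -> N (pt u *° (ofℚ ε *° conj (u ^° m))) ≡ N (pt u)
   Nf u Nu = N-* _ _ · cong (N (pt u) *_) (N-* _ _ · (cong₂ _*_ (N-ofℚ ε · εε) (N-conj _ · Unit.N-unit u Nu m)) · *-1ˡ 1#) · *-1ʳ _
   f-trivial : ∀ u -> N u ≡ 1# -> - (c 2 1 * (1# + N (pt u))) ≤ f u
   f-trivial u Nu = Tr≥ (lit +₀ N₀ (pt u)) (Nf u Nu ≡» gap≤ (lit +₀ N₀ (pt u) +₀ sq₀ (N (pt u))) (solve 1 (λ x -> (Κ 1# :+ x) :* (Κ 1# :+ x) := x :+ (Κ 1# :+ x :+ x :* x)) refl _)) »≡ sym (f≡ u)
   f-small : ∀ u -> N u ≡ 1# -> ∀ y k -> 0# < y -> 0# ≤ k -> c 12418 10000 * τ ≤ k * y -> Small u y -> - (c 2 1 * k) ≤ f u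
   f-small u Nu y k y₊ k₀ hk sm = Tr≥ k₀ (Nf u Nu ≡» cancel≤ (y₊ *₊ y₊) (*-comm (y * y) (N (pt u)) ≡» sm » Π²≡ n ≡» *≤ˡ (sq₀ τ) NC≤ » *-swap (c 12418 10000) (c 12418 10000) τ τ ≡» sq-mono (lit *₀ τ₀) hk »≡ *-swap k y k y · *-comm _ _)) »≡ sym (f≡ u)
    where
    NC≤ : N (C n) ≤ c 12418 10000 * c 12418 10000
    NC≤ = cong N (solve° 1 (λ y -> y := y :* Κ 1°) refl _) ≡» CF.NC 1° »≡ cong (c 12418 10000 * c 12418 10000 *_) N1° · *-1ʳ _
   B : ℚ
   B = Tr (C n *° w)
   -- 0.5164 = 1 - 2 * 0.2418: the phase has trace at least 1 and C differs from 1 by at most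
   -- 0.2418.
   B≥ : c 5164 10000 ≤ B
   B≥ = (solve 0 (κ 5164 10000 := Κ 1# :+ (:- (κ 2 1 :* κ 2418 10000))) refl ≡» +≤ w≥ (Tr≥ lit small)) »≡ sym (cong Tr (solve° 2 (λ c w -> c :* w := w :+ (c :- Κ 1°) :* w) refl _ w) · Tr-+ _ _)
    where
    small : N ((C n -° 1°) *° w) ≤ c 2418 10000 * c 2418 10000
    small = N-* _ _ · cong (N (C n -° 1°) *_) Nw · *-1ʳ _ ≡» CF.C-1 »≡ cong (c 2418 10000 * c 2418 10000 *_) N1° · *-1ʳ _
   B₀ : 0# ≤ B
   B₀ = lit » B≥
   K₀ : ℚ
   K₀ = 1# + N (pt 1°) + c 2 1 * (1# + N (pt ω))
   found : Σ ℕ λ k -> (K₀ + c 27 1 * sum β L) * inv τ τ₊ ≤ ι k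
   found = archimedes _
   -- The three summands serve different ends: the Archimedean bound that drowns the kernel error,
   -- the size L + m needed for the Dirichlet bound, and a numerical minimum.
   t' : ℕ
   t' = proj₁ found ℕ.+ (L ℕ.+ m) ℕ.+ 100
   t : ℕ
   t = t' ℕ.+ t'
   ιt' : c 100 1 ≤ ι t'
   ιt' = solve 0 (κ 100 1 := κ 10 1 :* κ 10 1) refl ≡» sym (cong₂ _*_ ι10 ι10) · sym (ι-* 10 10) ≡» ι-mono (ℕP.m≤n+m 100 (proj₁ found ℕ.+ (L ℕ.+ m)))
   ιt : ι t ≡ c 2 1 * ι t'
   ιt = ι-+ t' t' · solve 1 (λ x -> x :+ x := κ 2 1 :* x) refl _
   t'₊ : 0# < ι t'
   t'₊ = ℚP.<-≤-trans (ℚP.positive⁻¹ (c 100 1)) ιt'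
   t₊ : 0# < ι t
   t₊ = ℚP.<-≤-trans (ℚP.positive⁻¹ (c 2 1) *₊ t'₊) (of≡ (sym ιt))
   s₊ : 0# < ι s
   s₊ = ℚP.<-≤-trans (ℚP.positive⁻¹ (c 2000 1)) s≥10
   -- With this mesh x i = (i + 1) / (10 t), so that t consecutive indices make up one row of width
   -- 0.1 in the table.
   M : ℚ
   M = c 10 1 * ι t * ι s
   M≡ : M ≡ c 20 1 * ι t' * ι s
   M≡ = cong (λ p -> c 10 1 * p * ι s) ιt · solve 2 (λ t s -> κ 10 1 :* (κ 2 1 :* t) :* s := κ 20 1 :* t :* s) refl _ _
   M≥ : c 5432 1 ≤ M
   M≥ = (lit »≡ *≡ _ _ · cong (_* c 2000 1) (*≡ _ _)) » *≤ (lit *₀ lit) (ι₀ s) (*≤ʳ lit ιt') s≥10 »≡ sym M≡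
   module Pt = Point M M≥
   open Pt using (ζ; ξ; X)
   turn-at : ℕ
   turn-at = 11 ℕ.* t' ℕ.* s
   ι11 : ι 11 ≡ c 11 1
   ι11 = cong (1# +_) ι10 · solve 0 (Κ 1# :+ κ 10 1 := κ 11 1) refl
   turn-ι : ι turn-at ≡ c 55 100 * M
   turn-ι = ι-* (11 ℕ.* t') s · cong (_* ι s) (ι-* 11 t' · cong (_* ι t') ι11) · solve 2 (λ t s -> κ 11 1 :* t :* s := κ 55 100 :* (κ 20 1 :* t :* s)) refl _ _ · cong (c 55 100 *_) (sym M≡)
   the-turn : Σ ℕ λ q -> suc q ℕ.≤ turn-at × 0# ≤ Tr (ξ ^° q) × Tr (ξ ^° suc q) ≤ 0#
   the-turn = QuarterTurn.first-turn ξ Pt.Nξ turn-at (Pt.past turn-at turn-ι)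
   module Q = QuarterTurn.Turn ξ Pt.Nξ (proj₁ the-turn) (proj₁ (proj₂ (proj₂ the-turn))) (proj₂ (proj₂ (proj₂ the-turn)))
   n' : ℕ
   n' = Q.n
   ιq≤ : ι Q.q ≤ c 55 100 * M
   ιq≤ = ι-mono (proj₁ (proj₂ the-turn)) »≡ turn-ι
   z : ℕ -> 𝔼
   z i = ζ ^° suc i
   Nz : ∀ i -> N (z i) ≡ 1#
   Nz i = Pt.N-unit (suc i)
   g : ℕ -> ℚ
   g i = f (z i) + (f (ω *° z i) + f (ω *° conj (z i)))
   x : ℕ -> ℚ
   x i = X (suc i) * ι s
   xt : ∀ i -> x i * (c 10 1 * ι t) ≡ ι (suc i)
   xt i = solve 3 (λ x s t -> x :* s :* (κ 10 1 :* t) := x :* (κ 10 1 :* t :* s)) refl _ _ _ · Pt.XM (suc i)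
   xx : ∀ i -> X (suc i) * X (suc i) * S ≡ x i * x i
   xx i = *-swap (X (suc i)) (X (suc i)) (ι s) (ι s)
   x₊ : ∀ i -> 0# < X (suc i)
   x₊ i = factor₊ (Pt.X₀ (suc i)) (ℚP.<-≤-trans (ι₊ i) (of≡ (sym (Pt.XM (suc i)))))
   x₀ : ∀ i -> 0# ≤ x i
   x₀ i = <⇒≤ (x₊ i) *₀ ι₀ s
   10t₊ : 0# < c 10 1 * ι t
   10t₊ = ℚP.positive⁻¹ (c 10 1) *₊ t₊
   X≤ : ∀ i -> i ℕ.< n' -> X (suc i) ≤ c 11 10
   X≤ i h = cancel≤ Pt.M₊ (*-comm M _ · Pt.XM (suc i) ≡» ι-mono h » ι-+ Q.q Q.q ≡» +≤ ιq≤ ιq≤ »≡ solve 1 (λ m -> κ 55 100 :* m :+ κ 55 100 :* m := m :* κ 11 10) refl M)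
   TailsAt : ℕ -> 𝔼 -> Set
   TailsAt i y = (c 3025 100 ≤ X (suc i) * X (suc i) * S -> X (suc i) * X (suc i) * S ≤ c 81 1 -> Small (ω *° y) (c 400 1)) × (c 81 1 ≤ X (suc i) * X (suc i) * S -> Small (ω *° y) (c 5 1 * (X (suc i) * X (suc i) * S))) ×
    (0# < X (suc i) -> Small y (c 486 1) × Small y (c 6 1 * (X (suc i) * X (suc i) * S))) × (X (suc i) * X (suc i) * S ≤ c 81 1 -> c 9966 10000 * (X (suc i) * X (suc i) * S) ≤ N (1° -° y ^° 1) * V n)
   at-z : ∀ i -> i ℕ.< n' -> TailsAt i (z i)
   at-z i h = TS (z i) (Nz i) (X (suc i)) (Pt.X₀ (suc i)) (X≤ i h) (Pt.upper (suc i)) (Pt.lower (suc i) (X≤ i h))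
   Nz̄ : ∀ i -> N (conj (z i)) ≡ 1#
   Nz̄ i = N-conj (z i) · Nz i
   D̄ : ∀ i -> N (1° -° conj (z i) ^° 1) ≡ N (1° -° z i ^° 1)
   D̄ i = cong (λ y -> N (1° -° y)) (sym (conj-^ (z i) 1)) · N-1-conj (z i ^° 1)
   at-z̄ : ∀ i -> i ℕ.< n' -> TailsAt i (conj (z i))
   at-z̄ i h = TS (conj (z i)) (Nz̄ i) (X (suc i)) (Pt.X₀ (suc i)) (X≤ i h) (D̄ i ≡» Pt.upper (suc i)) (Pt.lower (suc i) (X≤ i h) »≡ sym (D̄ i))
   zero≥ : ∀ i -> i ℕ.< n' -> - (c 5112 1000000 * τ) ≤ f (z i)
   zero≥ i h = (cong -_ (solve 1 (λ t -> κ 5112 1000000 :* t := κ 2 1 :* (κ 2556 1000000 :* t)) refl τ)) ≡» f-small (z i) (Nz i) (c 486 1) (c 2556 1000000 * τ) (ℚP.positive⁻¹ (c 486 1)) (lit *₀ τ₀)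
    (scale≤ τ τ₀ lit »≡ solve 1 (λ t -> Κ (c 2556 1000000 ℚ.* c 486 1) :* t := κ 2556 1000000 :* t :* κ 486 1) refl τ) (proj₁ (proj₁ (proj₂ (proj₂ (at-z i h))) (x₊ i)))
   mid≥ : ∀ i -> i ℕ.< n' -> c 55 10 ≤ x i -> x i ≤ c 9 1 -> - (c 17530 1000000 * τ) ≤ g i
   mid≥ i h lo hi = solve 1 (λ t -> :- (κ 17530 1000000 :* t) := :- (κ 5112 1000000 :* t) :+ ((:- (κ 2 1 :* (κ 12418 4000000 :* t))) :+ (:- (κ 2 1 :* (κ 12418 4000000 :* t))))) refl τ ≡» +≤ (zero≥ i h) (+≤ (half (z i) (Nz i) (at-z i h)) (half (conj (z i)) (Nz̄ i) (at-z̄ i h)))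
    where
    half : ∀ y -> N y ≡ 1# -> TailsAt i y -> - (c 2 1 * (c 12418 4000000 * τ)) ≤ f (ω *° y)
    half y Ny ta = f-small (ω *° y) (N-ω* y · Ny) (c 400 1) (c 12418 4000000 * τ) (ℚP.positive⁻¹ (c 400 1)) (lit *₀ τ₀) (of≡ (solve 1 (λ t -> κ 12418 10000 :* t := κ 12418 4000000 :* t :* κ 400 1) refl τ))
     (proj₁ ta ((lit »≡ *≡ _ _) » sq-mono {c 55 10} lit lo »≡ sym (xx i)) (xx i ≡» sq-mono (x₀ i) hi » sym (*≡ _ _) ≡» lit))
   -- 140.738 = 100 * 2 * (1.2418/6 + 2 * 1.2418/5): one point near 1 and two near `ω`, where 1/x²
   -- equals 100 t² / (i+1)².
   far-constant : ℚ
   far-constant = c 140738 1000 * (τ * (ι t * ι t))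
   far≥ : ∀ i -> i ℕ.< n' -> c 9 1 ≤ x i -> - (far-constant * (recip i * recip i)) ≤ g i
   far≥ i h lo = solve 2 (λ q u -> :- (κ 140738 1000 :* q :* u) := :- (κ 2 1 :* (κ 20697 1000 :* (q :* u))) :+ ((:- (κ 2 1 :* (κ 24836 1000 :* (q :* u)))) :+ (:- (κ 2 1 :* (κ 24836 1000 :* (q :* u)))))) refl _ u² ≡» +≤ (f-small (z i) (Nz i) (c 6 1 * x²) (c 20697 1000 * (τ * (ι t * ι t) * u²)) (ℚP.positive⁻¹ (c 6 1) *₊ x²₊) (lit *₀ T₀)
    (scale≤ τ τ₀ lit »≡ sym (prod≡ (c 20697 1000) (c 6 1) (solve 0 (κ 20697 1000 :* (κ 6 1 :* κ 1 100) := Κ (c 20697 1000 ℚ.* c 6 100)) refl))) (proj₂ (proj₁ (proj₂ (proj₂ (at-z i h))) (x₊ i))))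
    (+≤ (half (z i) (Nz i) (at-z i h)) (half (conj (z i)) (Nz̄ i) (at-z̄ i h)))
    where
    u² x² : ℚ
    u² = recip i * recip i
    x² = X (suc i) * X (suc i) * S
    x²₊ : 0# < x²
    x²₊ = (x₊ i *₊ x₊ i) *₊ (s₊ *₊ s₊)
    T₀ : 0# ≤ τ * (ι t * ι t) * u²
    T₀ = τ₀ *₀ sq₀ (ι t) *₀ sq₀ (recip i)
    unit : ι t * ι t * u² * x² ≡ c 1 100
    unit = cong (ι t * ι t * u² *_) (xx i) · solve 3 (λ t u x -> t :* t :* (u :* u) :* (x :* x) := κ 1 100 :* (x :* (κ 10 1 :* t) :* u :* (x :* (κ 10 1 :* t) :* u))) refl _ _ _ · cong (λ p -> c 1 100 * (p * recip i * (p * recip i))) (xt i) · cong (λ p -> c 1 100 * (p * p)) (recip* i) · solve 0 (κ 1 100 :* (Κ 1# :* Κ 1#) := κ 1 100) refl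
    prod≡ : ∀ k y {q} -> k * (y * c 1 100) ≡ q -> k * (τ * (ι t * ι t) * u²) * (y * x²) ≡ q * τ
    prod≡ k y h = solve 6 (λ k τ tt u y x -> k :* (τ :* tt :* u) :* (y :* x) := k :* (y :* (tt :* u :* x)) :* τ) refl k τ _ u² y x² · cong (_* τ) (cong (λ p -> k * (y * p)) unit · h)
    half : ∀ y -> N y ≡ 1# -> TailsAt i y -> - (c 2 1 * (c 24836 1000 * (τ * (ι t * ι t) * u²))) ≤ f (ω *° y)
    half y Ny ta = f-small (ω *° y) (N-ω* y · Ny) (c 5 1 * x²) (c 24836 1000 * (τ * (ι t * ι t) * u²)) (ℚP.positive⁻¹ (c 5 1) *₊ x²₊) (lit *₀ T₀) (of≡ (sym (prod≡ (c 24836 1000) (c 5 1) (solve 0 (κ 24836 1000 :* (κ 5 1 :* κ 1 100) := κ 12418 10000) refl))))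
     (proj₁ (proj₂ ta) ((lit »≡ *≡ _ _) » sq-mono {c 9 1} lit lo »≡ sym (xx i)))
   -- In a row the upper end f' bounds the moment and the errors, and the lower end e' bounds |R|.
   -- The last constant is the third coset's share from `zero≥`.
   row≥ : ∀ j -> j ℕ.< 55 -> ∀ i -> i ℕ.< n' -> e' j ≤ x i -> x i ≤ f' j -> τ * (B * gain j + (- (cost j + c 5112 1000000))) ≤ g i
   row≥ j j<55 i h lo hi = solve 4 (λ t b k z -> t :* (b :+ (:- (k :+ z))) := :- (z :* t) :+ t :* (b :- k)) refl τ _ _ _ ≡» +≤ (zero≥ i h) ((cong (λ k -> τ * (B * gain j - k)) cost≡ ≡» Pr.pair≥ (qsel b20 * f' j) (h' j) (gain j) (qsel₀ b20 *₀ f₀) h₀ B₀ (E₁ b20 (proj₁ c₁)) (E₂ b20 (proj₁ c₁)) R₁' R₂ (gain≥ (j ℕ.<ᵇ 16))) »≡ sym (cong₂ _+_ (fω≡ (z i)) (fω≡ (conj (z i)))))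
    where
    b20 : Bool
    b20 = j ℕ.<ᵇ 20
    h' : ℕ -> ℚ
    h' = G1.h
    c₁ = ∧-T (f' j ≤ᵇ fmsel b20) (allBelow-T 55 rowCheck rows j j<55)
    c₂ = ∧-T (f' j ≤ᵇ c 55 10) (proj₂ c₁)
    c₃ = ∧-T (0# ≤ᵇ e' j) (proj₂ c₂)
    c₄ = ∧-T (e' j ≤ᵇ c 55 10) (proj₂ c₃)
    c₅ = ∧-T (0# ≤ᵇ h' j) (proj₂ c₄)
    h₀ : 0# ≤ h' j
    h₀ = ℚP.≤ᵇ⇒≤ (proj₁ c₅)
    x55 : x i ≤ c 55 10
    x55 = hi » ℚP.≤ᵇ⇒≤ (proj₁ c₂)
    f₀ : 0# ≤ f' j
    f₀ = x₀ i » hi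
    qsel₀ : ∀ b -> 0# ≤ qsel b
    qsel₀ true = lit
    qsel₀ false = lit
    x²81 : X (suc i) * X (suc i) * S ≤ c 81 1
    x²81 = xx i ≡» sq-mono (x₀ i) x55 » sym (*≡ _ _) ≡» lit
    module Pr = CF.Pair (z i) (Nz i) (X (suc i)) (Pt.X₀ (suc i)) (Pt.upper (suc i)) (proj₂ (proj₂ (proj₂ (at-z i h))) x²81) w Nw m
    E₁ : ∀ b -> T (f' j ≤ᵇ fmsel b) -> Pr.err (z i) (Nz i) ⊑[ qsel b * f' j ] Co.R (z i) (Nz i)
    E₁ true l = Pr.Z.error-bound (c 1026 1000) (c 1316 1000) (c 2 1) _ (f' j) _ _ _ _ _ hi (ℚP.≤ᵇ⇒≤ l)
    E₁ false l = Pr.Z.error-bound (c 12681 10000) (c 1621 1000) (c 55 10) _ (f' j) _ _ _ _ _ hi (ℚP.≤ᵇ⇒≤ l)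
    E₂ : ∀ b -> T (f' j ≤ᵇ fmsel b) -> Pr.err (conj (z i)) Pr.Nz̄ ⊑[ qsel b * f' j ] Co.R (conj (z i)) Pr.Nz̄
    E₂ true l = Pr.Z̄.error-bound (c 1026 1000) (c 1316 1000) (c 2 1) _ (f' j) _ _ _ _ _ hi (ℚP.≤ᵇ⇒≤ l)
    E₂ false l = Pr.Z̄.error-bound (c 12681 10000) (c 1621 1000) (c 55 10) _ (f' j) _ _ _ _ _ hi (ℚP.≤ᵇ⇒≤ l)
    R₁' : N (Co.R (z i) (Nz i)) ≤ h' j * τ * (h' j * τ)
    R₁' = Pr.Z.R-bound (e' j) (h' j) (proj₁ c₃) (proj₁ c₄) (proj₁ c₅) (proj₂ c₅) lo x55
    R₂ : N (Co.R (conj (z i)) Pr.Nz̄) ≤ h' j * τ * (h' j * τ)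
    R₂ = Pr.Z̄.R-bound (e' j) (h' j) (proj₁ c₃) (proj₁ c₄) (proj₁ c₅) (proj₂ c₅) lo x55
    gain≥ : ∀ b -> gainsel b (f' j) (h' j) * τ ≤ Tr Pr.Rm
    gain≥ true = cong (_* τ) (+≡ _ _ · cong (c 2 1 +_) (-≡ _ · (cong -_ (*≡ _ _)))) ≡» Pr.Rm-moment hs (f' j) f₀ hi
    gain≥ false = cong (_* τ) (-≡ _ · (cong -_ (*≡ _ _))) ≡» Pr.Rm-trivial (h' j) h₀ R₁'
    cost≡ : cost j ≡ c 4 1 * (qsel b20 * f' j * h' j)
    cost≡ = *≡ _ _ · cong (c 4 1 *_) (*≡ _ _ · cong (_* h' j) (*≡ _ _))
   index-lower : ∀ j i -> ι j * c 1 10 ≤ x (j ℕ.* t ℕ.+ i)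
   index-lower j i = cancel≤ 10t₊ (solve 2 (λ t j -> κ 10 1 :* t :* (j :* κ 1 10) := j :* t) refl _ _ · sym (ι-* j t) ≡» ι-mono (ℕP.≤-trans (ℕP.m≤m+n (j ℕ.* t) i) (ℕP.n≤1+n _)) »≡ sym (xt (j ℕ.* t ℕ.+ i)) · *-comm _ _)
   index-upper : ∀ j i -> suc i ℕ.≤ j ℕ.* t -> x i ≤ ι j * c 1 10
   index-upper j i h = cancel≤ 10t₊ (*-comm _ _ · xt i ≡» ι-mono h »≡ ι-* j t · solve 2 (λ t j -> j :* t := κ 10 1 :* t :* (j :* κ 1 10)) refl _ _)
   e≡ : ∀ j -> e' j ≡ ι j * c 1 10
   e≡ j = *≡ _ _ · cong (_* c 1 10) (ιᶜ≡ j)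
   lit55 : ι 55 ≡ c 55 1
   lit55 = sym (ιᶜ≡ 55) · refl
   lit35 : ι 35 ≡ c 35 1
   lit35 = sym (ιᶜ≡ 35) · refl
   lit90 : ι 90 ≡ c 90 1
   lit90 = sym (ιᶜ≡ 90) · refl
   -- At the quarter turn the squared chord is at least 2, which forces q² ≥ 2 M² / 9. Since M = 10
   -- t s with s ≥ 2000, this is far more than needed.
   enough : 90 ℕ.* t ℕ.≤ n'
   enough = ι-reflect (sq-cancel (ι₀ n') (cong (λ p -> p * p) (ι-* 90 t · cong (_* ι t) lit90) · solve 1 (λ t -> κ 90 1 :* t :* (κ 90 1 :* t) := κ 8100 1 :* (t :* t)) refl _ ≡» scale≤ (ι t * ι t) (sq₀ (ι t)) s²≥ » solve 2 (λ t s -> κ 8 9 :* κ 100 1 :* (s :* s) :* (t :* t) := κ 8 9 :* (κ 10 1 :* t :* s :* (κ 10 1 :* t :* s))) refl _ _ ≡» *≤ʳ lit M²≤ »≡ solve 1 (λ q -> κ 8 9 :* (κ 9 2 :* (q :* q)) := (q :+ q) :* (q :+ q)) refl _ · cong (λ p -> p * p) (sym (ι-+ Q.q Q.q))))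
    where
    s²≥ : c 8100 1 ≤ c 8 9 * c 100 1 * (ι s * ι s)
    s²≥ = lit » *≡ _ _ · (cong₂ _*_ (*≡ (c 8 9) (c 100 1)) (*≡ (c 2000 1) (c 2000 1))) ≡» *≤ʳ (lit *₀ lit) (sq-mono {c 2000 1} lit s≥10)
    two≤ : c 2 1 ≤ ι Q.q * ι Q.q * Pt.Ξ.D
    two≤ = (gap≤ (solve 0 (Κ 0# := :- Κ 0#) refl ≡» neg-mono (proj₂ (proj₂ (proj₂ the-turn)))) refl »≡ sym (Pt.Ξ.d-Tr Q.q)) » Pt.Ξ.d≤ Q.q
    M²≤ : M * M ≤ c 9 2 * (ι Q.q * ι Q.q)
    M²≤ = solve 1 (λ m -> m := κ 1 2 :* (κ 2 1 :* m)) refl _ ≡» *≤ʳ lit (*≤ˡ (sq₀ M) two≤) » solve 3 (λ q D m -> κ 1 2 :* (q :* D :* m) := κ 1 2 :* (q :* (D :* m))) refl _ Pt.Ξ.D _ ≡» *≤ʳ lit (*≤ʳ (sq₀ (ι Q.q)) Pt.Dξ≤) »≡ solve 1 (λ q -> κ 1 2 :* (q :* κ 9 1) := κ 9 2 :* q) refl _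
   90≡ : 55 ℕ.* t ℕ.+ 35 ℕ.* t ≡ 90 ℕ.* t
   90≡ = sym (ℕP.*-distribʳ-+ t 55 35)
   55≤ : 55 ℕ.* t ℕ.≤ n'
   55≤ = ℕP.≤-trans (ℕP.≤-trans (ℕP.m≤m+n (55 ℕ.* t) (35 ℕ.* t)) (ℕP.≤-reflexive 90≡)) enough
   rest : ℕ
   rest = n' ℕ.∸ 90 ℕ.* t
   n'≡ : n' ≡ 90 ℕ.* t ℕ.+ rest
   n'≡ = sym (ℕP.m+[n∸m]≡n enough)
   core≥ : ι t * (τ * (c 356 100 - c 55 1 * c 5112 1000000)) ≤ sum g (55 ℕ.* t)
   core≥ = *≤ʳ (ι₀ t) (*≤ʳ τ₀ (+≤ tot ≤-refl »≡ solve 3 (λ g k z -> g :- k :+ (:- z) := g :- (k :+ z)) refl _ _ _ · cong (λ i -> B * sum gain 55 - (sum cost 55 + i * c 5112 1000000)) (sym lit55)) »≡ sym (sum-*ˡ τ (λ j -> B * gain j + (- (cost j + c 5112 1000000))) 55 · cong (τ *_) (sum-affine B gain cost (c 5112 1000000) 55))) » sum-blocks g (λ j -> τ * (B * gain j + (- (cost j + c 5112 1000000)))) t 55 block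
    where
    tot : c 356 100 ≤ B * sum gain 55 - sum cost 55
    tot = ℚP.≤ᵇ⇒≤ (proj₂ totals) » +≡ _ _ · (cong₂ _+_ (*≡ _ _ · cong (c 5164 10000 *_) (sumᶜ≡ gain 55)) (-≡ _ · (cong -_ (sumᶜ≡ cost 55)))) ≡» +≤ (*≤ˡ (ℚP.≤ᵇ⇒≤ (proj₁ totals) »≡ sumᶜ≡ gain 55) B≥) ≤-refl
    block : ∀ j -> j ℕ.< 55 -> ∀ i -> i ℕ.< t -> τ * (B * gain j + (- (cost j + c 5112 1000000))) ≤ g (j ℕ.* t ℕ.+ i)
    block j j<55 i i<t = row≥ j j<55 (j ℕ.* t ℕ.+ i) (ℕP.≤-trans below (ℕP.≤-trans (ℕP.*-monoˡ-≤ t j<55) 55≤)) (e≡ j ≡» index-lower j i) (index-upper (suc j) (j ℕ.* t ℕ.+ i) below »≡ sym (e≡ (suc j)))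
     where
     below : suc (j ℕ.* t ℕ.+ i) ℕ.≤ suc j ℕ.* t
     below = ℕP.≤-trans (ℕP.≤-reflexive (sym (ℕP.+-suc (j ℕ.* t) i))) (ℕP.≤-trans (ℕP.+-monoʳ-≤ (j ℕ.* t) i<t) (ℕP.≤-reflexive (ℕP.+-comm (j ℕ.* t) t)))
   middle≥ : ι t * (- (c 35 1 * (c 17530 1000000 * τ))) ≤ sum (λ i -> g (55 ℕ.* t ℕ.+ i)) (35 ℕ.* t)
   middle≥ = solve 3 (λ t k y -> t :* (:- (k :* y)) := k :* t :* (:- y)) refl _ _ _ · cong (_* (- (c 17530 1000000 * τ))) (cong (_* ι t) (sym lit35) · sym (ι-* 35 t)) · sym (sum-const _ (35 ℕ.* t)) ≡» sum-mono (35 ℕ.* t) (λ i l -> mid≥ (55 ℕ.* t ℕ.+ i) (ℕP.≤-trans (below i l) enough) (solve 0 (κ 55 10 := κ 55 1 :* κ 1 10) refl · cong (_* c 1 10) (sym lit55) ≡» index-lower 55 i)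
    (index-upper 90 _ (below i l) »≡ cong (_* c 1 10) lit90 · solve 0 (κ 90 1 :* κ 1 10 := κ 9 1) refl))
    where
    below : ∀ i -> i ℕ.< 35 ℕ.* t -> suc (55 ℕ.* t ℕ.+ i) ℕ.≤ 90 ℕ.* t
    below i l = ℕP.≤-trans (ℕP.≤-reflexive (sym (ℕP.+-suc (55 ℕ.* t) i))) (ℕP.≤-trans (ℕP.+-monoʳ-≤ (55 ℕ.* t) l) (ℕP.≤-reflexive 90≡))
   far-sum : ι t * (- (c 140738 90000 * τ)) ≤ sum (λ i -> g (90 ℕ.* t ℕ.+ i)) rest
   far-sum = bound » tail-sum (λ i -> g (90 ℕ.* t ℕ.+ i)) far-constant a' (lit *₀ (τ₀ *₀ sq₀ (ι t))) rest term
    where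
    t>0 : 0 ℕ.< 90 ℕ.* t
    t>0 = ℕP.<-≤-trans (ℕ.s≤s (ℕ.z≤n {99})) (ℕP.≤-trans (ℕP.≤-trans (ℕP.m≤n+m 100 (proj₁ found ℕ.+ (L ℕ.+ m))) (ℕP.m≤m+n t' t')) (ℕP.m≤m+n t (89 ℕ.* t)))
    a' : ℕ
    a' = ℕ.pred (90 ℕ.* t)
    suc-a : suc a' ≡ 90 ℕ.* t
    suc-a = ℕP.suc-pred (90 ℕ.* t) {{ℕ.>-nonZero t>0}}
    term : ∀ i -> i ℕ.< rest -> - (far-constant * (recip (suc a' ℕ.+ i) * recip (suc a' ℕ.+ i))) ≤ g (90 ℕ.* t ℕ.+ i)
    term i l = subst (λ k -> - (far-constant * (recip (k ℕ.+ i) * recip (k ℕ.+ i))) ≤ g (90 ℕ.* t ℕ.+ i)) (sym suc-a)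
     (far≥ (90 ℕ.* t ℕ.+ i) (ℕP.≤-trans (ℕP.+-monoʳ-< (90 ℕ.* t) l) (ℕP.≤-reflexive (sym n'≡))) (solve 0 (κ 9 1 := κ 90 1 :* κ 1 10) refl · cong (_* c 1 10) (sym lit90) ≡» index-lower 90 i))
    ra : c 90 1 * ι t * recip a' ≡ 1#
    ra = cong (_* recip a') (cong (_* ι t) (sym lit90) · sym (ι-* 90 t) · cong ι (sym suc-a)) · recip* a'
    bound : ι t * (- (c 140738 90000 * τ)) ≤ - (far-constant * (recip a' - recip (a' ℕ.+ rest)))
    bound = gap≤ (lit *₀ (τ₀ *₀ sq₀ (ι t)) *₀ recip₀ (a' ℕ.+ rest)) (solve 4 (λ τ t r r' -> :- (κ 140738 1000 :* (τ :* (t :* t)) :* (r :- r')) := (:- (κ 140738 90000 :* τ :* t :* (κ 90 1 :* t :* r))) :+ κ 140738 1000 :* (τ :* (t :* t)) :* r') refl τ _ _ _ · cong (_+ far-constant * recip (a' ℕ.+ rest)) (cong (λ p -> - (c 140738 90000 * τ * ι t * p)) ra · solve 3 (λ k τ t -> :- (k :* τ :* t :* Κ 1#) := t :* (:- (k :* τ))) refl _ τ _))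
   all≥ : ι t * τ ≤ sum g n'
   all≥ = gap≤ (ι₀ t *₀ τ₀ *₀ lit) (solve 2 (λ t τ -> t :* (τ :* (κ 356 100 :- κ 55 1 :* κ 5112 1000000)) :+ t :* (:- (κ 35 1 :* (κ 17530 1000000 :* τ))) :+ t :* (:- (κ 140738 90000 :* τ)) := t :* τ :+ t :* τ :* Κ Κd) refl _ τ) » +≤ (+≤ core≥ middle≥) far-sum »≡ sym (cong (sum g) n'≡ · sum-split g (90 ℕ.* t) rest · cong (_+ sum (λ i -> g (90 ℕ.* t ℕ.+ i)) rest) (cong (sum g) (sym 90≡) · sum-split g (55 ℕ.* t) (35 ℕ.* t)))
    where
    Κd : ℚ
    -- The budget: 3.56 from the table minus 0.28 near 1, 0.61 for 5.5 ≤ x ≤ 9 and 1.57 beyond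
    -- leaves more than 1.
    Κd = c 356 100 ℚ.- c 55 1 ℚ.* c 5112 1000000 ℚ.- c 35 1 ℚ.* c 17530 1000000 ℚ.- c 140738 90000 ℚ.- 1#
   module Ex = Extraction ζ Pt.Nζ n' m
   kernel≤ : ∀ l -> 0# < ι l -> 3 ℕ.* l ℕ.≤ L ℕ.+ m -> dirichlet (ζ ^° (3 ℕ.* l)) n' * dirichlet (ζ ^° (3 ℕ.* l)) n' ≤ c 9 1 * c 9 1
   kernel≤ l l₊ hl = cong (λ v -> dirichlet v n' * dirichlet v n') (cong (ζ ^°_) (ℕP.*-comm 3 l) · ^°-* ζ l 3) ≡» Q.dirichlet-bound Pt.Dξ₊ l l₊ (cancel≤ (Pt.M₊ *₊ Pt.M₊) (solve 3 (λ m l D -> m :* (l :* D) := l :* (D :* m)) refl _ _ Pt.Ξ.D ≡» *≤ (sq₀ (ι l)) lit (sq-mono (ι₀ l) lt) Pt.Dξ≤ » *≤ʳ (sq₀ (ι t')) (lit » *≡ _ _ · (cong₂ _*_ (*≡ _ _ · cong (c 6 1 *_) (*≡ (c 20 1) (c 20 1))) (*≡ (c 2000 1) (c 2000 1))) ≡» *≤ʳ (lit *₀ sq₀ (c 20 1)) (sq-mono {c 2000 1} lit s≥10)) »≡ solve 2 (λ t s -> t :* t :* (κ 6 1 :* (κ 20 1 :* κ 20 1) :* (s :* s)) := κ 20 1 :* t :* s :* (κ 20 1 :* t :* s) :* κ 6 1) refl _ _ · cong (λ p -> p * p * c 6 1) (sym M≡)))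
    where
    lt : ι l ≤ ι t'
    lt = ι-mono (ℕP.≤-trans (ℕP.m≤m+n l (2 ℕ.* l)) (ℕP.≤-trans hl (ℕP.≤-trans (ℕP.m≤n+m (L ℕ.+ m) (proj₁ found)) (ℕP.m≤m+n _ 100))))
   -- The sampled sum is at least t τ, while the single points 1 and `ω` and all off-diagonal
   -- coefficients contribute an amount independent of t, which t was chosen to exceed.
   positive : 0# ≤ α m
   positive = cancel≤ {p = c 3 1 * (1# + c 2 1 * ι n')} (ℚP.positive⁻¹ (c 3 1) *₊ (0<1 +₊ (lit *₀ ι₀ n')))
    (*-0ʳ _ ≡» ungap (subst (0# ≤_) (solve 5 (λ e b k s g -> (e :+ b :- (s :- k)) :+ (g :- (k :+ b)) :+ (s :- g) := e :- Κ 0#) refl _ _ K₀ _ _)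
     (gap upper +₀ gap enough-t +₀ gap all≥)))
    where
    upper : sum g n' - K₀ ≤ c 3 1 * (1# + c 2 1 * ι n') * α m + c 27 1 * sum β L
    upper = (solve 3 (λ g a b -> g :- (a :+ b) := κ 1 2 :* (:- (κ 2 1 :* a)) :+ (:- b) :+ g) refl _ _ _ ≡» +≤ (+≤ (*≤ʳ lit (f-trivial 1° N1°)) (f-trivial ω (Ex.Term.Nω' 0))) ≤-refl) » Ex.Bound.extraction L m<L kernel≤ α β α≤ -α≤
    enough-t : K₀ + c 27 1 * sum β L ≤ ι t * τ
    enough-t = sym (*-1ʳ _) · cong ((K₀ + c 27 1 * sum β L) *_) (sym (*-inv τ τ₊)) · solve 3 (λ k t i -> k :* (t :* i) := k :* i :* t) refl _ τ _ ≡» *≤ˡ τ₀ (proj₂ found » ι-mono (ℕP.≤-trans (ℕP.≤-trans (ℕP.m≤m+n (proj₁ found) (L ℕ.+ m)) (ℕP.m≤m+n _ 100)) (ℕP.m≤m+n t' t')))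

-- Polynomials as coefficient sequences; the quotient and its palindrome

module H1 where
 open import Defs
 open U1 using (t3; a; b)
 open import Data.Integer using (ℤ; +_; _+_; _*_; -_; _-_)
 open import Data.Integer.Solver using (module +-*-Solver)
 open +-*-Solver using (solve; _:+_; _:*_; :-_; _:-_; _:=_; con)
 open import Data.List using ([]; _∷_)
 Seq : Set
 Seq = ℕ -> ℤ
 sh : ℕ -> Seq -> Seq
 sh zero f i = f i
 sh (suc d) f zero = + 0
 sh (suc d) f (suc i) = sh d f i
 -- Multiplication by 1 - q^k. Sequences replace coefficient lists so that trailing zeros disappear
 -- and equality up to an order can be stated.
 D : ℕ -> Seq -> Seq
 D k f i = f i - sh k f i
 δ : Seq
 δ zero = + 1
 δ (suc _) = + 0
 infix 4 _≈[_]_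
 _≈[_]_ : Seq -> ℕ -> Seq -> Set
 f ≈[ L ] g = ∀ i -> i ℕ.< L -> f i ≡ g i
 sh-cong : ∀ d {f g L} -> f ≈[ L ] g -> sh d f ≈[ L ] sh d g
 sh-cong zero h i l = h i l
 sh-cong (suc d) h zero l = refl
 sh-cong (suc d) h (suc i) l = sh-cong d h i (ℕP.<⇒≤ l)
 sh-cong⁺ : ∀ d {f g L} -> f ≈[ L ] g -> sh d f ≈[ d ℕ.+ L ] sh d g
 sh-cong⁺ zero h i l = h i l
 sh-cong⁺ (suc d) h zero l = refl
 sh-cong⁺ (suc d) h (suc i) (ℕ.s≤s l) = sh-cong⁺ d h i l
 sh-ext : ∀ d {f g} -> f ≗ g -> sh d f ≗ sh d g
 sh-ext d h i = sh-cong d {L = suc i} (λ j _ -> h j) i ℕP.≤-refl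
 sh-sh : ∀ d e f -> sh d (sh e f) ≗ sh (d ℕ.+ e) f
 sh-sh zero e f i = refl
 sh-sh (suc d) e f zero = refl
 sh-sh (suc d) e f (suc i) = sh-sh d e f i
 sh-+ : ∀ d f g -> sh d (λ i -> f i + g i) ≗ (λ i -> sh d f i + sh d g i)
 sh-+ zero f g i = refl
 sh-+ (suc d) f g zero = refl
 sh-+ (suc d) f g (suc i) = sh-+ d f g i
 sh-* : ∀ d c f -> sh d (λ i -> c * f i) ≗ (λ i -> c * sh d f i)
 sh-* zero c f i = refl
 sh-* (suc d) c f zero = sym (ℤP.*-zeroʳ c)
 sh-* (suc d) c f (suc i) = sh-* d c f i
 sh-neg : ∀ d f -> sh d (λ i -> - f i) ≗ (λ i -> - sh d f i)
 sh-neg zero f i = refl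
 sh-neg (suc d) f zero = refl
 sh-neg (suc d) f (suc i) = sh-neg d f i
 sh-0 : ∀ d -> sh d (λ _ -> + 0) ≗ (λ _ -> + 0)
 sh-0 zero i = refl
 sh-0 (suc d) zero = refl
 sh-0 (suc d) (suc i) = sh-0 d i
 sh-high : ∀ d f i -> i ℕ.< d -> sh d f i ≡ + 0
 sh-high (suc d) f zero l = refl
 sh-high (suc d) f (suc i) (ℕ.s≤s l) = sh-high d f i l
 sh-at : ∀ d f i -> sh d f (d ℕ.+ i) ≡ f i
 sh-at zero f i = refl
 sh-at (suc d) f i = sh-at d f i
 sh-D : ∀ j k f -> sh j (D k f) ≗ (λ i -> sh j f i - sh (j ℕ.+ k) f i)
 sh-D j k f i = sh-+ j f (λ i -> - sh k f i) i · cong (λ □ -> sh j f i + □) (sh-neg j (sh k f) i · (cong -_ (sh-sh j k f i)))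
 D-ext : ∀ k {f g} -> f ≗ g -> D k f ≗ D k g
 D-ext k h i = cong₂ _-_ (h i) (sh-ext k h i)
 D-comm : ∀ j k f -> D j (D k f) ≗ D k (D j f)
 D-comm j k f i = cong (λ □ -> f i - sh k f i - □) (sh-D j k f i) · solve 4 (λ x y z w -> x :- y :- (z :- w) := x :- z :- (y :- w)) refl (f i) (sh k f i) (sh j f i) (sh (j ℕ.+ k) f i) · cong (λ □ -> f i - sh j f i - □) (sym (sh-D k j f i · cong (λ e -> sh k f i - sh e f i) (ℕP.+-comm k j)))
 D-high : ∀ k f L -> L ℕ.≤ k -> D k f ≈[ L ] f
 D-high k f L h i l = cong (λ x -> f i - x) (sh-high k f i (ℕP.<-≤-trans l h)) · ℤP.+-identityʳ (f i)
 -- 1 - q^(k+1) is invertible as a power series: each coefficient is recovered from the product and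
 -- an earlier coefficient.
 D-cancel : ∀ k {f g L} -> D (suc k) f ≈[ L ] D (suc k) g -> f ≈[ L ] g
 D-cancel k {f} {g} {L} h i l = go (suc i) l i ℕP.≤-refl
  where
  back : ∀ f i -> f i ≡ D (suc k) f i + sh (suc k) f i
  back f i = solve 2 (λ x y -> x := x :- y :+ y) refl (f i) (sh (suc k) f i)
  lower : ∀ M -> f ≈[ M ] g -> sh (suc k) f ≈[ suc M ] sh (suc k) g
  lower M hM zero l' = refl
  lower M hM (suc j) (ℕ.s≤s l') = sh-cong k hM j l'
  go : ∀ M -> M ℕ.≤ L -> f ≈[ M ] g
  go (suc M) hM j l' = back f j · (cong₂ _+_ (h j (ℕP.<-≤-trans l' hM)) (lower M (go M (ℕP.<⇒≤ hM)) j l')) · sym (back g j)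
 act : ℕ -> Poly -> Seq -> Seq
 act d [] f i = + 0
 act d (c ∷ p) f i = c * f i + sh d (act d p f) i
 act-ext : ∀ d p {f g} -> f ≗ g -> act d p f ≗ act d p g
 act-ext d [] h i = refl
 act-ext d (c ∷ p) h i = cong₂ _+_ (cong (λ □ -> c * □) (h i)) (sh-ext d (act-ext d p h) i)
 act-⊕ : ∀ d p q f -> act d (p ⊕ q) f ≗ (λ i -> act d p f i + act d q f i)
 act-⊕ d [] q f i = sym (ℤP.+-identityˡ _)
 act-⊕ d (x ∷ p) [] f i = sym (ℤP.+-identityʳ _)
 act-⊕ d (x ∷ p) (y ∷ q) f i = cong (λ □ -> (x + y) * f i + □) (sh-ext d (act-⊕ d p q f) i · sh-+ d (act d p f) (act d q f) i) · solve 5 (λ x y z u v -> (x :+ y) :* z :+ (u :+ v) := x :* z :+ u :+ (y :* z :+ v)) refl x y (f i) (sh d (act d p f) i) (sh d (act d q f) i)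
 act-scale : ∀ d c p f -> act d (scale c p) f ≗ (λ i -> c * act d p f i)
 act-scale d c [] f i = sym (ℤP.*-zeroʳ c)
 act-scale d c (x ∷ p) f i = cong (λ □ -> c * x * f i + □) (sh-ext d (act-scale d c p f) i · sh-* d c (act d p f) i) · solve 4 (λ c x z u -> c :* x :* z :+ c :* u := c :* (x :* z :+ u)) refl c x (f i) (sh d (act d p f) i)
 act-⊗ : ∀ d p q f -> act d (p ⊗ q) f ≗ act d p (act d q f)
 act-⊗ d [] q f i = refl
 act-⊗ d (x ∷ p) q f i = act-⊕ d (scale x q) (shift (p ⊗ q)) f i · (cong₂ _+_ (act-scale d x q f i) (solve 2 (λ z u -> con (+ 0) :* z :+ u := u) refl (f i) (sh d (act d (p ⊗ q) f) i) · sh-ext d (act-⊗ d p q f) i))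
 act-monomial : ∀ d k f -> act d (monomial k) f ≗ sh (k ℕ.* d) f
 act-monomial d zero f i = cong (λ □ -> + 1 * f i + □) (sh-0 d i) · solve 1 (λ z -> con (+ 1) :* z :+ con (+ 0) := z) refl (f i)
 act-monomial d (suc k) f i = solve 2 (λ z u -> con (+ 0) :* z :+ u := u) refl (f i) _ · sh-ext d (act-monomial d k f) i · sh-sh d (k ℕ.* d) f i
 act-oneMinus : ∀ d k f -> act d (oneMinusQPow k) f ≗ D (k ℕ.* d) f
 act-oneMinus d k f i = act-⊕ d (+ 1 ∷ []) (neg (monomial k)) f i · (cong₂ _+_ (cong (λ □ -> + 1 * f i + □) (sh-0 d i) · solve 1 (λ z -> con (+ 1) :* z :+ con (+ 0) := z) refl (f i))
  (act-scale d (- + 1) (monomial k) f i · cong (λ □ -> - + 1 * □) (act-monomial d k f i) · solve 1 (λ z -> con (- + 1) :* z := :- z) refl (sh (k ℕ.* d) f i)))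
 coeff-⊕ : ∀ p q i -> coeff (p ⊕ q) i ≡ coeff p i + coeff q i
 coeff-⊕ [] q i = sym (ℤP.+-identityˡ _)
 coeff-⊕ (x ∷ p) [] i = sym (ℤP.+-identityʳ _)
 coeff-⊕ (x ∷ p) (y ∷ q) zero = refl
 coeff-⊕ (x ∷ p) (y ∷ q) (suc i) = coeff-⊕ p q i
 coeff-scale : ∀ c p i -> coeff (scale c p) i ≡ c * coeff p i
 coeff-scale c [] i = sym (ℤP.*-zeroʳ c)
 coeff-scale c (x ∷ p) zero = refl
 coeff-scale c (x ∷ p) (suc i) = coeff-scale c p i
 coeff-shift : ∀ p i -> coeff (shift p) i ≡ sh 1 (coeff p) i
 coeff-shift p zero = refl
 coeff-shift p (suc i) = refl
 coeff-⊗ : ∀ p q -> coeff (p ⊗ q) ≗ act 1 p (coeff q)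
 coeff-⊗ [] q i = refl
 coeff-⊗ (x ∷ p) q i = coeff-⊕ (scale x q) (shift (p ⊗ q)) i · (cong₂ _+_ (coeff-scale x q i) (coeff-shift (p ⊗ q) i · sh-ext 1 (coeff-⊗ p q) i))
 coeff-act : ∀ p -> coeff p ≗ act 1 p δ
 coeff-act [] i = refl
 coeff-act (x ∷ p) zero = solve 1 (λ x -> x := x :* con (+ 1) :+ con (+ 0)) refl x
 coeff-act (x ∷ p) (suc i) = coeff-act p i · solve 2 (λ x y -> y := x :* con (+ 0) :+ y) refl x (act 1 p δ i)
 act-subst3 : ∀ p f -> act 1 (subst3 p) f ≗ act 3 p f
 act-subst3 [] f i = refl
 act-subst3 (x ∷ p) f i = cong (λ □ -> x * f i + □) (sh-ext 1 (λ j -> trans (solve 2 (λ z u -> con (+ 0) :* z :+ u := u) refl (f j) _) (sh-ext 1 (λ k -> trans (solve 2 (λ z u -> con (+ 0) :* z :+ u := u) refl (f k) _) (sh-ext 1 (act-subst3 p f) k)) j)) i · sh-ext 1 (sh-sh 1 1 (act 3 p f)) i · sh-sh 1 2 (act 3 p f) i)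
 -- Multiplication by (q^d; q^d)_m.
 E : ℕ -> ℕ -> Seq -> Seq
 E d zero f = f
 E d (suc m) f = E d m (D (suc m ℕ.* d) f)
 E-ext : ∀ d m {f g} -> f ≗ g -> E d m f ≗ E d m g
 E-ext d zero h = h
 E-ext d (suc m) h = E-ext d m (D-ext (suc m ℕ.* d) h)
 act-qPoch : ∀ d m f -> act d (qPoch m) f ≗ E d m f
 act-qPoch d zero f i = cong (λ □ -> + 1 * f i + □) (sh-0 d i) · solve 1 (λ z -> con (+ 1) :* z :+ con (+ 0) := z) refl (f i)
 act-qPoch d (suc m) f i = act-⊗ d (qPoch m) (oneMinusQPow (suc m)) f i · act-ext d (qPoch m) (act-oneMinus d (suc m) f) i · act-qPoch d m (D (suc m ℕ.* d) f) i
 Fac : (ℕ -> ℕ) -> (ℕ -> ℕ) -> ℕ -> Seq -> Seq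
 Fac a b zero f = f
 Fac a b (suc n) f = Fac a b n (D (a n) (D (b n) f))
 Fac-ext : ∀ a b n {f g} -> f ≗ g -> Fac a b n f ≗ Fac a b n g
 Fac-ext a b zero h = h
 Fac-ext a b (suc n) h = Fac-ext a b n (D-ext (a n) (D-ext (b n) h))
 Fac-D : ∀ a b n k f -> Fac a b n (D k f) ≗ D k (Fac a b n f)
 Fac-D a b zero k f i = refl
 Fac-D a b (suc n) k f i = Fac-ext a b n (λ j -> trans (D-ext (a n) (D-comm (b n) k f) j) (D-comm (a n) k (D (b n) f) j)) i · Fac-D a b n k (D (a n) (D (b n) f)) i
 t3≡ : ∀ n -> t3 n ≡ n ℕ.* 3
 t3≡ zero = refl
 t3≡ (suc n) = cong (3 ℕ.+_) (t3≡ n)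
 -- Separates the exponents up to 3n that are multiples of 3, matching the divisor, from the two
 -- other classes.
 split : ∀ n f -> E 1 (t3 n) f ≗ E 3 n (Fac a b n f)
 split zero f i = refl
 split (suc n) f i = E-ext 1 (t3 n) (λ j -> trans (rearrange j) (D-ext (a n) (D-comm (b n) k f) j · D-comm (a n) k (D (b n) f) j)) i · split n (D k (D (a n) (D (b n) f))) i · E-ext 3 n (Fac-D a b n k (D (a n) (D (b n) f))) i
  where
  k : ℕ
  k = suc n ℕ.* 3
  one : ∀ k -> k ℕ.* 1 ≡ k
  one = ℕP.*-identityʳ
  rearrange : D (suc (t3 n) ℕ.* 1) (D (suc (suc (t3 n)) ℕ.* 1) (D (suc (suc (suc (t3 n))) ℕ.* 1) f)) ≗ D (a n) (D (b n) (D k f))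
  rearrange i rewrite one (t3 n) | t3≡ n = refl
 E-cancel : ∀ d m {f g} -> E (suc d) m f ≗ E (suc d) m g -> f ≗ g
 E-cancel d zero h = h
 E-cancel d (suc m) {f} {g} h i = D-cancel (d ℕ.+ m ℕ.* suc d) {f} {g} {suc i} (λ j _ -> E-cancel d m h j) i ℕP.≤-refl
 Pseq : ℕ -> Seq
 Pseq n = Fac a b n δ
 -- Division is avoided: both sides become (q³; q³)_n applied to a sequence, and this operator is
 -- cancelled.
 quotient : ∀ n G -> (∀ k -> coeff (q3Poch n ⊗ G) k ≡ coeff (qPoch (3 ℕ.* n)) k) -> coeff G ≗ Pseq n
 quotient n G h = E-cancel 2 n (λ i -> trans (sym (act-qPoch 3 n (coeff G) i)) (sym (act-subst3 (qPoch n) (coeff G) i) · sym (coeff-⊗ (q3Poch n) G i) · h i · coeff-act (qPoch (3 ℕ.* n)) i · act-qPoch 1 (3 ℕ.* n) δ i · cong (λ m -> E 1 m δ i) (ℕP.*-comm 3 n · sym (t3≡ n)) · split n δ i))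
 coeff-subst3-0 : ∀ p k -> coeff (subst3 p) (t3 k) ≡ coeff p k
 coeff-subst3-0 [] k = refl
 coeff-subst3-0 (x ∷ p) zero = refl
 coeff-subst3-0 (x ∷ p) (suc k) = coeff-subst3-0 p k
 coeff-subst3-1 : ∀ p k -> coeff (subst3 p) (suc (t3 k)) ≡ + 0
 coeff-subst3-1 [] k = refl
 coeff-subst3-1 (x ∷ p) zero = refl
 coeff-subst3-1 (x ∷ p) (suc k) = coeff-subst3-1 p k
 coeff-subst3-2 : ∀ p k -> coeff (subst3 p) (suc (suc (t3 k))) ≡ + 0
 coeff-subst3-2 [] k = refl
 coeff-subst3-2 (x ∷ p) zero = refl
 coeff-subst3-2 (x ∷ p) (suc k) = coeff-subst3-2 p k
 coeff-neg : ∀ p i -> coeff (neg p) i ≡ - coeff p i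
 coeff-neg p i = coeff-scale (- + 1) p i · solve 1 (λ z -> con (- + 1) :* z := :- z) refl (coeff p i)
 coeff-combine : ∀ A B C i -> coeff (combine A B C) i ≡ coeff (subst3 A) i + (- sh 1 (coeff (subst3 B)) i + - sh 2 (coeff (subst3 C)) i)
 coeff-combine A B C i = coeff-⊕ (subst3 A) _ i · cong (λ x -> coeff (subst3 A) i + x) (coeff-⊕ (neg (shift (subst3 B))) (neg (shift (shift (subst3 C)))) i · (cong₂ _+_ (coeff-neg (shift (subst3 B)) i · (cong -_ (coeff-shift (subst3 B) i)))
  (coeff-neg (shift (shift (subst3 C))) i · (cong -_ (coeff-shift (shift (subst3 C)) i · sh-ext 1 (coeff-shift (subst3 C)) i · sh-sh 1 1 (coeff (subst3 C)) i)))))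
 part-A : ∀ A B C k -> coeff (combine A B C) (t3 k) ≡ coeff A k
 part-A A B C k = coeff-combine A B C (t3 k) · (cong₂ _+_ (coeff-subst3-0 A k) (cong₂ (λ x y -> - x + - y) (s1 B k) (s2 C k))) · solve 1 (λ z -> z :+ ((:- con (+ 0)) :+ (:- con (+ 0))) := z) refl (coeff A k)
  where
  s1 : ∀ p k -> sh 1 (coeff (subst3 p)) (t3 k) ≡ + 0
  s1 p zero = refl
  s1 p (suc k) = coeff-subst3-2 p k
  s2 : ∀ p k -> sh 2 (coeff (subst3 p)) (t3 k) ≡ + 0
  s2 p zero = refl
  s2 p (suc k) = coeff-subst3-1 p k
 part-B : ∀ A B C k -> - coeff (combine A B C) (suc (t3 k)) ≡ coeff B k
 part-B A B C k = (cong -_ (coeff-combine A B C (suc (t3 k)) · (cong₂ _+_ (coeff-subst3-1 A k) (cong₂ (λ x y -> - x + - y) (coeff-subst3-0 B k) (s1 C k))))) · solve 1 (λ z -> :- (con (+ 0) :+ ((:- z) :+ (:- con (+ 0)))) := z) refl (coeff B k)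
  where
  s1 : ∀ p k -> sh 1 (coeff (subst3 p)) (t3 k) ≡ + 0
  s1 p zero = refl
  s1 p (suc k) = coeff-subst3-2 p k
 part-C : ∀ A B C k -> - coeff (combine A B C) (suc (suc (t3 k))) ≡ coeff C k
 part-C A B C k = (cong -_ (coeff-combine A B C (suc (suc (t3 k))) · (cong₂ _+_ (coeff-subst3-2 A k) (cong₂ (λ x y -> - x + - y) (coeff-subst3-1 B k) (coeff-subst3-0 C k))))) · solve 1 (λ z -> :- (con (+ 0) :+ ((:- con (+ 0)) :+ (:- z))) := z) refl (coeff C k)
 -- The sign is kept general because each factor 1 - q^k turns a palindrome into an antipalindrome
 -- and back; pairs of factors restore it.
 Sym : ℤ -> ℕ -> Seq -> Set
 Sym σ M f = (∀ i j -> i ℕ.+ j ≡ M -> f i ≡ σ * f j) × (∀ i -> M ℕ.< i -> f i ≡ + 0)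
 D-sym : ∀ σ M k f -> Sym σ M f -> Sym (- σ) (k ℕ.+ M) (D k f)
 D-sym σ M k f (s , z) = s' , z'
  where
  flip : ∀ i j -> i ℕ.+ j ≡ k ℕ.+ M -> f i ≡ σ * sh k f j
  flip i j e = go (ℕP.≤-<-connex k j)
   where
   go : k ℕ.≤ j ⊎ j ℕ.< k -> f i ≡ σ * sh k f j
   go (inj₁ l) = s i (j ℕ.∸ k) (ℕP.+-cancelˡ-≡ k _ _ (sym (ℕP.+-assoc k i (j ℕ.∸ k)) · cong (ℕ._+ (j ℕ.∸ k)) (ℕP.+-comm k i) · ℕP.+-assoc i k (j ℕ.∸ k) · cong (i ℕ.+_) (ℕP.m+[n∸m]≡n l) · e)) · cong (λ □ -> σ * □) (sym (sh-at k f (j ℕ.∸ k)) · cong (sh k f) (ℕP.m+[n∸m]≡n l))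
   go (inj₂ l) = z i (ℕP.+-cancelʳ-< j M i (ℕP.<-≤-trans (ℕP.+-monoʳ-< M l) (ℕP.≤-reflexive (ℕP.+-comm M k · sym e)))) · sym (cong (λ □ -> σ * □) (sh-high k f j l) · ℤP.*-zeroʳ σ)
  σ² : ∀ i j -> i ℕ.+ j ≡ k ℕ.+ M -> sh k f i ≡ σ * f j
  σ² i j e = go (ℕP.≤-<-connex k i)
   where
   go : k ℕ.≤ i ⊎ i ℕ.< k -> sh k f i ≡ σ * f j
   go (inj₁ l) = (cong (sh k f) (sym (ℕP.m+[n∸m]≡n l)) · sh-at k f (i ℕ.∸ k)) · s (i ℕ.∸ k) j (ℕP.+-cancelˡ-≡ k _ _ (sym (ℕP.+-assoc k (i ℕ.∸ k) j) · cong (ℕ._+ j) (ℕP.m+[n∸m]≡n l) · e))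
   go (inj₂ l) = sh-high k f i l · sym (cong (λ □ -> σ * □) (z j (ℕP.+-cancelˡ-< i M j (ℕP.<-≤-trans (ℕP.+-monoˡ-< M l) (ℕP.≤-reflexive (sym e))))) · ℤP.*-zeroʳ σ)
  s' : ∀ i j -> i ℕ.+ j ≡ k ℕ.+ M -> D k f i ≡ - σ * D k f j
  s' i j e = (cong₂ _-_ (flip i j e) (σ² i j e)) · solve 3 (λ s x y -> s :* x :- s :* y := (:- s) :* (y :- x)) refl σ (sh k f j) (f j)
  z' : ∀ i -> k ℕ.+ M ℕ.< i -> D k f i ≡ + 0
  z' i l = cong₂ _-_ (z i (ℕP.≤-<-trans (ℕP.m≤n+m M k) l)) (cong (sh k f) (sym (ℕP.m+[n∸m]≡n k≤i)) · sh-at k f (i ℕ.∸ k) · z (i ℕ.∸ k) (ℕP.+-cancelˡ-< k M (i ℕ.∸ k) (ℕP.<-≤-trans l (ℕP.≤-reflexive (sym (ℕP.m+[n∸m]≡n k≤i))))))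
   where
   k≤i : k ℕ.≤ i
   k≤i = ℕP.≤-trans (ℕP.m≤m+n k M) (ℕP.<⇒≤ l)
 δ-sym : Sym (+ 1) 0 δ
 δ-sym = (λ { zero zero _ -> refl }) , (λ { (suc i) _ -> refl })
 degree : (ℕ -> ℕ) -> (ℕ -> ℕ) -> ℕ -> ℕ -> ℕ
 degree a b zero M = M
 degree a b (suc n) M = degree a b n (a n ℕ.+ (b n ℕ.+ M))
 Fac-sym : ∀ a b n M f -> Sym (+ 1) M f -> Sym (+ 1) (degree a b n M) (Fac a b n f)
 Fac-sym a b zero M f h = h
 Fac-sym a b (suc n) M f h = Fac-sym a b n _ _ (D-sym (- + 1) _ (a n) _ (D-sym (+ 1) M (b n) f h))

-- A finite Jacobi triple product: Gaussian binomials

module J1 where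
 open H1
 open U1 using (t3)
 open import Data.Integer using (ℤ; +_; _+_; _*_; -_; _-_)
 open import Data.Integer.Solver using (module +-*-Solver)
 open +-*-Solver using (solve; _:+_; _:*_; :-_; _:-_; _:=_; con)
 open ℕS.+-*-Solver using () renaming (solve to solveⁿ; _:+_ to _⊹_; _:*_ to _⊛_; _:=_ to _≔_; con to conⁿ)
 infixl 6 _⊞_
 _⊞_ : Seq -> Seq -> Seq
 (f ⊞ g) i = f i + g i
 D-+ : ∀ k f g -> D k (f ⊞ g) ≗ D k f ⊞ D k g
 D-+ k f g i = cong (λ y -> f i + g i - y) (sh-+ k f g i) · solve 4 (λ x y u v -> x :+ y :- (u :+ v) := x :- u :+ (y :- v)) refl (f i) (g i) (sh k f i) (sh k g i)
 D-sh : ∀ k e f -> D k (sh e f) ≗ sh e (D k f)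
 D-sh k e f i = cong (λ y -> sh e f i - y) (sh-sh k e f i · cong (λ d -> sh d f i) (ℕP.+-comm k e)) · sym (sh-D e k f i)
 D-* : ∀ k c f -> D k (λ i -> c * f i) ≗ (λ i -> c * D k f i)
 D-* k c f i = cong (λ y -> c * f i - y) (sh-* k c f i) · solve 3 (λ c x y -> c :* x :- c :* y := c :* (x :- y)) refl c (f i) (sh k f i)
 D-zero : ∀ f -> D 0 f ≗ (λ _ -> + 0)
 D-zero f i = ℤP.+-inverseʳ (f i)
 E-D : ∀ d m k f -> E d m (D k f) ≗ D k (E d m f)
 E-D d zero k f i = refl
 E-D d (suc m) k f i = E-ext d m (D-comm (suc m ℕ.* d) k f) i · E-D d m k _ i
 E-suc : ∀ d m f -> E d (suc m) f ≗ D (suc m ℕ.* d) (E d m f)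
 E-suc d m f = E-D d m (suc m ℕ.* d) f
 E-+ : ∀ d m f g -> E d m (f ⊞ g) ≗ E d m f ⊞ E d m g
 E-+ d zero f g i = refl
 E-+ d (suc m) f g i = E-ext d m (D-+ (suc m ℕ.* d) f g) i · E-+ d m _ _ i
 E-sh : ∀ d m e f -> E d m (sh e f) ≗ sh e (E d m f)
 E-sh d zero e f i = refl
 E-sh d (suc m) e f i = E-ext d m (D-sh (suc m ℕ.* d) e f) i · E-sh d m e _ i
 E-* : ∀ d m c f -> E d m (λ i -> c * f i) ≗ (λ i -> c * E d m f i)
 E-* d zero c f i = refl
 E-* d (suc m) c f i = E-ext d m (D-* (suc m ℕ.* d) c f) i · E-* d m c _ i
 E-cancel≈ : ∀ d m {f g L} -> E (suc d) m f ≈[ L ] E (suc d) m g -> f ≈[ L ] g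
 E-cancel≈ d zero h = h
 E-cancel≈ d (suc m) {f} {g} {L} h = D-cancel (d ℕ.+ m ℕ.* suc d) {f} {g} {L} (E-cancel≈ d m h)
 E-high : ∀ d q r f -> E d (r ℕ.+ q) f ≈[ suc q ℕ.* d ] E d q f
 E-high d q zero f i l = refl
 E-high d q (suc r) f i l = E-suc d (r ℕ.+ q) f i · D-high (suc (r ℕ.+ q) ℕ.* d) (E d (r ℕ.+ q) f) (suc q ℕ.* d) (ℕP.*-monoˡ-≤ d (ℕ.s≤s (ℕP.m≤n+m q r))) i l · E-high d q r f i l
 D-D : ∀ x y f i -> D x (D y f) i ≡ f i - sh y f i - (sh x f i - sh (x ℕ.+ y) f i)
 D-D x y f i = cong (λ u -> f i - sh y f i - u) (sh-D x y f i)
 sh-D-D : ∀ e x y f i -> sh e (D x (D y f)) i ≡ sh e f i - sh (e ℕ.+ y) f i - (sh (e ℕ.+ x) f i - sh (e ℕ.+ x ℕ.+ y) f i)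
 sh-D-D e x y f i = sh-D e x (D y f) i · (cong₂ _-_ (sh-D e y f i) (sh-D (e ℕ.+ x) y f i))
 sumℤ : (ℕ -> ℤ) -> ℕ -> ℤ
 sumℤ h zero = + 0
 sumℤ h (suc B) = sumℤ h B + h B
 sumℤ-cong : ∀ {h h'} B -> (∀ j -> j ℕ.< B -> h j ≡ h' j) -> sumℤ h B ≡ sumℤ h' B
 sumℤ-cong zero e = refl
 sumℤ-cong (suc B) e = cong₂ _+_ (sumℤ-cong B (λ j l -> e j (ℕP.m<n⇒m<1+n l))) (e B (ℕP.n<1+n B))
 sumℤ-+ : ∀ h h' B -> sumℤ (λ j -> h j + h' j) B ≡ sumℤ h B + sumℤ h' B
 sumℤ-+ h h' zero = refl
 sumℤ-+ h h' (suc B) = cong (λ y -> y + (h B + h' B)) (sumℤ-+ h h' B) · solve 4 (λ x y u v -> x :+ y :+ (u :+ v) := x :+ u :+ (y :+ v)) refl (sumℤ h B) (sumℤ h' B) (h B) (h' B)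
 sumℤ-neg : ∀ h B -> sumℤ (λ j -> - h j) B ≡ - sumℤ h B
 sumℤ-neg h zero = refl
 sumℤ-neg h (suc B) = cong (λ y -> y + - h B) (sumℤ-neg h B) · solve 2 (λ x y -> (:- x) :+ (:- y) := :- (x :+ y)) refl (sumℤ h B) (h B)
 telescope : ∀ h B -> h 0 + sumℤ (λ j -> h (suc j)) B ≡ sumℤ h B + h B
 telescope h zero = solve 1 (λ x -> x :+ con (+ 0) := con (+ 0) :+ x) refl (h 0)
 telescope h (suc B) = sym (ℤP.+-assoc (h 0) _ _) · cong (λ y -> y + h (suc B)) (telescope h B)
 sh-sum : ∀ e (h : ℕ -> Seq) B i -> sh e (λ i -> sumℤ (λ j -> h j i) B) i ≡ sumℤ (λ j -> sh e (h j) i) B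
 sh-sum e h zero i = sh-0 e i
 sh-sum e h (suc B) i = sh-+ e (λ i -> sumℤ (λ j -> h j i) B) (h B) i · cong (λ y -> y + sh e (h B) i) (sh-sum e h B i)
 sgn : ℕ -> ℤ
 sgn zero = + 1
 sgn (suc j) = - sgn j
 -- The quadratic exponent c j + k j (j - 1) / 2, built from its increments.
 ex : ℕ -> ℕ -> ℕ -> ℕ
 ex k c zero = 0
 ex k c (suc j) = ex k c j ℕ.+ (c ℕ.+ k ℕ.* j)
 -- A truncated bilateral theta series, folded so that positive indices use `a` and negative ones
 -- `b`.
 Θ : ℕ -> ℕ -> ℕ -> ℕ -> Seq
 Θ k a b B i = δ i + sumℤ (λ j -> sgn (suc j) * sh (ex k a (suc j)) δ i + sgn (suc j) * sh (ex k b (suc j)) δ i) B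
 progression : ℕ -> ℕ -> ℕ -> ℕ
 progression k c i = k ℕ.* i ℕ.+ c
 module JacobiTriple (k' a b : ℕ) (ab : a ℕ.+ b ≡ suc k') where
  k : ℕ
  k = suc k'
  -- The central Gaussian binomial [2N; N + j] in base q^k, by the two-step Pascal recursion. It is
  -- even in j, so the row for j = 0 uses the entry 1 twice.
  g : ℕ -> ℕ -> Seq
  g zero zero = δ
  g zero (suc _) _ = + 0
  g (suc N) zero = g N 0 ⊞ sh (suc (N ℕ.+ N) ℕ.* k) (g N 0) ⊞ sh (suc N ℕ.* k) (g N 1) ⊞ sh (suc N ℕ.* k) (g N 1)
  g (suc N) (suc j) = g N (suc j) ⊞ sh (suc (N ℕ.+ N) ℕ.* k) (g N (suc j)) ⊞ sh ((N ℕ.∸ j) ℕ.* k) (g N j) ⊞ sh (suc (suc (N ℕ.+ j)) ℕ.* k) (g N (suc (suc j)))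
  g-zero : ∀ N j -> N ℕ.< j -> g N j ≗ (λ _ -> + 0)
  g-zero zero (suc j) _ i = refl
  g-zero (suc N) (suc j) (ℕ.s≤s l) i = cong₂ _+_ (cong₂ _+_ (cong₂ _+_ (z (suc j) (ℕP.m<n⇒m<1+n l) 0) (z (suc j) (ℕP.m<n⇒m<1+n l) (suc (N ℕ.+ N) ℕ.* k))) (z j l ((N ℕ.∸ j) ℕ.* k))) (z (suc (suc j)) (ℕP.m<n⇒m<1+n (ℕP.m<n⇒m<1+n l)) (suc (suc (N ℕ.+ j)) ℕ.* k))
   where
   z : ∀ j -> N ℕ.< j -> ∀ e -> sh e (g N j) i ≡ + 0
   z j l e = sh-ext e (g-zero N j l) i · sh-0 e i
  f₀ : ℕ -> Seq
  f₀ N = E k (N ℕ.+ N) δ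
  Closed : ℕ -> Set
  Closed N = ∀ j q -> q ℕ.+ j ≡ N -> E k (N ℕ.+ j) (E k q (g N j)) ≗ f₀ N
  E-zero : ∀ m f -> f ≗ (λ _ -> + 0) -> E k m f ≗ (λ _ -> + 0)
  E-zero zero f h = h
  E-zero (suc m) f h = E-zero m _ (λ i -> trans (D-ext (suc m ℕ.* k) h i) (cong (λ y -> + 0 - y) (sh-0 (suc m ℕ.* k) i)))
  -- Extends the closed form to j = N + 1, where the entry is zero and so is the factor 1 - q^0;
  -- this keeps the induction free of boundary cases.
  Closed⁺ : ∀ N -> Closed N -> ∀ j q -> q ℕ.+ j ≡ suc N -> E k (N ℕ.+ j) (E k q (g N j)) ≗ D (q ℕ.* k) (f₀ N)
  Closed⁺ N h j zero refl i = E-zero (N ℕ.+ j) _ (g-zero N j ℕP.≤-refl) i · sym (D-zero (f₀ N) i)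
  Closed⁺ N h j (suc q) e i = E-ext k (N ℕ.+ j) (E-suc k q (g N j)) i · E-D k (N ℕ.+ j) (suc q ℕ.* k) (E k q (g N j)) i · D-ext (suc q ℕ.* k) (h j q (ℕP.suc-injective e)) i
  -- The Pascal step once the common denominator is cleared: with P = (N + j + 1) k and Q = (N + 1 -
  -- j) k it is a polynomial identity among shifts.
  identity : ∀ P' Q' f -> let P = k ℕ.+ P' ; Q = k ℕ.+ Q' in
   D P (D Q f) ⊞ sh (P' ℕ.+ Q) (D P (D Q f)) ⊞ sh Q (D P (D P' f)) ⊞ sh P (D Q (D Q' f)) ≗ D (P ℕ.+ Q) (D (P' ℕ.+ Q) f)
  identity P' Q' f i = (cong₂ _+_ (cong₂ _+_ (cong₂ _+_ (D-D P Q f i) (sh-D-D (P' ℕ.+ Q) P Q f i)) (sh-D-D Q P P' f i)) (sh-D-D P Q Q' f i)) · (cong₂ _+_ (cong₂ _+_ (cong₂ _+_ (cong (λ x -> f i - at Q - (at P - at x)) (ℕP.+-comm P Q)) (cong₂ (λ x y -> at (P' ℕ.+ Q) - at x - (at y - at (P' ℕ.+ Q ℕ.+ P ℕ.+ Q))) e₁ e₂)) (cong₂ (λ x y -> at Q - at x - (at (Q ℕ.+ P) - at y)) (ℕP.+-comm Q P') (refl {x = Q ℕ.+ P ℕ.+ P'}))) (cong₂ (λ x y -> at P - at x - (at y - at (P ℕ.+ Q ℕ.+ Q'))) e₃ (ℕP.+-comm P Q))) · solve 9 (λ f q p qp p'q x y z w -> f :- q :- (p :- qp) :+ (p'q :-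 x :- (y :- z)) :+ (q :- p'q :- (qp :- y)) :+ (p :- p'q :- (qp :- x)) := f :- p'q :- (qp :- z)) refl (f i) (at Q) (at P) (at (Q ℕ.+ P)) (at (P' ℕ.+ Q)) (at (P ℕ.+ Q ℕ.+ Q')) (at (Q ℕ.+ P ℕ.+ P')) (at (P' ℕ.+ Q ℕ.+ P ℕ.+ Q)) (+ 0) · sym (D-D (P ℕ.+ Q) (P' ℕ.+ Q) f i · cong₂ (λ x y -> f i - at (P' ℕ.+ Q) - (at x - at y)) (ℕP.+-comm P Q) e₄)
   where
   P Q : ℕ
   P = k ℕ.+ P'
   Q = k ℕ.+ Q'
   at : ℕ -> ℤ
   at e = sh e f i
   e₁ : P' ℕ.+ Q ℕ.+ Q ≡ P ℕ.+ Q ℕ.+ Q'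
   e₁ = solveⁿ 3 (λ k p q -> p ⊹ (k ⊹ q) ⊹ (k ⊹ q) ≔ (k ⊹ p) ⊹ (k ⊹ q) ⊹ q) refl k P' Q'
   e₂ : P' ℕ.+ Q ℕ.+ P ≡ Q ℕ.+ P ℕ.+ P'
   e₂ = solveⁿ 3 (λ p q r -> p ⊹ q ⊹ r ≔ q ⊹ r ⊹ p) refl P' Q P
   e₃ : P ℕ.+ Q' ≡ P' ℕ.+ Q
   e₃ = solveⁿ 3 (λ k p q -> k ⊹ p ⊹ q ≔ p ⊹ (k ⊹ q)) refl k P' Q'
   e₄ : P ℕ.+ Q ℕ.+ (P' ℕ.+ Q) ≡ P' ℕ.+ Q ℕ.+ P ℕ.+ Q
   e₄ = solveⁿ 3 (λ p q r -> r ⊹ q ⊹ (p ⊹ q) ≔ p ⊹ q ⊹ r ⊹ q) refl P' Q P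
  step : ∀ N -> Closed N -> ∀ j q' (u v : Seq) -> suc q' ℕ.+ j ≡ suc N ->
   E k (suc N ℕ.+ j) (E k (suc q') u) ≗ D (suc (N ℕ.+ j) ℕ.* k) (D ((N ℕ.+ j) ℕ.* k) (f₀ N)) ->
   E k (suc N ℕ.+ j) (E k (suc q') v) ≗ D (suc q' ℕ.* k) (D (q' ℕ.* k) (f₀ N)) ->
   E k (suc N ℕ.+ j) (E k (suc q') (g N j ⊞ sh (suc (N ℕ.+ N) ℕ.* k) (g N j) ⊞ sh (suc q' ℕ.* k) u ⊞ sh (suc (N ℕ.+ j) ℕ.* k) v)) ≗ f₀ (suc N)
  step N h j q' u v e hu hv i = (E-ext k p lin₁ i · lin₂ i) · (cong₂ _+_ (cong₂ _+_ (cong₂ _+_ (one i) (sh-ext s one i · cong (λ x -> sh x (D P (D Q f)) i) s≡)) (sh-ext Q hu i)) (sh-ext P hv i)) · identity P' Q' f i · cong (λ x -> D x (D (P' ℕ.+ Q) f) i) PQ · D-ext (suc (suc (N ℕ.+ N)) ℕ.* k) (λ l -> cong (λ x -> D x f l) (sym s≡)) i · sym (fin i)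
   where
   f : Seq
   f = f₀ N
   p q P P' Q Q' s : ℕ
   p = suc N ℕ.+ j
   q = suc q'
   P' = (N ℕ.+ j) ℕ.* k
   P = k ℕ.+ P'
   Q' = q' ℕ.* k
   Q = k ℕ.+ Q'
   s = suc (N ℕ.+ N) ℕ.* k
   N≡ : N ≡ q' ℕ.+ j
   N≡ = sym (ℕP.suc-injective e)
   s≡ : s ≡ P' ℕ.+ Q
   s≡ = cong (λ x -> suc (N ℕ.+ x) ℕ.* k) N≡ · solveⁿ 4 (λ N q j k -> (conⁿ 1 ⊹ (N ⊹ (q ⊹ j))) ⊛ k ≔ (N ⊹ j) ⊛ k ⊹ (k ⊹ q ⊛ k)) refl N q' j k
   PQ : P ℕ.+ Q ≡ suc (suc (N ℕ.+ N)) ℕ.* k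
   PQ = ℕP.+-assoc k P' Q · cong (k ℕ.+_) (sym s≡)
   GG : ℕ -> Seq -> Seq
   GG _ x = E k p (E k q x)
   lin₁ : E k q (g N j ⊞ sh s (g N j) ⊞ sh Q u ⊞ sh P v) ≗ E k q (g N j) ⊞ sh s (E k q (g N j)) ⊞ sh Q (E k q u) ⊞ sh P (E k q v)
   lin₁ l = E-+ k q (g N j ⊞ sh s (g N j) ⊞ sh Q u) (sh P v) l · (cong₂ _+_ (E-+ k q (g N j ⊞ sh s (g N j)) (sh Q u) l · (cong₂ _+_ (E-+ k q (g N j) (sh s (g N j)) l · cong (λ y -> E k q (g N j) l + y) (E-sh k q s (g N j) l)) (E-sh k q Q u l))) (E-sh k q P v l))
   lin₂ : E k p (E k q (g N j) ⊞ sh s (E k q (g N j)) ⊞ sh Q (E k q u) ⊞ sh P (E k q v)) ≗ GG 0 (g N j) ⊞ sh s (GG 0 (g N j)) ⊞ sh Q (GG 0 u) ⊞ sh P (GG 0 v)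
   lin₂ l = E-+ k p (E k q (g N j) ⊞ sh s (E k q (g N j)) ⊞ sh Q (E k q u)) (sh P (E k q v)) l · (cong₂ _+_ (E-+ k p (E k q (g N j) ⊞ sh s (E k q (g N j))) (sh Q (E k q u)) l · (cong₂ _+_ (E-+ k p (E k q (g N j)) (sh s (E k q (g N j))) l · cong (λ y -> E k p (E k q (g N j)) l + y) (E-sh k p s (E k q (g N j)) l)) (E-sh k p Q (E k q u) l))) (E-sh k p P (E k q v) l))
   one : E k p (E k q (g N j)) ≗ D P (D Q f)
   one l = E-suc k (N ℕ.+ j) (E k q (g N j)) l · D-ext P (Closed⁺ N h j q e) l
   fin : f₀ (suc N) ≗ D (suc (suc (N ℕ.+ N)) ℕ.* k) (D s f)
   fin l = cong (λ x -> E k (suc x) δ l) (ℕP.+-suc N N) · E-suc k (suc (N ℕ.+ N)) δ l · D-ext (suc (suc (N ℕ.+ N)) ℕ.* k) (E-suc k (N ℕ.+ N) δ) l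
  step₀ : ∀ N -> Closed N -> E k (suc N ℕ.+ 0) (E k (suc N) (g (suc N) 0)) ≗ f₀ (suc N)
  step₀ N h i = E-ext k (suc N ℕ.+ 0) (E-ext k (suc N) (λ l -> cong (λ y -> g N 0 l + sh (suc (N ℕ.+ N) ℕ.* k) (g N 0) l + sh (suc N ℕ.* k) (g N 1) l + sh (suc y ℕ.* k) (g N 1) l) (sym (ℕP.+-identityʳ N)))) i · step N h 0 N (g N 1) (g N 1) (cong suc (ℕP.+-identityʳ N)) (λ i -> trans (core i) (cong (λ y -> D (suc y ℕ.* k) (D (y ℕ.* k) (f₀ N)) i) (sym (ℕP.+-identityʳ N)))) core i
   where
   core : E k (suc N ℕ.+ 0) (E k (suc N) (g N 1)) ≗ D (suc N ℕ.* k) (D (N ℕ.* k) (f₀ N))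
   core i = cong (λ x -> E k (suc x) (E k (suc N) (g N 1)) i) (ℕP.+-identityʳ N) · E-ext k (suc N) (E-suc k N (g N 1)) i · E-D k (suc N) (suc N ℕ.* k) (E k N (g N 1)) i · D-ext (suc N ℕ.* k) (λ l -> trans (cong (λ x -> E k x (E k N (g N 1)) l) (sym (ℕP.+-comm N 1))) (Closed⁺ N h 1 N (ℕP.+-comm N 1) l)) i
  closed-form : ∀ N -> Closed N
  closed-form zero zero zero refl i = refl
  closed-form (suc N) zero (suc q') e = subst (λ q -> E k (suc N ℕ.+ 0) (E k (suc q) (g (suc N) 0)) ≗ f₀ (suc N)) (sym (ℕP.suc-injective e) · ℕP.+-identityʳ q') (step₀ N (closed-form N))
  closed-form (suc N) (suc j) zero refl i = E-ext k (suc N ℕ.+ suc N) only i · cong (λ x -> E k (suc x) (g N N) i) (ℕP.+-suc N N) · E-suc k (suc (N ℕ.+ N)) (g N N) i · D-ext (suc (suc (N ℕ.+ N)) ℕ.* k) (λ l -> trans (E-suc k (N ℕ.+ N) (g N N) l) (D-ext (suc (N ℕ.+ N) ℕ.* k) (closed-form N N 0 refl) l)) i · sym (cong (λ x -> E k (suc x) δ i) (ℕP.+-suc N N) · E-suc k (suc (N ℕ.+ N)) δ i · D-ext (suc (suc (N ℕ.+ N)) ℕ.* k) (E-suc k (N ℕ.+ N) δ) i)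
   where
   z : ∀ j -> N ℕ.< j -> ∀ e i -> sh e (g N j) i ≡ + 0
   z j l e i = sh-ext e (g-zero N j l) i · sh-0 e i
   only : g (suc N) (suc N) ≗ g N N
   only i = (cong₂ _+_ (cong₂ _+_ (cong₂ _+_ (z (suc N) ℕP.≤-refl 0 i) (z (suc N) ℕP.≤-refl (suc (N ℕ.+ N) ℕ.* k) i)) (cong (λ x -> sh (x ℕ.* k) (g N N) i) (ℕP.n∸n≡0 N))) (z (suc (suc N)) (ℕP.m<n⇒m<1+n ℕP.≤-refl) (suc (suc (N ℕ.+ N)) ℕ.* k) i)) · solve 1 (λ x -> con (+ 0) :+ con (+ 0) :+ x :+ con (+ 0) := x) refl (g N N i)
  closed-form (suc N) (suc j) (suc q') e i = E-ext k (suc N ℕ.+ suc j) (E-ext k (suc q') (λ l -> cong₂ (λ x y -> g N (suc j) l + sh (suc (N ℕ.+ N) ℕ.* k) (g N (suc j)) l + sh (x ℕ.* k) (g N j) l + sh (suc y ℕ.* k) (g N (suc (suc j))) l) N∸j (sym (ℕP.+-suc N j)))) i · step N h (suc j) q' (g N j) (g N (suc (suc j))) e u v i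
   where
   h : Closed N
   h = closed-form N
   N≡ : suc q' ℕ.+ j ≡ N
   N≡ = sym (ℕP.+-suc q' j) · ℕP.suc-injective e
   N∸j : N ℕ.∸ j ≡ suc q'
   N∸j = cong (ℕ._∸ j) (sym N≡) · ℕP.m+n∸n≡m (suc q') j
   u : E k (suc N ℕ.+ suc j) (E k (suc q') (g N j)) ≗ D (suc (N ℕ.+ suc j) ℕ.* k) (D ((N ℕ.+ suc j) ℕ.* k) (f₀ N))
   u i = E-suc k (N ℕ.+ suc j) (E k (suc q') (g N j)) i · D-ext (suc (N ℕ.+ suc j) ℕ.* k) (λ l -> trans (cong (λ x -> E k x (E k (suc q') (g N j)) l) (ℕP.+-suc N j)) (E-suc k (N ℕ.+ j) (E k (suc q') (g N j)) l · D-ext (suc (N ℕ.+ j) ℕ.* k) (h j (suc q') N≡) l · cong (λ x -> D (x ℕ.* k) (f₀ N) l) (sym (ℕP.+-suc N j)))) i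
   v : E k (suc N ℕ.+ suc j) (E k (suc q') (g N (suc (suc j)))) ≗ D (suc q' ℕ.* k) (D (q' ℕ.* k) (f₀ N))
   v i = E-ext k (suc N ℕ.+ suc j) (E-suc k q' (g N (suc (suc j)))) i · E-D k (suc N ℕ.+ suc j) (suc q' ℕ.* k) (E k q' (g N (suc (suc j)))) i · D-ext (suc q' ℕ.* k) (λ l -> trans (cong (λ x -> E k x (E k q' (g N (suc (suc j)))) l) (sym (ℕP.+-suc N (suc j)))) (Closed⁺ N h (suc (suc j)) q' (ℕP.+-suc q' (suc j) · e) l)) i
  -- To order (q + 1) k the binomial is the reciprocal of the Euler product, as the remaining
  -- factors start at higher powers.
  E-g : ∀ j q r -> E k (r ℕ.+ q) (g (q ℕ.+ j) j) ≈[ suc q ℕ.* k ] δ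
  E-g j q r i l = E-high k q r (g (q ℕ.+ j) j) i l · E-cancel≈ k' q (λ i l -> trans (sym (cong (λ x -> E k x (E k q (g (q ℕ.+ j) j)) i) (a₁ j) · E-high k q (j ℕ.+ j) (E k q (g (q ℕ.+ j) j)) i l))
   (closed-form (q ℕ.+ j) j q refl i · cong (λ x -> E k x δ i) (a₂ j) · E-high k q (j ℕ.+ (q ℕ.+ j)) δ i l)) i l
   where
   a₁ : ∀ j -> q ℕ.+ j ℕ.+ j ≡ j ℕ.+ j ℕ.+ q
   a₁ j = solveⁿ 2 (λ q j -> q ⊹ j ⊹ j ≔ j ⊹ j ⊹ q) refl q j
   a₂ : ∀ j -> q ℕ.+ j ℕ.+ (q ℕ.+ j) ≡ j ℕ.+ (q ℕ.+ j) ℕ.+ q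
   a₂ j = solveⁿ 2 (λ q j -> q ⊹ j ⊹ (q ⊹ j) ≔ j ⊹ (q ⊹ j) ⊹ q) refl q j

-- Expansion of the double product and the truncated triple product

module J2 where
 open H1
 open J1
 open U1 using (t3)
 open import Data.Integer using (ℤ; +_; _+_; _*_; -_; _-_)
 open import Data.Integer.Solver using (module +-*-Solver)
 open +-*-Solver using (solve; _:+_; _:*_; :-_; _:-_; _:=_; con)
 open ℕS.+-*-Solver using () renaming (solve to solveⁿ; _:+_ to _⊹_; _:*_ to _⊛_; _:=_ to _≔_; con to conⁿ)
 E-sum : ∀ d m (h : ℕ -> Seq) B -> E d m (λ i -> sumℤ (λ j -> h j i) B) ≗ (λ i -> sumℤ (λ j -> E d m (h j) i) B)
 E-sum d m h zero i = zero' m i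
  where
  zero' : ∀ m -> E d m (λ _ -> + 0) ≗ (λ _ -> + 0)
  zero' zero i = refl
  zero' (suc m) i = E-ext d m (λ l -> cong (λ y -> + 0 - y) (sh-0 (suc m ℕ.* d) l)) i · zero' m i
 E-sum d m h (suc B) i = E-+ d m (λ i -> sumℤ (λ j -> h j i) B) (h B) i · cong (λ y -> y + E d m (h B) i) (E-sum d m h B i)
 module Expansion (k' a b : ℕ) (ab : a ℕ.+ b ≡ suc k') (a≥1 : 1 ℕ.≤ a) (b≥1 : 1 ℕ.≤ b) where
  open JacobiTriple k' a b ab
  term : ℕ -> ℕ -> ℕ -> Seq
  term c N j i = sgn j * sh (ex k c j) (g N j) i
  W : ℕ -> ℕ -> Seq
  W N B i = g N 0 i + sumℤ (λ j -> term a N (suc j) i + term b N (suc j) i) B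
  module Step (N : ℕ) (i : ℕ) where
   pe : ℕ -> ℕ -> ℕ -> ℤ
   pe c e j = sgn j * sh (ex k c j ℕ.+ e) (g N j) i
   pe-high : ∀ c e j -> N ℕ.< j -> pe c e j ≡ + 0
   pe-high c e j l = cong (λ □ -> sgn j * □) (sh-ext (ex k c j ℕ.+ e) (g-zero N j l) i · sh-0 (ex k c j ℕ.+ e) i) · ℤP.*-zeroʳ (sgn j)
   sh-term : ∀ c e j -> sh e (term c N j) i ≡ pe c e j
   sh-term c e j = sh-* e (sgn j) (sh (ex k c j) (g N j)) i · cong (λ □ -> sgn j * □) (sh-sh e (ex k c j) (g N j) i · cong (λ x -> sh x (g N j) i) (ℕP.+-comm e (ex k c j)))
   tot : ℕ -> ℕ -> ℤ
   tot e B = pe a e 0 + sumℤ (λ j -> pe a e (suc j) + pe b e (suc j)) B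
   sh-W : ∀ e B -> sh e (W N B) i ≡ tot e B
   sh-W e B = sh-+ e (g N 0) (λ i -> sumℤ (λ j -> term a N (suc j) i + term b N (suc j) i) B) i · (cong₂ _+_ (sym (ℤP.*-identityˡ (sh e (g N 0) i)))
    (sh-sum e (λ j i -> term a N (suc j) i + term b N (suc j) i) B i · sumℤ-cong B (λ j _ -> trans (sh-+ e (term a N (suc j)) (term b N (suc j)) i) (cong₂ _+_ (sh-term a e (suc j)) (sh-term b e (suc j))))))
   γ : ℕ
   γ = suc (N ℕ.+ N) ℕ.* k
   new : ∀ c c' -> c ℕ.+ c' ≡ k -> ∀ j -> term c (suc N) (suc j) i ≡ pe c 0 (suc j) + pe c γ (suc j) - pe c (progression k c N) j - pe c (progression k c' N) (suc (suc j))
   new c c' cc j = cong (λ □ -> sgn (suc j) * □) (sh-+ e (g N (suc j) ⊞ sh γ (g N (suc j)) ⊞ sh ((N ℕ.∸ j) ℕ.* k) (g N j)) (sh (suc (suc (N ℕ.+ j)) ℕ.* k) (g N (suc (suc j)))) i · (cong₂ _+_ (sh-+ e (g N (suc j) ⊞ sh γ (g N (suc j))) (sh ((N ℕ.∸ j) ℕ.* k) (g N j)) i · (cong₂ _+_ (sh-+ e (g N (suc j)) (sh γ (g N (suc j))) i · (cong₂ _+_ (cong (λ x -> sh x (g N (suc j)) i) (sym (ℕP.+-identityʳ e))) (sh-sh e γ (g N (suc j)) i))) (third (ℕP.≤-<-connex j N))))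
    (sh-sh e (suc (suc (N ℕ.+ j)) ℕ.* k) (g N (suc (suc j))) i · cong (λ x -> sh x (g N (suc (suc j))) i) e₄))) · solve 5 (λ s x y z w -> (:- s) :* (x :+ y :+ z :+ w) := (:- s) :* x :+ (:- s) :* y :- s :* z :- (:- (:- s)) :* w) refl (sgn j) (sh (e ℕ.+ 0) (g N (suc j)) i) (sh (e ℕ.+ γ) (g N (suc j)) i) (sh (ex k c j ℕ.+ progression k c N) (g N j) i) (sh (ex k c (suc (suc j)) ℕ.+ progression k c' N) (g N (suc (suc j))) i)
    where
    e : ℕ
    e = ex k c (suc j)
    third : j ℕ.≤ N ⊎ N ℕ.< j -> sh e (sh ((N ℕ.∸ j) ℕ.* k) (g N j)) i ≡ sh (ex k c j ℕ.+ progression k c N) (g N j) i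
    third (inj₁ l) = sh-sh e ((N ℕ.∸ j) ℕ.* k) (g N j) i · cong (λ x -> sh x (g N j) i) (solveⁿ 5 (λ x c k j d -> x ⊹ (c ⊹ k ⊛ j) ⊹ d ⊛ k ≔ x ⊹ (k ⊛ (j ⊹ d) ⊹ c)) refl (ex k c j) c k j (N ℕ.∸ j) · cong (λ y -> ex k c j ℕ.+ (k ℕ.* y ℕ.+ c)) (ℕP.m+[n∸m]≡n l))
    third (inj₂ l) = (sh-ext e (λ y -> trans (sh-ext ((N ℕ.∸ j) ℕ.* k) (g-zero N j l) y) (sh-0 ((N ℕ.∸ j) ℕ.* k) y)) i · sh-0 e i) · sym (sh-ext (ex k c j ℕ.+ progression k c N) (g-zero N j l) i · sh-0 (ex k c j ℕ.+ progression k c N) i)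
    e₄ : e ℕ.+ suc (suc (N ℕ.+ j)) ℕ.* k ≡ ex k c (suc (suc j)) ℕ.+ progression k c' N
    e₄ = solveⁿ 4 (λ e N j k -> e ⊹ (conⁿ 2 ⊹ (N ⊹ j)) ⊛ k ≔ e ⊹ (k ⊛ (conⁿ 1 ⊹ j) ⊹ (k ⊛ N ⊹ k))) refl e N j k · cong (λ y -> e ℕ.+ (k ℕ.* suc j ℕ.+ (k ℕ.* N ℕ.+ y))) (sym cc) · solveⁿ 5 (λ e kj kn c c' -> e ⊹ (kj ⊹ (kn ⊹ (c ⊹ c'))) ≔ e ⊹ (c ⊹ kj) ⊹ (kn ⊹ c')) refl e (k ℕ.* suc j) (k ℕ.* N) c c'
   α β : ℕ
   α = progression k a N
   β = progression k b N
   new₀ : g (suc N) 0 i ≡ pe a 0 0 + pe a γ 0 - pe a β 1 - pe b α 1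
   new₀ = (cong₂ _+_ (cong₂ _+_ (refl {x = g N 0 i + sh γ (g N 0) i}) (cong (λ x -> sh x (g N 1) i) (e₁ a b ab))) (cong (λ x -> sh x (g N 1) i) (e₁ b a (ℕP.+-comm b a · ab)))) · solve 4 (λ x y z w -> x :+ y :+ z :+ w := con (+ 1) :* x :+ con (+ 1) :* y :- (:- con (+ 1)) :* z :- (:- con (+ 1)) :* w) refl (g N 0 i) (sh γ (g N 0) i) (sh (ex k a 1 ℕ.+ β) (g N 1) i) (sh (ex k b 1 ℕ.+ α) (g N 1) i)
    where
    e₁ : ∀ c c' -> c ℕ.+ c' ≡ k -> suc N ℕ.* k ≡ ex k c 1 ℕ.+ progression k c' N
    e₁ c c' cc = solveⁿ 2 (λ N k -> (conⁿ 1 ⊹ N) ⊛ k ≔ k ⊛ N ⊹ k) refl N k · cong (k ℕ.* N ℕ.+_) (sym cc) · solveⁿ 4 (λ kn c c' k -> kn ⊹ (c ⊹ c') ≔ c ⊹ k ⊛ conⁿ 0 ⊹ (kn ⊹ c')) refl (k ℕ.* N) c c' k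
   -- Multiplying by two new factors shifts the bilateral index by one in both directions. After
   -- folding at 0 the shifted sums are realigned by `down` and `up`, whose last terms vanish
   -- because N < B.
   step-W : ∀ B -> N ℕ.< B -> W (suc N) B i ≡ D α (D β (W N B)) i
   step-W B l = lhs · algebra (pe a 0 0) (pe a γ 0) (pe a β 1) (pe b α 1) (Σ' 0) (Σ' γ) (sumℤ (pe a α) B) (sumℤ (λ j -> pe a β (suc (suc j))) B) (sumℤ (pe b β) B) (sumℤ (λ j -> pe b α (suc (suc j))) B) (sumℤ (λ j -> pe a α (suc j)) B) (sumℤ (λ j -> pe a β (suc j)) B) (sumℤ (λ j -> pe b β (suc j)) B) (sumℤ (λ j -> pe b α (suc j)) B) (pe a α 0) (pe b β 0)
    (down a α) (up a β) (down b β) (up b α) · sym rhs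
    where
    Σ' : ℕ -> ℤ
    Σ' e = sumℤ (λ j -> pe a e (suc j) + pe b e (suc j)) B
    αβ : α ℕ.+ β ≡ γ
    αβ = solveⁿ 4 (λ k N a b -> k ⊛ N ⊹ a ⊹ (k ⊛ N ⊹ b) ≔ k ⊛ N ⊹ k ⊛ N ⊹ (a ⊹ b)) refl k N a b · cong (k ℕ.* N ℕ.+ k ℕ.* N ℕ.+_) ab · solveⁿ 2 (λ k N -> k ⊛ N ⊹ k ⊛ N ⊹ k ≔ (conⁿ 1 ⊹ (N ⊹ N)) ⊛ k) refl k N
    regroup : ∀ j -> term a (suc N) (suc j) i + term b (suc N) (suc j) i ≡ (pe a 0 (suc j) + pe b 0 (suc j)) + ((pe a γ (suc j) + pe b γ (suc j)) + (- (pe a α j + pe a β (suc (suc j))) + - (pe b β j + pe b α (suc (suc j)))))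
    regroup j = (cong₂ _+_ (new a b ab j) (new b a (ℕP.+-comm b a · ab) j)) · solve 8 (λ x y z w x' y' z' w' -> x :+ y :- z :- w :+ (x' :+ y' :- z' :- w') := (x :+ x') :+ ((y :+ y') :+ ((:- (z :+ w)) :+ (:- (z' :+ w'))))) refl (pe a 0 (suc j)) (pe a γ (suc j)) (pe a α j) (pe a β (suc (suc j))) (pe b 0 (suc j)) (pe b γ (suc j)) (pe b β j) (pe b α (suc (suc j)))
    pair : ∀ c e c' e' -> sumℤ (λ j -> - (pe c e j + pe c' e' (suc (suc j)))) B ≡ - (sumℤ (pe c e) B + sumℤ (λ j -> pe c' e' (suc (suc j))) B)
    pair c e c' e' = sumℤ-neg (λ j -> pe c e j + pe c' e' (suc (suc j))) B · cong (λ y -> - y) (sumℤ-+ (pe c e) (λ j -> pe c' e' (suc (suc j))) B)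
    lhs : W (suc N) B i ≡ pe a 0 0 + pe a γ 0 - pe a β 1 - pe b α 1 + (Σ' 0 + (Σ' γ + (- (sumℤ (pe a α) B + sumℤ (λ j -> pe a β (suc (suc j))) B) + - (sumℤ (pe b β) B + sumℤ (λ j -> pe b α (suc (suc j))) B))))
    lhs = cong₂ _+_ new₀ (sumℤ-cong B (λ j _ -> regroup j) · sumℤ-+ (λ j -> pe a 0 (suc j) + pe b 0 (suc j)) rest B · cong (λ y -> Σ' 0 + y) (sumℤ-+ (λ j -> pe a γ (suc j) + pe b γ (suc j)) rest' B · cong (λ y -> Σ' γ + y) (sumℤ-+ (λ j -> - (pe a α j + pe a β (suc (suc j)))) (λ j -> - (pe b β j + pe b α (suc (suc j)))) B · (cong₂ _+_ (pair a α a β) (pair b β b α)))))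
     where
     rest' rest : ℕ -> ℤ
     rest' j = - (pe a α j + pe a β (suc (suc j))) + - (pe b β j + pe b α (suc (suc j)))
     rest j = (pe a γ (suc j) + pe b γ (suc j)) + rest' j
    shW : ∀ e -> sh e (W N B) i ≡ pe a e 0 + (sumℤ (λ j -> pe a e (suc j)) B + sumℤ (λ j -> pe b e (suc j)) B)
    shW e = sh-W e B · cong (λ y -> pe a e 0 + y) (sumℤ-+ (λ j -> pe a e (suc j)) (λ j -> pe b e (suc j)) B)
    rhs : D α (D β (W N B)) i ≡ pe a 0 0 + Σ' 0 - (pe b β 0 + (sumℤ (λ j -> pe a β (suc j)) B + sumℤ (λ j -> pe b β (suc j)) B)) - (pe a α 0 + (sumℤ (λ j -> pe a α (suc j)) B + sumℤ (λ j -> pe b α (suc j)) B) - (pe a γ 0 + Σ' γ))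
    rhs = D-D α β (W N B) i · (cong₂ _-_ (cong₂ _-_ (sh-W 0 B) (shW β)) (cong₂ _-_ (shW α) (cong (λ x -> sh x (W N B) i) αβ · sh-W γ B)))
    down : ∀ c e -> sumℤ (pe c e) B ≡ pe c e 0 + sumℤ (λ j -> pe c e (suc j)) B
    down c e = sym (telescope (pe c e) B · cong (λ □ -> sumℤ (pe c e) B + □) (pe-high c e B l) · ℤP.+-identityʳ _)
    up : ∀ c e -> pe c e 1 + sumℤ (λ j -> pe c e (suc (suc j))) B ≡ sumℤ (λ j -> pe c e (suc j)) B
    up c e = telescope (λ j -> pe c e (suc j)) B · cong (λ □ -> sumℤ (λ j -> pe c e (suc j)) B + □) (pe-high c e (suc B) (ℕP.m<n⇒m<1+n l)) · ℤP.+-identityʳ _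
    algebra : ∀ p0 pγ b1 a1 S0 Sγ A1 A2 B1 B2 C1 C2 C3 C4 α0 β0 -> A1 ≡ α0 + C1 -> b1 + A2 ≡ C2 -> B1 ≡ β0 + C3 -> a1 + B2 ≡ C4 ->
     p0 + pγ - b1 - a1 + (S0 + (Sγ + (- (A1 + A2) + - (B1 + B2)))) ≡ p0 + S0 - (β0 + (C2 + C3)) - (α0 + (C1 + C4) - (pγ + Sγ))
    algebra p0 pγ b1 a1 S0 Sγ _ A2 _ B2 C1 _ C3 _ α0 β0 refl refl refl refl = solve 12 (λ p0 pγ b1 a1 S0 Sγ A2 B2 C1 C3 α0 β0 ->
     p0 :+ pγ :- b1 :- a1 :+ (S0 :+ (Sγ :+ ((:- (α0 :+ C1 :+ A2)) :+ (:- (β0 :+ C3 :+ B2))))) := p0 :+ S0 :- (β0 :+ (b1 :+ A2 :+ C3)) :- (α0 :+ (C1 :+ (a1 :+ B2)) :- (pγ :+ Sγ))) refl p0 pγ b1 a1 S0 Sγ A2 B2 C1 C3 α0 β0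
  factors : ℕ -> Seq
  factors N = Fac (progression k a) (progression k b) N δ
  -- The exact finite form: a signed sum of Gaussian binomials with the theta exponents.
  expansion : ∀ N B -> N ℕ.≤ B -> factors N ≗ W N B
  expansion zero B _ i = sym (cong (λ □ -> δ i + □) (sumℤ-cong B (λ j _ -> cong₂ _+_ (z a j) (z b j)) · zeros B) · ℤP.+-identityʳ (δ i))
   where
   z : ∀ c j -> term c 0 (suc j) i ≡ + 0
   z c j = cong (λ □ -> sgn (suc j) * □) (sh-0 (ex k c (suc j)) i) · ℤP.*-zeroʳ (sgn (suc j))
   zeros : ∀ B -> sumℤ (λ _ -> + 0 + + 0) B ≡ + 0
   zeros zero = refl
   zeros (suc B) = cong (λ y -> y + (+ 0)) (zeros B)
  expansion (suc N) B l i = Fac-D (progression k a) (progression k b) N (progression k a N) (D (progression k b N) δ) i · D-ext (progression k a N) (λ y -> trans (Fac-D (progression k a) (progression k b) N (progression k b N) δ y) (D-ext (progression k b N) (expansion N B (ℕP.<⇒≤ l)) y)) i · sym (Step.step-W N i B l)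
  -- The binomials are inverted less accurately for larger j, but their terms start at exponent at
  -- least c + k (j - 1), which compensates exactly up to order k N.
  theta : ∀ N r -> E k (r ℕ.+ N) (factors N) ≈[ suc (k ℕ.* N) ] Θ k a b N
  theta N r i l = E-ext k R (expansion N N ℕP.≤-refl) i · E-+ k R (g N 0) (λ i -> sumℤ (λ j -> term a N (suc j) i + term b N (suc j) i) N) i · (cong₂ _+_ zeroth
   (E-sum k R (λ j i -> term a N (suc j) i + term b N (suc j) i) N i · sumℤ-cong N (λ j lj -> trans (E-+ k R (term a N (suc j)) (term b N (suc j)) i) (cong₂ _+_ (each a a≥1 j lj) (each b b≥1 j lj)))))
   where
   R : ℕ
   R = r ℕ.+ N
   zeroth : E k R (g N 0) i ≡ δ i
   zeroth = cong (λ x -> E k R (g x 0) i) (sym (ℕP.+-identityʳ N)) · E-g 0 N r i (ℕP.<-≤-trans l (ℕP.≤-trans (ℕ.s≤s (ℕP.≤-reflexive (ℕP.*-comm k N))) (ℕ.s≤s (ℕP.m≤n+m (N ℕ.* k) k'))))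
   each : ∀ c -> 1 ℕ.≤ c -> ∀ j -> j ℕ.< N -> E k R (term c N (suc j)) i ≡ sgn (suc j) * sh (ex k c (suc j)) δ i
   each c c≥1 j lj = E-* k R (sgn (suc j)) (sh (ex k c (suc j)) (g N (suc j))) i · cong (λ □ -> sgn (suc j) * □) (E-sh k R (ex k c (suc j)) (g N (suc j)) i · sh-cong⁺ (ex k c (suc j)) inverse i (ℕP.<-≤-trans l bound))
    where
    q : ℕ
    q = N ℕ.∸ suc j
    q+j : q ℕ.+ suc j ≡ N
    q+j = ℕP.m∸n+n≡m lj
    inverse : E k R (g N (suc j)) ≈[ suc q ℕ.* k ] δ
    inverse = subst (λ x -> E k (r ℕ.+ x) (g x (suc j)) ≈[ suc q ℕ.* k ] δ) q+j (λ i l -> trans (cong (λ x -> E k x (g (q ℕ.+ suc j) (suc j)) i) (solveⁿ 3 (λ r q j -> r ⊹ (q ⊹ j) ≔ r ⊹ j ⊹ q) refl r q (suc j))) (E-g (suc j) q (r ℕ.+ suc j) i l))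
    bound : suc (k ℕ.* N) ℕ.≤ ex k c (suc j) ℕ.+ suc q ℕ.* k
    bound = ℕP.≤-trans (ℕP.≤-reflexive (cong (λ x -> suc (k ℕ.* x)) (sym q+j) · solveⁿ 3 (λ k q j -> conⁿ 1 ⊹ k ⊛ (q ⊹ (conⁿ 1 ⊹ j)) ≔ conⁿ 1 ⊹ k ⊛ j ⊹ (conⁿ 1 ⊹ q) ⊛ k) refl k q j)) (ℕP.+-monoˡ-≤ (suc q ℕ.* k) (ℕP.≤-trans (ℕP.+-monoˡ-≤ (k ℕ.* j) c≥1) (ℕP.m≤n+m (c ℕ.+ k ℕ.* j) (ex k c j))))

-- Three-dissection of the pentagonal series; small coefficients

module J3 where
 open H1
 open J1
 open J2
 open U1 using (t3)
 open import Data.Integer using (ℤ; +_; _+_; _*_; -_; _-_)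
 open import Data.Integer.Solver using (module +-*-Solver)
 open +-*-Solver using (solve; _:+_; _:*_; :-_; _:-_; _:=_; con)
 open ℕS.+-*-Solver using () renaming (solve to solveⁿ; _:+_ to _⊹_; _:*_ to _⊛_; _:=_ to _≔_; con to conⁿ)
 open import Data.List using (List; []; _∷_; _++_)
 open import Data.List.Relation.Unary.All using (All; []; _∷_)
 ex-large : ∀ k c j -> 1 ℕ.≤ c -> k ℕ.* j ℕ.< ex k c (suc j)
 ex-large k c j h = ℕP.≤-trans (ℕP.+-monoˡ-≤ (k ℕ.* j) h) (ℕP.m≤n+m (c ℕ.+ k ℕ.* j) (ex k c j))
 Θ-stable : ∀ k a b -> 1 ℕ.≤ a -> 1 ℕ.≤ b -> ∀ N r -> Θ k a b (r ℕ.+ N) ≈[ suc (k ℕ.* N) ] Θ k a b N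
 Θ-stable k a b ha hb N zero i l = refl
 Θ-stable k a b ha hb N (suc r) i l = sym (ℤP.+-assoc (δ i) _ _) · (cong₂ _+_ (Θ-stable k a b ha hb N r i l) (cong₂ _+_ (z a ha) (z b hb))) · ℤP.+-identityʳ _
  where
  z : ∀ c -> 1 ℕ.≤ c -> sgn (suc (r ℕ.+ N)) * sh (ex k c (suc (r ℕ.+ N))) δ i ≡ + 0
  z c hc = cong (λ y -> sgn (suc (r ℕ.+ N)) * y) (sh-high (ex k c (suc (r ℕ.+ N))) δ i (ℕP.<-≤-trans l (ℕP.≤-trans (ℕ.s≤s (ℕP.*-monoʳ-≤ k (ℕP.m≤n+m N r))) (ex-large k c (r ℕ.+ N) hc)))) · ℤP.*-zeroʳ (sgn (suc (r ℕ.+ N)))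
 at-00 : ∀ x m -> sh (t3 x) δ (t3 m) ≡ sh x δ m
 at-00 zero zero = refl
 at-00 zero (suc m) = refl
 at-00 (suc x) zero = refl
 at-00 (suc x) (suc m) = at-00 x m
 at-10 : ∀ x m -> sh (suc (t3 x)) δ (t3 m) ≡ + 0
 at-10 x zero = refl
 at-10 zero (suc m) = refl
 at-10 (suc x) (suc m) = at-10 x m
 at-20 : ∀ x m -> sh (suc (suc (t3 x))) δ (t3 m) ≡ + 0
 at-20 x zero = refl
 at-20 zero (suc m) = refl
 at-20 (suc x) (suc m) = at-20 x m
 at-01 : ∀ x m -> sh (t3 x) δ (suc (t3 m)) ≡ + 0
 at-01 zero m = refl
 at-01 (suc x) zero = refl
 at-01 (suc x) (suc m) = at-01 x m
 at-02 : ∀ x m -> sh (t3 x) δ (suc (suc (t3 m))) ≡ + 0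
 at-02 zero m = refl
 at-02 (suc x) zero = refl
 at-02 (suc x) (suc m) = at-02 x m
 sum-thirds : ∀ h B -> sumℤ h (t3 B) ≡ sumℤ (λ l -> h (t3 l) + h (suc (t3 l)) + h (suc (suc (t3 l)))) B
 sum-thirds h zero = refl
 sum-thirds h (suc B) = solve 4 (λ s x y z -> s :+ x :+ y :+ z := s :+ (x :+ y :+ z)) refl (sumℤ h (t3 B)) (h (t3 B)) (h (suc (t3 B))) (h (suc (suc (t3 B)))) · cong (λ y -> y + (h (t3 B) + h (suc (t3 B)) + h (suc (suc (t3 B))))) (sum-thirds h B)
 sgn-t3 : ∀ l -> sgn (t3 l) ≡ sgn l
 sgn-t3 zero = refl
 sgn-t3 (suc l) = solve 1 (λ x -> :- (:- (:- x)) := :- x) refl (sgn (t3 l)) · (cong -_ (sgn-t3 l))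
 ex-t3 : ∀ c l -> ex 3 c (t3 l) ≡ t3 (ex 9 (c ℕ.+ 3) l)
 ex-t3 c zero = refl
 ex-t3 c (suc l) = cong₂ (λ x y -> x ℕ.+ (c ℕ.+ 3 ℕ.* y) ℕ.+ (c ℕ.+ 3 ℕ.* suc y) ℕ.+ (c ℕ.+ 3 ℕ.* suc (suc y))) (ex-t3 c l · t3≡ (ex 9 (c ℕ.+ 3) l)) (t3≡ l) · solveⁿ 3 (λ x c l -> x ⊛ conⁿ 3 ⊹ (c ⊹ conⁿ 3 ⊛ (l ⊛ conⁿ 3)) ⊹ (c ⊹ conⁿ 3 ⊛ (conⁿ 1 ⊹ l ⊛ conⁿ 3)) ⊹ (c ⊹ conⁿ 3 ⊛ (conⁿ 2 ⊹ l ⊛ conⁿ 3)) ≔ (x ⊹ (c ⊹ conⁿ 3 ⊹ conⁿ 9 ⊛ l)) ⊛ conⁿ 3) refl (ex 9 (c ℕ.+ 3) l) c l · sym (t3≡ _)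
 ex-+ : ∀ k c d l -> ex k (c ℕ.+ d) l ≡ ex k c l ℕ.+ d ℕ.* l
 ex-+ k c d zero = sym (ℕP.*-zeroʳ d)
 ex-+ k c d (suc l) = cong (λ x -> x ℕ.+ (c ℕ.+ d ℕ.+ k ℕ.* l)) (ex-+ k c d l) · solveⁿ 5 (λ x c d k l -> x ⊹ d ⊛ l ⊹ (c ⊹ d ⊹ k ⊛ l) ≔ x ⊹ (c ⊹ k ⊛ l) ⊹ d ⊛ (conⁿ 1 ⊹ l)) refl (ex k c l) c d k l
 ex-1 : ∀ c l -> ex 3 c (suc (t3 l)) ≡ c ℕ.+ t3 (ex 9 (c ℕ.+ 6) l)
 ex-1 c l = cong₂ (λ x y -> x ℕ.+ (c ℕ.+ 3 ℕ.* y)) (ex-t3 c l · t3≡ _) (t3≡ l) · solveⁿ 3 (λ x c l -> x ⊛ conⁿ 3 ⊹ (c ⊹ conⁿ 3 ⊛ (l ⊛ conⁿ 3)) ≔ c ⊹ (x ⊹ conⁿ 3 ⊛ l) ⊛ conⁿ 3) refl (ex 9 (c ℕ.+ 3) l) c l · cong (c ℕ.+_) (cong (ℕ._* 3) (sym (ex-+ 9 (c ℕ.+ 3) 3 l) · cong (λ y -> ex 9 y l) (ℕP.+-assoc c 3 3)) · sym (t3≡ _))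
 ex-2₁ : ∀ l -> ex 3 1 (suc (suc (t3 l))) ≡ 2 ℕ.+ t3 (ex 9 1 (suc l))
 ex-2₁ l = cong₂ (λ x y -> x ℕ.+ (1 ℕ.+ 3 ℕ.* y) ℕ.+ (1 ℕ.+ 3 ℕ.* suc y)) (ex-t3 1 l · t3≡ _ · cong (ℕ._* 3) (ex-+ 9 1 3 l)) (t3≡ l) · solveⁿ 2 (λ x l -> (x ⊹ conⁿ 3 ⊛ l) ⊛ conⁿ 3 ⊹ (conⁿ 1 ⊹ conⁿ 3 ⊛ (l ⊛ conⁿ 3)) ⊹ (conⁿ 1 ⊹ conⁿ 3 ⊛ (conⁿ 1 ⊹ l ⊛ conⁿ 3)) ≔ conⁿ 2 ⊹ (x ⊹ (conⁿ 1 ⊹ conⁿ 9 ⊛ l)) ⊛ conⁿ 3) refl (ex 9 1 l) l · cong (2 ℕ.+_) (sym (t3≡ (ex 9 1 (suc l))))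
 ex-2₂ : ∀ l -> ex 3 2 (suc (suc (t3 l))) ≡ 1 ℕ.+ t3 (ex 9 2 (suc l))
 ex-2₂ l = cong₂ (λ x y -> x ℕ.+ (2 ℕ.+ 3 ℕ.* y) ℕ.+ (2 ℕ.+ 3 ℕ.* suc y)) (ex-t3 2 l · t3≡ _ · cong (ℕ._* 3) (ex-+ 9 2 3 l)) (t3≡ l) · solveⁿ 2 (λ x l -> (x ⊹ conⁿ 3 ⊛ l) ⊛ conⁿ 3 ⊹ (conⁿ 2 ⊹ conⁿ 3 ⊛ (l ⊛ conⁿ 3)) ⊹ (conⁿ 2 ⊹ conⁿ 3 ⊛ (conⁿ 1 ⊹ l ⊛ conⁿ 3)) ≔ conⁿ 1 ⊹ (x ⊹ (conⁿ 2 ⊹ conⁿ 9 ⊛ l)) ⊛ conⁿ 3) refl (ex 9 2 l) l · cong (1 ℕ.+_) (sym (t3≡ (ex 9 2 (suc l))))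
 summand : ℕ -> ℕ -> ℕ -> ℤ
 summand i j e = sgn j * sh e δ i
 vanish : ∀ i j e -> sh e δ i ≡ + 0 -> summand i j e ≡ + 0
 vanish i j e h = cong (λ □ -> sgn j * □) h · ℤP.*-zeroʳ (sgn j)
 vanish≡ : ∀ i j {e e'} -> e ≡ e' -> sh e' δ i ≡ + 0 -> summand i j e ≡ + 0
 vanish≡ i j {e} p h = vanish i j e (cong (λ e -> sh e δ i) p · h)
 third : ℕ -> ℕ -> ℤ
 third i j = summand i (suc j) (ex 3 1 (suc j)) + summand i (suc j) (ex 3 2 (suc j))
 -- The exponents j (3j - 1) / 2 and j (3j + 1) / 2 are divisible by 3 together exactly when 3
 -- divides j; those terms form a theta series with modulus 9.
 dissect₀ : ∀ B m -> Θ 3 1 2 (t3 B) (t3 m) ≡ Θ 9 4 5 B m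
 dissect₀ B m = cong₂ _+_ (at-00 0 m) (sum-thirds (third (t3 m)) B · sumℤ-cong B (λ l _ -> trans (cong₂ _+_ (cong₂ _+_ (cong₂ _+_ (vanish≡ (t3 m) (suc (t3 l)) (ex-1 1 l) (at-10 (ex 9 7 l) m)) (vanish≡ (t3 m) (suc (t3 l)) (ex-1 2 l) (at-20 (ex 9 8 l) m))) (cong₂ _+_ (vanish≡ (t3 m) (suc (suc (t3 l))) (ex-2₁ l) (at-20 (ex 9 1 (suc l)) m)) (vanish≡ (t3 m) (suc (suc (t3 l))) (ex-2₂ l) (at-10 (ex 9 2 (suc l)) m)))) (cong₂ _+_ (hit 1 l) (hit 2 l))) (solve 1 (λ x -> con (+ 0) :+ con (+ 0) :+ (con (+ 0) :+ con (+ 0)) :+ x := x) refl _)))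
  where
  hit : ∀ c l -> summand (t3 m) (t3 (suc l)) (ex 3 c (t3 (suc l))) ≡ summand m (suc l) (ex 9 (c ℕ.+ 3) (suc l))
  hit c l = cong₂ _*_ (sgn-t3 (suc l)) (cong (λ e -> sh e δ (t3 m)) (ex-t3 c (suc l)) · at-00 (ex 9 (c ℕ.+ 3) (suc l)) m)
 -- In the other two classes the index starts at 0 on one side only; isolating this term as δ
 -- restores the folded shape, and the extra last term lies beyond m.
 shifted : ∀ B m p q -> 1 ℕ.≤ p -> m ℕ.< B -> (sumℤ (λ l -> summand m l (ex 9 p l)) B + sumℤ (λ l -> summand m (suc l) (ex 9 q (suc l))) B) ≡ δ m + sumℤ (λ l -> summand m (suc l) (ex 9 p (suc l)) + summand m (suc l) (ex 9 q (suc l))) B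
 shifted (suc B) m p q hp (ℕ.s≤s l) = cong (λ y -> y + S₂) (sym (ℤP.+-identityʳ (sumℤ h (suc B))) · cong (λ □ -> sumℤ h (suc B) + □) (sym last) · sym (telescope h (suc B))) · solve 3 (λ d x y -> con (+ 1) :* d :+ x :+ y := d :+ (x :+ y)) refl (δ m) _ S₂ · cong (λ □ -> δ m + □) (sym (sumℤ-+ (λ l -> h (suc l)) _ (suc B)))
  where
  h : ℕ -> ℤ
  h l = summand m l (ex 9 p l)
  S₂ : ℤ
  S₂ = sumℤ (λ l -> summand m (suc l) (ex 9 q (suc l))) (suc B)
  last : h (suc B) ≡ + 0
  last = vanish m (suc B) (ex 9 p (suc B)) (sh-high (ex 9 p (suc B)) δ m (ℕP.≤-<-trans (ℕP.≤-trans l (ℕP.m≤n*m B 9)) (ex-large 9 p B hp)))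
 dissect₁ : ∀ B m -> m ℕ.< B -> - Θ 3 1 2 (t3 B) (suc (t3 m)) ≡ Θ 9 7 2 B m
 dissect₁ B m l = (cong -_ (ℤP.+-identityˡ _ · sum-thirds (third (suc (t3 m))) B · sumℤ-cong B (λ l _ -> trans (cong₂ _+_ (cong₂ _+_ (cong₂ _+_ (cong₂ _*_ (cong -_ (sgn-t3 l)) (cong (λ e -> sh e δ (suc (t3 m))) (ex-1 1 l) · at-00 (ex 9 7 l) m)) (vanish≡ (suc (t3 m)) (suc (t3 l)) (ex-1 2 l) (at-10 (ex 9 8 l) m))) (cong₂ _+_ (vanish≡ (suc (t3 m)) (suc (suc (t3 l))) (ex-2₁ l) (at-10 (ex 9 1 (suc l)) m)) (cong₂ _*_ (cong (λ y -> - - y) (sgn-t3 l)) (cong (λ e -> sh e δ (suc (t3 m))) (ex-2₂ l) · at-00 (ex 9 2 (suc l)) m)))) (cong₂ _+_ (miss 1 l) (miss 2 l))) (solve 3 (λ s x y -> (:- s) :* x :+ con (+ 0) :+ (con (+ 0) :+ (:- (:- s)) :* y) :+ (con (+ 0) :+ con (+ 0)) := :- (s :* x :+ (:- s) :* y)) refl (sgn l) (sh (ex 9 7 l) δ m) (sh (ex 9 2 (suc l)) δ m))))) · (cong -_ (sumℤ-neg _ B · (cong -_ (sumℤ-+ (λ l -> summand m l (ex 9 7 l)) (λ l -> summand m (suc l) (ex 9 2 (suc l))) B)))) · ℤP.neg-involutive _ · shifted B m 7 2 (ℕ.s≤s ℕ.z≤n) l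
  where
  miss : ∀ c l -> summand (suc (t3 m)) (t3 (suc l)) (ex 3 c (t3 (suc l))) ≡ + 0
  miss c l = vanish≡ (suc (t3 m)) (t3 (suc l)) (ex-t3 c (suc l)) (at-01 (ex 9 (c ℕ.+ 3) (suc l)) m)
 dissect₂ : ∀ B m -> m ℕ.< B -> - Θ 3 1 2 (t3 B) (suc (suc (t3 m))) ≡ Θ 9 8 1 B m
 dissect₂ B m l = (cong -_ (ℤP.+-identityˡ _ · sum-thirds (third (suc (suc (t3 m)))) B · sumℤ-cong B (λ l _ -> trans (cong₂ _+_ (cong₂ _+_ (cong₂ _+_ (vanish≡ (suc (suc (t3 m))) (suc (t3 l)) (ex-1 1 l) (at-01 (ex 9 7 l) m)) (cong₂ _*_ (cong -_ (sgn-t3 l)) (cong (λ e -> sh e δ (suc (suc (t3 m)))) (ex-1 2 l) · at-00 (ex 9 8 l) m))) (cong₂ _+_ (cong₂ _*_ (cong (λ y -> - - y) (sgn-t3 l)) (cong (λ e -> sh e δ (suc (suc (t3 m)))) (ex-2₁ l) · at-00 (ex 9 1 (suc l)) m)) (vanish≡ (suc (suc (t3 m))) (suc (suc (t3 l))) (ex-2₂ l) (at-01 (ex 9 2 (suc l)) m)))) (cong₂ _+_ (miss 1 l) (miss 2 l))) (solve 3 (λ s x y -> con (+ 0) :+ (:- s) :* x :+ ((:- (:- s)) :* y :+ con (+ 0)) :+ (con (+ 0) :+ con (+ 0)) := :- (s :* x :+ (:- s) :* y)) refl (sgn l) (sh (ex 9 8 l) δ m) (sh (ex 9 1 (suc l))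 δ m))))) · (cong -_ (sumℤ-neg _ B · (cong -_ (sumℤ-+ (λ l -> summand m l (ex 9 8 l)) (λ l -> summand m (suc l) (ex 9 1 (suc l))) B)))) · ℤP.neg-involutive _ · shifted B m 8 1 (ℕ.s≤s ℕ.z≤n) l
  where
  miss : ∀ c l -> summand (suc (suc (t3 m))) (t3 (suc l)) (ex 3 c (t3 (suc l))) ≡ + 0
  miss c l = vanish≡ (suc (suc (t3 m))) (t3 (suc l)) (ex-t3 c (suc l)) (at-02 (ex 9 (c ℕ.+ 3) (suc l)) m)
 Nonneg : Seq -> ℕ -> Set
 Nonneg f L = ∀ i -> i ℕ.< L -> + 0 ℤ.≤ f i
 -- The inverse of 1 - q^k has non-negative coefficients.
 D-nonneg : ∀ k f L -> 1 ℕ.≤ k -> Nonneg (D k f) L -> Nonneg f L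
 D-nonneg (suc k) f L _ h i l = go (suc i) l i ℕP.≤-refl
  where
  lower : ∀ M -> Nonneg f M -> Nonneg (sh (suc k) f) (suc M)
  lower M hM zero _ = ℤP.≤-refl
  lower M hM (suc j) (ℕ.s≤s l') = low k j l'
   where
   low : ∀ k j -> j ℕ.< M -> + 0 ℤ.≤ sh k f j
   low zero j l = hM j l
   low (suc k) zero l = ℤP.≤-refl
   low (suc k) (suc j) l = low k j (ℕP.<⇒≤ l)
  go : ∀ M -> M ℕ.≤ L -> Nonneg f M
  go (suc M) hM j l' = ℤP.≤-trans (ℤP.+-mono-≤ (h j (ℕP.<-≤-trans l' hM)) (lower M (go M (ℕP.<⇒≤ hM)) j l')) (ℤP.≤-reflexive (solve 2 (λ x y -> x :- y :+ y := x) refl (f j) (sh (suc k) f j)))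
 D-cancel' : ∀ k {f g L} -> 1 ℕ.≤ k -> D k f ≈[ L ] D k g -> f ≈[ L ] g
 D-cancel' (suc k) {f} {g} {L} _ h = D-cancel k {f} {g} {L} h
 Dl : ℕ -> List ℕ -> Seq -> Seq
 Dl M [] f = f
 Dl M (o ∷ os) f = D (progression 9 o M) (Dl M os f)
 Dl-ext : ∀ M os {f g} -> f ≗ g -> Dl M os f ≗ Dl M os g
 Dl-ext M [] h = h
 Dl-ext M (o ∷ os) h = D-ext (progression 9 o M) (Dl-ext M os h)
 Dl-pull : ∀ M xs y ys f -> Dl M (xs ++ y ∷ ys) f ≗ D (progression 9 y M) (Dl M (xs ++ ys) f)
 Dl-pull M [] y ys f i = refl
 Dl-pull M (x ∷ xs) y ys f i = D-ext (progression 9 x M) (Dl-pull M xs y ys f) i · D-comm (progression 9 x M) (progression 9 y M) (Dl M (xs ++ ys) f) i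
 Dl-D : ∀ M os k f -> Dl M os (D k f) ≗ D k (Dl M os f)
 Dl-D M [] k f i = refl
 Dl-D M (o ∷ os) k f i = D-ext (progression 9 o M) (Dl-D M os k f) i · D-comm (progression 9 o M) k (Dl M os f) i
 progression≥1 : ∀ M o -> 1 ℕ.≤ o -> 1 ℕ.≤ progression 9 o M
 progression≥1 M o h = ℕP.≤-trans h (ℕP.m≤n+m o (9 ℕ.* M))
 nine : List ℕ
 nine = 9 ∷ 8 ∷ 7 ∷ 6 ∷ 5 ∷ 4 ∷ 3 ∷ 2 ∷ 1 ∷ []
 -- In (q; q) the exponents congruent to 0, a, b modulo 9 make up the theta product. Dividing it out
 -- leaves the reciprocal of the product over the other six classes.
 module Residues (a b : ℕ) (ab : a ℕ.+ b ≡ 9) (ha : 1 ℕ.≤ a) (hb : 1 ℕ.≤ b) (six : List ℕ) (six≥1 : All (1 ℕ.≤_) six)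
  (sorted : ∀ M f -> Dl M nine f ≗ Dl M (9 ∷ a ∷ b ∷ six) f) where
  open Expansion 8 a b ab ha hb using (theta; factors)
  S Tz : ℕ -> Seq -> Seq
  S zero f = f
  S (suc M) f = Dl M six (S M f)
  Tz zero f = f
  Tz (suc M) f = Dl M (9 ∷ a ∷ b ∷ []) (Tz M f)
  Tz-D : ∀ M k f -> Tz M (D k f) ≗ D k (Tz M f)
  Tz-D zero k f i = refl
  Tz-D (suc M) k f i = Dl-ext M (9 ∷ a ∷ b ∷ []) (Tz-D M k f) i · Dl-D M (9 ∷ a ∷ b ∷ []) k (Tz M f) i
  Tz-Dl : ∀ M N os f -> Tz M (Dl N os f) ≗ Dl N os (Tz M f)
  Tz-Dl M N [] f i = refl
  Tz-Dl M N (o ∷ os) f i = Tz-D M (progression 9 o N) (Dl N os f) i · D-ext (progression 9 o N) (Tz-Dl M N os f) i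
  all≗ : ∀ M f -> E 1 (M ℕ.* 9) f ≗ Tz M (S M f)
  all≗ zero f i = refl
  all≗ (suc M) f i = peel 9 i · Dl-ext M nine (all≗ M f) i · sorted M (Tz M (S M f)) i · Dl-ext M (9 ∷ a ∷ b ∷ []) (λ y -> sym (Tz-Dl M M six (S M f) y)) i
   where
   down : ℕ -> List ℕ
   down zero = []
   down (suc o) = suc o ∷ down o
   peel : ∀ o -> E 1 (o ℕ.+ M ℕ.* 9) f ≗ Dl M (down o) (E 1 (M ℕ.* 9) f)
   peel zero i = refl
   peel (suc o) i = E-suc 1 (o ℕ.+ M ℕ.* 9) f i · cong (λ x -> D x (E 1 (o ℕ.+ M ℕ.* 9) f) i) (solveⁿ 2 (λ o M -> (conⁿ 1 ⊹ (o ⊹ M ⊛ conⁿ 9)) ⊛ conⁿ 1 ≔ conⁿ 9 ⊛ M ⊹ (conⁿ 1 ⊹ o)) refl o M) · D-ext (progression 9 (suc o) M) (peel o) i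
  theta≗ : ∀ M f -> E 9 M (Fac (progression 9 a) (progression 9 b) M f) ≗ Tz M f
  theta≗ zero f i = refl
  theta≗ (suc M) f i = E-suc 9 M (Fac pa pb M (D (pa M) (D (pb M) f))) i · cong (λ x -> D x (E 9 M (Fac pa pb M (D (pa M) (D (pb M) f)))) i) (solveⁿ 1 (λ M -> (conⁿ 1 ⊹ M) ⊛ conⁿ 9 ≔ conⁿ 9 ⊛ M ⊹ conⁿ 9) refl M) · D-ext (progression 9 9 M) (λ y -> trans (theta≗ M (D (pa M) (D (pb M) f)) y) (Tz-D M (pa M) (D (pb M) f) y · D-ext (pa M) (Tz-D M (pb M) f) y)) i
   where
   pa pb : ℕ -> ℕ
   pa = progression 9 a
   pb = progression 9 b
  Tz-cancel : ∀ M {f g L} -> Tz M f ≈[ L ] Tz M g -> f ≈[ L ] g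
  Tz-cancel zero h = h
  Tz-cancel (suc M) h = Tz-cancel M (D-cancel' (progression 9 b M) (progression≥1 M b hb) (D-cancel' (progression 9 a M) (progression≥1 M a ha) (D-cancel' (progression 9 9 M) (progression≥1 M 9 (ℕ.s≤s ℕ.z≤n)) h)))
  Dl-nonneg : ∀ M os f L -> All (1 ℕ.≤_) os -> Nonneg (Dl M os f) L -> Nonneg f L
  Dl-nonneg M [] f L _ h = h
  Dl-nonneg M (o ∷ os) f L (p ∷ ps) h = Dl-nonneg M os f L ps (D-nonneg (progression 9 o M) (Dl M os f) L (progression≥1 M o p) h)
  S-nonneg : ∀ M f L -> Nonneg (S M f) L -> Nonneg f L
  S-nonneg zero f L h = h
  S-nonneg (suc M) f L h = S-nonneg M f L (Dl-nonneg M six (S M f) L six≥1 h)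
  -- Both sides carry the theta product `Tz`; cancelling it shows that the six remaining factors
  -- times f equal 1 to order L, so f is a product of geometric series there.
  nonneg : ∀ M f L -> L ℕ.≤ suc (9 ℕ.* M) -> E 1 (M ℕ.* 9) f ≈[ L ] Θ 9 a b M -> Nonneg f L
  nonneg M f L hL h = S-nonneg M f L (λ i l -> ℤP.≤-trans (δ₀ i) (ℤP.≤-reflexive (sym (Tz-cancel M {S M f} {δ} {L} (λ i l -> trans (sym (all≗ M f i)) (h i l · sym (theta M 0 i (ℕP.<-≤-trans l hL)) · theta≗ M δ i)) i l))))
   where
   δ₀ : ∀ i -> + 0 ℤ.≤ δ i
   δ₀ zero = ℤ.+≤+ ℕ.z≤n
   δ₀ (suc i) = ℤP.≤-refl
 comp : ℕ -> Seq -> Seq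
 comp c f m = f (t3 m ℕ.+ c)
 -- Factors in q³ respect residue classes, so on one class they act as factors in q.
 comp-E : ∀ c -> c ℕ.< 3 -> ∀ R f m -> E 3 R f (t3 m ℕ.+ c) ≡ E 1 R (comp c f) m
 comp-E c hc zero f m = refl
 comp-E c hc (suc R) f m = comp-E c hc R (D (suc R ℕ.* 3) f) m · E-ext 1 R (λ m -> cong (λ y -> f (t3 m ℕ.+ c) - y) (comp-sh (suc R) m)) m
  where
  comp-sh : ∀ x m -> sh (x ℕ.* 3) f (t3 m ℕ.+ c) ≡ sh (x ℕ.* 1) (comp c f) m
  comp-sh zero m = refl
  comp-sh (suc x) zero = sh-high (suc x ℕ.* 3) f c (ℕP.≤-trans hc (ℕP.m≤m+n 3 (x ℕ.* 3)))
  comp-sh (suc x) (suc m) = comp-sh x m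
 Fac-cong : ∀ {p p' q q'} -> (∀ i -> p i ≡ p' i) -> (∀ i -> q i ≡ q' i) -> ∀ n f -> Fac p q n f ≗ Fac p' q' n f
 Fac-cong hp hq zero f i = refl
 Fac-cong {p} {p'} {q} {q'} hp hq (suc n) f i = Fac-cong hp hq n (D (p n) (D (q n) f)) i · Fac-ext p' q' n (λ y -> cong₂ (λ u v -> D u (D v f) y) (hp n) (hq n)) i
 module Small (n : ℕ) where
  M R : ℕ
  M = suc n
  R = M ℕ.* 9
  -- Euler's pentagonal number theorem, valid up to order 3n because the omitted factors start
  -- beyond it.
  pent : E 3 R (Pseq n) ≈[ suc (3 ℕ.* n) ] Θ 3 1 2 (t3 M)
  pent i l = E-ext 3 R (Fac-cong (λ i -> trans (cong suc (t3≡ i)) (solveⁿ 1 (λ i -> conⁿ 1 ⊹ i ⊛ conⁿ 3 ≔ conⁿ 3 ⊛ i ⊹ conⁿ 1) refl i)) (λ i -> trans (cong (λ x -> suc (suc x)) (t3≡ i)) (solveⁿ 1 (λ i -> conⁿ 2 ⊹ i ⊛ conⁿ 3 ≔ conⁿ 3 ⊛ i ⊹ conⁿ 2) refl i)) n δ) i · cong (λ x -> E 3 x (Fac (progression 3 1) (progression 3 2) n δ) i) (sym (ℕP.m∸n+n≡m n≤R)) · Expansion.theta 2 1 2 refl (ℕ.s≤s ℕ.z≤n) (ℕ.s≤s ℕ.z≤n) n (R ℕ.∸ n) i l · sym (Θ-stable 3 1 2 (ℕ.s≤s ℕ.z≤n) (ℕ.s≤s ℕ.z≤n) n (t3 M ℕ.∸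 n) i l) · cong (λ x -> Θ 3 1 2 x i) (ℕP.m∸n+n≡m n≤t3)
   where
   n≤t3 : n ℕ.≤ t3 M
   n≤t3 = ℕP.≤-trans (ℕP.≤-trans (ℕP.m≤m*n n 3) (ℕP.≤-reflexive (sym (t3≡ n)))) (ℕP.m≤n+m (t3 n) 3)
   n≤R : n ℕ.≤ R
   n≤R = ℕP.≤-trans (ℕP.m≤m*n n 9) (ℕP.m≤n+m (n ℕ.* 9) 9)
  bound : ∀ c m -> c ℕ.+ 3 ℕ.* m ℕ.≤ 3 ℕ.* n -> t3 m ℕ.+ c ℕ.< suc (3 ℕ.* n)
  bound c m h = ℕ.s≤s (ℕP.≤-trans (ℕP.≤-reflexive (cong (ℕ._+ c) (t3≡ m) · solveⁿ 2 (λ m c -> m ⊛ conⁿ 3 ⊹ c ≔ c ⊹ conⁿ 3 ⊛ m) refl m c)) h)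
  9M : ∀ L -> L ℕ.≤ suc n -> L ℕ.≤ suc (9 ℕ.* M)
  9M L h = ℕP.≤-trans h (ℕP.≤-trans (ℕP.m≤n*m M 9) (ℕP.n≤1+n (9 ℕ.* M)))
  E-neg : ∀ d m f -> E d m (λ i -> - f i) ≗ (λ i -> - E d m f i)
  E-neg d m f i = E-ext d m (λ i -> solve 1 (λ x -> :- x := (:- con (+ 1)) :* x) refl (f i)) i · E-* d m (- + 1) f i · solve 1 (λ x -> (:- con (+ 1)) :* x := :- x) refl (E d m f i)
  small-A : ∀ m -> m ℕ.≤ n -> + 0 ℤ.≤ Pseq n (t3 m)
  small-A m h = subst (λ x -> + 0 ℤ.≤ Pseq n x) (ℕP.+-identityʳ (t3 m)) (Residues.nonneg 4 5 refl (ℕ.s≤s ℕ.z≤n) (ℕ.s≤s ℕ.z≤n) (8 ∷ 7 ∷ 6 ∷ 3 ∷ 2 ∷ 1 ∷ []) (o ∷ o ∷ o ∷ o ∷ o ∷ o ∷ [])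
   (λ M f -> D-ext (progression 9 9 M) (λ y -> trans (Dl-pull M (8 ∷ 7 ∷ 6 ∷ 5 ∷ []) 4 (3 ∷ 2 ∷ 1 ∷ []) f y) (D-ext (progression 9 4 M) (Dl-pull M (8 ∷ 7 ∷ 6 ∷ []) 5 (3 ∷ 2 ∷ 1 ∷ []) f) y)))
    M (comp 0 (Pseq n)) (suc n) (9M (suc n) ℕP.≤-refl) (λ m l -> trans (sym (comp-E 0 (ℕ.s≤s ℕ.z≤n) R (Pseq n) m)) (pent (t3 m ℕ.+ 0) (bound 0 m (ℕP.*-monoʳ-≤ 3 (ℕP.≤-pred l))) · cong (Θ 3 1 2 (t3 M)) (ℕP.+-identityʳ (t3 m)) · dissect₀ M m)) m (ℕ.s≤s h))
   where
   o : ∀ {k} -> 1 ℕ.≤ suc k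
   o = ℕ.s≤s ℕ.z≤n
  small-B : ∀ m -> m ℕ.< n -> + 0 ℤ.≤ - Pseq n (suc (t3 m))
  small-B m h = subst (λ x -> + 0 ℤ.≤ - Pseq n x) (ℕP.+-comm (t3 m) 1) (Residues.nonneg 7 2 refl (ℕ.s≤s ℕ.z≤n) (ℕ.s≤s ℕ.z≤n) (8 ∷ 6 ∷ 5 ∷ 4 ∷ 3 ∷ 1 ∷ []) (o ∷ o ∷ o ∷ o ∷ o ∷ o ∷ [])
   (λ M f -> D-ext (progression 9 9 M) (λ y -> trans (Dl-pull M (8 ∷ []) 7 (6 ∷ 5 ∷ 4 ∷ 3 ∷ 2 ∷ 1 ∷ []) f y) (D-ext (progression 9 7 M) (Dl-pull M (8 ∷ 6 ∷ 5 ∷ 4 ∷ 3 ∷ []) 2 (1 ∷ []) f) y)))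
    M (λ m -> - comp 1 (Pseq n) m) n (9M n (ℕP.n≤1+n n)) (λ m l -> trans (E-neg 1 R (comp 1 (Pseq n)) m) ((cong -_ (sym (comp-E 1 (ℕ.s≤s (ℕ.s≤s ℕ.z≤n)) R (Pseq n) m) · pent (t3 m ℕ.+ 1) (bound 1 m (below 1 m (ℕ.s≤s ℕ.z≤n) l)) · cong (Θ 3 1 2 (t3 M)) (ℕP.+-comm (t3 m) 1))) · dissect₁ M m (ℕP.m<n⇒m<1+n l))) m h)
   where
   o : ∀ {k} -> 1 ℕ.≤ suc k
   o = ℕ.s≤s ℕ.z≤n
   below : ∀ c m -> c ℕ.≤ 3 -> m ℕ.< n -> c ℕ.+ 3 ℕ.* m ℕ.≤ 3 ℕ.* n
   below c m hc l = ℕP.≤-trans (ℕP.+-monoˡ-≤ (3 ℕ.* m) hc) (ℕP.≤-trans (ℕP.≤-reflexive (sym (ℕP.*-suc 3 m))) (ℕP.*-monoʳ-≤ 3 l))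
  small-C : ∀ m -> m ℕ.< n -> + 0 ℤ.≤ - Pseq n (suc (suc (t3 m)))
  small-C m h = subst (λ x -> + 0 ℤ.≤ - Pseq n x) (ℕP.+-comm (t3 m) 2) (Residues.nonneg 8 1 refl (ℕ.s≤s ℕ.z≤n) (ℕ.s≤s ℕ.z≤n) (7 ∷ 6 ∷ 5 ∷ 4 ∷ 3 ∷ 2 ∷ []) (o ∷ o ∷ o ∷ o ∷ o ∷ o ∷ [])
   (λ M f -> D-ext (progression 9 9 M) (D-ext (progression 9 8 M) (Dl-pull M (7 ∷ 6 ∷ 5 ∷ 4 ∷ 3 ∷ 2 ∷ []) 1 [] f)))
    M (λ m -> - comp 2 (Pseq n) m) n (9M n (ℕP.n≤1+n n)) (λ m l -> trans (E-neg 1 R (comp 2 (Pseq n)) m) ((cong -_ (sym (comp-E 2 (ℕ.s≤s (ℕ.s≤s (ℕ.s≤s ℕ.z≤n))) R (Pseq n) m) · pent (t3 m ℕ.+ 2) (bound 2 m (below 2 m (ℕ.s≤s (ℕ.s≤s ℕ.z≤n)) l)) · cong (Θ 3 1 2 (t3 M)) (ℕP.+-comm (t3 m) 2))) · dissect₂ M m (ℕP.m<n⇒m<1+n l))) m h)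
   where
   o : ∀ {k} -> 1 ℕ.≤ suc k
   o = ℕ.s≤s ℕ.z≤n
   below : ∀ c m -> c ℕ.≤ 3 -> m ℕ.< n -> c ℕ.+ 3 ℕ.* m ℕ.≤ 3 ℕ.* n
   below c m hc l = ℕP.≤-trans (ℕP.+-monoˡ-≤ (3 ℕ.* m) hc) (ℕP.≤-trans (ℕP.≤-reflexive (sym (ℕP.*-suc 3 m))) (ℕP.*-monoʳ-≤ 3 l))

-- From the saddle-point estimate to the sign of a coefficient

module H2 where
 open Q1
 open E1
 open U1
 open P1
 open F1
 open G2 using (sum-split)
 open G3
 open H1 using (Seq; sh; D; δ; Fac; Pseq; degree)
 open import Data.Integer using (ℤ)
 open import Data.Rational using (mkℚ)
 fromℤ : ℤ -> ℚ
 fromℤ z = mkℚ z 0 (Cop.sym (Cop.1-coprimeTo ℤ.∣ z ∣))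
 opaque
  unfolding _+_
  fromℤ-+ : ∀ x y -> fromℤ (x ℤ.+ y) ≡ fromℤ x + fromℤ y
  fromℤ-+ x y = sym (cong (λ z -> z ℚ./ 1) (cong₂ ℤ._+_ (ℤP.*-identityʳ x) (ℤP.*-identityʳ y)) · ℚP.↥p/↧p≡p (fromℤ (x ℤ.+ y)))
  fromℤ-neg : ∀ x -> fromℤ (ℤ.- x) ≡ - fromℤ x
  fromℤ-neg (ℤ.+ zero) = refl
  fromℤ-neg (ℤ.+ suc n) = refl
  fromℤ-neg ℤ.-[1+ n ] = refl
 nonneg-fromℤ : ∀ z -> 0# ≤ fromℤ z -> ℤ.+ 0 ℤ.≤ z
 nonneg-fromℤ z h = ℤP.≤-trans (ℚP.drop-*≤* h) (ℤP.≤-reflexive (ℤP.*-identityʳ z))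
 sum°-cong : ∀ {f g} n -> (∀ i -> i ℕ.< n -> f i ≡ g i) -> sum° f n ≡ sum° g n
 sum°-cong zero h = refl
 sum°-cong (suc n) h = cong₂ _+°_ (sum°-cong n (λ i l -> h i (ℕP.m<n⇒m<1+n l))) (h n (ℕP.n<1+n n))
 sum°-*ˡ : ∀ k f n -> sum° (λ i -> k *° f i) n ≡ k *° sum° f n
 sum°-*ˡ k f zero = solve° 1 (λ k -> Κ 0° := k :* Κ 0°) refl k
 sum°-*ˡ k f (suc n) = cong (_+° k *° f n) (sum°-*ˡ k f n) · solve° 3 (λ k a b -> k :* a :+ k :* b := k :* (a :+ b)) refl k _ _
 sum°-front : ∀ f n -> sum° f (suc n) ≡ f 0 +° sum° (λ i -> f (suc i)) n
 sum°-front f zero = solve° 1 (λ x -> Κ 0° :+ x := x :+ Κ 0°) refl _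
 sum°-front f (suc n) = cong (_+° f (suc n)) (sum°-front f n) · solve° 3 (λ x y z -> x :+ y :+ z := x :+ (y :+ z)) refl _ _ _
 val : Seq -> ℕ -> 𝔼 -> 𝔼
 val f L s = sum° (λ j -> ofℚ (fromℤ (f j)) *° s ^° j) L
 Supp : Seq -> ℕ -> Set
 Supp f B = ∀ i -> B ℕ.≤ i -> f i ≡ ℤ.+ 0
 zero-term : ∀ y -> ofℚ 0# *° y ≡ 0°
 zero-term y = solve° 1 (λ y -> Κ 0° :* y := Κ 0°) refl y
 val-tail : ∀ f B d s -> Supp f B -> val f (d ℕ.+ B) s ≡ val f B s
 val-tail f B zero s h = refl
 val-tail f B (suc d) s h = (cong₂ _+°_ (val-tail f B d s h) (cong (λ z -> ofℚ (fromℤ z) *° s ^° (d ℕ.+ B)) (h (d ℕ.+ B) (ℕP.m≤n+m B d)) · zero-term _)) · solve° 1 (λ x -> x :+ Κ 0° := x) refl _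
 val-sh : ∀ k f M s -> val (sh k f) (k ℕ.+ M) s ≡ s ^° k *° val f M s
 val-sh zero f M s = sum°-cong M (λ i _ -> refl) · solve° 1 (λ x -> x := Κ 1° :* x) refl _
 val-sh (suc k) f M s = sum°-front _ (k ℕ.+ M) · (cong₂ _+°_ (zero-term (s ^° 0)) (sum°-cong (k ℕ.+ M) (λ i _ -> solve° 3 (λ a s y -> a :* (s :* y) := s :* (a :* y)) refl _ s _) · sum°-*ˡ s _ (k ℕ.+ M))) · cong (λ v -> 0° +° s *° v) (val-sh k f M s) · solve° 3 (λ s y v -> Κ 0° :+ s :* (y :* v) := s :* y :* v) refl s _ _
 val-D : ∀ k f B L s -> Supp f B -> k ℕ.+ B ℕ.≤ L -> val (D k f) L s ≡ (1° -° s ^° k) *° val f L s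
 val-D k f B L s h l = go L · cong₂ (λ x y -> x -° y) (refl {x = val f L s}) shifted · solve° 2 (λ v y -> v :- y :* v := (Κ 1° :- y) :* v) refl _ _
  where
  go : ∀ L -> val (D k f) L s ≡ val f L s -° val (sh k f) L s
  go zero = solve° 0 (Κ 0° := Κ 0° :- Κ 0°) refl
  go (suc L) = (cong₂ _+°_ (go L) (cong (_*° s ^° L) (cong ofℚ (fromℤ-+ (f L) (ℤ.- sh k f L) · cong (fromℤ (f L) +_) (fromℤ-neg (sh k f L))) · ofℚ-+ _ _ · cong (ofℚ (fromℤ (f L)) +°_) (ofℚ-neg _)))) · solve° 5 (λ x y a b s -> (x :- y) :+ (a :- b) :* s := (x :+ a :* s) :- (y :+ b :* s)) refl _ _ _ _ _
  M d : ℕ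
  d = L ℕ.∸ (k ℕ.+ B)
  M = d ℕ.+ B
  kM : k ℕ.+ M ≡ L
  kM = (sym (ℕP.+-assoc k d B) · cong (ℕ._+ B) (ℕP.+-comm k d) · ℕP.+-assoc d k B) · ℕP.m∸n+n≡m l
  shifted : val (sh k f) L s ≡ s ^° k *° val f L s
  shifted = cong (λ L -> val (sh k f) L s) (sym kM) · val-sh k f M s · cong (s ^° k *°_) (val-tail f B d s h · sym (cong (λ L -> val f L s) (sym (ℕP.+-assoc k d B · kM)) · val-tail f B (k ℕ.+ d) s h))
 Supp-D : ∀ k f B -> Supp f B -> Supp (D k f) (k ℕ.+ B)
 Supp-D k f B h i l = cong₂ ℤ._-_ (h i (ℕP.≤-trans (ℕP.m≤n+m B k) l)) (cong (sh k f) (sym (ℕP.m+[n∸m]≡n k≤i)) · H1.sh-at k f (i ℕ.∸ k) · h (i ℕ.∸ k) (ℕP.+-cancelˡ-≤ k B (i ℕ.∸ k) (ℕP.≤-trans l (ℕP.≤-reflexive (sym (ℕP.m+[n∸m]≡n k≤i))))))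
  where
  k≤i : k ℕ.≤ i
  k≤i = ℕP.≤-trans (ℕP.m≤m+n k B) l
 degree≥ : ∀ p q n B -> B ℕ.≤ degree p q n B
 degree≥ p q zero B = ℕP.≤-refl
 degree≥ p q (suc n) B = ℕP.≤-trans (ℕP.≤-trans (ℕP.m≤n+m B (q n)) (ℕP.m≤n+m (q n ℕ.+ B) (p n))) (degree≥ p q n (p n ℕ.+ (q n ℕ.+ B)))
 val-Fac : ∀ n f B L s -> Supp f B -> degree a b n B ℕ.≤ L -> val (Fac a b n f) L s ≡ P s n *° val f L s
 val-Fac zero f B L s h l = solve° 1 (λ x -> x := Κ 1° :* x) refl _
 val-Fac (suc n) f B L s h l = val-Fac n _ (a n ℕ.+ (b n ℕ.+ B)) L s (Supp-D (a n) _ _ (Supp-D (b n) f B h)) l · cong (P s n *°_) (val-D (a n) (D (b n) f) (b n ℕ.+ B) L s (Supp-D (b n) f B h) l' · cong ((1° -° s ^° a n) *°_) (val-D (b n) f B L s h (ℕP.≤-trans (ℕP.m≤n+m (b n ℕ.+ B) (a n)) l'))) · solve° 4 (λ p x y v -> p :* (x :* (y :* v)) := p :* (x :* y) :* v) refl _ _ _ _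
  where
  l' : a n ℕ.+ (b n ℕ.+ B) ℕ.≤ L
  l' = ℕP.≤-trans (degree≥ a b n (a n ℕ.+ (b n ℕ.+ B))) l
 val-δ : ∀ d s -> val δ (d ℕ.+ 1) s ≡ 1°
 val-δ d s = val-tail δ 1 d s (λ { (suc i) _ -> refl }) · solve° 0 (Κ 0° :+ Κ 1° :* Κ 1° := Κ 1°) refl
 val-P : ∀ n L s -> degree a b n 1 ℕ.≤ L -> val (Pseq n) L s ≡ P s n
 val-P n L s l = val-Fac n δ 1 L s (λ { (suc i) _ -> refl }) l · cong (P s n *°_) (cong (λ L -> val δ L s) (sym (ℕP.m∸n+n≡m (ℕP.≤-trans (degree≥ a b n 1) l))) · val-δ (L ℕ.∸ 1) s) · solve° 1 (λ x -> x :* Κ 1° := x) refl _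
 σ : ℕ -> ℤ
 σ 0 = ℤ.+ 1
 σ 1 = ℤ.- ℤ.+ 1
 σ 2 = ℤ.- ℤ.+ 1
 σ (suc (suc (suc m))) = σ m
 Good : ℕ -> ℕ -> Set
 Good n m = ℤ.+ 0 ℤ.≤ σ m ℤ.* Pseq n m
 -- The phase ε ω^(-m) has trace 2 for m divisible by 3 and, with ε = -1, trace 1 otherwise; this is
 -- what makes the peak contribution positive in every class.
 sign-data : ∀ m -> (σ m ≡ ℤ.+ 1 × 1# ≤ Tr (ofℚ 1# *° conj (ω ^° m))) ⊎ (σ m ≡ ℤ.- ℤ.+ 1 × 1# ≤ Tr (ofℚ (- 1#) *° conj (ω ^° m)))
 sign-data 0 = inj₁ (refl , ≤-trans (gap≤ lit (cong Tr (cong (1° *°_) (conj-ofℚ 1#) · solve° 0 (Κ 1° :* Κ 1° := Κ 1°) refl) · Tr-ofℚ 1#)) ≤-refl)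
 sign-data 1 = inj₂ (refl , of≡ (sym (cong Tr ((cong₂ _*°_ (ofℚ-neg 1#) (conj-* ω 1° · (cong₂ _*°_ conj-ω (conj-ofℚ 1#)))) · solve° 0 ((:- Κ 1°) :* (Κ ω̄ :* Κ 1°) := :- Κ ω̄) refl) · t)))
  where
  opaque
   unfolding _+°_
   t : Tr (-° ω̄) ≡ 1#
   t = solve 0 (let m = Κ (ℚ.- 1#) in (:- m) :+ (:- m) :- (:- m) := Κ 1#) refl
 sign-data 2 = inj₂ (refl , of≡ (sym (cong Tr ((cong₂ _*°_ (ofℚ-neg 1#) (conj-^ ω 2 · cong (_^° 2) conj-ω)) · solve° 0 ((:- Κ 1°) :* (Κ ω̄ :* (Κ ω̄ :* Κ 1°)) := :- Κ ω) refl) · t)))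
  where
  opaque
   unfolding _+°_
   t : Tr (-° ω) ≡ 1#
   t = solve 0 ((:- Κ 0#) :+ (:- Κ 0#) :- (:- Κ 1#) := Κ 1#) refl
 sign-data (suc (suc (suc m))) = shift (sign-data m)
  where
  cube : ω ^° suc (suc (suc m)) ≡ ω ^° m
  cube = solve° 1 (λ x -> Κ ω :* (Κ ω :* (Κ ω :* x)) := x) refl _
  shift : _ -> _
  shift (inj₁ (p , q)) = inj₁ (p , ≤-trans q (of≡ (cong (λ x -> Tr (ofℚ 1# *° conj x)) (sym cube))))
  shift (inj₂ (p , q)) = inj₂ (p , ≤-trans q (of≡ (cong (λ x -> Tr (ofℚ (- 1#) *° conj x)) (sym cube))))
 module Coefficient (r : ℚ) (r₊ : 0# < r) (r₁ : r ≤ 1#) (n : ℕ) (hn : 7000 ℕ.< n) (h747 : (1# - r * (r * r)) * c 747 10 ≤ 1#)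
  (m s : ℕ) where
  open R1 using (module Main)
  open Main r r₊ r₁ using (V; μ)
  good : V n + (μ n - ι m) * (μ n - ι m) ≤ ι s * ι s -> ι s * ι s ≤ c 1003 1000 * V n -> Good n m
  good hs hs' = by-sign (sign-data m)
   where
   Nω : N (ω ^° m) ≡ 1#
   Nω = N-^ ω m · cong (_^ m) (cong N (solve° 0 (Κ ω := Κ ω :* Κ 1°) refl) · N-ω* 1° · N1) · 1^ m
    where
    N1 : N 1° ≡ 1#
    N1 = N-ofℚ 1# · *-1ˡ 1#
   L : ℕ
   L = suc m ℕ.+ degree a b n 1
   coefficient : ∀ ε -> ε * ε ≡ 1# -> 1# ≤ Tr (ofℚ ε *° conj (ω ^° m)) -> 0# ≤ ε * fromℤ (Pseq n m)
   coefficient ε εε hw = cancel≤ (^₊ m r₊) (*-0ʳ (r ^ m) ≡» Saddle.At.positive r r₊ r₁ n hn h747 m s hs hs' ε hw (N-* _ _ · (cong₂ _*_ (N-ofℚ ε · εε) (N-conj _ · Nω)) · *-1ˡ 1#) εε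
      α β L (ℕP.m≤m+n (suc m) (degree a b n 1)) α≤ -α≤ heval »≡ *-comm _ (r ^ m))
    where
    α β : ℕ -> ℚ
    α j = ε * fromℤ (Pseq n j) * r ^ j
    -- A rational majorant of |α j|; only its finite sum matters.
    β j = 1# + α j * α j
    α≤ : ∀ j -> α j ≤ β j
    α≤ j = gap≤ (sq₀ (α j - c 1 2) +₀ lit) (solve 1 (λ x -> Κ 1# :+ x :* x := x :+ ((x :- κ 1 2) :* (x :- κ 1 2) :+ κ 3 4)) refl _)
    -α≤ : ∀ j -> - α j ≤ β j
    -α≤ j = gap≤ (sq₀ (α j + c 1 2) +₀ lit) (solve 1 (λ x -> Κ 1# :+ x :* x := (:- x) :+ ((x :+ κ 1 2) :* (x :+ κ 1 2) :+ κ 3 4)) refl _)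
    heval : ∀ u -> eval α L u ≡ ofℚ ε *° P (ofℚ r *° u) n
    heval u = sum°-cong L (λ j _ -> trans (cong (_*° u ^° j) (ofℚ-* _ _ · cong (_*° ofℚ (r ^ j)) (ofℚ-* ε _))) (solve° 4 (λ e p r u -> e :* p :* r :* u := e :* (p :* (r :* u))) refl _ _ _ _ · cong (λ y -> ofℚ ε *° (ofℚ (fromℤ (Pseq n j)) *° y)) (sym (scaled-^ r u j)))) · sum°-*ˡ (ofℚ ε) _ L · cong (ofℚ ε *°_) (val-P n L (ofℚ r *° u) (ℕP.m≤n+m (degree a b n 1) (suc m)))
   by-sign : _ -> Good n m
   by-sign (inj₁ (e , h)) = ℤP.≤-trans (nonneg-fromℤ (Pseq n m) (coefficient 1# (*-1ˡ 1#) h »≡ *-1ˡ _)) (ℤP.≤-reflexive (sym (cong (ℤ._* Pseq n m) e · ℤP.*-identityˡ _)))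
   by-sign (inj₂ (e , h)) = ℤP.≤-trans (nonneg-fromℤ (ℤ.- Pseq n m) (coefficient (- 1#) (solve 0 ((:- Κ 1#) :* (:- Κ 1#) := Κ 1#) refl) h »≡ solve 1 (λ x -> (:- Κ 1#) :* x := :- x) refl _ · sym (fromℤ-neg (Pseq n m))))
    (ℤP.≤-reflexive (sym (cong (ℤ._* Pseq n m) e · ℤP.-1*i≡-i _)))

-- Choosing the radius: the mean as a function of r

module H3 where
 open Q1
 open U1
 open R1 using (module Main; e)
 open N2 using (ι-a; ι-e; pow3)
 open N5 using (7000<⇒)
 open F2 using (archimedes)
 open G2 using (module Assemble)
 open H2
 open H1 using (Pseq)
 root : ∀ U k -> 0# ≤ U -> U ≤ ι k * ι k -> Σ ℕ λ s -> (ι s * ι s ≤ U) × (U ≤ ι (suc s) * ι (suc s))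
 root U zero U₀ h = 0 , ≤-trans (of≡ (*-0ˡ 0#)) U₀ , ≤-trans h (*≤ {q = ι 1} (ι₀ 0) (ι₀ 1) (ι₀ 1) (ι₀ 1))
 root U (suc k) U₀ h = go (≤-total U (ι k * ι k))
  where
  go : _ -> _
  go (inj₁ l) = root U k U₀ l
  go (inj₂ l) = k , l , h
 square-above : ∀ U -> 0# ≤ U -> Σ ℕ λ s -> (ι s * ι s ≤ U) × (U ≤ ι (suc s) * ι (suc s))
 square-above U U₀ = root U (suc (proj₁ (archimedes U))) U₀ (proj₂ (archimedes U) » gap≤ (lit +₀ ι₀ (proj₁ (archimedes U)) +₀ sq₀ k) (solve 1 (λ k -> (Κ 1# :+ k) :* (Κ 1# :+ k) := k :+ (Κ 1# :+ k :+ k :* k)) refl k))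
  where
  k : ℚ
  k = ι (proj₁ (archimedes U))
 -- For V ≥ 4000000 consecutive squares near V differ by less than 0.2 percent of V, so an integer s
 -- exists in the required window.
 next-square : ∀ {V U s} -> c 4000000 1 ≤ V -> U ≤ c 1001 1000 * V -> 0# ≤ s -> s * s ≤ U -> (1# + s) * (1# + s) ≤ c 1003 1000 * V
 next-square {V} {U} {s} hV hU s₀ hs = gap≤
  (lit *₀ gap s≤ +₀ gap ss +₀ (lit *₀ gap hV +₀ lit)) (solve 2 (λ V s -> κ 1003 1000 :* V := (Κ 1# :+ s) :* (Κ 1# :+ s) :+ (κ 2 1 :* (κ 9 10000 :* V :- s) :+ (κ 1001 1000 :* V :- s :* s) :+ (κ 2 10000 :* (V :- κ 4000000 1) :+ κ 799 1))) refl V s)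
  where
  κV : ℚ
  κV = c 9 10000 * V
  V₀ : 0# ≤ V
  V₀ = lit » hV
  ss : s * s ≤ c 1001 1000 * V
  ss = hs » hU
  s≤ : s ≤ κV
  s≤ = sq-cancel (lit *₀ V₀) (ss » gap≤ (V₀ *₀ (lit *₀ gap hV +₀ lit)) (solve 1 (λ V -> κ 9 10000 :* V :* (κ 9 10000 :* V) := κ 1001 1000 :* V :+ V :* (κ 81 100000000 :* (V :- κ 4000000 1) :+ κ 2239 1000)) refl V))
 module Near (r : ℚ) (r₊ : 0# < r) (r₁ : r ≤ 1#) (n m : ℕ) (hn : 7000 ℕ.< n) (h747 : (1# - r * (r * r)) * c 747 10 ≤ 1#) where
  open Main r r₊ r₁ using (V; μ)
  d : ℚ
  d = μ n - ι m
  V≥ : c 4000000 1 ≤ V n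
  V≥ = Assemble.V-large r r₊ r₁ n hn h747
  -- The mean need not equal m: an offset with square at most V/1000 fits into the 0.3 percent
  -- tolerance.
  near : d * d ≤ c 1 1000 * V n -> Good n m
  near h = go (square-above (V n + d * d) (≤-trans lit V≥ +₀ sq₀ d))
   where
   go : _ -> Good n m
   go (s , l , u) = Coefficient.good r r₊ r₁ n hn h747 m (suc s) u (next-square V≥
    (+≤ ≤-refl h »≡ solve 1 (λ V -> V :+ κ 1 1000 :* V := κ 1001 1000 :* V) refl _) (ι₀ s) l)
 module One (r₊ : 0# < 1#) (r₁ : 1# ≤ 1#) where
  open Main 1# r₊ r₁
  x≡ : ∀ i -> x i ≡ 1#
  x≡ i = 1^ (a i)
  v≡ : ∀ i -> v i ≡ c 1 3
  v≡ i = solve 1 (λ v -> v := κ 1 3 :* ((Κ 1# :+ κ 1 2 :* (Κ 1# :+ Κ 1#) :* Κ 1# :+ Κ 1# :* (Κ 1# :* Κ 1#)) :* v)) refl _ · cong (c 1 3 *_) (cong (λ x -> (1# + λ' * x + 1# * (x * x)) * v i) (sym (x≡ i)) · nv i) · *-1ʳ _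
  μ̂≡ : ∀ i -> μ̂ i ≡ c 3 1 * ι i + c 4 3
  μ̂≡ i = (cong₂ _*_ (cong₂ _+_ (cong₂ (λ x y -> λ' * x * y) (x≡ i) (ι-a i)) (cong₂ (λ x y -> 1# * (x * x) * y) (x≡ i) (ι-e i))) (v≡ i)) · solve 1 (λ i -> (κ 1 2 :* (Κ 1# :+ Κ 1#) :* Κ 1# :* (Κ 1# :+ κ 3 1 :* i) :+ Κ 1# :* (Κ 1# :* Κ 1#) :* (κ 3 1 :+ κ 6 1 :* i)) :* κ 1 3 := κ 3 1 :* i :+ κ 4 3) refl _
  -- At r = 1 the mean falls k/6 short of the centre 3k²/2, because each trinomial puts its whole
  -- middle weight 1/3 at exponent a instead of sharing it with b.
  μ≡ : ∀ k -> μ k ≡ c 3 2 * (ι k * ι k) - c 1 6 * ι k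
  μ≡ zero = solve 0 (Κ 0# := κ 3 2 :* (Κ 0# :* Κ 0#) :- κ 1 6 :* Κ 0#) refl
  μ≡ (suc k) = (cong₂ _+_ (μ≡ k) (μ̂≡ k)) · solve 1 (λ k -> κ 3 2 :* (k :* k) :- κ 1 6 :* k :+ (κ 3 1 :* k :+ κ 4 3) := κ 3 2 :* ((Κ 1# :+ k) :* (Κ 1# :+ k)) :- κ 1 6 :* (Κ 1# :+ k)) refl _
  V̂≥ : ∀ i -> (1# + c 2 1 * ι i) * (1# + c 2 1 * ι i) ≤ V̂ i
  V̂≥ i = gap≤ ((A₁₀ i *₀ sq₀ _ +₀ A₁₀ i *₀ A₂₀ i *₀ sq₀ _) *₀ sq₀ _) (solve 3 (λ p q v -> (p :+ q) :* v := q :* v :+ p :* v) refl _ _ _ · cong (_+ (A₁ i * (ι (a i) * ι (a i)) + A₁ i * A₂ i * (ι (b i) * ι (b i))) * (v i * v i)) (cong₂ (λ p v -> p * (v * v)) (cong₂ (λ x y -> 1# * (x * x) * (y * y)) (x≡ i) (ι-e i)) (v≡ i) · solve 1 (λ i -> Κ 1# :* (Κ 1# :* Κ 1#) :* ((κ 3 1 :+ κ 6 1 :* i) :* (κ 3 1 :+ κ 6 1 :* i)) :* (κ 1 3 :* κ 1 3) := (Κ 1# :+ κ 2 1 :* i) :* (Κ 1# :+ κ 2 1 :* i)) refl _))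
  V≥ : ∀ k -> ι k * (ι k * ι k) ≤ V k
  V≥ zero = of≡ (*-0ˡ _)
  V≥ (suc k) = gap≤ (sq₀ _ +₀ ι₀ k) (solve 1 (λ k -> k :* (k :* k) :+ (Κ 1# :+ κ 2 1 :* k) :* (Κ 1# :+ κ 2 1 :* k) := (Κ 1# :+ k) :* ((Κ 1# :+ k) :* (Κ 1# :+ k)) :+ (k :* k :+ k)) refl _) » +≤ (V≥ k) (V̂≥ k)
  -- Bridges the gap between the largest mean and the centre of symmetry: an offset of n/6 is
  -- negligible against V ≥ n³.
  centre : ∀ n m -> 7000 ℕ.< n -> μ n ≤ ι m -> ι m ≤ c 3 2 * (ι n * ι n) -> Good n m
  centre n m hn h h' = Near.near 1# r₊ r₁ n m hn (solve 0 ((Κ 1# :- Κ 1# :* (Κ 1# :* Κ 1#)) :* κ 747 10 := Κ 0#) refl ≡» lit) (solve 2 (λ p q -> (p :- q) :* (p :- q) := (q :- p) :* (q :- p)) refl _ _ ≡» *≤ {q = c 1 6 * ι n} (gap h) (lit *₀ ι₀ n) d≤ d≤ » gap≤ (sq₀ _ *₀ (lit *₀ gap (7000<⇒ hn) +₀ lit)) (solve 1 (λ n -> κ 1 1000 :* (n :* (n :* n)) := κ 1 6 :* n :* (κ 1 6 :* n) :+ n :* n :* (κ 1 1000 :* (n :- κ 7000 1) :+ κ 251 36)) refl _) » *≤ʳ lit (V≥ n))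
   where
   d≤ : ι m - μ n ≤ c 1 6 * ι n
   d≤ = gap≤ (gap h') (solve 3 (λ s m k -> κ 1 6 :* k := m :- (s :- κ 1 6 :* k) :+ (s :- m)) refl _ _ _ · cong (λ z -> ι m - z + (c 3 2 * (ι n * ι n) - ι m)) (sym (μ≡ n)))
 module Mean≤ (r : ℚ) (r₊ : 0# < r) (r₁ : r ≤ 1#) where
  open Main r r₊ r₁
  r₀ : 0# ≤ r
  r₀ = <⇒≤ r₊
  v≤1 : ∀ i -> v i ≤ 1#
  v≤1 i = gap≤ (A₁₀ i *₀ v₀ i +₀ A₂₀ i *₀ v₀ i) (solve 3 (λ p q v -> (Κ 1# :+ p :+ q) :* v := v :+ (p :* v :+ q :* v)) refl _ _ _) »≡ nv i
  x≤r : ∀ i -> x i ≤ r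
  x≤r i = *≤ʳ r₀ (^≤1 (t3 i) r₀ r₁) »≡ *-1ʳ r
  A₁≤r : ∀ i -> A₁ i ≤ r
  A₁≤r i = gap≤ (lit *₀ (gap r₁ *₀ x₀ i)) (solve 2 (λ r x -> x := κ 1 2 :* (Κ 1# :+ r) :* x :+ κ 1 2 :* ((Κ 1# :- r) :* x)) refl r _) » x≤r i
  A₂≤r : ∀ i -> A₂ i ≤ r
  A₂≤r i = *≤ʳ r₀ (*≤ (x₀ i) lit (x≤1 i) (x≤1 i) »≡ *-1ˡ 1#) »≡ *-1ʳ r
  mean≤ : ∀ n -> μ n ≤ r * (ι n * (c 2 1 * (c 3 1 + c 6 1 * ι n)))
  mean≤ n = sum-mono n term »≡ sum-const _ n · solve 3 (λ n r k -> n :* (r :* k) := r :* (n :* k)) refl _ r _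
   where
   term : ∀ i -> i ℕ.< n -> μ̂ i ≤ r * (c 2 1 * (c 3 1 + c 6 1 * ι n))
   term i l = *≤ {q = r * k + r * k} (A₁₀ i *₀ ι₀ (a i) +₀ A₂₀ i *₀ ι₀ (e i)) lit
    (+≤ (*≤ (A₁₀ i) k₀ (A₁≤r i) (ι-mono (ℕP.m≤m+n (a i) (b i)) » e≤)) (*≤ (A₂₀ i) k₀ (A₂≤r i) e≤)) (v≤1 i) »≡ solve 2 (λ r k -> (r :* k :+ r :* k) :* Κ 1# := r :* (κ 2 1 :* k)) refl r k
    where
    k : ℚ
    k = c 3 1 + c 6 1 * ι n
    k₀ : 0# ≤ k
    k₀ = lit +₀ lit *₀ ι₀ n
    e≤ : ι (e i) ≤ k
    e≤ = ι-e i ≡» +≤ ≤-refl (*≤ʳ lit (ι-mono (ℕP.<⇒≤ l)))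
  y t' : ℚ
  y = r * (r * r)
  t' = 1# - y
  y₀ : 0# ≤ y
  y₀ = r₀ *₀ sq₀ r
  y₁ : y ≤ 1#
  y₁ = ^≤1 3 r₀ r₁ ∙ solve 1 (λ r -> r :* (r :* (r :* Κ 1#)) := r :* (r :* r)) refl r
   where
   _∙_ : ∀ {p q} -> p ≤ 1# -> p ≡ q -> q ≤ 1#
   h ∙ refl = h
  linear-geometric : ∀ n -> sum (λ i -> (1# + ι i) * y ^ i) n * (t' * t') ≡ 1# - y ^ n * (1# + ι n * t')
  linear-geometric zero = solve 1 (λ t -> Κ 0# :* (t :* t) := Κ 1# :- Κ 1# :* (Κ 1# :+ Κ 0# :* t)) refl t'
  linear-geometric (suc n) = solve 3 (λ s p t -> (s :+ p) :* (t :* t) := s :* (t :* t) :+ p :* (t :* t)) refl _ _ t' · cong (_+ (1# + ι n) * y ^ n * (t' * t')) (linear-geometric n) · solve 3 (λ y n p -> Κ 1# :- p :* (Κ 1# :+ n :* (Κ 1# :- y)) :+ (Κ 1# :+ n) :* p :* ((Κ 1# :- y) :* (Κ 1# :- y)) := Κ 1# :- y :* p :* (Κ 1# :+ (Κ 1# :+ n) :* (Κ 1# :- y))) refl y _ _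
  μ̂≤ : ∀ i -> μ̂ i ≤ c 375 100 * ((1# + ι i) * y ^ i)
  μ̂≤ i = *≤ˡ (v₀ i) (+≤
    (*≤ʳ (A₁₀ i) (gap≤ {q = c 3 1 * (1# + ι i)} lit (solve 1 (λ i -> κ 3 1 :* (Κ 1# :+ i) := Κ 1# :+ κ 3 1 :* i :+ κ 2 1) refl _ · cong (_+ c 2 1) (sym (ι-a i)))))
    (*≤ʳ (A₂₀ i) (gap≤ {q = c 6 1 * (1# + ι i)} lit (solve 1 (λ i -> κ 6 1 :* (Κ 1# :+ i) := κ 3 1 :+ κ 6 1 :* i :+ κ 3 1) refl _ · cong (_+ c 3 1) (sym (ι-e i)))))) » gap≤ ((lit +₀ ι₀ i) *₀ v₀ i *₀ (x₀ i *₀ g₀)) (solve 4 (λ r x i v -> κ 375 100 :* ((Κ 1# :+ i) :* (x :* ((Κ 1# :+ κ 1 2 :* (Κ 1# :+ r) :* x :+ r :* (x :* x)) :* v))) :=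
     (κ 1 2 :* (Κ 1# :+ r) :* x :* (κ 3 1 :* (Κ 1# :+ i)) :+ r :* (x :* x) :* (κ 6 1 :* (Κ 1# :+ i))) :* v
     :+ (Κ 1# :+ i) :* v :* (x :* ((Κ 1# :- r) :* (κ 225 100 :+ κ 1875 1000 :* x) :+ r :* (κ 375 100 :* ((x :- κ 3 10) :* (x :- κ 3 10)) :+ κ 4125 10000)))) refl r _ _ _) » *≤ʳ lit (*≤ʳ (lit +₀ ι₀ i) (cong (x i *_) (nv i) · *-1ʳ (x i) ≡» *≤ˡ (^₀ (t3 i) r₀) r₁ »≡ *-1ˡ _ · pow3 r i))
   where
   g : ℚ
   g = (1# - r) * (c 225 100 + c 1875 1000 * x i) + r * (c 375 100 * ((x i - c 3 10) * (x i - c 3 10)) + c 4125 10000)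
   g₀ : 0# ≤ g
   g₀ = gap r₁ *₀ (lit +₀ lit *₀ x₀ i) +₀ r₀ *₀ (lit *₀ sq₀ _ +₀ lit)
  -- Σ (1 + i) y^i ≤ 1 / (1 - y)² ≤ 74.7², and 3.75 * 74.7² is below 20926.
  μ-bounded : ∀ n -> 1# ≤ t' * c 747 10 -> μ n ≤ c 20926 1
  μ-bounded n h = sum-mono n (λ i _ -> μ̂≤ i) » sum-*ˡ _ _ n ≡» *≤ʳ lit ((sym (*-1ʳ S) ≡» *≤ʳ S₀ (sym (*-1ˡ 1#) ≡» *≤ lit (gap y₁ *₀ lit) h h)) » solve 3 (λ s t k -> s :* (t :* k :* (t :* k)) := k :* k :* (s :* (t :* t))) refl S t' k ≡» *≤ʳ (sq₀ k) (linear-geometric n ≡» gap≤ (^₀ n y₀ *₀ (lit +₀ ι₀ n *₀ gap y₁)) (solve 1 (λ z -> Κ 1# := Κ 1# :- z :+ z) refl _)) »≡ *-1ʳ (k * k)) » gap≤ (lit »≡ solve 0 (Κ (c 20926 1 ℚ.+ (ℚ.- (c 375 100 ℚ.* (c 747 10 ℚ.* c 747 10)))) := κ 20926 1 :- κ 375 100 :* (κ 747 10 :* κ 747 10)) refl) (solve 2 (λ p q -> p := q :+ (p :- q)) refl _ _)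
   where
   k S : ℚ
   k = c 747 10
   S = sum (λ i -> (1# + ι i) * y ^ i) n
   S₀ : 0# ≤ S
   S₀ = sum₀ n (λ i -> (lit +₀ ι₀ i) *₀ ^₀ i y₀)
 module Step (r : ℚ) (r₊ : 0# < r) (r₁ : r ≤ 1#) (h : ℚ) (h₀ : 0# ≤ h) (g₊ : 0# < 1# - h) (r'₊ : 0# < (1# - h) * r) (r'₁ : (1# - h) * r ≤ 1#) where
  g : ℚ
  g = 1# - h
  module M = Main r r₊ r₁
  module M' = Main (g * r) r'₊ r'₁
  open M using (A₁; A₂; x; v)
  g₀ : 0# ≤ g
  g₀ = <⇒≤ g₊
  g₁ : g ≤ 1#
  g₁ = gap≤ h₀ (solve 1 (λ h -> Κ 1# := Κ 1# :- h :+ h) refl h)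
  r₀ : 0# ≤ r
  r₀ = <⇒≤ r₊
  gr≤r : g * r ≤ r
  gr≤r = *≤ˡ r₀ g₁ »≡ *-1ˡ r
  w : ℕ -> ℚ
  w i = g ^ e i
  A₁≥ : ∀ i -> A₁ i * w i ≤ M'.A₁ i
  A₁≥ i = *≤ʳ (M.A₁₀ i) (^-anti {m = b i} {n = e i} g₀ g₁ (ℕP.m≤n+m (b i) (a i))) » solve 4 (λ r g x k -> κ 1 2 :* (Κ 1# :+ r) :* x :* (g :* k) := κ 1 2 :* (g :+ g :* r) :* (k :* x)) refl r g _ _ ≡» *≤ˡ (^₀ (a i) g₀ *₀ M.x₀ i) (*≤ʳ lit (+≤ g₁ ≤-refl)) »≡ cong (M'.λ' *_) (sym (*-^ g r (a i)))
  A₂≥ : ∀ i -> A₂ i * w i ≤ M'.A₂ i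
  A₂≥ i = of≡ (cong (A₂ i *_) (^-+ g (a i) (b i)) · solve 4 (λ r g x k -> r :* (x :* x) :* (k :* (g :* k)) := g :* r :* (k :* x :* (k :* x))) refl r g _ _ · cong (λ z -> g * r * (z * z)) (sym (*-^ g r (a i))))
  x≥ : ∀ i -> M'.x i ≤ x i
  x≥ i = ^-mono (a i) (<⇒≤ r'₊) gr≤r
  n≥ : ∀ i -> M'.n i ≤ M.n i
  n≥ i = +≤ (+≤ ≤-refl (*≤ (lit *₀ (lit +₀ <⇒≤ r'₊)) (M.x₀ i) (*≤ʳ lit (+≤ ≤-refl gr≤r)) (x≥ i)))
   (*≤ (<⇒≤ r'₊) (sq₀ (x i)) gr≤r (*≤ (M'.x₀ i) (M.x₀ i) (x≥ i) (x≥ i)))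
  v≤ : ∀ i -> v i ≤ M'.v i
  v≤ i = cancel≤ (M'.n₊ i) (*≤ˡ (M.v₀ i) (n≥ i) »≡ M.nv i · sym (M'.nv i))
  μ̂≥ : ∀ i -> w i * M.μ̂ i ≤ M'.μ̂ i
  μ̂≥ i = solve 6 (λ w p q r s v -> w :* ((p :* q :+ r :* s) :* v) := (p :* w :* q :+ r :* w :* s) :* v) refl _ _ _ _ _ _ ≡» *≤ (M.A₁₀ i *₀ w₀ *₀ ι₀ (a i) +₀ M.A₂₀ i *₀ w₀ *₀ ι₀ (e i)) (M'.v₀ i) (+≤ (*≤ˡ (ι₀ (a i)) (A₁≥ i)) (*≤ˡ (ι₀ (e i)) (A₂≥ i))) (v≤ i)
   where
   w₀ : 0# ≤ w i
   w₀ = ^₀ (e i) g₀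
  -- Lowering r by the factor 1 - h multiplies weights by at least (1 - h)^e and only decreases the
  -- normalisers, so by Bernoulli the mean drops by at most the fraction C h.
  step : ∀ n C -> (∀ i -> i ℕ.< n -> ι (e i) ≤ C) -> (1# - C * h) * M.μ n ≤ M'.μ n
  step n C hC = sym (sum-*ˡ (1# - C * h) M.μ̂ n) ≡» (sum-mono n λ i l -> ≤-trans (*≤ˡ (μ̂₀ i)
   (gap≤ (gap (hC i l) *₀ h₀) (solve 3 (λ C k h -> Κ 1# :+ k :* (:- h) := Κ 1# :- C :* h :+ (C :- k) :* h) refl C _ h) » bernoulli {p = - h} (e i) g₀)) (μ̂≥ i))
   where
   μ̂₀ : ∀ i -> 0# ≤ M.μ̂ i
   μ̂₀ i = (M.A₁₀ i *₀ ι₀ (a i) +₀ M.A₂₀ i *₀ ι₀ (e i)) *₀ M.v₀ i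

-- Discrete intermediate value argument and conclusion

module H4 where
 open Q1
 open U1
 open R1 using (module Main; e)
 open N2 using (ι-e)
 open N5 using (7000<⇒)
 open H1 hiding (E; D)
 open H2
 open H3
 open J3 using (module Small)
 open import Defs
 open ℕS.+-*-Solver using () renaming (solve to solveⁿ; _:+_ to _⊹_; _:*_ to _⊛_; _:=_ to _≔_; con to conⁿ)
 open import Data.Integer using (ℤ)
 module Grid (n m : ℕ) (hn : 7000 ℕ.< n) (hm : 3 ℕ.* n ℕ.< m) (start : ∀ p q -> ι m ≤ Main.μ 1# p q n) where
  -- C bounds all exponents and the step is 1/H, so one step lowers the mean by at most the fraction
  -- C/H = 1/(m+1). After i₀ steps the radius is so small that the mean is at most 1.
  C H i₀ : ℕ
  C = e n
  H = C ℕ.* suc m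
  i₀ = n ℕ.* (2 ℕ.* C) ℕ.* H
  H₊ : 0# < ι H
  H₊ = ι₊ (m ℕ.+ (t3 n ℕ.+ b n) ℕ.* suc m)
  h g u : ℚ
  h = inv (ι H) H₊
  g = 1# - h
  u = ι C * h
  h₀ : 0# ≤ h
  h₀ = inv₀ (ι H) H₊
  Hh : ι H * h ≡ 1#
  Hh = *-inv (ι H) H₊
  H≥2 : 2 ℕ.≤ H
  H≥2 = ℕP.≤-trans (ℕ.s≤s (ℕP.≤-trans (ℕ.s≤s ℕ.z≤n) (ℕP.m≤n+m (b n) (t3 n)))) (ℕP.m≤m*n C (suc m))
  h≤½ : h ≤ c 1 2
  h≤½ = cancel≤ H₊ (Hh · solve 0 (Κ 1# := (Κ 1# :+ (Κ 1# :+ Κ 0#)) :* κ 1 2) refl ≡» *≤ˡ lit (ι-mono H≥2))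
  g₊ : 0# < g
  g₊ = by-gap< _ (ℚP.positive⁻¹ (c 1 2) +₊ gap h≤½) (solve 1 (λ h -> Κ 1# :- h := Κ 0# :+ (κ 1 2 :+ (κ 1 2 :- h))) refl h)
  g₀ : 0# ≤ g
  g₀ = <⇒≤ g₊
  g₁ : g ≤ 1#
  g₁ = gap≤ h₀ (solve 1 (λ h -> Κ 1# := Κ 1# :- h :+ h) refl h)
  u≡ : u * (1# + ι m) ≡ 1#
  u≡ = solve 3 (λ C h m -> C :* h :* m := C :* m :* h) refl _ h _ · cong (_* h) (sym (ι-* C (suc m))) · Hh
  u₀ : 0# ≤ u
  u₀ = ι₀ C *₀ h₀
  M : ℕ -> ℚ
  M i = Main.μ (g ^ i) (^₊ i g₊) (^≤1 i g₀ g₁) n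
  next : ∀ i -> (1# - u) * M i ≤ M (suc i)
  next i = Step.step (g ^ i) (^₊ i g₊) (^≤1 i g₀ g₁) h h₀ g₊ (^₊ (suc i) g₊) (^≤1 (suc i) g₀ g₁) n (ι C)
   (λ j l -> ≤-trans (of≡ (ι-e j)) (+≤ ≤-refl (*≤ʳ lit (ι-mono (ℕP.<⇒≤ l))) »≡ sym (ι-e n)))
  m≥1 : 1# ≤ ι m
  m≥1 = solve 0 (Κ 1# := Κ 1# :+ Κ 0#) refl ≡» ι-mono (ℕP.≤-trans (ℕ.s≤s ℕ.z≤n) hm)
  decay : ∀ i -> g ^ i * (1# + ι i * h) ≤ 1#
  decay i = *≤ʳ (^₀ i g₀) (bernoulli i (lit +₀ h₀)) » sym (*-^ g (1# + h) i) ≡» ^≤1 i (g₀ *₀ (lit +₀ h₀)) (gap≤ (sq₀ h) (solve 1 (λ h -> Κ 1# := (Κ 1# :- h) :* (Κ 1# :+ h) :+ h :* h) refl h))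
  last : M i₀ ≤ ι m
  last = Mean≤.mean≤ (g ^ i₀) (^₊ i₀ g₊) (^≤1 i₀ g₀ g₁) n » *≤ʳ (^₀ i₀ g₀) (gap≤ lit eq) » decay i₀ » m≥1
   where
   eq : 1# + ι i₀ * h ≡ ι n * (c 2 1 * (c 3 1 + c 6 1 * ι n)) + 1#
   eq = +-comm 1# (ι i₀ * h) · cong (_+ 1#) (cong (_* h) (ι-* (n ℕ.* (2 ℕ.* C)) H) · *-assoc _ (ι H) h · cong (ι (n ℕ.* (2 ℕ.* C)) *_) Hh · *-1ʳ _ · ι-* n (2 ℕ.* C) · cong (ι n *_) (ι-* 2 C · (cong₂ _*_ (solve 0 (Κ 1# :+ (Κ 1# :+ Κ 0#) := κ 2 1) refl) (ι-e n))))
  -- A rational replacement for solving mean = m: the last step across m starts at a mean of at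
  -- least m and loses less than 1.
  search : ∀ i -> M i ≤ ι m -> Σ ℕ λ j -> (M j ≤ ι m) × (ι m ≤ M j + 1#)
  search zero l = 0 , l , ≤-trans (start (^₊ 0 g₊) (^≤1 0 g₀ g₁)) (gap≤ lit refl)
  search (suc i) l = go (≤-total (M i) (ι m))
   where
   go : _ -> _
   go (inj₁ l') = search i l'
   go (inj₂ l') = suc i , l , ≤-trans (gap≤ u₀ (solve 2 (λ u m -> (Κ 1# :- u) :* m :+ u :* (Κ 1# :+ m) := m :+ u) refl u _ · refl)
    ) (cong ((1# - u) * ι m +_) u≡ ≡» +≤ (*≤ʳ u₁ l' » next i) ≤-refl)
    where
    u₁ : 0# ≤ 1# - u
    u₁ = gap (gap≤ (u₀ *₀ ι₀ m) (solve 2 (λ u m -> u :* (Κ 1# :+ m) := u :+ u :* m) refl u _) »≡ u≡)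
  good : Good n m
  good = go (search i₀ last)
   where
   go : _ -> Good n m
   go (j , l , l') = Near.near r r₊ r₁ n m hn (h747 (≤-total (t' * c 747 10) 1#)) (solve 2 (λ p q -> (p :- q) :* (p :- q) := (q :- p) :* (q :- p)) refl _ _ ≡» *≤ {q = 1#} (gap l) lit d≤ d≤ » gap≤ lit (solve 0 (κ 1 1000 :* κ 4000000 1 := Κ 1# :* Κ 1# :+ κ 3999 1) refl) » *≤ʳ lit (Near.V≥ r r₊ r₁ n m hn (h747 (≤-total (t' * c 747 10) 1#))))
    where
    r : ℚ
    r = g ^ j
    r₊ : 0# < r
    r₊ = ^₊ j g₊
    r₁ : r ≤ 1#
    r₁ = ^≤1 j g₀ g₁
    open Mean≤ r r₊ r₁ using (t'; μ-bounded)
    d≤ : ι m - M j ≤ 1#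
    d≤ = gap≤ (gap l') (solve 2 (λ p q -> Κ 1# := p :- q :+ (q :+ Κ 1# :- p)) refl _ _)
    -- If r were too small for the estimates, the mean would be at most 20926, yet it is within 1 of
    -- m > 3n > 21000.
    big : 1# ≤ t' * c 747 10 -> c 21000 1 ≤ c 20926 1
    big h' = ungap (gap chain »≡ solve 0 (κ 20926 1 :+ Κ 1# :- (Κ 1# :+ κ 21000 1) := κ 20926 1 :- κ 21000 1) refl)
     where
     chain : 1# + c 21000 1 ≤ c 20926 1 + 1#
     chain = +≤ ≤-refl (solve 0 (κ 21000 1 := (Κ 1# :+ (Κ 1# :+ (Κ 1# :+ Κ 0#))) :* κ 7000 1) refl ≡» *≤ʳ (ι₀ 3) (7000<⇒ hn) »≡ sym (ι-* 3 n)) » ι-mono hm » l' » +≤ (μ-bounded n h') ≤-refl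
    h747 : _ -> t' * c 747 10 ≤ 1#
    h747 (inj₁ p) = p
    h747 (inj₂ p) = ⊥-elim (ℚP.<-irrefl refl (ℚP.<-≤-trans (by-gap< _ (ℚP.positive⁻¹ (c 74 1)) (solve 0 (κ 21000 1 := κ 20926 1 :+ κ 74 1) refl)) (big p)))
 data Residue : ℕ -> Set where
  r0 : ∀ k -> Residue (t3 k)
  r1 : ∀ k -> Residue (suc (t3 k))
  r2 : ∀ k -> Residue (suc (suc (t3 k)))
 residue : ∀ m -> Residue m
 residue zero = r0 0
 residue (suc zero) = r1 0
 residue (suc (suc zero)) = r2 0
 residue (suc (suc (suc m))) = up (residue m)
  where
  up : ∀ {m} -> Residue m -> Residue (suc (suc (suc m)))
  up (r0 k) = r0 (suc k)
  up (r1 k) = r1 (suc k)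
  up (r2 k) = r2 (suc k)
 σ0 : ∀ k -> σ (t3 k) ≡ ℤ.+ 1
 σ0 zero = refl
 σ0 (suc k) = σ0 k
 σ1 : ∀ k -> σ (suc (t3 k)) ≡ ℤ.- ℤ.+ 1
 σ1 zero = refl
 σ1 (suc k) = σ1 k
 σ2 : ∀ k -> σ (suc (suc (t3 k))) ≡ ℤ.- ℤ.+ 1
 σ2 zero = refl
 σ2 (suc k) = σ2 k
 -- The degree 3n² is a multiple of 3, so reflection fixes class 0 and exchanges classes 1 and 2,
 -- which carry the same sign.
 σ-flip : ∀ i j x -> i ℕ.+ j ≡ t3 x -> σ i ≡ σ j
 σ-flip zero j x refl = sym (σ0 x)
 σ-flip (suc zero) j (suc x) refl = sym (σ2 x)
 σ-flip (suc (suc zero)) j (suc x) refl = sym (σ1 x)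
 σ-flip (suc (suc (suc i))) j (suc x) h = σ-flip i j x (ℕP.suc-injective (ℕP.suc-injective (ℕP.suc-injective h)))
 σ+ : ∀ {s} x -> s ≡ ℤ.+ 1 -> s ℤ.* x ≡ x
 σ+ x refl = ℤP.*-identityˡ x
 σ- : ∀ {s} x -> s ≡ ℤ.- ℤ.+ 1 -> s ℤ.* x ≡ ℤ.- x
 σ- x refl = ℤP.-1*i≡-i x
 degree≡ : ∀ n M -> degree a b n M ≡ t3 (n ℕ.* n) ℕ.+ M
 degree≡ zero M = refl
 degree≡ (suc n) M = degree≡ n _ · cong₂ (λ p q -> p ℕ.+ (suc q ℕ.+ (suc (suc q) ℕ.+ M))) (t3≡ (n ℕ.* n)) (t3≡ n) · solveⁿ 2 (λ n M -> n ⊛ n ⊛ conⁿ 3 ⊹ (conⁿ 1 ⊹ n ⊛ conⁿ 3 ⊹ (conⁿ 2 ⊹ n ⊛ conⁿ 3 ⊹ M)) ≔ (conⁿ 1 ⊹ n) ⊛ (conⁿ 1 ⊹ n) ⊛ conⁿ 3 ⊹ M) refl n M · cong (ℕ._+ M) (sym (t3≡ (suc n ℕ.* suc n)))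
 Pseq-sym : ∀ n -> Sym (ℤ.+ 1) (t3 (n ℕ.* n)) (Pseq n)
 Pseq-sym n = subst (λ d -> Sym (ℤ.+ 1) d (Pseq n)) (degree≡ n 0 · ℕP.+-identityʳ _) (Fac-sym a b n 0 δ δ-sym)
 module _ (n : ℕ) (hn : 7000 ℕ.< n) where
  low : ∀ m -> m ℕ.≤ 3 ℕ.* n -> Good n m
  low m l = go (residue m) l
   where
   le : ∀ k -> t3 k ℕ.≤ 3 ℕ.* n -> k ℕ.≤ n
   le k l = ℕP.*-cancelʳ-≤ k n 3 (subst (ℕ._≤ n ℕ.* 3) (t3≡ k) (ℕP.≤-trans l (ℕP.≤-reflexive (ℕP.*-comm 3 n))))
   lt : ∀ k -> t3 k ℕ.< 3 ℕ.* n -> k ℕ.< n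
   lt k l = ℕP.*-cancelʳ-< 3 k n (subst (ℕ._< n ℕ.* 3) (t3≡ k) (ℕP.<-≤-trans l (ℕP.≤-reflexive (ℕP.*-comm 3 n))))
   go : ∀ {m} -> Residue m -> m ℕ.≤ 3 ℕ.* n -> Good n m
   go (r0 k) l = subst (ℤ.+ 0 ℤ.≤_) (sym (σ+ _ (σ0 k))) (Small.small-A n k (le k l))
   go (r1 k) l = subst (ℤ.+ 0 ℤ.≤_) (sym (σ- _ (σ1 k))) (Small.small-B n k (lt k l))
   go (r2 k) l = subst (ℤ.+ 0 ℤ.≤_) (sym (σ- _ (σ2 k))) (Small.small-C n k (lt k (ℕP.≤-trans (ℕP.n≤1+n _) l)))
  lower-half : ∀ m -> m ℕ.+ m ℕ.≤ t3 (n ℕ.* n) -> Good n m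
  lower-half m hm = by-size (ℕP.≤-<-connex m (3 ℕ.* n))
   where
   m≤ : ι m ≤ c 3 2 * (ι n * ι n)
   m≤ = cancel≤ (ℚP.positive⁻¹ (c 2 1)) (solve 1 (λ m -> κ 2 1 :* m := m :+ m) refl _ · sym (ι-+ m m) ≡» ι-mono hm »≡ ι-t3 (n ℕ.* n) · cong (c 3 1 *_) (ι-* n n) · solve 1 (λ n -> κ 3 1 :* (n :* n) := κ 2 1 :* (κ 3 2 :* (n :* n))) refl _)
   by-size : _ -> Good n m
   by-size (inj₁ l) = low m l
   by-size (inj₂ l) = by-mean (≤-total (ι m) (c 3 2 * (ι n * ι n) - c 1 6 * ι n))
    where
    by-mean : _ -> Good n m
    by-mean (inj₁ p) = Grid.good n m hn l (λ r₊ r₁ -> ≤-trans p (of≡ (sym (One.μ≡ r₊ r₁ n))))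
    by-mean (inj₂ p) = One.centre 0<1 ≤-refl n m hn (One.μ≡ 0<1 ≤-refl n ≡» p) m≤
  all-good : ∀ m -> Good n m
  all-good m = go (ℕP.≤-<-connex (m ℕ.+ m) T) (ℕP.≤-<-connex m T)
   where
   T : ℕ
   T = t3 (n ℕ.* n)
   go : _ -> _ -> Good n m
   go (inj₁ l) _ = lower-half m l
   go (inj₂ l) (inj₂ l') = subst (ℤ.+ 0 ℤ.≤_) (sym (cong (σ m ℤ.*_) (proj₂ (Pseq-sym n) m l') · ℤP.*-zeroʳ (σ m))) ℤP.≤-refl
   go (inj₂ l) (inj₁ l') = subst (ℤ.+ 0 ℤ.≤_) (cong₂ ℤ._*_ (sym (σ-flip m j (n ℕ.* n) mj)) (sym (proj₁ (Pseq-sym n) m j mj · ℤP.*-identityˡ _))) (lower-half j jj)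
    where
    j : ℕ
    j = T ℕ.∸ m
    mj : m ℕ.+ j ≡ T
    mj = ℕP.m+[n∸m]≡n l'
    jj : j ℕ.+ j ℕ.≤ T
    jj = ℕP.≤-trans (ℕP.+-monoˡ-≤ j (ℕP.<⇒≤ (ℕP.+-cancelˡ-< m j m (subst (ℕ._< m ℕ.+ m) (sym mj) l)))) (ℕP.≤-reflexive mj)
 nonneg-coefficients : ∀ n -> 7000 ℕ.< n -> ∀ A B C -> (∀ k -> coeff (combine A B C) k ≡ Pseq n k) -> NonNegCoeffs A × NonNegCoeffs B × NonNegCoeffs C
 nonneg-coefficients n hn A B C P≡ =
  (λ k -> subst (ℤ.+ 0 ℤ.≤_) (σ+ _ (σ0 k) · sym (P≡ (t3 k)) · part-A A B C k) (all-good n hn (t3 k)))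
  , (λ k -> subst (ℤ.+ 0 ℤ.≤_) (σ- _ (σ1 k) · (cong ℤ.-_ (sym (P≡ (suc (t3 k))))) · part-B A B C k) (all-good n hn (suc (t3 k))))
  , (λ k -> subst (ℤ.+ 0 ℤ.≤_) (σ- _ (σ2 k) · (cong ℤ.-_ (sym (P≡ (suc (suc (t3 k)))))) · part-C A B C k) (all-good n hn (suc (suc (t3 k)))))

open import Defs
open import Data.Nat using (_<_; _*_)
open H4 using (nonneg-coefficients)
open H1 using (quotient)

theorem12p1 : (n : ℕ) -> 7000 < n -> (A B C : Poly)
    -> (∀ k -> coeff (q3Poch n ⊗ combine A B C) k ≡ coeff (qPoch (3 * n)) k)
    -> NonNegCoeffs A × NonNegCoeffs B × NonNegCoeffs C
theorem12p1 n hn A B C h = nonneg-coefficients n hn A B C (quotient n (combine A B C) h)
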